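{- Let $H$ be a rational symmetric matrix indexed by a finite set $V$, let $a\in V$, and suppose $\operatorname{supp}_H(e_a)=-\operatorname{supp}_H(e_a)$. Then for every $b\in V$ with $b\neq a$ and every positive odd integer $r$, \[ H^r\text{ has PST from }a\text{ to }b\quad\Longleftrightarrow\quad H\text{ has PST from }a\text{ to }b. \] In particular, for the adjacency matrix $A$ of every finite bipartite graph, all distinct vertices $a,b$ and every positive odd integer $r$, $A^r$ has PST from $a$ to $b$ if and only if $A$ has PST from $a$ to $b$.
   Context: Graphs are finite and simple. For a finite set $V$ (elements are called vertices), $e_v$ denotes the standard basis vector indexed by $v\in V$. For a real symmetric matrix $H$ indexed by $V$ with spectral decomposition $H=\sum_{\lambda\in\operatorname{Spec}(H)}\lambda E_\lambda$ ($E_\lambda$ the orthogonal projection onto the $\lambda$-eigenspace), and a vector $x$, put $\operatorname{supp}_H(x)=\{\lambda\in\operatorname{Spec}(H):E_\lambda x\neq 0\}$. For a set $S\subseteq\mathbb R$, $-S=\{ -s:s\in S\}$. A rational symmetric matrix is a symmetric matrix with entries in $\mathbb Q$. A real symmetric matrix $K$ has perfect state transfer (PST) from $a$ to $b$ if $\exp(-\mathrm i\tau K)e_a=\gamma e_b$ for some $\tau>0$ and some $\gamma\in\mathbb C$ with $|\gamma|=1$. -}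

module Defs where

open import Algebra.Bundles using (CommutativeMonoid)
open import Algebra.Bundles.Raw using (RawRing; RawSemiring)
import Algebra.Definitions.RawSemiring as RawSemiringOps
import Algebra.Properties.CommutativeSemigroup as CommutativeSemigroupProperties
open import Data.Bool.Base using (Bool; if_then_else_)
open import Data.Fin.Base using (Fin; toℕ)
import Data.Fin.Properties as Fin
open import Data.Integer.Base using (1ℤ)
open import Data.Nat.Base as ℕ using (ℕ; _!)
import Data.Nat.Properties as ℕ
open import Data.Product using (Σ-syntax; ∃; ∃-syntax; _×_; _,_; proj₁; proj₂)
open import Data.Rational.Base as ℚ using (ℚ; 0ℚ; 1ℚ; Positive)
import Data.Rational.Properties as ℚ
open import Data.Vec.Functional using (Vector)
open import Level using (0ℓ)
open import Relation.Binary.Core using (Rel)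
open import Relation.Binary.Definitions using (Symmetric; Irreflexive; Decidable)
open import Relation.Binary.PropositionalEquality
  using (_≡_; _≢_; refl; sym; cong; cong₂; subst)
open import Relation.Nullary using (¬_; does)
open import Relation.Unary using (Pred)

-- Reals are Cauchy sequences of rationals, compared by the setoid equality _≈ℝ_.

IsCauchy : (ℕ → ℚ) → Set
IsCauchy s = ∀ ε → 0ℚ ℚ.< ε →
  ∃[ N ] (∀ m n → N ℕ.≤ m → N ℕ.≤ n → ℚ.∣ s m ℚ.- s n ∣ ℚ.< ε)

record ℝ : Set where
  constructor mkℝ
  field
    seq    : ℕ → ℚ
    cauchy : IsCauchy seq

open ℝ public

private abstract
  rearrange : ∀ a b c d → (a ℚ.+ b) ℚ.- (c ℚ.+ d) ≡ (a ℚ.- c) ℚ.+ (b ℚ.- d)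
  rearrange a b c d = begin
    (a ℚ.+ b) ℚ.+ ℚ.- (c ℚ.+ d)        ≡⟨ cong (a ℚ.+ b ℚ.+_) (ℚ.neg-distrib-+ c d) ⟩
    (a ℚ.+ b) ℚ.+ (ℚ.- c ℚ.+ ℚ.- d)    ≡⟨ interchange a b (ℚ.- c) (ℚ.- d) ⟩
    (a ℚ.- c) ℚ.+ (b ℚ.- d)            ∎
    where
    open Relation.Binary.PropositionalEquality.≡-Reasoning
    open CommutativeSemigroupProperties
      (CommutativeMonoid.commutativeSemigroup ℚ.+-0-commutativeMonoid) using (interchange)

  cancel : ∀ a b → (a ℚ.- b) ℚ.+ b ≡ a
  cancel a b = begin
    (a ℚ.- b) ℚ.+ b          ≡⟨ ℚ.+-assoc a (ℚ.- b) b ⟩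
    a ℚ.+ (ℚ.- b ℚ.+ b)      ≡⟨ cong (a ℚ.+_) (ℚ.+-inverseˡ b) ⟩
    a ℚ.+ 0ℚ                 ≡⟨ ℚ.+-identityʳ a ⟩
    a                        ∎
    where open Relation.Binary.PropositionalEquality.≡-Reasoning

  *-split : ∀ a b c d → a ℚ.* b ℚ.- c ℚ.* d ≡ a ℚ.* (b ℚ.- d) ℚ.+ (a ℚ.- c) ℚ.* d
  *-split a b c d = begin
    a ℚ.* b ℚ.- c ℚ.* d
      ≡⟨ cong (ℚ._- c ℚ.* d) (cancel (a ℚ.* b) (a ℚ.* d)) ⟨
    (a ℚ.* b ℚ.- a ℚ.* d) ℚ.+ a ℚ.* d ℚ.- c ℚ.* d
      ≡⟨ ℚ.+-assoc (a ℚ.* b ℚ.- a ℚ.* d) (a ℚ.* d) (ℚ.- (c ℚ.* d)) ⟩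
    (a ℚ.* b ℚ.- a ℚ.* d) ℚ.+ (a ℚ.* d ℚ.- c ℚ.* d)
      ≡⟨ cong₂ (λ x y → (a ℚ.* b ℚ.+ x) ℚ.+ (a ℚ.* d ℚ.+ y))
           (ℚ.neg-distribʳ-* a d) (ℚ.neg-distribˡ-* c d) ⟩
    (a ℚ.* b ℚ.+ a ℚ.* ℚ.- d) ℚ.+ (a ℚ.* d ℚ.+ ℚ.- c ℚ.* d)
      ≡⟨ cong₂ ℚ._+_ (ℚ.*-distribˡ-+ a b (ℚ.- d)) (ℚ.*-distribʳ-+ d a (ℚ.- c)) ⟨
    a ℚ.* (b ℚ.- d) ℚ.+ (a ℚ.- c) ℚ.* d
      ∎
    where open Relation.Binary.PropositionalEquality.≡-Reasoning

  ½>0 : ∀ {ε} → 0ℚ ℚ.< ε → 0ℚ ℚ.< ε ℚ.* ℚ.½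
  ½>0 {ε} ε>0 = ℚ.positive⁻¹ _ {{ℚ.pos*pos⇒pos ε {{ℚ.positive ε>0}} ℚ.½}}

  ½+½ : ∀ ε → ε ℚ.* ℚ.½ ℚ.+ ε ℚ.* ℚ.½ ≡ ε
  ½+½ ε = begin
    ε ℚ.* ℚ.½ ℚ.+ ε ℚ.* ℚ.½ ≡⟨ ℚ.*-distribˡ-+ ε ℚ.½ ℚ.½ ⟨
    ε ℚ.* 1ℚ                ≡⟨ ℚ.*-identityʳ ε ⟩
    ε                       ∎
    where open Relation.Binary.PropositionalEquality.≡-Reasoning

  +-cauchy : ∀ {s t} → IsCauchy s → IsCauchy t → IsCauchy (λ n → s n ℚ.+ t n)
  +-cauchy {s} {t} cs ct ε ε>0 with cs _ (½>0 ε>0) | ct _ (½>0 ε>0)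
  ... | M , hs | N , ht = M ℕ.⊔ N , λ m n p q → begin-strict
    ℚ.∣ (s m ℚ.+ t m) ℚ.- (s n ℚ.+ t n) ∣         ≡⟨ cong ℚ.∣_∣ (rearrange (s m) (t m) (s n) (t n)) ⟩
    ℚ.∣ (s m ℚ.- s n) ℚ.+ (t m ℚ.- t n) ∣         ≤⟨ ℚ.∣p+q∣≤∣p∣+∣q∣ (s m ℚ.- s n) (t m ℚ.- t n) ⟩
    ℚ.∣ s m ℚ.- s n ∣ ℚ.+ ℚ.∣ t m ℚ.- t n ∣       <⟨ ℚ.+-mono-<
      (hs m n (ℕ.m⊔n≤o⇒m≤o M N p) (ℕ.m⊔n≤o⇒m≤o M N q))
      (ht m n (ℕ.m⊔n≤o⇒n≤o M N p) (ℕ.m⊔n≤o⇒n≤o M N q)) ⟩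
    ε ℚ.* ℚ.½ ℚ.+ ε ℚ.* ℚ.½                       ≡⟨ ½+½ ε ⟩
    ε                                             ∎
    where
    open ℚ.≤-Reasoning

  neg-cauchy : ∀ {s} → IsCauchy s → IsCauchy (λ n → ℚ.- s n)
  neg-cauchy {s} cs ε ε>0 with cs ε ε>0
  ... | N , h = N , λ m n p q → subst (ℚ._< ε) (eq (s m) (s n)) (h m n p q)
    where
    open Relation.Binary.PropositionalEquality.≡-Reasoning
    eq : ∀ a b → ℚ.∣ a ℚ.- b ∣ ≡ ℚ.∣ (ℚ.- a) ℚ.- (ℚ.- b) ∣
    eq a b = begin
      ℚ.∣ a ℚ.- b ∣               ≡⟨ ℚ.∣-p∣≡∣p∣ (a ℚ.- b) ⟨
      ℚ.∣ ℚ.- (a ℚ.- b) ∣         ≡⟨ cong ℚ.∣_∣ (ℚ.neg-distrib-+ a (ℚ.- b)) ⟩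
      ℚ.∣ (ℚ.- a) ℚ.- (ℚ.- b) ∣   ∎

  bounded : ∀ {s} → IsCauchy s →
    Σ[ B ∈ ℚ ] 0ℚ ℚ.< B × ∃[ N ] (∀ n → N ℕ.≤ n → ℚ.∣ s n ∣ ℚ.≤ B)
  bounded {s} cs with cs 1ℚ (ℚ.positive⁻¹ 1ℚ)
  ... | N , h = 1ℚ ℚ.+ ℚ.∣ s N ∣
              , ℚ.+-mono-<-≤ (ℚ.positive⁻¹ 1ℚ) (ℚ.0≤∣p∣ (s N))
              , N
              , λ n p → begin
    ℚ.∣ s n ∣                                ≡⟨ cong ℚ.∣_∣ (sym (cancel (s n) (s N))) ⟩
    ℚ.∣ (s n ℚ.- s N) ℚ.+ s N ∣              ≤⟨ ℚ.∣p+q∣≤∣p∣+∣q∣ (s n ℚ.- s N) (s N) ⟩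
    ℚ.∣ s n ℚ.- s N ∣ ℚ.+ ℚ.∣ s N ∣          ≤⟨ ℚ.+-monoˡ-≤ ℚ.∣ s N ∣ (ℚ.<⇒≤ (h n N p ℕ.≤-refl)) ⟩
    1ℚ ℚ.+ ℚ.∣ s N ∣                         ∎
    where
    open ℚ.≤-Reasoning

  *-cauchy′ : ∀ {s t} → IsCauchy s → IsCauchy t →
    ∀ B → 0ℚ ℚ.< B → ∃[ K ] (∀ n → K ℕ.≤ n → ℚ.∣ s n ∣ ℚ.≤ B) →
    ∀ C → 0ℚ ℚ.< C → ∃[ L ] (∀ n → L ℕ.≤ n → ℚ.∣ t n ∣ ℚ.≤ C) →
    IsCauchy (λ n → s n ℚ.* t n)
  *-cauchy′ {s} {t} cs ct B B>0 (K , hB) C C>0 (L , hC) ε ε>0 = result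
    where
    instance
      B-pos : Positive B
      B-pos = ℚ.positive B>0
      C-pos : Positive C
      C-pos = ℚ.positive C>0
      D-pos : Positive (B ℚ.+ C)
      D-pos = ℚ.pos+pos⇒pos B C
      D-nz : ℚ.NonZero (B ℚ.+ C)
      D-nz = ℚ.pos⇒nonZero (B ℚ.+ C)
      D⁻¹-pos : Positive (ℚ.1/ (B ℚ.+ C))
      D⁻¹-pos = ℚ.1/pos⇒pos (B ℚ.+ C)
      ε-pos : Positive ε
      ε-pos = ℚ.positive ε>0
    δ : ℚ
    δ = ε ℚ.* ℚ.1/ (B ℚ.+ C)
    δ>0 : 0ℚ ℚ.< δ
    δ>0 = ℚ.positive⁻¹ δ {{ℚ.pos*pos⇒pos ε (ℚ.1/ (B ℚ.+ C))}}
    M N : ℕ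
    M = proj₁ (cs δ δ>0)
    N = proj₁ (ct δ δ>0)
    total : B ℚ.* δ ℚ.+ δ ℚ.* C ≡ ε
    total = begin
      B ℚ.* δ ℚ.+ δ ℚ.* C                   ≡⟨ cong (B ℚ.* δ ℚ.+_) (ℚ.*-comm δ C) ⟩
      B ℚ.* δ ℚ.+ C ℚ.* δ                   ≡⟨ ℚ.*-distribʳ-+ δ B C ⟨
      (B ℚ.+ C) ℚ.* (ε ℚ.* ℚ.1/ (B ℚ.+ C))  ≡⟨ ℚ.*-comm (B ℚ.+ C) δ ⟩
      ε ℚ.* ℚ.1/ (B ℚ.+ C) ℚ.* (B ℚ.+ C)    ≡⟨ ℚ.*-assoc ε _ _ ⟩
      ε ℚ.* (ℚ.1/ (B ℚ.+ C) ℚ.* (B ℚ.+ C))  ≡⟨ cong (ε ℚ.*_) (ℚ.*-inverseˡ (B ℚ.+ C)) ⟩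
      ε ℚ.* 1ℚ                              ≡⟨ ℚ.*-identityʳ ε ⟩
      ε                                     ∎
      where open Relation.Binary.PropositionalEquality.≡-Reasoning
    prod< : ∀ E → .{{Positive E}} → ∀ a u → ℚ.∣ a ∣ ℚ.≤ E → ℚ.∣ u ∣ ℚ.< δ → ℚ.∣ a ℚ.* u ∣ ℚ.< E ℚ.* δ
    prod< E a u a≤ u< = begin-strict
      ℚ.∣ a ℚ.* u ∣          ≡⟨ ℚ.∣p*q∣≡∣p∣*∣q∣ a u ⟩
      ℚ.∣ a ∣ ℚ.* ℚ.∣ u ∣    ≤⟨ ℚ.*-monoʳ-≤-nonNeg ℚ.∣ u ∣ {{ℚ.nonNegative (ℚ.0≤∣p∣ u)}} a≤ ⟩
      E ℚ.* ℚ.∣ u ∣          <⟨ ℚ.*-monoʳ-<-pos E u< ⟩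
      E ℚ.* δ                ∎
      where open ℚ.≤-Reasoning
    bound : ℕ
    bound = (K ℕ.⊔ L) ℕ.⊔ (M ℕ.⊔ N)
    K≤ : ∀ {m} → bound ℕ.≤ m → K ℕ.≤ m
    K≤ p = ℕ.m⊔n≤o⇒m≤o K L (ℕ.m⊔n≤o⇒m≤o (K ℕ.⊔ L) (M ℕ.⊔ N) p)
    L≤ : ∀ {m} → bound ℕ.≤ m → L ℕ.≤ m
    L≤ p = ℕ.m⊔n≤o⇒n≤o K L (ℕ.m⊔n≤o⇒m≤o (K ℕ.⊔ L) (M ℕ.⊔ N) p)
    M≤ : ∀ {m} → bound ℕ.≤ m → M ℕ.≤ m
    M≤ p = ℕ.m⊔n≤o⇒m≤o M N (ℕ.m⊔n≤o⇒n≤o (K ℕ.⊔ L) (M ℕ.⊔ N) p)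
    N≤ : ∀ {m} → bound ℕ.≤ m → N ℕ.≤ m
    N≤ p = ℕ.m⊔n≤o⇒n≤o M N (ℕ.m⊔n≤o⇒n≤o (K ℕ.⊔ L) (M ℕ.⊔ N) p)
    result : ∃[ O ] (∀ m n → O ℕ.≤ m → O ℕ.≤ n → ℚ.∣ s m ℚ.* t m ℚ.- s n ℚ.* t n ∣ ℚ.< ε)
    result = bound , λ m n p q → begin-strict
      ℚ.∣ s m ℚ.* t m ℚ.- s n ℚ.* t n ∣
        ≡⟨ cong ℚ.∣_∣ (*-split (s m) (t m) (s n) (t n)) ⟩
      ℚ.∣ s m ℚ.* (t m ℚ.- t n) ℚ.+ (s m ℚ.- s n) ℚ.* t n ∣
        ≤⟨ ℚ.∣p+q∣≤∣p∣+∣q∣ (s m ℚ.* (t m ℚ.- t n)) ((s m ℚ.- s n) ℚ.* t n) ⟩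
      ℚ.∣ s m ℚ.* (t m ℚ.- t n) ∣ ℚ.+ ℚ.∣ (s m ℚ.- s n) ℚ.* t n ∣
        ≡⟨ cong (λ x → ℚ.∣ s m ℚ.* (t m ℚ.- t n) ∣ ℚ.+ ℚ.∣ x ∣) (ℚ.*-comm (s m ℚ.- s n) (t n)) ⟩
      ℚ.∣ s m ℚ.* (t m ℚ.- t n) ∣ ℚ.+ ℚ.∣ t n ℚ.* (s m ℚ.- s n) ∣
        <⟨ ℚ.+-mono-<
             (prod< B (s m) (t m ℚ.- t n) (hB m (K≤ p)) (proj₂ (ct δ δ>0) m n (N≤ p) (N≤ q)))
             (prod< C (t n) (s m ℚ.- s n) (hC n (L≤ q)) (proj₂ (cs δ δ>0) m n (M≤ p) (M≤ q))) ⟩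
      B ℚ.* δ ℚ.+ C ℚ.* δ
        ≡⟨ cong (B ℚ.* δ ℚ.+_) (ℚ.*-comm C δ) ⟩
      B ℚ.* δ ℚ.+ δ ℚ.* C
        ≡⟨ total ⟩
      ε ∎
      where open ℚ.≤-Reasoning

  *-cauchy : ∀ {s t} → IsCauchy s → IsCauchy t → IsCauchy (λ n → s n ℚ.* t n)
  *-cauchy {s} {t} cs ct =
    *-cauchy′ {s} {t} cs ct (proj₁ bs) (proj₁ (proj₂ bs)) (proj₂ (proj₂ bs))
                            (proj₁ bt) (proj₁ (proj₂ bt)) (proj₂ (proj₂ bt))
    where
    bs : Σ[ B ∈ ℚ ] 0ℚ ℚ.< B × ∃[ N ] (∀ n → N ℕ.≤ n → ℚ.∣ s n ∣ ℚ.≤ B)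
    bs = bounded {s} cs
    bt : Σ[ B ∈ ℚ ] 0ℚ ℚ.< B × ∃[ N ] (∀ n → N ℕ.≤ n → ℚ.∣ t n ∣ ℚ.≤ B)
    bt = bounded {t} ct

infix  8 -ℝ_
infixl 7 _*ℝ_
infixl 6 _+ℝ_
infix  4 _≈ℝ_ _<ℝ_

ℚ→ℝ : ℚ → ℝ
ℚ→ℝ q = mkℝ (λ _ → q) λ ε ε>0 → 0 , λ _ _ _ _ →
  subst (ℚ._< ε) (cong ℚ.∣_∣ (sym (ℚ.+-inverseʳ q))) ε>0

0ℝ 1ℝ : ℝ
0ℝ = ℚ→ℝ 0ℚ
1ℝ = ℚ→ℝ 1ℚ

_+ℝ_ _*ℝ_ : ℝ → ℝ → ℝ
x +ℝ y = mkℝ (λ n → seq x n ℚ.+ seq y n) (+-cauchy {seq x} {seq y} (cauchy x) (cauchy y))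
x *ℝ y = mkℝ (λ n → seq x n ℚ.* seq y n) (*-cauchy {seq x} {seq y} (cauchy x) (cauchy y))

-ℝ_ : ℝ → ℝ
-ℝ x = mkℝ (λ n → ℚ.- seq x n) (neg-cauchy {seq x} (cauchy x))

record _≈ℝ_ (x y : ℝ) : Set where
  constructor mk≈
  field
    close : ∀ ε → 0ℚ ℚ.< ε →
      ∃[ N ] (∀ n → N ℕ.≤ n → ℚ.∣ seq x n ℚ.- seq y n ∣ ℚ.< ε)

record _<ℝ_ (x y : ℝ) : Set where
  constructor mk<
  field
    gap      : ℚ
    gap>0    : 0ℚ ℚ.< gap
    from     : ℕ
    separate : ∀ n → from ℕ.≤ n → seq x n ℚ.+ gap ℚ.≤ seq y n

-- u converges to x; strict bounds on both sides stand for |u n − x| < ε.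
_⟶ℝ_ : (ℕ → ℝ) → ℝ → Set
u ⟶ℝ x = ∀ ε → 0ℝ <ℝ ε →
  ∃[ N ] (∀ n → N ℕ.≤ n → (x +ℝ (-ℝ ε)) <ℝ u n × u n <ℝ (x +ℝ ε))

ℝ-rawRing : RawRing 0ℓ 0ℓ
ℝ-rawRing = record
  { Carrier = ℝ ; _≈_ = _≈ℝ_ ; _+_ = _+ℝ_ ; _*_ = _*ℝ_ ; -_ = -ℝ_ ; 0# = 0ℝ ; 1# = 1ℝ }

infix  8 -ℂ_
infixl 7 _*ℂ_
infixl 6 _+ℂ_
infix  4 _≈ℂ_

record ℂ : Set where
  constructor _+i_
  field
    re im : ℝ

open ℂ public

record _≈ℂ_ (z w : ℂ) : Set where
  constructor mk≈
  field
    re≈ : re z ≈ℝ re w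
    im≈ : im z ≈ℝ im w

_+ℂ_ _*ℂ_ : ℂ → ℂ → ℂ
z +ℂ w = (re z +ℝ re w) +i (im z +ℝ im w)
z *ℂ w = (re z *ℝ re w +ℝ (-ℝ (im z *ℝ im w))) +i (re z *ℝ im w +ℝ im z *ℝ re w)

-ℂ_ : ℂ → ℂ
-ℂ z = (-ℝ re z) +i (-ℝ im z)

ℝ→ℂ : ℝ → ℂ
ℝ→ℂ x = x +i 0ℝ

𝕚 : ℂ
𝕚 = 0ℝ +i 1ℝ

-- |z|²; in PST the condition |γ| = 1 is written |γ|² = 1.
normSq : ℂ → ℝ
normSq z = re z *ℝ re z +ℝ im z *ℝ im z

_⟶ℂ_ : (ℕ → ℂ) → ℂ → Set
u ⟶ℂ z = ((λ n → re (u n)) ⟶ℝ re z) × ((λ n → im (u n)) ⟶ℝ im z)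

ℂ-rawRing : RawRing 0ℓ 0ℓ
ℂ-rawRing = record
  { Carrier = ℂ ; _≈_ = _≈ℂ_ ; _+_ = _+ℂ_ ; _*_ = _*ℂ_ ; -_ = -ℂ_
  ; 0# = ℝ→ℂ 0ℝ ; 1# = ℝ→ℂ 1ℝ }

Matrix : Set → ℕ → Set
Matrix A n = Fin n → Fin n → A

mapMatrix : ∀ {A B n} → (A → B) → Matrix A n → Matrix B n
mapMatrix f M i j = f (M i j)

module LinearAlgebra (R : RawRing 0ℓ 0ℓ) where
  open RawRing R
  open RawSemiringOps rawSemiring using (sum)

  infixl 7 _·ᵛ_ _·ᵐ_ _*ᵐ_ _*ᵛ_
  infixl 6 _-ᵛ_
  infixr 8 _^ᵐ_
  infix  4 _≈ᵛ_

  _≈ᵛ_ : ∀ {n} → Rel (Vector Carrier n) 0ℓ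
  v ≈ᵛ w = ∀ i → v i ≈ w i

  0ᵛ : ∀ {n} → Vector Carrier n
  0ᵛ _ = 0#

  _-ᵛ_ : ∀ {n} → Vector Carrier n → Vector Carrier n → Vector Carrier n
  (v -ᵛ w) i = v i + - w i

  _·ᵛ_ : ∀ {n} → Carrier → Vector Carrier n → Vector Carrier n
  (c ·ᵛ v) i = c * v i

  ⟨_,_⟩ : ∀ {n} → Vector Carrier n → Vector Carrier n → Carrier
  ⟨ v , w ⟩ = sum (λ i → v i * w i)

  basis : ∀ {n} → Fin n → Vector Carrier n
  basis a v = if does (a Fin.≟ v) then 1# else 0#

  _·ᵐ_ : ∀ {n} → Carrier → Matrix Carrier n → Matrix Carrier n
  (c ·ᵐ M) i j = c * M i j

  _*ᵐ_ : ∀ {n} → Matrix Carrier n → Matrix Carrier n → Matrix Carrier n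
  (M *ᵐ N) i j = sum (λ k → M i k * N k j)

  _*ᵛ_ : ∀ {n} → Matrix Carrier n → Vector Carrier n → Vector Carrier n
  (M *ᵛ v) i = sum (λ k → M i k * v k)

  matrix-rawSemiring : ℕ → RawSemiring 0ℓ 0ℓ
  matrix-rawSemiring n = record
    { Carrier = Matrix Carrier n
    ; _≈_ = λ M N → ∀ i j → M i j ≈ N i j
    ; _+_ = λ M N i j → M i j + N i j
    ; _*_ = _*ᵐ_
    ; 0#  = λ _ _ → 0#
    ; 1#  = basis
    }

  _^ᵐ_ : ∀ {n} → Matrix Carrier n → ℕ → Matrix Carrier n
  _^ᵐ_ {n} = RawSemiringOps._^_ (matrix-rawSemiring n)

  IsSymmetric : ∀ {n} → Matrix Carrier n → Set
  IsSymmetric M = ∀ i j → M i j ≈ M j i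

module ℚM = LinearAlgebra ℚ.+-*-rawRing
module ℝM = LinearAlgebra ℝ-rawRing
module ℂM = LinearAlgebra ℂ-rawRing

toℝ : ∀ {n} → Matrix ℚ n → Matrix ℝ n
toℝ = mapMatrix ℚ→ℝ

toℂ : ∀ {n} → Matrix ℝ n → Matrix ℂ n
toℂ = mapMatrix ℝ→ℂ

module _ {n} (H : Matrix ℝ n) where
  open ℝM

  InEigenspace : ℝ → Pred (Vector ℝ n) 0ℓ
  InEigenspace λ′ v = H *ᵛ v ≈ᵛ λ′ ·ᵛ v

  Spec : Pred ℝ 0ℓ
  Spec λ′ = ∃[ v ] (InEigenspace λ′ v × ¬ (v ≈ᵛ 0ᵛ))

  record IsEigenprojection (λ′ : ℝ) (E : Matrix ℝ n) : Set where
    field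
      range      : ∀ v → InEigenspace λ′ (E *ᵛ v)
      orthogonal : ∀ v w → InEigenspace λ′ w → ⟨ v -ᵛ (E *ᵛ v) , w ⟩ ≈ℝ 0ℝ

  -- E_λ is determined up to ≈ by IsEigenprojection, so ∃ picks out "the" E_λ.
  Supp : Vector ℝ n → Pred ℝ 0ℓ
  Supp x λ′ = Spec λ′ × ∃[ E ] (IsEigenprojection λ′ E × ¬ (E *ᵛ x ≈ᵛ 0ᵛ))

-ˢ_ : Pred ℝ 0ℓ → Pred ℝ 0ℓ
(-ˢ S) x = ∃[ s ] (S s × x ≈ℝ -ℝ s)

1/_! : ℕ → ℂ
1/ k ! = ℝ→ℂ (ℚ→ℝ ((1ℤ ℚ./ (k !)) {{k ℕ.!≢0}}))

expPartialSum : ∀ {n} → Matrix ℂ n → ℕ → Matrix ℂ n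
expPartialSum {n} M N = sum {N} (λ k → 1/ toℕ k ! ·ᵐ M ^ᵐ toℕ k)
  where
  open ℂM
  open RawSemiringOps (matrix-rawSemiring n) using (sum)

-- X = exp(M), stated relationally: X is the entrywise sum of the (always
-- convergent) exponential series.
IsExp : ∀ {n} → Matrix ℂ n → Matrix ℂ n → Set
IsExp M X = ∀ i j → (λ N → expPartialSum M N i j) ⟶ℂ X i j

PST : ∀ {n} → Matrix ℝ n → Fin n → Fin n → Set
PST K a b =
  Σ[ τ ∈ ℝ ] 0ℝ <ℝ τ ×
  Σ[ γ ∈ ℂ ] normSq γ ≈ℝ 1ℝ ×
  ∃[ X ] (IsExp ((-ℂ (𝕚 *ℂ ℝ→ℂ τ)) ·ᵐ toℂ K) X × X *ᵛ basis a ≈ᵛ γ ·ᵛ basis b)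
  where open ℂM

record SimpleGraph (n : ℕ) : Set₁ where
  field
    Adj         : Rel (Fin n) 0ℓ
    adj?        : Decidable Adj
    symmetric   : Symmetric Adj
    irreflexive : Irreflexive _≡_ Adj

open SimpleGraph public

Bipartite : ∀ {n} → SimpleGraph n → Set
Bipartite {n} G = Σ[ side ∈ (Fin n → Bool) ] (∀ {u v} → Adj G u v → side u ≢ side v)

adjacencyMatrix : ∀ {n} → SimpleGraph n → Matrix ℚ n
adjacencyMatrix G u v = if does (adj? G u v) then 1ℚ else 0ℚ

{-# OPTIONS --safe #-}
module Submission where

-- The Lanczos recurrence started at e_a runs over ℚ and is a Sturm sequence, so the eigenvalues λᵢ in the
-- support of e_a are separated real roots of its last polynomial; symmetry of the support says that −λ is a
-- root together with λ.  PST at time τ means e(τλᵢ) = γ sᵢ, with e(x) = exp(−ix) and sᵢ = ±1 the ratio of the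
-- components of e_b and e_a.  Hence e(2τλᵢ) = γ², and the root −λᵢ gives e(4τλᵢ) = 1; as the kernel of e is
-- discrete, Euclid's algorithm makes the τλᵢ coprime integer multiples nᵢy, and ζ = e(y) has ζ⁴ = 1 and
-- ζ^(2nᵢ) constant.  By parity ζ^(nᵢʳ) = ζ^(nᵢ), so Hʳ transfers at the time that puts its phases at nᵢʳy.
-- Conversely, PST of Hʳ gives λᵢʳ = mᵢη.  Orthogonal projection over ℚ and Vandermonde show that λ is one odd
-- rational polynomial in λʳ on the whole support, and η² ∈ ℚ because the sum of the squared roots is rational.
-- So the λᵢ/η are rational, the λᵢ are again coprime multiples of one number, and the parity argument applies.


-- Equality of Cauchy reals is not decidable, and this shapes the proof. Diagonalising `H` directly
-- would ask for ranks of real matrices; the Lanczos process only asks whether rational norms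
-- vanish, and Sturm's sign changes deliver roots that are already apart from one another. Exact
-- comparisons of reals are assumed only under a double negation, which is enough because the
-- conclusions drawn there are negations or equalities, and equality is stable.
--
-- A root carries an explicit eigenvector with e_a-component 1, the Christoffel-Darboux kernel.
-- Phases are read off by pairing with it, and the ratio of components is simply its e_b-component.
--
-- With λᵢ = nᵢθ, the new time is the old one divided or multiplied by θ^(r-1); r - 1 is even, so it
-- is positive whatever the sign of θ. In the converse only the multiples nᵢʳ·4y are known to lie in
-- the kernel of e, and the coprimality of the nᵢʳ recovers 4y. The polynomial relation between λ
-- and λʳ is rational because it is found among the rational vectors Hʲe_a, and only then evaluated
-- at the eigenvalues.

open import Algebra.Bundles using (CommutativeRing)
open import Level using (0ℓ)
open import Defs

-- Linear algebra over a commutative ring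

module LinearAlgebraProperties (R : CommutativeRing 0ℓ 0ℓ) where

  import Algebra.Properties.CommutativeMonoid.Sum as CommutativeMonoidSum
  import Algebra.Properties.CommutativeSemigroup as CommutativeSemigroupProperties
  import Algebra.Properties.Semiring.Exp as SemiringExp
  import Algebra.Properties.Semiring.Sum as SemiringSum
  open import Data.Fin.Base using (Fin; zero; suc)
  import Data.Fin.Properties as Fin
  open import Data.Nat.Base using (ℕ; zero; suc)
  open import Data.Vec.Functional using (Vector)
  open import Relation.Binary.PropositionalEquality as ≡ using (_≡_)
  open import Relation.Nullary using (yes; no)
  open import Defs using (Matrix; module LinearAlgebra)

  open CommutativeRing R hiding (zero) public
  open LinearAlgebra rawRing public
  open SemiringSum semiring public
    using (sum; sum-cong-≋; ∑-distrib-+; ∑-comm; *-distribˡ-sum; *-distribʳ-sum)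
  open SemiringExp semiring public using (_^_)
  open CommutativeSemigroupProperties *-commutativeSemigroup public
    using () renaming (x∙yz≈y∙xz to x*yz≈y*xz; xy∙z≈xz∙y to xy*z≈xz*y)
  open import Relation.Binary.Reasoning.Setoid setoid public

  infixl 6 _+ᵛ_

  _+ᵛ_ : ∀ {n} → Vector Carrier n → Vector Carrier n → Vector Carrier n
  (v +ᵛ w) i = v i + w i

  ∑ᵛ : ∀ {m n} → (Fin m → Vector Carrier n) → Vector Carrier n
  ∑ᵛ V i = sum λ j → V j i

  sum-0 : ∀ {n} (f : Vector Carrier n) → (∀ i → f i ≈ 0#) → sum f ≈ 0#
  sum-0 {zero}  f h = refl
  sum-0 {suc n} f h = trans (+-cong (h zero) (sum-0 (λ i → f (suc i)) (λ i → h (suc i)))) (+-identityˡ 0#)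

  sum-basis : ∀ {n} (f : Vector Carrier n) (a : Fin n) → sum (λ i → f i * basis a i) ≈ f a
  sum-basis {suc n} f zero = trans
    (+-cong (*-identityʳ (f zero)) (sum-0 (λ i → f (suc i) * 0#) (λ i → zeroʳ (f (suc i)))))
    (+-identityʳ (f zero))
  sum-basis {suc n} f (suc a) = trans
    (+-cong (zeroʳ (f zero)) (trans
      (sum-cong-≋ {x = λ i → f (suc i) * basis (suc a) (suc i)} {y = λ i → f (suc i) * basis a i}
        (λ i → *-congˡ (reflexive (shift i))))
      (sum-basis (λ i → f (suc i)) a)))
    (+-identityˡ (f (suc a)))
    where
    shift : ∀ i → basis (suc a) (suc i) ≡ basis a i
    shift i with a Fin.≟ i
    ... | yes _ = ≡.refl
    ... | no  _ = ≡.refl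

  ⟨⟩-cong : ∀ {n} {v v′ w w′ : Vector Carrier n} → v ≈ᵛ v′ → w ≈ᵛ w′ → ⟨ v , w ⟩ ≈ ⟨ v′ , w′ ⟩
  ⟨⟩-cong p q = sum-cong-≋ λ i → *-cong (p i) (q i)

  ⟨⟩-comm : ∀ {n} (v w : Vector Carrier n) → ⟨ v , w ⟩ ≈ ⟨ w , v ⟩
  ⟨⟩-comm v w = sum-cong-≋ λ i → *-comm (v i) (w i)

  ⟨⟩-+ˡ : ∀ {n} (u v w : Vector Carrier n) → ⟨ u +ᵛ v , w ⟩ ≈ ⟨ u , w ⟩ + ⟨ v , w ⟩
  ⟨⟩-+ˡ u v w = trans (sum-cong-≋ λ i → distribʳ (w i) (u i) (v i))
    (∑-distrib-+ (λ i → u i * w i) (λ i → v i * w i))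

  ⟨⟩-·ˡ : ∀ {n} c (v w : Vector Carrier n) → ⟨ c ·ᵛ v , w ⟩ ≈ c * ⟨ v , w ⟩
  ⟨⟩-·ˡ c v w = trans (sum-cong-≋ λ i → *-assoc c (v i) (w i))
    (sym (*-distribˡ-sum c (λ i → v i * w i)))

  ⟨⟩-+ʳ : ∀ {n} (u v w : Vector Carrier n) → ⟨ u , v +ᵛ w ⟩ ≈ ⟨ u , v ⟩ + ⟨ u , w ⟩
  ⟨⟩-+ʳ u v w = trans (⟨⟩-comm u (v +ᵛ w)) (trans (⟨⟩-+ˡ v w u)
    (+-cong (⟨⟩-comm v u) (⟨⟩-comm w u)))

  ⟨⟩-·ʳ : ∀ {n} c (v w : Vector Carrier n) → ⟨ v , c ·ᵛ w ⟩ ≈ c * ⟨ v , w ⟩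
  ⟨⟩-·ʳ c v w = trans (⟨⟩-comm v (c ·ᵛ w)) (trans (⟨⟩-·ˡ c w v) (*-congˡ (⟨⟩-comm w v)))

  ⟨⟩-∑ˡ : ∀ {m n} (V : Fin m → Vector Carrier n) (w : Vector Carrier n) →
    ⟨ ∑ᵛ V , w ⟩ ≈ sum λ j → ⟨ V j , w ⟩
  ⟨⟩-∑ˡ V w = trans (sum-cong-≋ λ i → *-distribʳ-sum (w i) (λ j → V j i))
    (∑-comm λ i j → V j i * w i)

  ⟨⟩-∑ʳ : ∀ {m n} (v : Vector Carrier n) (W : Fin m → Vector Carrier n) →
    ⟨ v , ∑ᵛ W ⟩ ≈ sum λ j → ⟨ v , W j ⟩
  ⟨⟩-∑ʳ v W = trans (⟨⟩-comm v (∑ᵛ W)) (trans (⟨⟩-∑ˡ W v) (sum-cong-≋ λ j → ⟨⟩-comm (W j) v))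

  ⟨⟩-0ˡ : ∀ {n} {v w : Vector Carrier n} → v ≈ᵛ 0ᵛ → ⟨ v , w ⟩ ≈ 0#
  ⟨⟩-0ˡ {v = v} {w} v≈0 = sum-0 (λ i → v i * w i) λ i → trans (*-congʳ (v≈0 i)) (zeroˡ (w i))

  ⟨⟩-0ʳ : ∀ {n} {v w : Vector Carrier n} → w ≈ᵛ 0ᵛ → ⟨ v , w ⟩ ≈ 0#
  ⟨⟩-0ʳ {v = v} {w} w≈0 = trans (⟨⟩-comm v w) (⟨⟩-0ˡ w≈0)

  ⟨⟩-basis : ∀ {n} (v : Vector Carrier n) a → ⟨ v , basis a ⟩ ≈ v a
  ⟨⟩-basis = sum-basis

  *ᵛ-cong : ∀ {n} (M : Matrix Carrier n) {v w} → v ≈ᵛ w → M *ᵛ v ≈ᵛ M *ᵛ w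
  *ᵛ-cong M v≈w i = ⟨⟩-cong (λ _ → refl) v≈w

  *ᵛ-+ : ∀ {n} (M : Matrix Carrier n) v w → M *ᵛ (v +ᵛ w) ≈ᵛ M *ᵛ v +ᵛ M *ᵛ w
  *ᵛ-+ M v w i = ⟨⟩-+ʳ (M i) v w

  *ᵛ-· : ∀ {n} (M : Matrix Carrier n) c v → M *ᵛ (c ·ᵛ v) ≈ᵛ c ·ᵛ (M *ᵛ v)
  *ᵛ-· M c v i = ⟨⟩-·ʳ c (M i) v

  *ᵛ-∑ : ∀ {m n} (M : Matrix Carrier n) (V : Fin m → Vector Carrier n) →
    M *ᵛ ∑ᵛ V ≈ᵛ ∑ᵛ λ j → M *ᵛ V j
  *ᵛ-∑ M V i = ⟨⟩-∑ʳ (M i) V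

  *ᵛ-basis : ∀ {n} (M : Matrix Carrier n) a i → (M *ᵛ basis a) i ≈ M i a
  *ᵛ-basis M a i = sum-basis (M i) a

  1ᵐ-*ᵛ : ∀ {n} (v : Vector Carrier n) → basis *ᵛ v ≈ᵛ v
  1ᵐ-*ᵛ v i = trans (⟨⟩-comm (basis i) v) (sum-basis v i)

  *ᵐ-*ᵛ : ∀ {n} (M N : Matrix Carrier n) v → (M *ᵐ N) *ᵛ v ≈ᵛ M *ᵛ (N *ᵛ v)
  *ᵐ-*ᵛ M N v i = trans (⟨⟩-∑ˡ (λ k j → M i k * N k j) v)
    (sum-cong-≋ λ k → ⟨⟩-·ˡ (M i k) (N k) v)

  ⟨⟩-adjoint : ∀ {n} (M : Matrix Carrier n) → IsSymmetric M → ∀ v w → ⟨ M *ᵛ v , w ⟩ ≈ ⟨ v , M *ᵛ w ⟩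
  ⟨⟩-adjoint M M-sym v w = begin
    sum (λ i → sum (λ k → M i k * v k) * w i)
      ≈⟨ sum-cong-≋ (λ i → *-distribʳ-sum (w i) (λ k → M i k * v k)) ⟩
    sum (λ i → sum (λ k → M i k * v k * w i))
      ≈⟨ ∑-comm (λ i k → M i k * v k * w i) ⟩
    sum (λ k → sum (λ i → M i k * v k * w i))
      ≈⟨ sum-cong-≋ (λ k → trans
           (sum-cong-≋ λ i → trans (*-congʳ (*-congʳ (M-sym i k))) (trans (xy*z≈xz*y (M k i) (v k) (w i)) (*-comm _ (v k))))
           (sym (*-distribˡ-sum (v k) (λ i → M k i * w i)))) ⟩
    sum (λ k → v k * sum (λ i → M k i * w i)) ∎

  -- Iterated application to a vector takes the place of matrix powers, so that associativity of the
  -- matrix product is never involved; `^ᵐ-*ᵛ` connects the two.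
  pow : ∀ {n} → Matrix Carrier n → ℕ → Vector Carrier n → Vector Carrier n
  pow M zero    v = v
  pow M (suc k) v = M *ᵛ pow M k v

  pow-cong : ∀ {n} (M : Matrix Carrier n) k {v w} → v ≈ᵛ w → pow M k v ≈ᵛ pow M k w
  pow-cong M zero    h = h
  pow-cong M (suc k) h = *ᵛ-cong M (pow-cong M k h)

  ^ᵐ-*ᵛ : ∀ {n} (M : Matrix Carrier n) k v → (M ^ᵐ k) *ᵛ v ≈ᵛ pow M k v
  ^ᵐ-*ᵛ M zero    v   = 1ᵐ-*ᵛ v
  ^ᵐ-*ᵛ M (suc k) v i = trans (*ᵐ-*ᵛ M (M ^ᵐ k) v i) (*ᵛ-cong M (^ᵐ-*ᵛ M k v) i)

  Eigenvector : ∀ {n} → Matrix Carrier n → Carrier → Vector Carrier n → Set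
  Eigenvector M c v = M *ᵛ v ≈ᵛ c ·ᵛ v

  pow-eigenvector : ∀ {n} (M : Matrix Carrier n) {c v} → Eigenvector M c v →
    ∀ k → pow M k v ≈ᵛ (c ^ k) ·ᵛ v
  pow-eigenvector M {c} {v} e zero    i = sym (*-identityˡ (v i))
  pow-eigenvector M {c} {v} e (suc k) i = begin
    (M *ᵛ pow M k v) i         ≈⟨ *ᵛ-cong M (pow-eigenvector M e k) i ⟩
    (M *ᵛ ((c ^ k) ·ᵛ v)) i    ≈⟨ *ᵛ-· M (c ^ k) v i ⟩
    c ^ k * (M *ᵛ v) i         ≈⟨ *-congˡ (e i) ⟩
    c ^ k * (c * v i)          ≈⟨ x*yz≈y*xz (c ^ k) c (v i) ⟩
    c * (c ^ k * v i)          ≈⟨ *-assoc c (c ^ k) (v i) ⟨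
    c * c ^ k * v i            ∎

  ⟨⟩-pow-eigenvector : ∀ {n} (M : Matrix Carrier n) → IsSymmetric M → ∀ {c v} → Eigenvector M c v →
    ∀ k x → ⟨ pow M k x , v ⟩ ≈ c ^ k * ⟨ x , v ⟩
  ⟨⟩-pow-eigenvector M M-sym {c} {v} e zero    x = sym (*-identityˡ _)
  ⟨⟩-pow-eigenvector M M-sym {c} {v} e (suc k) x = begin
    ⟨ M *ᵛ pow M k x , v ⟩    ≈⟨ ⟨⟩-adjoint M M-sym (pow M k x) v ⟩
    ⟨ pow M k x , M *ᵛ v ⟩    ≈⟨ ⟨⟩-cong (λ _ → refl) e ⟩
    ⟨ pow M k x , c ·ᵛ v ⟩    ≈⟨ ⟨⟩-·ʳ c (pow M k x) v ⟩
    c * ⟨ pow M k x , v ⟩     ≈⟨ *-congˡ (⟨⟩-pow-eigenvector M M-sym e k x) ⟩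
    c * (c ^ k * ⟨ x , v ⟩)   ≈⟨ *-assoc c (c ^ k) _ ⟨
    c * c ^ k * ⟨ x , v ⟩     ∎

open import Data.Fin.Base using (Fin; zero; suc; toℕ)
import Data.Fin.Properties as Fin
open import Data.Nat.Base as ℕ using (ℕ; zero; suc; s≤s; z≤n)
import Data.Nat.Properties as ℕ
open import Data.Product using (∃; Σ; Σ-syntax; _×_; _,_; proj₁; proj₂)
open import Data.Rational.Base as ℚ using (ℚ; 0ℚ; 1ℚ; ½)
import Data.Rational.Properties as ℚ
import Data.Rational.Solver as ℚ
open import Data.Sum.Base using (_⊎_; inj₁; inj₂; [_,_]′)
open import Data.Vec.Functional using (Vector)
open import Function.Base using (_∘_)
open import Relation.Binary.Definitions using (tri<; tri≈; tri>)
open import Relation.Binary.PropositionalEquality as ≡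
  using (_≡_; _≢_; refl; sym; trans; cong; cong₂; subst; subst₂; module ≡-Reasoning)
open import Relation.Nullary using (¬_; Dec; yes; no; contradiction)

-- Order, reciprocals and powers of one half in the rationals

module RationalProperties where

  open import Data.Integer.Base as ℤ using (-[1+_])
  import Data.Integer.Properties as ℤ
  open import Data.Rational.Base
  open import Data.Rational.Properties

  open ℚ.+-*-Solver

  ≤⇒0≤- : ∀ {p q} → p ≤ q → 0ℚ ≤ q - p
  ≤⇒0≤- {p} {q} p≤q = subst (_≤ q - p) (+-inverseʳ p) (+-monoˡ-≤ (- p) p≤q)

  0≤-⇒≤ : ∀ {p q} → 0ℚ ≤ q - p → p ≤ q
  0≤-⇒≤ {p} {q} h = subst₂ _≤_ (+-identityˡ p)
    (solve 2 (λ p q → q :- p :+ p := q) refl p q) (+-monoˡ-≤ p h)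

  <⇒0<- : ∀ {p q} → p < q → 0ℚ < q - p
  <⇒0<- {p} {q} p<q = subst (_< q - p) (+-inverseʳ p) (+-monoˡ-< (- p) p<q)

  0<-⇒< : ∀ {p q} → 0ℚ < q - p → p < q
  0<-⇒< {p} {q} h = subst₂ _<_ (+-identityˡ p)
    (solve 2 (λ p q → q :- p :+ p := q) refl p q) (+-monoˡ-< p h)

  ≤-by : ∀ {p q r} → 0ℚ ≤ r → q - p ≡ r → p ≤ q
  ≤-by h eq = 0≤-⇒≤ (subst (0ℚ ≤_) (sym eq) h)

  <-by : ∀ {p q r} → 0ℚ < r → q - p ≡ r → p < q
  <-by h eq = 0<-⇒< (subst (0ℚ <_) (sym eq) h)

  +-nonNeg : ∀ {p q} → 0ℚ ≤ p → 0ℚ ≤ q → 0ℚ ≤ p + q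
  +-nonNeg = +-mono-≤

  +-pos : ∀ {p q} → 0ℚ < p → 0ℚ < q → 0ℚ < p + q
  +-pos = +-mono-<

  *-nonNeg : ∀ {p q} → 0ℚ ≤ p → 0ℚ ≤ q → 0ℚ ≤ p * q
  *-nonNeg {p} {q} hp hq =
    nonNegative⁻¹ _ {{nonNeg*nonNeg⇒nonNeg p {{nonNegative hp}} q {{nonNegative hq}}}}

  *-pos : ∀ {p q} → 0ℚ < p → 0ℚ < q → 0ℚ < p * q
  *-pos {p} {q} hp hq = positive⁻¹ _ {{pos*pos⇒pos p {{positive hp}} q {{positive hq}}}}

  *-mono-≤ : ∀ {a b c d} → 0ℚ ≤ a → 0ℚ ≤ c → a ≤ b → c ≤ d → a * c ≤ b * d
  *-mono-≤ {a} {b} {c} {d} 0≤a 0≤c a≤b c≤d = ≤-trans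
    (*-monoʳ-≤-nonNeg c {{nonNegative 0≤c}} a≤b)
    (*-monoˡ-≤-nonNeg b {{nonNegative (≤-trans 0≤a a≤b)}} c≤d)

  neg-nonNeg : ∀ {p} → p ≤ 0ℚ → 0ℚ ≤ - p
  neg-nonNeg = neg-antimono-≤

  0≤square : ∀ p → 0ℚ ≤ p * p
  0≤square p with ≤-total 0ℚ p
  ... | inj₁ h = *-nonNeg h h
  ... | inj₂ h = subst (0ℚ ≤_) (solve 1 (λ p → :- p :* :- p := p :* p) refl p)
                   (*-nonNeg (neg-nonNeg h) (neg-nonNeg h))

  p≤∣p∣ : ∀ p → p ≤ ∣ p ∣
  p≤∣p∣ p with ≤-total 0ℚ p
  ... | inj₁ h = ≤-reflexive (sym (0≤p⇒∣p∣≡p h))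
  ... | inj₂ h = ≤-trans h (0≤∣p∣ p)

  -p≤∣p∣ : ∀ p → - p ≤ ∣ p ∣
  -p≤∣p∣ p = subst (- p ≤_) (∣-p∣≡∣p∣ p) (p≤∣p∣ (- p))

  ∣p∣≤ : ∀ {p q} → p ≤ q → - p ≤ q → ∣ p ∣ ≤ q
  ∣p∣≤ {p} h k with ∣p∣≡p∨∣p∣≡-p p
  ... | inj₁ eq = subst (_≤ _) (sym eq) h
  ... | inj₂ eq = subst (_≤ _) (sym eq) k

  ∣-∣-comm : ∀ p q → ∣ p - q ∣ ≡ ∣ q - p ∣
  ∣-∣-comm p q = trans (sym (∣-p∣≡∣p∣ (p - q)))
    (cong ∣_∣ (solve 2 (λ p q → :- (p :- q) := q :- p) refl p q))

  ∣-∣-triangle : ∀ p q r → ∣ p - r ∣ ≤ ∣ p - q ∣ + ∣ q - r ∣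
  ∣-∣-triangle p q r = subst (λ x → ∣ x ∣ ≤ ∣ p - q ∣ + ∣ q - r ∣)
    (solve 3 (λ p q r → (p :- q) :+ (q :- r) := p :- r) refl p q r)
    (∣p+q∣≤∣p∣+∣q∣ (p - q) (q - r))

  0<1 : 0ℚ < 1ℚ
  0<1 = positive⁻¹ 1ℚ

  0<½ : 0ℚ < ½
  0<½ = positive⁻¹ ½

  half-pos : ∀ {ε} → 0ℚ < ε → 0ℚ < ½ * ε
  half-pos = *-pos 0<½

  halves : ∀ ε → ½ * ε + ½ * ε ≡ ε
  halves = solve 1 (λ ε → con ½ :* ε :+ con ½ :* ε := ε) refl

  >⇒≢0 : ∀ {p} → 0ℚ < p → p ≢ 0ℚ
  >⇒≢0 0<p refl = <-irrefl refl 0<p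

  abstract
    -- Made total by the default value 0 at 0, so that no evidence of being nonzero travels with
    -- formulas. The default is met where Lanczos divides by `h 0`, which is 0, and where a
    -- projection meets a dependent vector.
    inv : ℚ → ℚ
    inv p with p ≟ 0ℚ
    ... | yes _  = 0ℚ
    ... | no p≢0 = (1/ p) {{≢-nonZero p≢0}}

    *-inv : ∀ {p} → p ≢ 0ℚ → p * inv p ≡ 1ℚ
    *-inv {p} p≢0 with p ≟ 0ℚ
    ... | yes eq = contradiction eq p≢0
    ... | no p≢0′ = *-inverseʳ p {{≢-nonZero p≢0′}}

    inv-0 : inv 0ℚ ≡ 0ℚ
    inv-0 = refl

    inv-pos : ∀ {p} → 0ℚ < p → 0ℚ < inv p
    inv-pos {p} 0<p with p ≟ 0ℚ
    ... | yes refl = contradiction 0<p (<-irrefl refl)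
    ... | no p≢0 = positive⁻¹ _ {{1/pos⇒pos p {{positive 0<p}}}}

  *-zero-product : ∀ {p q} → p ≢ 0ℚ → p * q ≡ 0ℚ → q ≡ 0ℚ
  *-zero-product {p} {q} p≢0 pq≡0 = trans (sym (*-identityˡ q)) (trans
    (cong (_* q) (sym (*-inv p≢0))) (trans
    (solve 3 (λ p q i → p :* i :* q := i :* (p :* q)) refl p q (inv p)) (trans
    (cong (inv p *_) pq≡0) (*-zeroʳ (inv p)))))

  ≡-*-inv : ∀ {p q r} → q ≢ 0ℚ → p * q ≡ r → p ≡ r * inv q
  ≡-*-inv {p} {q} q≢0 refl = trans (sym (*-identityʳ p)) (trans
    (cong (p *_) (sym (*-inv q≢0))) (sym (*-assoc p q (inv q))))

  ι : ℕ → ℚ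
  ι zero    = 0ℚ
  ι (suc n) = 1ℚ + ι n

  0≤ι : ∀ n → 0ℚ ≤ ι n
  0≤ι zero    = ≤-refl
  0≤ι (suc n) = +-nonNeg (<⇒≤ 0<1) (0≤ι n)

  0<ι : ∀ n → 0ℚ < ι (suc n)
  0<ι n = +-mono-<-≤ 0<1 (0≤ι n)

  ι-+ : ∀ m n → ι (m ℕ.+ n) ≡ ι m + ι n
  ι-+ zero    n = sym (+-identityˡ (ι n))
  ι-+ (suc m) n = trans (cong (1ℚ +_) (ι-+ m n)) (sym (+-assoc 1ℚ (ι m) (ι n)))

  ι-* : ∀ m n → ι (m ℕ.* n) ≡ ι m * ι n
  ι-* zero    n = sym (*-zeroˡ (ι n))
  ι-* (suc m) n = trans (ι-+ n (m ℕ.* n)) (trans (cong (ι n +_) (ι-* m n))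
    (solve 2 (λ m n → n :+ m :* n := (con 1ℚ :+ m) :* n) refl (ι m) (ι n)))

  ι-mono : ∀ {m n} → m ℕ.≤ n → ι m ≤ ι n
  ι-mono {n = n} ℕ.z≤n = 0≤ι n
  ι-mono (ℕ.s≤s h)     = +-monoʳ-≤ 1ℚ (ι-mono h)

  ι-/1 : ∀ n → (ℤ.+ n) / 1 ≡ ι n
  ι-/1 zero    = refl
  ι-/1 (suc n) = trans
    (toℚᵘ-injective (ℚᵘ.≃-trans (toℚᵘ-fromℚᵘ (mkℚᵘ (ℤ.+ suc n) 0)) (ℚᵘ.≃-trans
      (*≡* (cong (ℤ._* ℤ.+ 1)
        (trans (ℤ.pos-+ 1 n) (sym (cong (λ i → ℤ.+ 1 ℤ.+ i) (ℤ.*-identityʳ (ℤ.+ n)))))))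
      (ℚᵘ.≃-trans
        (ℚᵘ.+-congʳ (mkℚᵘ (ℤ.+ 1) 0) (ℚᵘ.≃-sym (toℚᵘ-fromℚᵘ (mkℚᵘ (ℤ.+ n) 0))))
        (ℚᵘ.≃-sym (toℚᵘ-homo-+ 1ℚ ((ℤ.+ n) / 1)))))))
    (cong (1ℚ +_) (ι-/1 n))
    where
    open import Data.Rational.Unnormalised.Base as ℚᵘ using (mkℚᵘ; *≡*)
    import Data.Rational.Unnormalised.Properties as ℚᵘ

  archimedean : ∀ p → ∃ λ n → p ≤ ι n
  archimedean p@(mkℚ (ℤ.+ n) d c) = n , subst (p ≤_) (ι-/1 n)
    (toℚᵘ-cancel-≤ (ℚᵘ.≤-respʳ-≃ (ℚᵘ.≃-sym (toℚᵘ-fromℚᵘ (mkℚᵘ (ℤ.+ n) 0)))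
      (ℚᵘ.*≤* (subst (ℤ._≤ ℤ.+ n ℤ.* ℤ.+ suc d) (sym (ℤ.*-identityʳ (ℤ.+ n)))
         (subst₂ ℤ._≤_ (ℤ.*-identityʳ (ℤ.+ n)) refl
           (ℤ.*-monoˡ-≤-nonNeg (ℤ.+ n) (ℤ.+≤+ (ℕ.s≤s ℕ.z≤n))))))))
    where
    open import Data.Rational.Unnormalised.Base as ℚᵘ using (mkℚᵘ)
    import Data.Rational.Unnormalised.Properties as ℚᵘ
  archimedean p@(mkℚ -[1+ n ] d c) = 0 , <⇒≤ (negative⁻¹ p)

  ½^ : ℕ → ℚ
  ½^ zero    = 1ℚ
  ½^ (suc n) = ½ * ½^ n

  0<½^ : ∀ n → 0ℚ < ½^ n
  0<½^ zero    = 0<1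
  0<½^ (suc n) = half-pos (0<½^ n)

  ½^-+ : ∀ m n → ½^ (m ℕ.+ n) ≡ ½^ m * ½^ n
  ½^-+ zero    n = sym (*-identityˡ (½^ n))
  ½^-+ (suc m) n = trans (cong (½ *_) (½^-+ m n)) (sym (*-assoc ½ (½^ m) (½^ n)))

  ½^-anti : ∀ {m n} → m ℕ.≤ n → ½^ n ≤ ½^ m
  ½^-anti {m} {n} m≤n with ℕ.m≤n⇒∃[o]m+o≡n m≤n
  ... | o , refl = go o
    where
    go : ∀ o → ½^ (m ℕ.+ o) ≤ ½^ m
    go zero    = ≤-reflexive (cong ½^ (ℕ.+-identityʳ m))
    go (suc o) = ≤-trans (≤-reflexive (cong ½^ (ℕ.+-suc m o)))
      (≤-trans (≤-by (*-nonNeg (<⇒≤ 0<½) (<⇒≤ (0<½^ (m ℕ.+ o))))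
        (solve 1 (λ x → x :- con ½ :* x := con ½ :* x) refl (½^ (m ℕ.+ o)))) (go o))

  ι*½^≤1 : ∀ n → ι (suc n) * ½^ n ≤ 1ℚ
  ι*½^≤1 zero    = ≤-refl
  ι*½^≤1 (suc n) = ≤-trans (≤-by (*-nonNeg (*-nonNeg (<⇒≤ 0<½) (0≤ι n)) (<⇒≤ (0<½^ n)))
    (solve 2 (λ n h → (con 1ℚ :+ n) :* h :- (con 1ℚ :+ (con 1ℚ :+ n)) :* (con ½ :* h)
         := con ½ :* n :* h) refl (ι n) (½^ n)))
    (ι*½^≤1 n)

  ½^-small : ∀ C ε → 0ℚ < ε → ∃ λ N → ∀ n → N ℕ.≤ n → C * ½^ n < ε
  ½^-small C ε 0<ε with archimedean (∣ C ∣ * inv ε)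
  ... | N , h = N , λ n N≤n → ≤-<-trans
    (≤-trans (*-monoʳ-≤-nonNeg (½^ n) {{nonNegative (<⇒≤ (0<½^ n))}} (p≤∣p∣ C))
    (*-monoˡ-≤-nonNeg ∣ C ∣ {{nonNegative (0≤∣p∣ C)}} (½^-anti N≤n))) core
    where
    bound : ∣ C ∣ ≤ ε * ι N
    bound = subst (_≤ ε * ι N)
      (trans (solve 3 (λ e c i → e :* (c :* i) := (e :* i) :* c) refl ε ∣ C ∣ (inv ε))
        (trans (cong (_* ∣ C ∣) (*-inv (>⇒≢0 0<ε))) (*-identityˡ ∣ C ∣)))
      (*-monoˡ-≤-nonNeg ε {{nonNegative (<⇒≤ 0<ε)}} h)
    core : ∣ C ∣ * ½^ N < ε
    core = ≤-<-trans
      (*-monoʳ-≤-nonNeg (½^ N) {{nonNegative (<⇒≤ (0<½^ N))}} bound)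
      (<-≤-trans
        (<-by (*-pos 0<ε (0<½^ N))
          (solve 3 (λ e i h → e :* ((con 1ℚ :+ i) :* h) :- e :* i :* h := e :* h) refl ε (ι N) (½^ N)))
        (≤-trans (*-monoˡ-≤-nonNeg ε {{nonNegative (<⇒≤ 0<ε)}} (ι*½^≤1 N))
          (≤-reflexive (*-identityʳ ε))))

  *-monoˡ-≤′ : ∀ r {p q} → 0ℚ ≤ r → p ≤ q → r * p ≤ r * q
  *-monoˡ-≤′ r 0≤r p≤q = *-monoˡ-≤-nonNeg r {{nonNegative 0≤r}} p≤q

  *-monoʳ-≤′ : ∀ r {p q} → 0ℚ ≤ r → p ≤ q → p * r ≤ q * r
  *-monoʳ-≤′ r 0≤r p≤q = *-monoʳ-≤-nonNeg r {{nonNegative 0≤r}} p≤q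

  *-monoˡ-<′ : ∀ r {p q} → 0ℚ < r → p < q → r * p < r * q
  *-monoˡ-<′ r 0<r p<q = *-monoʳ-<-pos r {{positive 0<r}} p<q

-- Positive definiteness over the rationals

module RationalVectors where

  open import Data.Rational.Base using (_≤_) renaming (_+_ to _⊹_; _*_ to _·_; _-_ to _∸_)
  open RationalProperties

  module Q = LinearAlgebraProperties ℚ.+-*-commutativeRing
  open Q using (⟨_,_⟩)
  open ℚ.+-*-Solver using (solve; _:=_; _:+_; _:-_; con)

  sum-nonNeg : ∀ {m} (f : Vector ℚ m) → (∀ i → 0ℚ ≤ f i) → 0ℚ ≤ Q.sum f
  sum-nonNeg {zero}  f 0≤f = ℚ.≤-refl
  sum-nonNeg {suc m} f 0≤f = +-nonNeg (0≤f zero) (sum-nonNeg (f ∘ suc) (0≤f ∘ suc))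

  sum-1 : ∀ m → Q.sum {m} (λ _ → 1ℚ) ≡ ι m
  sum-1 zero    = refl
  sum-1 (suc m) = cong (1ℚ ⊹_) (sum-1 m)

  sum≡0⇒≡0 : ∀ {m} (f : Vector ℚ m) → (∀ i → 0ℚ ≤ f i) → Q.sum f ≡ 0ℚ → ∀ i → f i ≡ 0ℚ
  sum≡0⇒≡0 {suc m} f 0≤f eq = λ { zero → f0≡0 ; (suc i) → sum≡0⇒≡0 (f ∘ suc) (0≤f ∘ suc) rest≡0 i }
    where
    rest = Q.sum (f ∘ suc)
    0≤rest : 0ℚ ≤ rest
    0≤rest = sum-nonNeg (f ∘ suc) (0≤f ∘ suc)
    f0≡0 : f zero ≡ 0ℚ
    f0≡0 = ℚ.≤-antisym (≤-by 0≤rest (trans (solve 2 (λ x y → con 0ℚ :- x := y :- (x :+ y)) refl (f zero) rest)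
      (trans (cong (rest ∸_) eq) (ℚ.+-identityʳ rest)))) (0≤f zero)
    rest≡0 : rest ≡ 0ℚ
    rest≡0 = trans (sym (ℚ.+-identityˡ rest)) (trans (cong (_⊹ rest) (sym f0≡0)) eq)

  ⟨v,v⟩≡0⇒v≡0 : ∀ {m} (v : Vector ℚ m) → ⟨ v , v ⟩ ≡ 0ℚ → ∀ i → v i ≡ 0ℚ
  ⟨v,v⟩≡0⇒v≡0 v eq i with v i ℚ.≟ 0ℚ
  ... | yes vi≡0 = vi≡0
  ... | no vi≢0  = *-zero-product vi≢0 (sum≡0⇒≡0 (λ i → v i · v i) (λ i → 0≤square (v i)) eq i)

  term≤sum : ∀ {m} (f : Vector ℚ m) → (∀ i → 0ℚ ≤ f i) → ∀ i → f i ≤ Q.sum f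
  term≤sum {suc m} f 0≤f zero    = subst (_≤ Q.sum f) (ℚ.+-identityʳ (f zero))
    (ℚ.+-monoʳ-≤ (f zero) (sum-nonNeg (f ∘ suc) (0≤f ∘ suc)))
  term≤sum {suc m} f 0≤f (suc i) = subst (_≤ Q.sum f) (ℚ.+-identityˡ (f (suc i)))
    (ℚ.+-mono-≤ (0≤f zero) (term≤sum (f ∘ suc) (0≤f ∘ suc) i))

-- The ring of Cauchy reals, with order, apartness and inverses

module RealProperties where

  open import Algebra.Bundles using (CommutativeRing)
  open import Algebra.Bundles.Raw using (RawRing)
  open import Algebra.Solver.Ring.AlmostCommutativeRing using (fromCommutativeRing; _-Raw-AlmostCommutative⟶_)
  import Algebra.Solver.Ring
  open import Data.Maybe.Base using (Maybe; just; nothing)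
  open import Data.Rational.Base
  open import Data.Rational.Properties
  open import Level using (0ℓ)
  open RationalProperties

  private module S = ℚ.+-*-Solver
  open S using (_:=_; _:+_; _:*_; _:-_; :-_; con)

  Ev : (ℕ → Set) → Set
  Ev P = ∃ λ N → ∀ n → N ℕ.≤ n → P n

  Ev-map : ∀ {P Q : ℕ → Set} → (∀ n → P n → Q n) → Ev P → Ev Q
  Ev-map f (N , h) = N , λ n N≤n → f n (h n N≤n)

  Ev-zip : ∀ {P Q R : ℕ → Set} → (∀ n → P n → Q n → R n) → Ev P → Ev Q → Ev R
  Ev-zip f (M , g) (N , h) = M ℕ.⊔ N , λ n p →
    f n (g n (ℕ.m⊔n≤o⇒m≤o M N p)) (h n (ℕ.m⊔n≤o⇒n≤o M N p))

  Ev-all : ∀ {P : ℕ → Set} → (∀ n → P n) → Ev P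
  Ev-all f = 0 , λ n _ → f n

  Ev-const : ∀ {P : ℕ → Set} {A : Set} → (∀ n → P n → A) → Ev P → A
  Ev-const f (N , h) = f N (h N ℕ.≤-refl)

  Null : (ℕ → ℚ) → Set
  Null s = ∀ ε → 0ℚ < ε → Ev λ n → ∣ s n ∣ < ε

  Null-+ : ∀ {s t} → Null s → Null t → Null (λ n → s n + t n)
  Null-+ {s} {t} hs ht ε 0<ε = Ev-zip
    (λ n p q → ≤-<-trans (∣p+q∣≤∣p∣+∣q∣ (s n) (t n)) (subst (_ <_) (halves ε) (+-mono-< p q)))
    (hs _ (half-pos 0<ε)) (ht _ (half-pos 0<ε))

  Null-dominated : ∀ {s t} → Ev (λ n → ∣ s n ∣ ≤ ∣ t n ∣) → Null t → Null s
  Null-dominated hs ht ε 0<ε = Ev-zip (λ n → ≤-<-trans) hs (ht ε 0<ε)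

  Bounded : (ℕ → ℚ) → Set
  Bounded s = ∃ λ B → 0ℚ < B × Ev λ n → ∣ s n ∣ ≤ B

  Null-*-bounded : ∀ {s t} → Bounded s → Null t → Null (λ n → s n * t n)
  Null-*-bounded {s} {t} (B , 0<B , hs) ht ε 0<ε = Ev-zip
    (λ n p q → ≤-<-trans (≤-reflexive (∣p*q∣≡∣p∣*∣q∣ (s n) (t n)))
      (≤-<-trans (*-monoʳ-≤′ ∣ t n ∣ (0≤∣p∣ (t n)) p)
        (subst (B * ∣ t n ∣ <_) eq (*-monoˡ-<′ B 0<B q))))
    hs (ht (ε * inv B) (*-pos 0<ε (inv-pos 0<B)))
    where
    eq : B * (ε * inv B) ≡ ε
    eq = trans (S.solve 3 (λ b e i → b :* (e :* i) := (b :* i) :* e) refl B ε (inv B))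
      (trans (cong (_* ε) (*-inv (>⇒≢0 0<B))) (*-identityˡ ε))

  bounded : ∀ x → Bounded (seq x)
  bounded x with cauchy x 1ℚ 0<1
  ... | N , h = 1ℚ + ∣ seq x N ∣ , +-mono-<-≤ 0<1 (0≤∣p∣ (seq x N)) , N , λ n N≤n →
    ≤-trans (subst (λ y → ∣ y ∣ ≤ ∣ seq x n - seq x N ∣ + ∣ seq x N ∣)
        (S.solve 2 (λ a b → (a :- b) :+ b := a) refl (seq x n) (seq x N))
        (∣p+q∣≤∣p∣+∣q∣ (seq x n - seq x N) (seq x N)))
      (+-monoˡ-≤ ∣ seq x N ∣ (<⇒≤ (h n N N≤n ℕ.≤-refl)))

  null⇒≈ : ∀ {x y} → Null (λ n → seq x n - seq y n) → x ≈ℝ y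
  null⇒≈ h = mk≈ h

  ≈⇒null : ∀ {x y} → x ≈ℝ y → Null (λ n → seq x n - seq y n)
  ≈⇒null (mk≈ h) = h

  Null-≗ : ∀ {s t} → (∀ n → s n ≡ t n) → Null s → Null t
  Null-≗ eq h = Null-dominated (Ev-all λ n → ≤-reflexive (cong ∣_∣ (sym (eq n)))) h

  Null-neg : ∀ {s} → Null s → Null (λ n → - s n)
  Null-neg {s} = Null-dominated (Ev-all λ n → ≤-reflexive (∣-p∣≡∣p∣ (s n)))

  pointwise : ∀ {x y} → (∀ n → seq x n ≡ seq y n) → x ≈ℝ y
  pointwise {x} {y} eq = null⇒≈ λ ε 0<ε → Ev-all λ n →
    subst (_< ε) (cong ∣_∣ (sym (trans (cong (_- seq y n) (eq n)) (+-inverseʳ (seq y n))))) 0<ε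

  ≈-refl : ∀ {x} → x ≈ℝ x
  ≈-refl = pointwise λ _ → refl

  ≈-sym : ∀ {x y} → x ≈ℝ y → y ≈ℝ x
  ≈-sym {x} {y} p = null⇒≈ (Null-≗
    (λ n → S.solve 2 (λ a b → :- (a :- b) := b :- a) refl (seq x n) (seq y n))
    (Null-neg (≈⇒null p)))

  ≈-trans : ∀ {x y z} → x ≈ℝ y → y ≈ℝ z → x ≈ℝ z
  ≈-trans {x} {y} {z} p q = null⇒≈ (Null-≗
    (λ n → S.solve 3 (λ a b c → (a :- b) :+ (b :- c) := a :- c) refl (seq x n) (seq y n) (seq z n))
    (Null-+ (≈⇒null p) (≈⇒null q)))

  +-cong : ∀ {x y u v} → x ≈ℝ y → u ≈ℝ v → (x +ℝ u) ≈ℝ (y +ℝ v)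
  +-cong {x} {y} {u} {v} p q = null⇒≈ (Null-≗
    (λ n → S.solve 4 (λ a b c d → (a :- b) :+ (c :- d) := (a :+ c) :- (b :+ d)) refl
      (seq x n) (seq y n) (seq u n) (seq v n))
    (Null-+ (≈⇒null p) (≈⇒null q)))

  *-cong : ∀ {x y u v} → x ≈ℝ y → u ≈ℝ v → (x *ℝ u) ≈ℝ (y *ℝ v)
  *-cong {x} {y} {u} {v} p q = null⇒≈ (Null-≗
    (λ n → S.solve 4 (λ a b c d → a :* (c :- d) :+ d :* (a :- b) := a :* c :- b :* d) refl
      (seq x n) (seq y n) (seq u n) (seq v n))
    (Null-+ (Null-*-bounded (bounded x) (≈⇒null q)) (Null-*-bounded (bounded v) (≈⇒null p))))

  -ℝ‿cong : ∀ {x y} → x ≈ℝ y → (-ℝ x) ≈ℝ (-ℝ y)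
  -ℝ‿cong {x} {y} p = null⇒≈ (Null-≗
    (λ n → S.solve 2 (λ a b → :- (a :- b) := (:- a) :- (:- b)) refl (seq x n) (seq y n))
    (Null-neg (≈⇒null p)))

  ℝ-commutativeRing : CommutativeRing 0ℓ 0ℓ
  ℝ-commutativeRing = record
    { RawRing ℝ-rawRing
    ; isCommutativeRing = record
      { isRing = record
        { +-isAbelianGroup = record
          { isGroup = record
            { isMonoid = record
              { isSemigroup = record
                { isMagma = record
                  { isEquivalence = record { refl = ≈-refl ; sym = ≈-sym ; trans = ≈-trans }
                  ; ∙-cong = +-cong }
                ; assoc = λ x y z → pointwise λ n → +-assoc (seq x n) (seq y n) (seq z n) }
              ; identity = (λ x → pointwise λ n → +-identityˡ (seq x n))
                         , (λ x → pointwise λ n → +-identityʳ (seq x n)) }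
            ; inverse = (λ x → pointwise λ n → +-inverseˡ (seq x n))
                      , (λ x → pointwise λ n → +-inverseʳ (seq x n))
            ; ⁻¹-cong = -ℝ‿cong }
          ; comm = λ x y → pointwise λ n → +-comm (seq x n) (seq y n) }
        ; *-cong = *-cong
        ; *-assoc = λ x y z → pointwise λ n → *-assoc (seq x n) (seq y n) (seq z n)
        ; *-identity = (λ x → pointwise λ n → *-identityˡ (seq x n))
                     , (λ x → pointwise λ n → *-identityʳ (seq x n))
        ; distrib = (λ x y z → pointwise λ n → *-distribˡ-+ (seq x n) (seq y n) (seq z n))
                  , (λ x y z → pointwise λ n → *-distribʳ-+ (seq x n) (seq y n) (seq z n)) }
      ; *-comm = λ x y → pointwise λ n → *-comm (seq x n) (seq y n) } }

  ℚ→ℝ-cong : ∀ {p q} → p ≡ q → ℚ→ℝ p ≈ℝ ℚ→ℝ q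
  ℚ→ℝ-cong refl = ≈-refl

  ℚ→ℝ-morphism : +-*-rawRing -Raw-AlmostCommutative⟶ fromCommutativeRing ℝ-commutativeRing
  ℚ→ℝ-morphism = record
    { ⟦_⟧ = ℚ→ℝ
    ; +-homo = λ _ _ → pointwise λ _ → refl
    ; *-homo = λ _ _ → pointwise λ _ → refl
    ; -‿homo = λ _ → pointwise λ _ → refl
    ; 0-homo = ≈-refl
    ; 1-homo = ≈-refl
    }

  ℚ→ℝ-weaklyDecidable : ∀ p q → Maybe (ℚ→ℝ p ≈ℝ ℚ→ℝ q)
  ℚ→ℝ-weaklyDecidable p q with p ≟ q
  ... | yes p≡q = just (ℚ→ℝ-cong p≡q)
  ... | no _    = nothing

  module ℝ-Solver = Algebra.Solver.Ring +-*-rawRing (fromCommutativeRing ℝ-commutativeRing)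
    ℚ→ℝ-morphism ℚ→ℝ-weaklyDecidable

  ℚ→ℝ-injective : ∀ {p q} → ℚ→ℝ p ≈ℝ ℚ→ℝ q → p ≡ q
  ℚ→ℝ-injective {p} {q} (mk≈ h) with p ≟ q
  ... | yes p≡q = p≡q
  ... | no p≢q  = contradiction (Ev-const (λ _ lt → lt) (h ∣ p - q ∣ 0<∣p-q∣)) (<-irrefl refl)
    where
    ≤∧≢⇒< : ∀ {a b} → a ≤ b → a ≢ b → a < b
    ≤∧≢⇒< {a} {b} a≤b a≢b with a <? b
    ... | yes lt = lt
    ... | no ¬lt = contradiction (≤-antisym a≤b (≮⇒≥ ¬lt)) a≢b
    p-q≡0⇒p≡q : p - q ≡ 0ℚ → p ≡ q
    p-q≡0⇒p≡q eq = trans (S.solve 2 (λ p q → p := (p :- q) :+ q) refl p q)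
      (trans (cong (_+ q) eq) (+-identityˡ q))
    0<∣p-q∣ : 0ℚ < ∣ p - q ∣
    0<∣p-q∣ = ≤∧≢⇒< (0≤∣p∣ (p - q)) λ eq → p≢q (p-q≡0⇒p≡q (∣p∣≡0⇒p≡0 _ (sym eq)))

  -- Order and apartness

  record Pos (x : ℝ) : Set where
    constructor mkPos
    field
      bound   : ℚ
      0<bound : 0ℚ < bound
      above   : Ev λ n → bound ≤ seq x n

  Pos-cong : ∀ {x y} → x ≈ℝ y → Pos x → Pos y
  Pos-cong {x} {y} x≈y (mkPos δ 0<δ h) = mkPos (½ * δ) (half-pos 0<δ) (Ev-zip
    (λ n p q → ≤-by (+-nonNeg (≤⇒0≤- p) (<⇒≤ (<⇒0<- (≤-<-trans (p≤∣p∣ _) q))))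
      (S.solve 3 (λ d a b → b :- con ½ :* d := (a :- d) :+ (con ½ :* d :- (a :- b))) refl
        δ (seq x n) (seq y n)))
    h (≈⇒null x≈y _ (half-pos 0<δ)))

  Pos-+ : ∀ {x y} → Pos x → Pos y → Pos (x +ℝ y)
  Pos-+ (mkPos δ 0<δ h) (mkPos ε 0<ε k) = mkPos (δ + ε) (+-pos 0<δ 0<ε) (Ev-zip (λ n → +-mono-≤) h k)

  Pos-* : ∀ {x y} → Pos x → Pos y → Pos (x *ℝ y)
  Pos-* (mkPos δ 0<δ h) (mkPos ε 0<ε k) = mkPos (δ * ε) (*-pos 0<δ 0<ε)
    (Ev-zip (λ n → RationalProperties.*-mono-≤ (<⇒≤ 0<δ) (<⇒≤ 0<ε)) h k)

  Pos-ℚ : ∀ {q} → 0ℚ < q → Pos (ℚ→ℝ q)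
  Pos-ℚ {q} 0<q = mkPos q 0<q (Ev-all λ _ → ≤-refl)

  Pos⇒≉0 : ∀ {x} → Pos x → ¬ (x ≈ℝ 0ℝ)
  Pos⇒≉0 {x} (mkPos δ 0<δ h) x≈0 = Ev-const (λ n lt → <-irrefl refl lt)
    (Ev-zip (λ n p q → ≤-<-trans p (≤-<-trans (≤-trans (p≤∣p∣ (seq x n))
        (≤-reflexive (cong ∣_∣ (sym (+-identityʳ (seq x n)))))) q))
      h (≈⇒null x≈0 δ 0<δ))

  Pos-asym : ∀ {x} → Pos x → ¬ Pos (-ℝ x)
  Pos-asym {x} p q = Pos⇒≉0 (Pos-+ p q) (CommutativeRing.-‿inverseʳ ℝ-commutativeRing x)

  Pos⇒< : ∀ {x y} → Pos (y +ℝ (-ℝ x)) → x <ℝ y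
  Pos⇒< {x} {y} (mkPos δ 0<δ (N , h)) = mk< δ 0<δ N λ n N≤n → ≤-by (≤⇒0≤- (h n N≤n))
    (S.solve 3 (λ d a b → b :- (a :+ d) := (b :- a) :- d) refl δ (seq x n) (seq y n))

  <⇒Pos : ∀ {x y} → x <ℝ y → Pos (y +ℝ (-ℝ x))
  <⇒Pos {x} {y} (mk< δ 0<δ N h) = mkPos δ 0<δ (N , λ n N≤n → ≤-by (≤⇒0≤- (h n N≤n))
    (S.solve 3 (λ d a b → (b :- a) :- d := b :- (a :+ d)) refl δ (seq x n) (seq y n)))

  _#0 : ℝ → Set
  x #0 = Pos x ⊎ Pos (-ℝ x)

  infix 4 _#0

  #0-cong : ∀ {x y} → x ≈ℝ y → x #0 → y #0
  #0-cong x≈y (inj₁ p) = inj₁ (Pos-cong x≈y p)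
  #0-cong x≈y (inj₂ p) = inj₂ (Pos-cong (-ℝ‿cong x≈y) p)

  #0⇒≉0 : ∀ {x} → x #0 → ¬ (x ≈ℝ 0ℝ)
  #0⇒≉0 (inj₁ p) eq = Pos⇒≉0 p eq
  #0⇒≉0 (inj₂ p) eq = Pos⇒≉0 p (≈-trans (-ℝ‿cong eq) (pointwise λ _ → refl))

  #0-neg : ∀ {x} → x #0 → -ℝ x #0
  #0-neg {x} (inj₁ p) = inj₂ (Pos-cong (pointwise λ n → sym (S.solve 1 (λ a → :- (:- a) := a) refl (seq x n))) p)
  #0-neg     (inj₂ p) = inj₁ p

  private
    module R = ℝ-Solver

  #0-* : ∀ {x y} → x #0 → y #0 → x *ℝ y #0
  #0-* {x} {y} (inj₁ p) (inj₁ q) = inj₁ (Pos-* p q)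
  #0-* {x} {y} (inj₁ p) (inj₂ q) = inj₂ (Pos-cong
    (R.solve 2 (λ a b → a R.:* R.:- b R.:= R.:- (a R.:* b)) ≈-refl x y) (Pos-* p q))
  #0-* {x} {y} (inj₂ p) (inj₁ q) = inj₂ (Pos-cong
    (R.solve 2 (λ a b → R.:- a R.:* b R.:= R.:- (a R.:* b)) ≈-refl x y) (Pos-* p q))
  #0-* {x} {y} (inj₂ p) (inj₂ q) = inj₁ (Pos-cong
    (R.solve 2 (λ a b → R.:- a R.:* R.:- b R.:= a R.:* b) ≈-refl x y) (Pos-* p q))

  #0-square : ∀ {x} → x #0 → Pos (x *ℝ x)
  #0-square {x} (inj₁ p) = Pos-* p p
  #0-square {x} (inj₂ p) = Pos-cong
    (R.solve 1 (λ a → R.:- a R.:* R.:- a R.:= a R.:* a) ≈-refl x) (Pos-* p p)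

  #0-ℚ : ∀ {q} → q ≢ 0ℚ → ℚ→ℝ q #0
  #0-ℚ {q} q≢0 with <-cmp q 0ℚ
  ... | tri< q<0 _ _ = inj₂ (mkPos (- q) (neg-antimono-< q<0) (Ev-all λ _ → ≤-refl))
  ... | tri≈ _ q≡0 _ = contradiction q≡0 q≢0
  ... | tri> _ _ 0<q = inj₁ (Pos-ℚ 0<q)

  -- Replaces trichotomy. One late term is compared with ε/2 in ℚ, and all later terms stay within
  -- ε/4 of it: below ε/2 they remain under ε, otherwise they keep distance ε/4 from 0 on a known
  -- side.
  small-or-large : ∀ x ε → 0ℚ < ε →
    Ev (λ n → ∣ seq x n ∣ < ε) ⊎ Ev (λ n → ½ * (½ * ε) ≤ seq x n) ⊎ Ev (λ n → ½ * (½ * ε) ≤ - seq x n)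
  small-or-large x ε 0<ε with cauchy x (½ * (½ * ε)) (half-pos (half-pos 0<ε))
  ... | N , h = cases
    where
    a = seq x N
    near : ∀ n → N ℕ.≤ n → ∣ a - seq x n ∣ < ½ * (½ * ε)
    near n N≤n = h N n ℕ.≤-refl N≤n
    cases : Ev (λ n → ∣ seq x n ∣ < ε) ⊎ Ev (λ n → ½ * (½ * ε) ≤ seq x n) ⊎ Ev (λ n → ½ * (½ * ε) ≤ - seq x n)
    cases with ∣ a ∣ <? ½ * ε
    ... | yes lt = inj₁ (N , λ n N≤n → ≤-<-trans
      (≤-trans (≤-reflexive (cong ∣_∣ (S.solve 2 (λ a b → b := a :- (a :- b)) refl a (seq x n))))
        (∣p-q∣≤∣p∣+∣q∣ a (a - seq x n)))
      (<-trans (+-mono-< lt (near n N≤n)) (<-by (half-pos (half-pos 0<ε))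
        (S.solve 1 (λ e → e :- (con ½ :* e :+ con ½ :* (con ½ :* e)) := con ½ :* (con ½ :* e)) refl ε))))
    ... | no ¬lt with ∣p∣≡p∨∣p∣≡-p a
    ...   | inj₁ eq = inj₂ (inj₁ (N , λ n N≤n → ≤-by
              (+-nonNeg (≤⇒0≤- (subst (½ * ε ≤_) eq (≮⇒≥ ¬lt)))
                (≤⇒0≤- (≤-trans (p≤∣p∣ _) (<⇒≤ (near n N≤n)))))
              (S.solve 3 (λ e a b → b :- con ½ :* (con ½ :* e)
                 := (a :- con ½ :* e) :+ (con ½ :* (con ½ :* e) :- (a :- b))) refl ε a (seq x n))))
    ...   | inj₂ eq = inj₂ (inj₂ (N , λ n N≤n → ≤-by
              (+-nonNeg (≤⇒0≤- (subst (½ * ε ≤_) eq (≮⇒≥ ¬lt)))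
                (≤⇒0≤- (≤-trans (-p≤∣p∣ _) (<⇒≤ (near n N≤n)))))
              (S.solve 3 (λ e a b → :- b :- con ½ :* (con ½ :* e)
                 := (:- a :- con ½ :* e) :+ (con ½ :* (con ½ :* e) :- :- (a :- b))) refl ε a (seq x n))))

  small-or-apart : ∀ x ε → 0ℚ < ε → Ev (λ n → ∣ seq x n ∣ < ε) ⊎ x #0
  small-or-apart x ε 0<ε with small-or-large x ε 0<ε
  ... | inj₁ h = inj₁ h
  ... | inj₂ (inj₁ h) = inj₂ (inj₁ (mkPos (½ * (½ * ε)) (half-pos (half-pos 0<ε)) h))
  ... | inj₂ (inj₂ h) = inj₂ (inj₂ (mkPos (½ * (½ * ε)) (half-pos (half-pos 0<ε)) h))

  small⇒≈0 : ∀ {x} → (∀ ε → 0ℚ < ε → Ev λ n → ∣ seq x n ∣ < ε) → x ≈ℝ 0ℝ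
  small⇒≈0 {x} h = null⇒≈ (Null-≗ (λ n → sym (+-identityʳ (seq x n))) h)

  tight : ∀ {x} → ¬ (x #0) → x ≈ℝ 0ℝ
  tight {x} ¬x#0 = small⇒≈0 λ ε 0<ε → [ (λ h → h) , (λ x#0 → contradiction x#0 ¬x#0) ]′ (small-or-apart x ε 0<ε)

  -- Equality with 0 is the negation of apartness (`tight`), so classical case distinctions are
  -- permitted in proving it.
  ≈0-stable : ∀ {x} → ¬ ¬ (x ≈ℝ 0ℝ) → x ≈ℝ 0ℝ
  ≈0-stable ¬¬h = tight λ x#0 → ¬¬h (#0⇒≉0 x#0)

  ≈0-or-#0 : ∀ x → ¬ ¬ (x ≈ℝ 0ℝ ⊎ x #0)
  ≈0-or-#0 x k = k (inj₁ (tight (k ∘ inj₂)))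

  #0-lower : ∀ {x} → x #0 → ∃ λ δ → 0ℚ < δ × Ev λ n → δ ≤ ∣ seq x n ∣
  #0-lower {x} (inj₁ (mkPos δ 0<δ h)) = δ , 0<δ , Ev-map (λ n p → ≤-trans p (p≤∣p∣ (seq x n))) h
  #0-lower {x} (inj₂ (mkPos δ 0<δ h)) = δ , 0<δ , Ev-map (λ n p → ≤-trans p (-p≤∣p∣ (seq x n))) h

  -- If B bounds x and δ bounds the product away from 0, then y cannot be eventually below δ/B;
  -- hence the approximate dichotomy for y at that threshold must report apartness.
  #0-cancelˡ : ∀ {x y} → x *ℝ y #0 → y #0
  #0-cancelˡ {x} {y} xy#0 = go (bounded x) (#0-lower xy#0)
    where
    go : Bounded (seq x) → (∃ λ δ → 0ℚ < δ × Ev λ n → δ ≤ ∣ seq x n * seq y n ∣) → y #0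
    go (B , 0<B , hB) (δ , 0<δ , hδ) =
      [ (λ small → contradiction (Ev-const (λ _ lt → lt) (collapse small)) (<-irrefl refl)) , (λ h → h) ]′
      (small-or-apart y (δ * inv B) (*-pos 0<δ (inv-pos 0<B)))
      where
      scale : B * (δ * inv B) ≡ δ
      scale = trans
        (S.solve 3 (λ b d i → b :* (d :* i) := (b :* i) :* d) refl B δ (inv B))
        (trans (cong (_* δ) (*-inv (>⇒≢0 0<B))) (*-identityˡ δ))
      product-bound : ∀ n → ∣ seq x n ∣ ≤ B → ∣ seq y n ∣ < δ * inv B → ∣ seq x n * seq y n ∣ < δ
      product-bound n p q = begin-strict
        ∣ seq x n * seq y n ∣        ≡⟨ ∣p*q∣≡∣p∣*∣q∣ (seq x n) (seq y n) ⟩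
        ∣ seq x n ∣ * ∣ seq y n ∣    ≤⟨ *-monoʳ-≤′ ∣ seq y n ∣ (0≤∣p∣ (seq y n)) p ⟩
        B * ∣ seq y n ∣              <⟨ *-monoˡ-<′ B 0<B q ⟩
        B * (δ * inv B)              ≡⟨ scale ⟩
        δ                            ∎
        where open ≤-Reasoning
      collapse : Ev (λ n → ∣ seq y n ∣ < δ * inv B) → Ev λ _ → δ < δ
      collapse small = Ev-zip (λ n → ≤-<-trans) hδ (Ev-zip product-bound hB small)

  Pos-cancelˡ : ∀ {x y} → Pos x → Pos (x *ℝ y) → Pos y
  Pos-cancelˡ {x} {y} px pxy = [ (λ py → py) , (λ p-y → contradiction (flipped p-y) (Pos-asym pxy)) ]′
    (#0-cancelˡ {x} {y} (inj₁ pxy))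
    where
    flipped : Pos (-ℝ y) → Pos (-ℝ (x *ℝ y))
    flipped p-y = Pos-cong (R.solve 2 (λ a b → a R.:* R.:- b R.:= R.:- (a R.:* b)) ≈-refl x y) (Pos-* px p-y)

  inverse : ∀ x → x #0 → ∃ λ y → x *ℝ y ≈ℝ 1ℝ
  inverse x x#0 = mkℝ (λ n → inv (seq x n)) cau , mk≈ λ ε 0<ε → Ev-map
    (λ n p → subst (_< ε) (sym (cong ∣_∣ (trans (cong (_- 1ℚ) (*-inv (away p))) (+-inverseʳ 1ℚ)))) 0<ε) hδ
    where
    bound = #0-lower x#0
    δ = proj₁ bound
    0<δ = proj₁ (proj₂ bound)
    hδ = proj₂ (proj₂ bound)
    N = proj₁ hδ
    away : ∀ {a} → δ ≤ ∣ a ∣ → a ≢ 0ℚ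
    away h refl = <-irrefl refl (<-≤-trans 0<δ h)
    inv-bound : ∀ {a} → δ ≤ ∣ a ∣ → ∣ inv a ∣ ≤ inv δ
    inv-bound {a} h = *-cancelˡ-≤-pos δ {{positive 0<δ}} (begin
      δ * ∣ inv a ∣        ≤⟨ *-monoʳ-≤′ ∣ inv a ∣ (0≤∣p∣ (inv a)) h ⟩
      ∣ a ∣ * ∣ inv a ∣    ≡⟨ ∣p*q∣≡∣p∣*∣q∣ a (inv a) ⟨
      ∣ a * inv a ∣        ≡⟨ cong ∣_∣ (*-inv (away h)) ⟩
      1ℚ                   ≡⟨ *-inv (>⇒≢0 0<δ) ⟨
      δ * inv δ            ∎)
      where open ≤-Reasoning
    C = inv δ * inv δ
    difference : ∀ {a b} → a ≢ 0ℚ → b ≢ 0ℚ → inv a - inv b ≡ (inv a * inv b) * (b - a)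
    difference {a} {b} ha hb = trans
      (cong₂ _-_ (trans (sym (*-identityˡ (inv a))) (cong (_* inv a) (sym (*-inv hb))))
                 (trans (sym (*-identityˡ (inv b))) (cong (_* inv b) (sym (*-inv ha)))))
      (S.solve 4 (λ a b i j → b :* j :* i :- a :* i :* j := i :* j :* (b :- a)) refl a b (inv a) (inv b))
    cau : IsCauchy (λ n → inv (seq x n))
    -- The factor δ² pays for the denominators in 1/a - 1/b = (b - a)/(ab), which are at least δ in
    -- absolute value.
    cau ε 0<ε with cauchy x (ε * (δ * δ)) (*-pos 0<ε (*-pos 0<δ 0<δ))
    ... | M , h = M ℕ.⊔ N , λ m n p q → close m n
        (proj₂ hδ m (ℕ.m⊔n≤o⇒n≤o M N p)) (proj₂ hδ n (ℕ.m⊔n≤o⇒n≤o M N q))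
        (h n m (ℕ.m⊔n≤o⇒m≤o M N q) (ℕ.m⊔n≤o⇒m≤o M N p))
      where
      open ≤-Reasoning
      close : ∀ m n → δ ≤ ∣ seq x m ∣ → δ ≤ ∣ seq x n ∣ → ∣ seq x n - seq x m ∣ < ε * (δ * δ) →
        ∣ inv (seq x m) - inv (seq x n) ∣ < ε
      close m n hm hn lt = begin-strict
        ∣ inv (seq x m) - inv (seq x n) ∣
          ≡⟨ cong ∣_∣ (difference (away hm) (away hn)) ⟩
        ∣ (inv (seq x m) * inv (seq x n)) * (seq x n - seq x m) ∣
          ≡⟨ ∣p*q∣≡∣p∣*∣q∣ (inv (seq x m) * inv (seq x n)) (seq x n - seq x m) ⟩
        ∣ inv (seq x m) * inv (seq x n) ∣ * ∣ seq x n - seq x m ∣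
          ≡⟨ cong (_* ∣ seq x n - seq x m ∣) (∣p*q∣≡∣p∣*∣q∣ (inv (seq x m)) (inv (seq x n))) ⟩
        ∣ inv (seq x m) ∣ * ∣ inv (seq x n) ∣ * ∣ seq x n - seq x m ∣
          ≤⟨ *-monoʳ-≤′ ∣ seq x n - seq x m ∣ (0≤∣p∣ (seq x n - seq x m))
               (RationalProperties.*-mono-≤ (0≤∣p∣ (inv (seq x m))) (0≤∣p∣ (inv (seq x n))) (inv-bound hm) (inv-bound hn)) ⟩
        C * ∣ seq x n - seq x m ∣
          <⟨ *-monoˡ-<′ C (*-pos (inv-pos 0<δ) (inv-pos 0<δ)) lt ⟩
        C * (ε * (δ * δ))
          ≡⟨ S.solve 3 (λ e d i → i :* i :* (e :* (d :* d)) := (d :* i) :* (d :* i) :* e) refl ε δ (inv δ) ⟩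
        (δ * inv δ) * (δ * inv δ) * ε
          ≡⟨ cong (λ u → u * u * ε) (*-inv (>⇒≢0 0<δ)) ⟩
        1ℚ * 1ℚ * ε
          ≡⟨ *-identityˡ ε ⟩
        ε ∎

-- Division and factorisation of polynomials in a linear operator

module Polynomials where

  open import Data.Unit.Base using (⊤; tt)
  open import Data.Vec.Base using (Vec; []; _∷_)
  open RealProperties

  module R = LinearAlgebraProperties ℝ-commutativeRing
  open ℝ-Solver using (solve; _:=_; _:+_; _:*_; _:-_; :-_; con)

  module _ {I : Set} where

    infix 4 _≋_
    _≋_ : (I → ℝ) → (I → ℝ) → Set
    u ≋ v = ∀ i → u i ≈ℝ v i

  record Linear {I : Set} (T : (I → ℝ) → (I → ℝ)) : Set where
    field
      T-cong : ∀ {u v} → u ≋ v → T u ≋ T v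
      T-+    : ∀ u v → T (λ i → u i +ℝ v i) ≋ λ i → T u i +ℝ T v i
      T-·    : ∀ c u → T (λ i → c *ℝ u i) ≋ λ i → c *ℝ T u i

    T-combination : ∀ {v} u c w → v ≋ (λ i → u i +ℝ c *ℝ w i) → T v ≋ λ i → T u i +ℝ c *ℝ T w i
    T-combination u c w eq i = R.trans (T-cong eq i) (R.trans (T-+ u (λ i → c *ℝ w i) i) (R.+-congˡ (T-· c w i)))

    T-0 : ∀ {u} → u ≋ (λ _ → 0ℝ) → T u ≋ λ _ → 0ℝ
    T-0 {u} u≋0 i = R.trans
      (T-cong (λ j → R.trans (u≋0 j) (R.sym (R.zeroˡ (u j)))) i) (R.trans (T-· 0ℝ u i) (R.zeroˡ (T u i)))

  -- A coefficient vector lists a polynomial from its leading coefficient down, and is evaluated by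
  -- Horner's rule at a linear operator T applied to a vector e.  Evaluation at a scalar x is the
  -- special case of multiplication by x on the one-dimensional space.
  module Horner {I : Set} (T : (I → ℝ) → (I → ℝ)) (e : I → ℝ) where

    eval : ∀ {d} → Vec ℝ d → (I → ℝ) → (I → ℝ)
    eval []       u = u
    eval (c ∷ cs) u = eval cs (λ i → T u i +ℝ c *ℝ e i)

    infixl 6 T-_$_
    T-_$_ : ℝ → (I → ℝ) → (I → ℝ)
    (T- x $ u) i = T u i +ℝ -ℝ (x *ℝ u i)

    ∏ : ∀ {d} → (Fin d → ℝ) → (I → ℝ)
    ∏ {zero}  xs = e
    ∏ {suc d} xs = T- xs zero $ ∏ (xs ∘ suc)

  scale : ℝ → (⊤ → ℝ) → (⊤ → ℝ)
  scale x u _ = x *ℝ u tt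

  scale-linear : ∀ x → Linear (scale x)
  scale-linear x = record
    { T-cong = λ eq _ → *-cong ≈-refl (eq tt)
    ; T-+    = λ u v _ → R.distribˡ x (u tt) (v tt)
    ; T-·    = λ c u _ → R.x*yz≈y*xz x c (u tt)
    }

  module At x = Horner (scale x) (λ _ → 1ℝ)

  evalAt : ∀ {d} → ℝ → Vec ℝ d → ℝ → ℝ
  evalAt x cs b = At.eval x cs (λ _ → b) tt

  ∏At : ∀ {d} → ℝ → (Fin d → ℝ) → ℝ
  ∏At x xs = At.∏ x xs tt

  -- Synthetic division by X - x: the coefficients of the quotient are the intermediate values of
  -- Horner's scheme at x, and b is the value reached so far.
  quotient : ∀ {d} → ℝ → Vec ℝ d → ℝ → Vec ℝ d
  quotient x []       b = []
  quotient x (c ∷ cs) b = b ∷ quotient x cs (x *ℝ b +ℝ c *ℝ 1ℝ)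

  Apart : ∀ {d} → (Fin d → ℝ) → Set
  Apart xs = ∀ {i j} → i ≢ j → xs i +ℝ -ℝ xs j #0

  module _ {I : Set} {T : (I → ℝ) → (I → ℝ)} (T-linear : Linear T) (e : I → ℝ) where
    open Linear T-linear
    open Horner T e

    eval-cong : ∀ {d} (cs : Vec ℝ d) {u v} → u ≋ v → eval cs u ≋ eval cs v
    eval-cong []       eq = eq
    eval-cong (c ∷ cs) eq = eval-cong cs λ i → R.+-congʳ (T-cong eq i)

    T--cong : ∀ x {u v} → u ≋ v → T- x $ u ≋ T- x $ v
    T--cong x eq i = R.+-cong (T-cong eq i) (-ℝ‿cong (R.*-congˡ (eq i)))

    -- The invariant u = (T - x)q + be survives a step of Horner's rule, since T u + ce = (T - x)(T
    -- q + be) + (xb + c)e. The operator and the scalar evaluation thus run side by side, and the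
    -- remainder is the value at x.
    division : ∀ {d} x (cs : Vec ℝ d) b q {u} → u ≋ (λ i → (T- x $ q) i +ℝ b *ℝ e i) →
      eval cs u ≋ λ i → (T- x $ eval (quotient x cs b) q) i +ℝ evalAt x cs b *ℝ e i
    division x []       b q eq = eq
    division x (c ∷ cs) b q {u} eq = division x cs (x *ℝ b +ℝ c *ℝ 1ℝ) (λ i → T q i +ℝ b *ℝ e i) step
      where
      step : (λ i → T u i +ℝ c *ℝ e i) ≋
             λ i → (T- x $ (λ i → T q i +ℝ b *ℝ e i)) i +ℝ (x *ℝ b +ℝ c *ℝ 1ℝ) *ℝ e i
      step i = R.begin
        T u i +ℝ c *ℝ e i
          R.≈⟨ R.+-congʳ (R.trans (T-combination (T- x $ q) b e eq i)
                 (R.+-congʳ (T-combination (T q) (-ℝ x) q (λ j → R.+-congˡ (neg x (q j))) i))) ⟩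
        T (T q) i +ℝ -ℝ x *ℝ T q i +ℝ b *ℝ T e i +ℝ c *ℝ e i
          R.≈⟨ solve 7 (λ ttq x tq b te c e → ttq :+ :- x :* tq :+ b :* te :+ c :* e
                 := (ttq :+ b :* te) :- x :* (tq :+ b :* e) :+ (x :* b :+ c :* con 1ℚ) :* e) ≈-refl
                 (T (T q) i) x (T q i) b (T e i) c (e i) ⟩
        (T (T q) i +ℝ b *ℝ T e i) +ℝ -ℝ (x *ℝ (T q i +ℝ b *ℝ e i)) +ℝ (x *ℝ b +ℝ c *ℝ 1ℝ) *ℝ e i
          R.≈⟨ R.+-congʳ (R.+-congʳ (T-combination (T q) b e (λ _ → ≈-refl) i)) ⟨
        T (λ i → T q i +ℝ b *ℝ e i) i +ℝ -ℝ (x *ℝ (T q i +ℝ b *ℝ e i)) +ℝ (x *ℝ b +ℝ c *ℝ 1ℝ) *ℝ e i R.∎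
        where
        neg : ∀ x y → -ℝ (x *ℝ y) ≈ℝ -ℝ x *ℝ y
        neg = solve 2 (λ x y → :- (x :* y) := :- x :* y) ≈-refl

    -- The leading coefficient 1 of the dividend is not listed in c ∷ cs.
    monic-division : ∀ {d} x c (cs : Vec ℝ d) →
      eval (c ∷ cs) e ≋ λ i → (T- x $ eval (quotient x cs (x *ℝ 1ℝ +ℝ c *ℝ 1ℝ)) e) i +ℝ evalAt x (c ∷ cs) 1ℝ *ℝ e i
    monic-division x c cs i = R.trans
      (division x (c ∷ cs) 1ℝ (λ _ → 0ℝ) start i)
      (R.+-congʳ (T--cong x (eval-cong (quotient x cs (x *ℝ 1ℝ +ℝ c *ℝ 1ℝ)) first) i))
      where
      start : e ≋ λ i → (T- x $ (λ _ → 0ℝ)) i +ℝ 1ℝ *ℝ e i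
      start i = R.trans (solve 2 (λ x e → e := con 0ℚ :- x :* con 0ℚ :+ con 1ℚ :* e) ≈-refl x (e i))
        (R.+-congʳ (R.+-congʳ (R.sym (T-0 (λ _ → ≈-refl) i))))
      first : (λ i → T (λ _ → 0ℝ) i +ℝ 1ℝ *ℝ e i) ≋ e
      first i = R.trans (R.+-congʳ (T-0 (λ _ → ≈-refl) i))
        (solve 1 (λ e → con 0ℚ :+ con 1ℚ :* e := e) ≈-refl (e i))

  cancel-factor : ∀ {x y} → x #0 → x *ℝ y ≈ℝ 0ℝ → y ≈ℝ 0ℝ
  cancel-factor {x} {y} x#0 xy≈0 = tight λ y#0 → #0⇒≉0 (#0-* x#0 y#0) xy≈0

  quotient-root : ∀ {d} x y c (cs : Vec ℝ d) → x +ℝ -ℝ y #0 →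
    evalAt y (c ∷ cs) 1ℝ ≈ℝ 0ℝ → evalAt x (c ∷ cs) 1ℝ ≈ℝ 0ℝ →
    evalAt x (quotient y cs (y *ℝ 1ℝ +ℝ c *ℝ 1ℝ)) 1ℝ ≈ℝ 0ℝ
  quotient-root x y c cs x#y fy≈0 fx≈0 = cancel-factor x#y (R.begin
    (x +ℝ -ℝ y) *ℝ q                           R.≈⟨ solve 3 (λ x y q → (x :- y) :* q := x :* q :- y :* q :+ con 0ℚ :* con 1ℚ) ≈-refl x y q ⟩
    x *ℝ q +ℝ -ℝ (y *ℝ q) +ℝ 0ℝ *ℝ 1ℝ          R.≈⟨ R.+-congˡ (R.*-congʳ fy≈0) ⟨
    x *ℝ q +ℝ -ℝ (y *ℝ q) +ℝ evalAt y (c ∷ cs) 1ℝ *ℝ 1ℝ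
                                               R.≈⟨ monic-division (scale-linear x) (λ _ → 1ℝ) y c cs tt ⟨
    evalAt x (c ∷ cs) 1ℝ                       R.≈⟨ fx≈0 ⟩
    0ℝ                                         R.∎)
    where q = evalAt x (quotient y cs (y *ℝ 1ℝ +ℝ c *ℝ 1ℝ)) 1ℝ

  -- Roots are split off one at a time; a later root is apart from the earlier one, so it can be
  -- cancelled into the quotient. There are as many roots as the degree, which leaves the quotient
  -- 1. With T a scalar this yields the signs of a polynomial, with T = H the annihilation of a
  -- vector.
  factor : ∀ {I : Set} {T : (I → ℝ) → (I → ℝ)} (T-linear : Linear T) (e : I → ℝ) →
    ∀ {d} (cs : Vec ℝ d) (xs : Fin d → ℝ) → Apart xs → (∀ i → evalAt (xs i) cs 1ℝ ≈ℝ 0ℝ) →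
    Horner.eval T e cs e ≋ Horner.∏ T e xs
  factor T-linear e []       xs apart roots i = ≈-refl
  factor {T = T} T-linear e (c ∷ cs) xs apart roots i = R.begin
    Horner.eval T e (c ∷ cs) e i
      R.≈⟨ monic-division T-linear e x c cs i ⟩
    (T- x $ eval q e) i +ℝ evalAt x (c ∷ cs) 1ℝ *ℝ e i
      R.≈⟨ R.+-cong (T--cong T-linear e x (factor T-linear e q (xs ∘ suc) (λ i≢j → apart (i≢j ∘ suc-injective))
             (λ j → quotient-root (xs (suc j)) x c cs (apart {suc j} {zero} λ ()) (roots zero) (roots (suc j)))) i)
           (R.trans (R.*-congʳ (roots zero)) (R.zeroˡ (e i))) ⟩
    (T- x $ ∏ (xs ∘ suc)) i +ℝ 0ℝ
      R.≈⟨ R.+-identityʳ _ ⟩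
    (T- x $ ∏ (xs ∘ suc)) i R.∎
    where
    open Horner T e
    open import Data.Fin.Properties using (suc-injective)
    x = xs zero
    q = quotient x cs (x *ℝ 1ℝ +ℝ c *ℝ 1ℝ)

-- Polynomials defined by a three-term recurrence

module ThreeTerm (α β : ℕ → ℚ) where

  open import Data.Rational.Base using () renaming (_+_ to _⊹_; _*_ to _·_; _-_ to _∸_; -_ to ⊖_)
  open import Data.Unit.Base using (tt)
  open import Data.Vec.Base using (Vec; []; _∷_; _∷ʳ_; zipWith; head; tail)
  open RealProperties
  open Polynomials
  open ℝ-Solver using (solve; _:=_; _:+_; _:*_; _:-_; :-_; con)

  module Sequence {I : Set} (T : (I → ℝ) → (I → ℝ)) (e : I → ℝ) where

    S : ℕ → I → ℝ
    S zero          _ = 0ℝ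
    S (suc zero)      = e
    S (suc (suc k)) i =
      (T (S (suc k)) i +ℝ -ℝ (ℚ→ℝ (α (suc k)) *ℝ S (suc k) i)) +ℝ -ℝ (ℚ→ℝ (β (suc k)) *ℝ S k i)

  P : ℝ → ℕ → ℝ
  P x k = Sequence.S (scale x) (λ _ → 1ℝ) k tt

  P-cong : ∀ {x y} → x ≈ℝ y → ∀ k → P x k ≈ℝ P y k
  P-cong eq zero          = ≈-refl
  P-cong eq (suc zero)    = ≈-refl
  P-cong eq (suc (suc k)) = +-cong
    (+-cong (*-cong eq (P-cong eq (suc k))) (-ℝ‿cong (R.*-congˡ (P-cong eq (suc k)))))
    (-ℝ‿cong (R.*-congˡ (P-cong eq k)))

  -- By `seq-P` the n-th approximation of `P x k` is the rational value at the n-th approximation of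
  -- x, which is what lets a bisection decide signs.
  Pℚ : ℚ → ℕ → ℚ
  Pℚ x zero          = 0ℚ
  Pℚ x (suc zero)    = 1ℚ
  Pℚ x (suc (suc k)) = (x · Pℚ x (suc k) ∸ α (suc k) · Pℚ x (suc k)) ∸ β (suc k) · Pℚ x k

  seq-P : ∀ x k n → seq (P x k) n ≡ Pℚ (seq x n) k
  seq-P x zero          n = ≡.refl
  seq-P x (suc zero)    n = ≡.refl
  seq-P x (suc (suc k)) n = cong₂ (λ p q → (seq x n · p ∸ α (suc k) · p) ∸ β (suc k) · q)
    (seq-P x (suc k) n) (seq-P x k n)

  plus : ∀ {d} → ℝ → Vec ℝ d → Vec ℝ d → Vec ℝ d
  plus c = zipWith λ a b → a +ℝ c *ℝ b

  -- Leading coefficients come first: appending `0ℝ` multiplies by the variable, whereas prepending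
  -- `0ℝ` merely pads to equal length.
  coefficients : ∀ k → Vec ℝ k
  coefficients zero          = []
  coefficients (suc zero)    = 1ℝ ∷ []
  coefficients (suc (suc k)) =
    plus (-ℝ (ℚ→ℝ (β (suc k))))
      (plus (-ℝ (ℚ→ℝ (α (suc k)))) (coefficients (suc k) ∷ʳ 0ℝ) (0ℝ ∷ coefficients (suc k)))
      (0ℝ ∷ 0ℝ ∷ coefficients k)

  module _ {I : Set} {T : (I → ℝ) → (I → ℝ)} (T-linear : Linear T) (e : I → ℝ) where
    open Linear T-linear
    open Horner T e
    open Sequence T e

    eval-plus : ∀ {d} c (p q : Vec ℝ d) {u v w} → w ≋ (λ i → u i +ℝ c *ℝ v i) →
      eval (plus c p q) w ≋ λ i → eval p u i +ℝ c *ℝ eval q v i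
    eval-plus c []      []      eq = eq
    eval-plus c (a ∷ p) (b ∷ q) {u} {v} {w} eq = eval-plus c p q λ i →
      R.trans (R.+-congʳ (T-combination u c v eq i))
        (solve 6 (λ tu c tv a b e → tu :+ c :* tv :+ (a :+ c :* b) :* e
                                  := (tu :+ a :* e) :+ c :* (tv :+ b :* e)) ≈-refl (T u i) c (T v i) a b (e i))

    eval-snoc : ∀ {d} (p : Vec ℝ d) u → eval (p ∷ʳ 0ℝ) u ≋ T (eval p u)
    eval-snoc []      u i = solve 2 (λ t e → t :+ con 0ℚ :* e := t) ≈-refl (T u i) (e i)
    eval-snoc (c ∷ p) u i = eval-snoc p _ i

    T0+0e : (λ i → T (λ _ → 0ℝ) i +ℝ 0ℝ *ℝ e i) ≋ λ _ → 0ℝ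
    T0+0e i = R.trans (R.+-cong (T-0 (λ _ → ≈-refl) i) (R.zeroˡ (e i))) (R.+-identityˡ 0ℝ)

    eval-coefficients : ∀ k → eval (coefficients k) (λ _ → 0ℝ) ≋ S k
    eval-coefficients zero       i = ≈-refl
    eval-coefficients (suc zero) i = R.trans (R.+-congʳ (T-0 (λ _ → ≈-refl) i))
      (solve 1 (λ e → con 0ℚ :+ con 1ℚ :* e := e) ≈-refl (e i))
    eval-coefficients (suc (suc k)) i = R.begin
      eval (coefficients (suc (suc k))) 0s i
        R.≈⟨ eval-plus b (plus a (p ∷ʳ 0ℝ) (0ℝ ∷ p)) (0ℝ ∷ 0ℝ ∷ q) (λ _ → zeros b) i ⟩
      eval (plus a (p ∷ʳ 0ℝ) (0ℝ ∷ p)) 0s i +ℝ b *ℝ eval (0ℝ ∷ 0ℝ ∷ q) 0s i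
        R.≈⟨ R.+-cong (eval-plus a (p ∷ʳ 0ℝ) (0ℝ ∷ p) (λ _ → zeros a) i)
               (R.*-congˡ (eval-cong T-linear e q (λ j → R.trans (R.+-congʳ (T-cong T0+0e j)) (T0+0e j)) i)) ⟩
      eval (p ∷ʳ 0ℝ) 0s i +ℝ a *ℝ eval (0ℝ ∷ p) 0s i +ℝ b *ℝ eval q 0s i
        R.≈⟨ R.+-cong (R.+-cong
               (R.trans (eval-snoc p 0s i) (T-cong (eval-coefficients (suc k)) i))
               (R.*-congˡ (R.trans (eval-cong T-linear e p T0+0e i) (eval-coefficients (suc k) i))))
               (R.*-congˡ (eval-coefficients k i)) ⟩
      T (S (suc k)) i +ℝ a *ℝ S (suc k) i +ℝ b *ℝ S k i
        R.≈⟨ solve 5 (λ t a x b y → t :+ :- a :* x :+ :- b :* y := (t :- a :* x) :- b :* y) ≈-refl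
               (T (S (suc k)) i) (ℚ→ℝ (α (suc k))) (S (suc k) i) (ℚ→ℝ (β (suc k))) (S k i) ⟩
      S (suc (suc k)) i R.∎
      where
      0s : I → ℝ
      0s _ = 0ℝ
      a = -ℝ (ℚ→ℝ (α (suc k)))
      b = -ℝ (ℚ→ℝ (β (suc k)))
      p = coefficients (suc k)
      q = coefficients k
      zeros : ∀ c → 0ℝ ≈ℝ 0ℝ +ℝ c *ℝ 0ℝ
      zeros = solve 1 (λ c → con 0ℚ := con 0ℚ :+ c :* con 0ℚ) ≈-refl

  lead : ∀ k → head (coefficients (suc k)) ≈ℝ 1ℝ
  lead zero    = ≈-refl
  lead (suc k) = R.trans (lead′ (coefficients (suc k)) (0ℝ ∷ coefficients k) _ _) (lead k)
    where
    lead′ : ∀ {d} (p r : Vec ℝ (suc d)) a b →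
      head (plus b (plus a (p ∷ʳ 0ℝ) (0ℝ ∷ p)) (0ℝ ∷ r)) ≈ℝ head p
    lead′ (c ∷ p) r a b = solve 3 (λ c a b → c :+ a :* con 0ℚ :+ b :* con 0ℚ := c) ≈-refl c a b

  monic : ∀ k → Vec ℝ k
  monic k = tail (coefficients (suc k))

  eval-monic : ∀ {I : Set} {T : (I → ℝ) → (I → ℝ)} (T-linear : Linear T) (e : I → ℝ) k →
    Horner.eval T e (monic k) e ≋ Sequence.S T e (suc k)
  eval-monic {T = T} T-linear e k i = R.trans (split (coefficients (suc k)) (lead k)) (eval-coefficients T-linear e (suc k) i)
    where
    open Linear T-linear
    open Horner T e
    split : ∀ {d} (p : Vec ℝ (suc d)) → head p ≈ℝ 1ℝ → eval (tail p) e i ≈ℝ eval p (λ _ → 0ℝ) i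
    split (c ∷ p) c≈1 = eval-cong T-linear e p (λ j → R.sym (R.trans
      (R.+-cong (T-0 (λ _ → ≈-refl) j) (R.*-congʳ c≈1))
      (solve 1 (λ e → con 0ℚ :+ con 1ℚ :* e := e) ≈-refl (e j)))) i

  P-factor : ∀ {I : Set} {T : (I → ℝ) → (I → ℝ)} (T-linear : Linear T) (e : I → ℝ) {d} (xs : Fin d → ℝ) →
    Apart xs → (∀ i → P (xs i) (suc d) ≈ℝ 0ℝ) → Sequence.S T e (suc d) ≋ Horner.∏ T e xs
  P-factor T-linear e {d} xs apart roots i = R.trans (R.sym (eval-monic T-linear e d i))
    (factor T-linear e (monic d) xs apart
      (λ j → R.trans (eval-monic (scale-linear (xs j)) (λ _ → 1ℝ) d tt) (roots j)) i)

-- Constructive intermediate value theorem by bisection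

module IntermediateValue where

  open import Data.Rational.Base
  open import Data.Rational.Properties
  open RationalProperties
  open RealProperties
  open ℚ.+-*-Solver using (solve; _:=_; _:+_; _:*_; _:-_; :-_; con)

  -- Roots are kept with nested rational brackets, whose ends serve as starting points of later bisections.
  record Cut : Set where
    field
      lower upper   : ℝ
      lower≈upper   : lower ≈ℝ upper
      lower≤upper   : ∀ n → seq lower n ≤ seq upper n
      lower-mono    : ∀ {m n} → m ℕ.≤ n → seq lower m ≤ seq lower n
      upper-anti    : ∀ {m n} → m ℕ.≤ n → seq upper n ≤ seq upper m

  open Cut

  constant : ℚ → Cut
  constant q = record
    { lower = ℚ→ℝ q ; upper = ℚ→ℝ q ; lower≈upper = ≈-refl ; lower≤upper = λ _ → ≤-refl
    ; lower-mono = λ _ → ≤-refl ; upper-anti = λ _ → ≤-refl }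

  -- What the bisection needs from a function. It acts termwise through a rational map, whose signs
  -- are decidable; and `separates` upgrades the weak order of a root relative to the end points,
  -- all that nested brackets give, to the strict one.
  record RationalFunction : Set where
    field
      fun     : ℝ → ℝ
      funℚ    : ℚ → ℚ
      seq-fun : ∀ x n → seq (fun x) n ≡ funℚ (seq x n)
      fun-cong : ∀ {x y} → x ≈ℝ y → fun x ≈ℝ fun y
      separates : ∀ {x y} → fun x +ℝ -ℝ fun y #0 → x +ℝ -ℝ y #0

  open RationalFunction

  negate : RationalFunction → RationalFunction
  negate f = record
    { fun = λ x → -ℝ fun f x
    ; funℚ = λ q → - funℚ f q
    ; seq-fun = λ x n → cong -_ (seq-fun f x n)
    ; fun-cong = λ eq → -ℝ‿cong (fun-cong f eq)
    ; separates = λ {x} {y} h → separates f (#0-cong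
        (R.solve 2 (λ a b → R.:- (R.:- a R.:- R.:- b) R.:= a R.:- b) ≈-refl (fun f x) (fun f y)) (#0-neg h))
    }
    where module R = ℝ-Solver

  module Bisection (φ : ℚ → ℚ) {l u : ℚ} (l<u : l < u) (φl≤0 : φ l ≤ 0ℚ) (0<φu : 0ℚ < φ u) where

    record Bracket : Set where
      constructor bracket
      field
        left right : ℚ
        left<right : left < right
        φ-left     : φ left ≤ 0ℚ
        φ-right    : 0ℚ < φ right
    open Bracket

    width : Bracket → ℚ
    width b = right b - left b

    mid : Bracket → ℚ
    mid b = ½ * (left b + right b)

    left-half : ∀ b → mid b - left b ≡ ½ * width b
    left-half b = solve 2 (λ l r → con ½ :* (l :+ r) :- l := con ½ :* (r :- l)) refl (left b) (right b)

    right-half : ∀ b → right b - mid b ≡ ½ * width b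
    right-half b = solve 2 (λ l r → r :- con ½ :* (l :+ r) := con ½ :* (r :- l)) refl (left b) (right b)

    0<½width : ∀ b → 0ℚ < ½ * width b
    0<½width b = half-pos (<⇒0<- (left<right b))

    Refines : Bracket → Bracket → Set
    Refines b b′ = left b ≤ left b′ × right b′ ≤ right b × width b′ ≡ ½ * width b

    abstract
      refine : ∀ b → Σ Bracket (Refines b)
      refine b = go (0ℚ <? φ (mid b))
        where
        go : Dec (0ℚ < φ (mid b)) → Σ Bracket (Refines b)
        go (yes 0<φm) = bracket (left b) (mid b) (<-by (0<½width b) (left-half b)) (φ-left b) 0<φm
                      , ≤-refl , ≤-by (<⇒≤ (0<½width b)) (right-half b) , left-half b
        go (no ≮)     = bracket (mid b) (right b) (<-by (0<½width b) (right-half b)) (≮⇒≥ ≮) (φ-right b)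
                      , ≤-by (<⇒≤ (0<½width b)) (left-half b) , ≤-refl , right-half b

    iterate : ℕ → Bracket
    iterate zero    = bracket l u l<u φl≤0 0<φu
    iterate (suc n) = proj₁ (refine (iterate n))

    L U : ℕ → ℚ
    L n = left (iterate n)
    U n = right (iterate n)

    iterate-width : ∀ n → width (iterate n) ≡ (u - l) * ½^ n
    iterate-width zero    = sym (*-identityʳ (u - l))
    iterate-width (suc n) = trans (proj₂ (proj₂ (proj₂ (refine (iterate n))))) (trans (cong (½ *_) (iterate-width n))
      (solve 2 (λ w h → con ½ :* (w :* h) := w :* (con ½ :* h)) refl (u - l) (½^ n)))

    L≤U : ∀ n → L n ≤ U n
    L≤U n = <⇒≤ (left<right (iterate n))

    L-mono′ : ∀ m k → L m ≤ L (k ℕ.+ m)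
    L-mono′ m zero    = ≤-refl
    L-mono′ m (suc k) = ≤-trans (L-mono′ m k) (proj₁ (proj₂ (refine (iterate (k ℕ.+ m)))))

    U-anti′ : ∀ m k → U (k ℕ.+ m) ≤ U m
    U-anti′ m zero    = ≤-refl
    U-anti′ m (suc k) = ≤-trans (proj₁ (proj₂ (proj₂ (refine (iterate (k ℕ.+ m)))))) (U-anti′ m k)

    L-mono : ∀ {m n} → m ℕ.≤ n → L m ≤ L n
    L-mono {m} {n} m≤n = subst (λ z → L m ≤ L z) (ℕ.m∸n+n≡m m≤n) (L-mono′ m (n ℕ.∸ m))

    U-anti : ∀ {m n} → m ℕ.≤ n → U n ≤ U m
    U-anti {m} {n} m≤n = subst (λ z → U z ≤ U m) (ℕ.m∸n+n≡m m≤n) (U-anti′ m (n ℕ.∸ m))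

    small : ∀ ε → 0ℚ < ε → ∃ λ N → U N - L N < ε
    small ε 0<ε = let N , h = ½^-small (u - l) ε 0<ε in
      N , subst (_< ε) (sym (iterate-width N)) (h N ℕ.≤-refl)

    within : ∀ {a b x y} → a ≤ x → x ≤ b → a ≤ y → y ≤ b → ∣ x - y ∣ ≤ b - a
    within {a} {b} {x} {y} ax xb ay yb = ∣p∣≤
      (≤-by (+-nonNeg (≤⇒0≤- xb) (≤⇒0≤- ay))
        (solve 4 (λ a b x y → (b :- a) :- (x :- y) := (b :- x) :+ (y :- a)) refl a b x y))
      (≤-by (+-nonNeg (≤⇒0≤- yb) (≤⇒0≤- ax))
        (solve 4 (λ a b x y → (b :- a) :- :- (x :- y) := (b :- y) :+ (x :- a)) refl a b x y))

    cut : Cut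
    cut = record
      { lower = mkℝ L λ ε 0<ε → let N , lt = small ε 0<ε in N , λ m n p q → ≤-<-trans
          (within (L-mono p) (≤-trans (L≤U m) (U-anti p)) (L-mono q) (≤-trans (L≤U n) (U-anti q))) lt
      ; upper = mkℝ U λ ε 0<ε → let N , lt = small ε 0<ε in N , λ m n p q → ≤-<-trans
          (within (≤-trans (L-mono p) (L≤U m)) (U-anti p) (≤-trans (L-mono q) (L≤U n)) (U-anti q)) lt
      ; lower≈upper = mk≈ λ ε 0<ε → let N , lt = small ε 0<ε in N , λ n p → ≤-<-trans
          (within (L-mono p) (≤-trans (L≤U n) (U-anti p)) (≤-trans (L-mono p) (L≤U n)) (U-anti p)) lt
      ; lower≤upper = L≤U
      ; lower-mono = L-mono
      ; upper-anti = U-anti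
      }

    φ-L : ∀ n → φ (L n) ≤ 0ℚ
    φ-L n = φ-left (iterate n)

    φ-U : ∀ n → 0ℚ < φ (U n)
    φ-U n = φ-right (iterate n)

  intermediate-value : (f : RationalFunction) (X Y : Cut) → Pos (lower X +ℝ -ℝ lower Y) →
    Pos (fun f (lower X)) → Pos (-ℝ fun f (lower Y)) →
    Σ Cut λ Z → fun f (lower Z) ≈ℝ 0ℝ × Pos (lower X +ℝ -ℝ lower Z) × Pos (lower Z +ℝ -ℝ lower Y)
  intermediate-value f X Y X>Y fX>0 fY<0 =
    B.cut , root , strict X (B.cut) X-Z≥0 (apart-X) , strict B.cut Y Z-Y≥0 apart-Y
    where
    φ = funℚ f
    X>Y′ : Pos (lower X +ℝ -ℝ upper Y)
    X>Y′ = Pos-cong (+-cong ≈-refl (-ℝ‿cong (lower≈upper Y))) X>Y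
    fY<0′ : Pos (-ℝ fun f (upper Y))
    fY<0′ = Pos-cong (-ℝ‿cong (fun-cong f (lower≈upper Y))) fY<0
    positive-term : ∀ {x} → Pos x → Ev λ n → 0ℚ < seq x n
    positive-term (mkPos δ 0<δ h) = Ev-map (λ n → <-≤-trans 0<δ) h
    start : Ev λ n → (0ℚ < φ (seq (lower X) n)) × (φ (seq (upper Y) n) ≤ 0ℚ) × (seq (upper Y) n < seq (lower X) n)
    start = Ev-zip (λ n p q → p , q)
      (Ev-map (λ n → subst (0ℚ <_) (seq-fun f (lower X) n)) (positive-term fX>0))
      (Ev-zip (λ n p q → p , q)
        (Ev-map (λ n p → subst₂ _≤_ (solve 1 (λ x → :- (:- x) := x) refl (φ (seq (upper Y) n))) refl
            (neg-antimono-≤ (subst (λ z → 0ℚ ≤ - z) (seq-fun f (upper Y) n) (<⇒≤ p)))) (positive-term fY<0′))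
        (Ev-map (λ n → 0<-⇒<) (positive-term X>Y′)))
    -- At a late enough index the rational approximations of the end points already show both signs
    -- and their order, so they can start the bisection.
    N = proj₁ start
    at-N = proj₂ start N ℕ.≤-refl
    module B = Bisection φ (proj₂ (proj₂ at-N)) (proj₁ (proj₂ at-N)) (proj₁ at-N)
    -- From φ(L) ≤ 0 < φ(U) follows |φ(L)| ≤ |φ(L) - φ(U)|, and the right side tends to 0 because
    -- both ends converge to the same real.
    root : fun f (lower B.cut) ≈ℝ 0ℝ
    root = small⇒≈0 (Null-dominated (Ev-all bound)
      (≈⇒null (fun-cong f (lower≈upper B.cut))))
      where
      bound : ∀ n → ∣ seq (fun f (lower B.cut)) n ∣ ≤ ∣ seq (fun f (lower B.cut)) n - seq (fun f (upper B.cut)) n ∣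
      bound n = subst₂ (λ a b → ∣ a ∣ ≤ ∣ a - b ∣) (sym (seq-fun f (lower B.cut) n)) (sym (seq-fun f (upper B.cut) n))
        (∣p∣≤ (≤-trans (B.φ-L n) (0≤∣p∣ _))
          (≤-trans (≤-by (<⇒≤ (B.φ-U n)) (solve 2 (λ a b → :- (a :- b) :- :- a := b) refl (φ (B.L n)) (φ (B.U n))))
            (-p≤∣p∣ (φ (B.L n) - φ (B.U n)))))
    strict : ∀ X Y → Ev (λ n → seq (lower Y) n ≤ seq (lower X) n) → lower X +ℝ -ℝ lower Y #0 → Pos (lower X +ℝ -ℝ lower Y)
    strict X Y h (inj₁ p) = p
    strict X Y h (inj₂ (mkPos δ 0<δ k)) = contradiction (Ev-const (λ _ lt → lt) (Ev-zip
      (λ n p q → <-≤-trans 0<δ (≤-trans q (neg-antimono-≤ (≤⇒0≤- p)))) h k)) (<-irrefl refl)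
    X-Z≥0 : Ev λ n → B.L n ≤ seq (lower X) n
    X-Z≥0 = N , λ n N≤n → ≤-trans (B.L≤U n) (≤-trans (B.U-anti (ℕ.z≤n {n})) (lower-mono X N≤n))
    Z-Y≥0 : Ev λ n → seq (lower Y) n ≤ B.L n
    Z-Y≥0 = N , λ n N≤n → ≤-trans (lower≤upper Y n) (≤-trans (upper-anti Y N≤n) (B.L-mono (ℕ.z≤n {n})))
    apart-X : lower X +ℝ -ℝ lower B.cut #0
    apart-X = separates f (inj₁ (Pos-cong (≈-trans
      (ℝ-Solver.solve 1 (λ x → x ℝ-Solver.:= x ℝ-Solver.:- ℝ-Solver.con 0ℚ) ≈-refl (fun f (lower X)))
        (+-cong ≈-refl (-ℝ‿cong (≈-sym root)))) fX>0))
    apart-Y : lower B.cut +ℝ -ℝ lower Y #0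
    apart-Y = separates f (inj₁ (Pos-cong
      (≈-trans (ℝ-Solver.solve 1 (λ x → ℝ-Solver.:- x ℝ-Solver.:= ℝ-Solver.con 0ℚ ℝ-Solver.:- x) ≈-refl (fun f (lower Y)))
        (+-cong (≈-sym root) ≈-refl)) fY<0))

-- Sturm sequences: interlacing real roots

module Interlacing (α β : ℕ → ℚ) (0≤β : ∀ k → 0ℚ ℚ.≤ β k)
  (D : ℕ) (0<β : ∀ k → suc (suc k) ℕ.≤ D → 0ℚ ℚ.< β (suc (suc k))) where

  open import Data.Rational.Base using (_≤_; _<_; ∣_∣; _-_) renaming (_+_ to _⊹_; _*_ to _·_; -_ to ⊖_)
  open import Data.Unit.Base using (⊤; tt)
  open import Data.Vec.Base using (_∷_)
  open import Data.Vec.Functional as Vector using (Vector)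
  open RationalProperties
  open RealProperties
  open Polynomials
  open IntermediateValue
  open ThreeTerm α β
  open Cut using (lower)
  open RationalFunction
  open ℝ-Solver using (solve; _:=_; _:+_; _:*_; _:-_; :-_; con)
  private module S = ℚ.+-*-Solver

  -- Division by X - y gives P(x) - P(y) = Q·(x - y), and a product apart from 0 has factors apart
  -- from 0.
  P-separates : ∀ k {x y} → P x k +ℝ -ℝ P y k #0 → x +ℝ -ℝ y #0
  P-separates zero h = contradiction (R.-‿inverseʳ 0ℝ) (#0⇒≉0 h)
  P-separates (suc zero) h = contradiction (R.-‿inverseʳ 1ℝ) (#0⇒≉0 h)
  P-separates (suc (suc k)) {x} {y} h = #0-cancelˡ (#0-cong (difference (monic (suc k)) ≡.refl) h)
    where
    evalP : ∀ z → evalAt z (monic (suc k)) 1ℝ ≈ℝ P z (suc (suc k))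
    evalP z = eval-monic (scale-linear z) (λ _ → 1ℝ) (suc k) tt
    q : Data.Vec.Base.Vec ℝ (suc k) → ℝ
    q (c ∷ cs) = evalAt x (quotient y cs (y *ℝ 1ℝ +ℝ c *ℝ 1ℝ)) 1ℝ
    difference : ∀ cs → cs ≡ monic (suc k) → P x (suc (suc k)) +ℝ -ℝ P y (suc (suc k)) ≈ℝ q cs *ℝ (x +ℝ -ℝ y)
    difference (c ∷ cs) eq = R.begin
      P x (suc (suc k)) +ℝ -ℝ P y (suc (suc k))
        R.≈⟨ R.+-cong (evalP x) (-ℝ‿cong (evalP y)) ⟨
      evalAt x (monic (suc k)) 1ℝ +ℝ -ℝ evalAt y (monic (suc k)) 1ℝ
        R.≡⟨ cong (λ p → evalAt x p 1ℝ +ℝ -ℝ evalAt y p 1ℝ) (≡.sym eq) ⟩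
      evalAt x (c ∷ cs) 1ℝ +ℝ -ℝ evalAt y (c ∷ cs) 1ℝ
        R.≈⟨ R.+-congʳ (monic-division (scale-linear x) (λ _ → 1ℝ) y c cs tt) ⟩
      (x *ℝ Q +ℝ -ℝ (y *ℝ Q) +ℝ fy *ℝ 1ℝ) +ℝ -ℝ fy
        R.≈⟨ solve 4 (λ x y q f → (x :* q :- y :* q :+ f :* con 1ℚ) :- f := q :* (x :- y)) ≈-refl x y Q fy ⟩
      Q *ℝ (x +ℝ -ℝ y) R.∎
      where
      Q = q (c ∷ cs)
      fy = evalAt y (c ∷ cs) 1ℝ

  P-function : ℕ → RationalFunction
  P-function k = record
    { fun = λ x → P x k ; funℚ = λ q → Pℚ q k ; seq-fun = λ x n → seq-P x k n
    ; fun-cong = λ eq → P-cong eq k ; separates = P-separates k }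

  -- Alternating signs

  sg : ℕ → ℝ → ℝ
  sg zero    x = x
  sg (suc n) x = sg n (-ℝ x)

  sg-cong : ∀ n {x y} → x ≈ℝ y → sg n x ≈ℝ sg n y
  sg-cong zero    eq = eq
  sg-cong (suc n) eq = sg-cong n (-ℝ‿cong eq)

  sg-neg : ∀ n x → sg n (-ℝ x) ≈ℝ -ℝ sg n x
  sg-neg zero    x = ≈-refl
  sg-neg (suc n) x = sg-neg n (-ℝ x)

  sg-* : ∀ n c x → sg n (c *ℝ x) ≈ℝ c *ℝ sg n x
  sg-* zero    c x = ≈-refl
  sg-* (suc n) c x = R.trans (sg-cong n (solve 2 (λ c x → :- (c :* x) := c :* (:- x)) ≈-refl c x)) (sg-* n c (-ℝ x))

  sg-≈0 : ∀ n {x} → sg n x ≈ℝ 0ℝ → x ≈ℝ 0ℝ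
  sg-≈0 zero    eq = eq
  sg-≈0 (suc n) {x} eq = R.trans (solve 1 (λ x → x := :- (:- x)) ≈-refl x)
    (R.trans (-ℝ‿cong (sg-≈0 n eq)) (solve 0 (:- con 0ℚ := con 0ℚ) ≈-refl))

  signed : ℕ → RationalFunction → RationalFunction
  signed zero    f = f
  signed (suc n) f = signed n (negate f)

  fun-signed : ∀ n f x → fun (signed n f) x ≡ sg n (fun f x)
  fun-signed zero    f x = ≡.refl
  fun-signed (suc n) f x = fun-signed n (negate f) x

  infix 4 _>_
  _>_ : Cut → Cut → Set
  X > Y = Pos (lower X +ℝ -ℝ lower Y)

  >-trans : ∀ {X Y Z} → X > Y → Y > Z → X > Z
  >-trans {X} {Y} {Z} p q = Pos-cong
    (solve 3 (λ x y z → (x :- y) :+ (y :- z) := x :- z) ≈-refl (lower X) (lower Y) (lower Z)) (Pos-+ p q)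

  Chain : ∀ {d} → Cut → (Fin d → Cut) → Cut → Set
  Chain {zero}  U xs L = U > L
  Chain {suc d} U xs L = U > xs zero × Chain (xs zero) (xs ∘ suc) L

  Interlaced : ∀ {d} → Cut → (Fin (suc d) → Cut) → (Fin d → Cut) → Cut → Set
  Interlaced {zero}  U ys xs L = U > ys zero × ys zero > L
  Interlaced {suc d} U ys xs L = U > ys zero × ys zero > xs zero × Interlaced (xs zero) (ys ∘ suc) (xs ∘ suc) L

  AltSign : ∀ {d} → (ℝ → ℝ) → ℕ → (Fin d → Cut) → Set
  AltSign {zero}  g n xs = ⊤
  AltSign {suc d} g n xs = Pos (sg n (g (lower (xs zero)))) × AltSign g (suc n) (xs ∘ suc)

  AltSign-cong : ∀ {d} {f g : ℝ → ℝ} → (∀ x → f x ≈ℝ g x) → ∀ n (xs : Fin d → Cut) → AltSign f n xs → AltSign g n xs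
  AltSign-cong {zero}  eq n xs h       = tt
  AltSign-cong {suc d} eq n xs (p , h) = Pos-cong (sg-cong n (eq _)) p , AltSign-cong eq (suc n) (xs ∘ suc) h

  Chain-below : ∀ {d} U (xs : Fin d → Cut) L → Chain U xs L → ∀ i → U > xs i
  Chain-below U xs L (p , c) zero    = p
  Chain-below U xs L (p , c) (suc i) = >-trans {U} {xs zero} {xs (suc i)} p (Chain-below (xs zero) (xs ∘ suc) L c i)

  Chain-apart : ∀ {d} U (xs : Fin d → Cut) L → Chain U xs L → Apart (lower ∘ xs)
  Chain-apart U xs L (p , c) {zero}  {zero}  i≢j = contradiction ≡.refl i≢j
  Chain-apart U xs L (p , c) {zero}  {suc j} i≢j = inj₁ (Chain-below (xs zero) (xs ∘ suc) L c j)
  Chain-apart U xs L (p , c) {suc i} {zero}  i≢j = inj₂ (Pos-cong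
    (solve 2 (λ x y → x :- y := :- (y :- x)) ≈-refl (lower (xs zero)) (lower (xs (suc i))))
    (Chain-below (xs zero) (xs ∘ suc) L c i))
  Chain-apart U xs L (p , c) {suc i} {suc j} i≢j = Chain-apart (xs zero) (xs ∘ suc) L c (i≢j ∘ cong suc)

  Chain-raise : ∀ {d} X Y (zs : Fin d → Cut) L → X > Y → Chain Y zs L → Chain X zs L
  Chain-raise {zero}  X Y zs L p c       = >-trans {X} {Y} {L} p c
  Chain-raise {suc d} X Y zs L p (q , c) = >-trans {X} {Y} {zs zero} p q , c

  Interlaced⇒Chain-ys : ∀ {d} U (ys : Fin (suc d) → Cut) xs L → Interlaced U ys xs L → Chain U ys L
  Interlaced⇒Chain-ys {zero}  U ys xs L (p , q) = p , q
  Interlaced⇒Chain-ys {suc d} U ys xs L (p , q , r) =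
    p , Chain-raise (ys zero) (xs zero) (ys ∘ suc) L q (Interlaced⇒Chain-ys (xs zero) (ys ∘ suc) (xs ∘ suc) L r)

  Interlaced⇒Chain-xs : ∀ {d} U (ys : Fin (suc d) → Cut) xs L → Interlaced U ys xs L → Chain (ys zero) xs L
  Interlaced⇒Chain-xs {zero}  U ys xs L (p , q)     = q
  Interlaced⇒Chain-xs {suc d} U ys xs L (p , q , r) =
    q , Chain-raise (xs zero) (ys (suc zero)) (xs ∘ suc) L (above r) (Interlaced⇒Chain-xs (xs zero) (ys ∘ suc) (xs ∘ suc) L r)
    where
    above : ∀ {d} {xs′ : Fin d → Cut} {ys′ : Fin (suc d) → Cut} → Interlaced (xs zero) ys′ xs′ L → xs zero > ys′ zero
    above {zero}  = proj₁
    above {suc d} = proj₁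

  ∏At-pos : ∀ {d} X (xs : Fin d → Cut) L → Chain X xs L → Pos (∏At (lower X) (lower ∘ xs))
  ∏At-pos {zero}  X xs L c       = Pos-ℚ 0<1
  ∏At-pos {suc d} X xs L (p , c) = Pos-cong
    (solve 3 (λ x y p → (x :- y) :* p := x :* p :- y :* p) ≈-refl (lower X) (lower (xs zero)) (∏At (lower X) (lower ∘ xs ∘ suc)))
    (Pos-* p (∏At-pos X (xs ∘ suc) L (Chain-raise X (xs zero) (xs ∘ suc) L p c)))

  -- The prefix A collects the factors belonging to roots above U.
  ∏At-signs : ∀ {d} (A : ℝ → ℝ) n U (ys : Fin (suc d) → Cut) xs L →
    (∀ Y → U > Y → Pos (sg n (A (lower Y)))) → Interlaced U ys xs L →
    AltSign (λ y → A y *ℝ ∏At y (lower ∘ xs)) n ys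
  ∏At-signs {zero} A n U ys xs L hA (p , q) =
    Pos-cong (sg-cong n (R.sym (R.*-identityʳ _))) (hA (ys zero) p) , tt
  ∏At-signs {suc d} A n U ys xs L hA int@(p , q , r) =
    Pos-cong (R.trans (R.sym (sg-* n Π₀ (A y₀))) (sg-cong n (R.*-comm Π₀ (A y₀))))
      (Pos-* (∏At-pos (ys zero) xs L (Interlaced⇒Chain-xs U ys xs L int)) (hA (ys zero) p)) ,
    AltSign-cong (λ y → solve 4 (λ a y x p → a :* (y :- x) :* p := a :* (y :* p :- x :* p)) ≈-refl
        (A y) y x₀ (∏At y (lower ∘ xs ∘ suc))) (suc n) (ys ∘ suc)
      (∏At-signs (λ y → A y *ℝ (y +ℝ -ℝ x₀)) (suc n) (xs zero) (ys ∘ suc) (xs ∘ suc) L hA′ r)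
    where
    y₀ = lower (ys zero)
    x₀ = lower (xs zero)
    Π₀ = ∏At y₀ (lower ∘ xs)
    hA′ : ∀ Y → xs zero > Y → Pos (sg (suc n) (A (lower Y) *ℝ (lower Y +ℝ -ℝ x₀)))
    hA′ Y x₀>Y = Pos-cong
      (R.trans (R.sym (sg-* n (x₀ +ℝ -ℝ lower Y) (A (lower Y)))) (sg-cong n
        (solve 3 (λ x y a → (x :- y) :* a := :- (a :* (y :- x))) ≈-refl x₀ (lower Y) (A (lower Y)))))
      (Pos-* x₀>Y (hA Y (>-trans {U} {xs zero} {Y} (>-trans {U} {ys zero} {xs zero} p q) x₀>Y)))

  root-between : ∀ f n X Y → X > Y → Pos (sg n (fun f (lower X))) → Pos (sg (suc n) (fun f (lower Y))) →
    Σ[ Z ∈ Cut ] (fun f (lower Z) ≈ℝ 0ℝ × X > Z × Z > Y)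
  root-between f n X Y X>Y pX pY =
    let Z , fZ≈0 , X>Z , Z>Y = intermediate-value (signed n f) X Y X>Y
          (subst Pos (≡.sym (fun-signed n f (lower X))) pX)
          (subst (λ z → Pos (-ℝ z)) (≡.sym (fun-signed n f (lower Y))) (Pos-cong (sg-neg n (fun f (lower Y))) pY))
    in Z , sg-≈0 n (subst (_≈ℝ 0ℝ) (fun-signed n f (lower Z)) fZ≈0) , X>Z , Z>Y

  -- The d inner points and the two ends show d + 1 sign changes, hence d + 1 roots: one for each
  -- degree of the next polynomial. The counter n keeps the sign expected at the current upper end.
  interlace : ∀ f {d} n U (xs : Fin d → Cut) L → Chain U xs L →
    Pos (sg n (fun f (lower U))) → AltSign (fun f) (suc n) xs → Pos (sg (d ℕ.+ suc n) (fun f (lower L))) →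
    Σ[ ys ∈ (Fin (suc d) → Cut) ] ((∀ i → fun f (lower (ys i)) ≈ℝ 0ℝ) × Interlaced U ys xs L)
  interlace f {zero} n U xs L U>L pU _ pL =
    let Z , fZ≈0 , U>Z , Z>L = root-between f n U L U>L pU pL
    in (λ _ → Z) , (λ _ → fZ≈0) , U>Z , Z>L
  interlace f {suc d} n U xs L (U>x , c) pU (px , alt) pL =
    let Z , fZ≈0 , U>Z , Z>x = root-between f n U (xs zero) U>x pU px
        ys , roots , int     = interlace f (suc n) (xs zero) (xs ∘ suc) L c px alt
          (subst (λ m → Pos (sg m (fun f (lower L)))) (≡.sym (ℕ.+-suc d (suc n))) pL)
    in Z Vector.∷ ys , (λ { zero → fZ≈0 ; (suc i) → roots i }) , U>Z , Z>x , int

  -- Beyond the bound M the sequence of values is increasing, which fixes the signs at ±M.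

  growth : (α : ℕ → ℚ) (M : ℚ) → (∀ j → j ℕ.≤ D → α j ⊹ β j ⊹ 1ℚ ≤ M) → ∀ k → k ℕ.≤ D →
    ThreeTerm.Pℚ α β M k ≤ ThreeTerm.Pℚ α β M (suc k) × 0ℚ < ThreeTerm.Pℚ α β M (suc k)
  growth α M bound zero    _    = ℚ.<⇒≤ 0<1 , 0<1
  growth α M bound (suc k) k<D  = p≤q , ℚ.<-≤-trans 0<p p≤q
    where
    ih = growth α M bound k (ℕ.<⇒≤ k<D)
    p = ThreeTerm.Pℚ α β M (suc k)
    p⁻ = ThreeTerm.Pℚ α β M k
    0<p : 0ℚ < p
    0<p = proj₂ ih
    p≤q : p ≤ ThreeTerm.Pℚ α β M (suc (suc k))
    p≤q = ≤-by (+-nonNeg (*-nonNeg (≤⇒0≤- (bound (suc k) k<D)) (ℚ.<⇒≤ 0<p)) (*-nonNeg (0≤β (suc k)) (≤⇒0≤- (proj₁ ih))))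
      (S.solve 5 (λ m a b p r → ((m S.:* p S.:- a S.:* p) S.:- b S.:* r) S.:- p
         S.:= (m S.:- (a S.:+ b S.:+ S.con 1ℚ)) S.:* p S.:+ b S.:* (p S.:- r)) ≡.refl
        M (α (suc k)) (β (suc k)) p p⁻)

  alternating : ℕ → ℚ
  alternating zero    = ⊖ 1ℚ
  alternating (suc k) = ⊖ alternating k

  -- Up to sign, x ↦ -x turns the recurrence for α into that for -α. The growth argument at M,
  -- applied to -α, thereby settles the signs at -M.
  reflect : ∀ M k → ThreeTerm.Pℚ (⊖_ ∘ α) β M k ≡ alternating k · Pℚ (⊖ M) k
  reflect M zero          = ≡.refl
  reflect M (suc zero)    = ≡.refl
  reflect M (suc (suc k)) = ≡.trans
    (≡.cong₂ (λ p r → (M · p - ⊖ α (suc k) · p) - β (suc k) · r) (reflect M (suc k)) (reflect M k))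
    (S.solve 6 (λ m a b s p r → (m S.:* (S.:- s S.:* p) S.:- S.:- a S.:* (S.:- s S.:* p)) S.:- b S.:* (s S.:* r)
        S.:= S.:- (S.:- s) S.:* ((S.:- m S.:* p S.:- a S.:* p) S.:- b S.:* r)) ≡.refl
      M (α (suc k)) (β (suc k)) (alternating k) (Pℚ (⊖ M) (suc k)) (Pℚ (⊖ M) k))

  P-ℚ : ∀ q k → P (ℚ→ℝ q) k ≈ℝ ℚ→ℝ (Pℚ q k)
  P-ℚ q k = pointwise (seq-P (ℚ→ℝ q) k)

  sg-ℚ : ∀ k q → sg k (ℚ→ℝ q) ≈ℝ ℚ→ℝ (alternating (suc k) · q)
  sg-ℚ zero    q = pointwise λ _ → ≡.sym (ℚ.*-identityˡ q)
  sg-ℚ (suc k) q = R.trans (sg-cong k (pointwise λ _ → ≡.refl)) (R.trans (sg-ℚ k (⊖ q))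
    (pointwise λ _ → S.solve 2 (λ s q → S.:- s S.:* (S.:- q) S.:= S.:- (S.:- s) S.:* q) ≡.refl (alternating k) q))

  -- For M ≥ α + β + 1 the recurrence yields p₂ - p₁ = (M - α - β - 1)p₁ + β(p₁ - p₀) ≥ 0 for
  -- successive values p₀ ≤ p₁ with p₁ > 0. The absolute value makes one bound serve α and -α.
  size : ℕ → ℚ
  size j = ∣ α j ∣ ⊹ β j ⊹ 1ℚ

  0<size : ∀ j → 0ℚ < size j
  0<size j = ℚ.+-mono-≤-< (+-nonNeg (ℚ.0≤∣p∣ (α j)) (0≤β j)) 0<1

  bounds : ∀ D → ∃ λ M → 0ℚ < M × (∀ j → j ℕ.≤ D → size j ≤ M)
  bounds zero = size zero , 0<size zero , λ { zero _ → ℚ.≤-refl }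
  bounds (suc D) = let M , 0<M , h = bounds D in M ⊹ size (suc D) , +-pos 0<M (0<size (suc D)) , extend M 0<M h
    where
    extend : ∀ M → 0ℚ < M → (∀ j → j ℕ.≤ D → size j ≤ M) → ∀ j → j ℕ.≤ suc D → size j ≤ M ⊹ size (suc D)
    extend M 0<M h j j≤ with ℕ.m≤n⇒m<n∨m≡n j≤
    ... | inj₁ j<1+D  = ℚ.≤-trans (h j (ℕ.≤-pred j<1+D))
            (≤-by (ℚ.<⇒≤ (0<size (suc D))) (S.solve 2 (λ m s → (m S.:+ s) S.:- m S.:= s) ≡.refl M (size (suc D))))
    ... | inj₂ ≡.refl = ≤-by (ℚ.<⇒≤ 0<M) (S.solve 2 (λ m s → (m S.:+ s) S.:- s S.:= m) ≡.refl M (size (suc D)))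

  M : ℚ
  M = proj₁ (bounds D)

  top bottom : Cut
  top    = constant M
  bottom = constant (⊖ M)

  top-sign : ∀ k → k ℕ.≤ D → Pos (P (lower top) (suc k))
  top-sign k k≤D = Pos-cong (R.sym (P-ℚ M (suc k))) (Pos-ℚ (proj₂ (growth α M bound k k≤D)))
    where
    bound : ∀ j → j ℕ.≤ D → α j ⊹ β j ⊹ 1ℚ ≤ M
    bound j j≤D = ℚ.≤-trans (ℚ.+-monoˡ-≤ 1ℚ (ℚ.+-monoˡ-≤ (β j) (p≤∣p∣ (α j)))) (proj₂ (proj₂ (bounds D)) j j≤D)

  bottom-sign : ∀ k → k ℕ.≤ D → Pos (sg k (P (lower bottom) (suc k)))
  bottom-sign k k≤D = Pos-cong
    (R.sym (R.trans (sg-cong k (P-ℚ (⊖ M) (suc k))) (sg-ℚ k (Pℚ (⊖ M) (suc k)))))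
    (Pos-ℚ (subst (0ℚ <_) (reflect M (suc k)) (proj₂ (growth (⊖_ ∘ α) M bound k k≤D))))
    where
    bound : ∀ j → j ℕ.≤ D → ⊖ α j ⊹ β j ⊹ 1ℚ ≤ M
    bound j j≤D = ℚ.≤-trans (ℚ.+-monoˡ-≤ 1ℚ (ℚ.+-monoˡ-≤ (β j) (-p≤∣p∣ (α j)))) (proj₂ (proj₂ (bounds D)) j j≤D)

  record Roots (k : ℕ) : Set where
    field
      root    : Fin k → Cut
      is-root : ∀ i → P (lower (root i)) (suc k) ≈ℝ 0ℝ
      chain   : Chain top root bottom
      signs   : AltSign (λ x → P x k) 0 root

  private
    -- At a root of the middle polynomial the recurrence collapses to P(k+2) = -βP(k) with β > 0, so
    -- the alternation is handed on with one extra sign.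
    next-signs : ∀ k {d} (xs : Fin d → Cut) n → 0ℚ < β (suc k) → (∀ i → P (lower (xs i)) (suc k) ≈ℝ 0ℝ) →
      AltSign (λ x → P x k) n xs → AltSign (λ x → P x (suc (suc k))) (suc n) xs
    next-signs k {zero}  xs n 0<β hroots _ = tt
    next-signs k {suc d} xs n 0<β hroots (p , h) =
      Pos-cong (R.trans (R.sym (sg-* n b (P x k))) (sg-cong n (R.trans
          (solve 4 (λ b p x a → b :* p := :- ((x :* con 0ℚ :- a :* con 0ℚ) :- b :* p)) ≈-refl b (P x k) x a)
          (-ℝ‿cong (R.+-congʳ (R.sym (R.+-cong (R.*-congˡ (hroots zero)) (-ℝ‿cong (R.*-congˡ (hroots zero))))))))))
        (Pos-* (Pos-ℚ 0<β) p) ,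
      next-signs k (xs ∘ suc) (suc n) 0<β (hroots ∘ suc) h
      where
      x = lower (xs zero)
      a = ℚ→ℝ (α (suc k))
      b = ℚ→ℝ (β (suc k))

    M>-M : top > bottom
    M>-M = Pos-cong (pointwise λ _ → ≡.refl) (Pos-ℚ (subst (0ℚ <_) (S.solve 1 (λ m → m S.:+ m S.:= m S.:- S.:- m) ≡.refl M)
      (+-pos (proj₁ (proj₂ (bounds D))) (proj₁ (proj₂ (bounds D))))))

    step : ∀ k → suc k ℕ.≤ D → Roots k → Roots (suc k)
    step k k<D rs = record
      { root = ys
      ; is-root = roots
      ; chain = Interlaced⇒Chain-ys top ys xs bottom int
      -- `P y (suc k)` is the product of the differences from its roots `xs`, and passing from one
      -- entry of `ys` to the next crosses exactly one of these.
      ; signs = AltSign-cong (λ y → R.trans (R.*-identityˡ _) (R.sym (factored y))) 0 ys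
          (∏At-signs (λ _ → 1ℝ) 0 top ys xs bottom (λ _ _ → Pos-ℚ 0<1) int)
      }
      where
      open Roots rs renaming (root to xs)
      found = interlace (P-function (suc (suc k))) 0 top xs bottom chain (top-sign (suc k) k<D) (alt k k<D xs is-root signs)
        (subst (λ m → Pos (sg m (P (lower bottom) (suc (suc k))))) (ℕ.+-comm 1 k) (bottom-sign (suc k) k<D))
        where
        alt : ∀ k → suc k ℕ.≤ D → (xs : Fin k → Cut) → (∀ i → P (lower (xs i)) (suc k) ≈ℝ 0ℝ) →
          AltSign (λ x → P x k) 0 xs → AltSign (λ x → P x (suc (suc k))) 1 xs
        alt zero    _   xs _  _ = tt
        alt (suc k) k<D xs is s = next-signs (suc k) xs 0 (0<β k k<D) is s
      ys = proj₁ found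
      roots = proj₁ (proj₂ found)
      int = proj₂ (proj₂ found)
      factored : ∀ y → P y (suc k) ≈ℝ ∏At y (lower ∘ xs)
      factored y = P-factor (scale-linear y) (λ _ → 1ℝ) (lower ∘ xs) (Chain-apart top xs bottom chain) is-root tt

  all-roots : ∀ k → k ℕ.≤ D → Roots k
  all-roots zero    _   = record { root = λ () ; is-root = λ () ; chain = M>-M ; signs = tt }
  all-roots (suc k) k<D = step k k<D (all-roots k (ℕ.<⇒≤ k<D))

-- The Lanczos recurrence over the rationals

module Lanczos {n : ℕ} (H : Matrix ℚ n) (H-sym : ℚM.IsSymmetric H) (a : Fin n) where

  open import Data.Rational.Base using (_≤_; _<_) renaming (_+_ to _⊹_; _*_ to _·_; _-_ to _∸_; -_ to ⊖_)
  open RationalProperties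
  open RationalVectors

  open Q using (⟨_,_⟩; _*ᵛ_; _·ᵛ_; _+ᵛ_; basis; 0ᵛ; _≈ᵛ_)
  open ℚ.+-*-Solver using (solve; _:=_; _:+_; _:*_; _:-_; :-_; con)

  -- Indices are shifted by one: w 0 = 0 and w 1 = e_a, so that the recurrence is uniform.
  w : ℕ → Vector ℚ n
  h α : ℕ → ℚ
  β : ℕ → ℚ

  w zero          = 0ᵛ
  w (suc zero)    = basis a
  w (suc (suc k)) i = ((H *ᵛ w (suc k)) i ∸ α (suc k) · w (suc k) i) ∸ β (suc k) · w k i

  h k = ⟨ w k , w k ⟩
  α k = ⟨ w k , H *ᵛ w k ⟩ · inv (h k)

  β zero    = 0ℚ
  β (suc k) = h (suc k) · inv (h k)

  H-w : ∀ k → H *ᵛ w (suc k) ≈ᵛ (w (suc (suc k)) +ᵛ α (suc k) ·ᵛ w (suc k)) +ᵛ β (suc k) ·ᵛ w k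
  H-w k i = solve 3 (λ x y z → x := ((x :- y) :- z) :+ y :+ z) refl
    ((H *ᵛ w (suc k)) i) (α (suc k) · w (suc k) i) (β (suc k) · w k i)

  private
    combination : ∀ {p q r} c d (u v x y : Vector ℚ n) → ⟨ u , x ⟩ ≡ p → ⟨ v , x ⟩ ≡ q → ⟨ y , x ⟩ ≡ r →
      ⟨ (u +ᵛ c ·ᵛ v) +ᵛ d ·ᵛ y , x ⟩ ≡ p ⊹ c · q ⊹ d · r
    combination c d u v x y refl refl refl = trans (Q.⟨⟩-+ˡ (u +ᵛ c ·ᵛ v) (d ·ᵛ y) x)
      (cong₂ _⊹_ (trans (Q.⟨⟩-+ˡ u (c ·ᵛ v) x) (cong (⟨ u , x ⟩ ⊹_) (Q.⟨⟩-·ˡ c v x))) (Q.⟨⟩-·ˡ d y x))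

    next : ∀ {p q r} k (x : Vector ℚ n) →
      ⟨ H *ᵛ w (suc k) , x ⟩ ≡ p → ⟨ w (suc k) , x ⟩ ≡ q → ⟨ w k , x ⟩ ≡ r →
      ⟨ w (suc (suc k)) , x ⟩ ≡ (p ∸ α (suc k) · q) ∸ β (suc k) · r
    next {p} {q} {r} k x hp hq hr = begin
      y                                              ≡⟨ solve 3 (λ y a b → y := ((y :+ a :+ b) :- a) :- b) refl y A B ⟩
      ((y ⊹ A ⊹ B) ∸ A) ∸ B                          ≡⟨ cong (λ z → (z ∸ A) ∸ B) (trans (sym
           (trans (Q.⟨⟩-cong {w = x} {w′ = x} (H-w k) (λ _ → refl))
             (combination (α (suc k)) (β (suc k)) (w (suc (suc k))) (w (suc k)) x (w k) refl refl refl))) hp) ⟩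
      (p ∸ A) ∸ B                                    ≡⟨ cong₂ (λ y z → (p ∸ α (suc k) · y) ∸ β (suc k) · z) hq hr ⟩
      (p ∸ α (suc k) · q) ∸ β (suc k) · r            ∎
      where
      open ≡-Reasoning
      y = ⟨ w (suc (suc k)) , x ⟩
      A = α (suc k) · ⟨ w (suc k) , x ⟩
      B = β (suc k) · ⟨ w k , x ⟩

    swap : ∀ {r} (u v : Vector ℚ n) → ⟨ u , v ⟩ ≡ r → ⟨ v , u ⟩ ≡ r
    swap u v eq = trans (Q.⟨⟩-comm v u) eq

  NonzeroBelow : ℕ → Set
  NonzeroBelow d = ∀ {j} → j ℕ.< d → h (suc j) ≢ 0ℚ

  -- Symmetry shortens Gram-Schmidt to three terms. For i < d, moving H across turns ⟨H w(d+1),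
  -- w(i+1)⟩ into a combination of products of w(d+1) with w(i+2), w(i+1) and w(i), all of which
  -- vanish unless i + 1 = d. This case is cancelled by β, and the case i = d by α.
  orthogonal : ∀ d → NonzeroBelow d → ∀ i j → i ℕ.< j → j ℕ.≤ suc d → ⟨ w i , w j ⟩ ≡ 0ℚ
  orthogonal d nz zero j _ _ = Q.⟨⟩-0ˡ {v = w 0} {w = w j} (λ _ → refl)
  orthogonal zero nz (suc i) j i<j j≤1 = contradiction (ℕ.≤-trans i<j j≤1) λ { (s≤s ()) }
  orthogonal (suc d) nz (suc i) j i<j j≤2+d with ℕ.m≤n⇒m<n∨m≡n j≤2+d
  ... | inj₁ (s≤s j≤1+d) = orthogonal d (λ lt → nz (ℕ.m<n⇒m<1+n lt)) (suc i) j i<j j≤1+d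
  ... | inj₂ refl = swap (w (suc (suc d))) (w (suc i)) (last (ℕ.m≤n⇒m<n∨m≡n (ℕ.≤-pred (ℕ.≤-pred i<j))))
    where
    ih : ∀ i j → i ℕ.< j → j ℕ.≤ suc d → ⟨ w i , w j ⟩ ≡ 0ℚ
    ih = orthogonal d (λ lt → nz (ℕ.m<n⇒m<1+n lt))
    h-cancel : ∀ {k} → k ℕ.< suc d → ∀ x → x · inv (h (suc k)) · h (suc k) ≡ x
    h-cancel {k} lt x = trans (solve 3 (λ x i y → x :* i :* y := x :* (y :* i)) refl x (inv (h (suc k))) (h (suc k)))
      (trans (cong (x ·_) (*-inv (nz lt))) (ℚ.*-identityʳ x))
    last : i ℕ.< d ⊎ i ≡ d → ⟨ w (suc (suc d)) , w (suc i) ⟩ ≡ 0ℚ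
    last (inj₂ refl) = trans
      (next d (w (suc d)) (swap (w (suc d)) (H *ᵛ w (suc d)) refl) refl (ih d (suc d) ℕ.≤-refl ℕ.≤-refl))
      (trans (cong (λ z → (⟨ w (suc d) , H *ᵛ w (suc d) ⟩ ∸ z) ∸ β (suc d) · 0ℚ) (h-cancel ℕ.≤-refl ⟨ w (suc d) , H *ᵛ w (suc d) ⟩))
        (solve 2 (λ x b → (x :- x) :- b :* con 0ℚ := con 0ℚ) refl ⟨ w (suc d) , H *ᵛ w (suc d) ⟩ (β (suc d))))
    last (inj₁ i<d) = trans
      (next d (w (suc i)) shifted (swap (w (suc i)) (w (suc d)) (ih (suc i) (suc d) (s≤s i<d) ℕ.≤-refl)) refl)
      (final (ℕ.m≤n⇒m<n∨m≡n i<d))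
      where
      x = ⟨ w (suc (suc i)) , w (suc d) ⟩
      shifted : ⟨ H *ᵛ w (suc d) , w (suc i) ⟩ ≡ x
      shifted = trans (Q.⟨⟩-adjoint H H-sym (w (suc d)) (w (suc i)))
        (trans (Q.⟨⟩-comm (w (suc d)) (H *ᵛ w (suc i)))
        (trans (Q.⟨⟩-cong {w = w (suc d)} {w′ = w (suc d)} (H-w i) (λ _ → refl))
        (trans (combination (α (suc i)) (β (suc i)) (w (suc (suc i))) (w (suc i)) (w (suc d)) (w i) refl
          (ih (suc i) (suc d) (s≤s i<d) ℕ.≤-refl) (ih i (suc d) (s≤s (ℕ.<⇒≤ i<d)) ℕ.≤-refl))
        (solve 3 (λ x p q → x :+ p :* con 0ℚ :+ q :* con 0ℚ := x) refl x (α (suc i)) (β (suc i))))))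
      final : suc i ℕ.< d ⊎ suc i ≡ d → (x ∸ α (suc d) · 0ℚ) ∸ β (suc d) · ⟨ w d , w (suc i) ⟩ ≡ 0ℚ
      final (inj₁ lt) = trans
        (cong₂ (λ y z → (y ∸ α (suc d) · 0ℚ) ∸ β (suc d) · z)
          (ih (suc (suc i)) (suc d) (s≤s lt) ℕ.≤-refl)
          (swap (w (suc i)) (w d) (ih (suc i) d lt (ℕ.n≤1+n d))))
        (solve 2 (λ p q → (con 0ℚ :- p :* con 0ℚ) :- q :* con 0ℚ := con 0ℚ) refl (α (suc d)) (β (suc d)))
      final (inj₂ refl) = trans
        (cong (λ z → (x ∸ α (suc d) · 0ℚ) ∸ z) (h-cancel (ℕ.m<n⇒m<1+n (ℕ.n<1+n i)) (h (suc d))))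
        (solve 2 (λ x p → (x :- p :* con 0ℚ) :- x := con 0ℚ) refl x (α (suc d)))

  private
    -- Bessel's inequality for the basis vectors, summed over the basis, bounds the number of steps by n.
    residual : Fin n → ℕ → Vector ℚ n
    residual j zero    = basis j
    residual j (suc m) = residual j m +ᵛ (⊖ (w (suc m) j · inv (h (suc m)))) ·ᵛ w (suc m)

    energy : Fin n → ℕ → ℚ
    energy j zero    = 1ℚ
    energy j (suc m) = energy j m ∸ w (suc m) j · w (suc m) j · inv (h (suc m))

    residual-w : ∀ d → NonzeroBelow d → ∀ j m l → m ℕ.≤ l → l ℕ.≤ d → ⟨ residual j m , w (suc l) ⟩ ≡ w (suc l) j
    residual-w d nz j zero    l _ _ = trans (Q.⟨⟩-comm (basis j) (w (suc l))) (Q.⟨⟩-basis (w (suc l)) j)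
    residual-w d nz j (suc m) l m<l l≤d = trans
      (Q.⟨⟩-+ˡ (residual j m) (c ·ᵛ w (suc m)) (w (suc l)))
      (trans (cong₂ _⊹_ (residual-w d nz j m l (ℕ.<⇒≤ m<l) l≤d)
        (trans (Q.⟨⟩-·ˡ c (w (suc m)) (w (suc l)))
          (cong (c ·_) (orthogonal d nz (suc m) (suc l) (s≤s m<l) (s≤s l≤d)))))
      (solve 2 (λ x c → x :+ c :* con 0ℚ := x) refl (w (suc l) j) c))
      where c = ⊖ (w (suc m) j · inv (h (suc m)))

    ⟨residual⟩ : ∀ d → NonzeroBelow d → ∀ j m → m ℕ.≤ d → ⟨ residual j m , residual j m ⟩ ≡ energy j m
    ⟨residual⟩ d nz j zero    _   = trans (Q.⟨⟩-basis (basis j) j) (basis-diagonal j)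
      where
      basis-diagonal : ∀ {m} (j : Fin m) → basis j j ≡ 1ℚ
      basis-diagonal j with j Fin.≟ j
        where import Data.Fin.Properties as Fin
      ... | yes _ = refl
      ... | no ¬p = contradiction refl ¬p
    ⟨residual⟩ d nz j (suc m) m<d = trans (Q.⟨⟩-+ˡ r (c ·ᵛ v) (r +ᵛ c ·ᵛ v))
      (trans (cong₂ _⊹_
          (trans (Q.⟨⟩-+ʳ r r (c ·ᵛ v)) (cong₂ _⊹_ (⟨residual⟩ d nz j m (ℕ.<⇒≤ m<d)) (trans (Q.⟨⟩-·ʳ c r v) (cong (c ·_) r·v))))
          (trans (Q.⟨⟩-·ˡ c v (r +ᵛ c ·ᵛ v)) (cong (c ·_)
            (trans (Q.⟨⟩-+ʳ v r (c ·ᵛ v)) (cong₂ _⊹_ (swap r v r·v) (Q.⟨⟩-·ʳ c v v))))))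
      (trans (solve 4 (λ e x i h → (e :+ (:- (x :* i)) :* x) :+ (:- (x :* i)) :* (x :+ (:- (x :* i)) :* h)
                := e :- x :* x :* i :- x :* x :* i :* (con 1ℚ :- h :* i)) refl (energy j m) (v j) (inv (h (suc m))) (h (suc m)))
      (trans (cong (λ z → energy j (suc m) ∸ v j · v j · inv (h (suc m)) · (1ℚ ∸ z)) (*-inv (nz m<d)))
        (solve 2 (λ x y → x :- y :* (con 1ℚ :- con 1ℚ) := x) refl (energy j (suc m)) (v j · v j · inv (h (suc m)))))))
      where
      r = residual j m
      v = w (suc m)
      c = ⊖ (v j · inv (h (suc m)))
      r·v : ⟨ r , v ⟩ ≡ v j
      r·v = residual-w d nz j m m ℕ.≤-refl (ℕ.<⇒≤ m<d)

    sum-energy : ∀ d → NonzeroBelow d → ∀ m → m ℕ.≤ d → Q.sum (λ j → energy j m) ≡ ι n ∸ ι m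
    sum-energy d nz zero    _   = trans (sum-1 n) (sym (ℚ.+-identityʳ (ι n)))
    sum-energy d nz (suc m) m<d = trans
      (Q.∑-distrib-+ (λ j → energy j m) (λ j → ⊖ (v j · v j · inv (h (suc m)))))
      (trans (cong₂ _⊹_ (sum-energy d nz m (ℕ.<⇒≤ m<d)) minus-one)
        (solve 2 (λ x y → x :- y :+ :- con 1ℚ := x :- (con 1ℚ :+ y)) refl (ι n) (ι m)))
      where
      v = w (suc m)
      i = inv (h (suc m))
      minus-one : Q.sum (λ j → ⊖ (v j · v j · i)) ≡ ⊖ 1ℚ
      minus-one = trans
        (Q.sum-cong-≋ (λ j → solve 2 (λ x i → :- (x :* i) := (:- i) :* x) refl (v j · v j) i))
        (trans (sym (Q.*-distribˡ-sum (⊖ i) (λ j → v j · v j)))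
        (trans (solve 2 (λ h i → (:- i) :* h := :- (h :* i)) refl (h (suc m)) i) (cong ⊖_ (*-inv (nz m<d)))))

  NonzeroBelow⇒≤n : ∀ d → NonzeroBelow d → d ℕ.≤ n
  NonzeroBelow⇒≤n d nz = ℕ.≮⇒≥ λ n<d → ℚ.<-irrefl refl (ℚ.<-≤-trans (ι-< n<d) (ι≤ι))
    where
    ι≤ι : ι d ≤ ι n
    ι≤ι = 0≤-⇒≤ (subst (0ℚ ≤_) (sum-energy d nz d ℕ.≤-refl)
      (sum-nonNeg (λ j → energy j d) λ j → subst (0ℚ ≤_) (⟨residual⟩ d nz j d ℕ.≤-refl)
        (sum-nonNeg (λ i → residual j d i · residual j d i) (λ i → 0≤square (residual j d i)))))
    ι-< : n ℕ.< d → ι n < ι d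
    ι-< n<d = ℚ.<-≤-trans (<-by 0<1 (solve 1 (λ x → (con 1ℚ :+ x) :- x := con 1ℚ) refl (ι n))) (ι-mono n<d)

  private
    -- The norms `h` are rational, so the breakdown of the recurrence can be looked for by decision;
    -- Bessel's bound guarantees that it occurs.
    search : ∀ m → (∃ λ d → NonzeroBelow d × h (suc d) ≡ 0ℚ) ⊎ NonzeroBelow m
    search zero = inj₂ λ ()
    search (suc m) with search m
    ... | inj₁ found = inj₁ found
    ... | inj₂ nz with h (suc m) ℚ.≟ 0ℚ
    ...   | yes h≡0 = inj₁ (m , nz , h≡0)
    ...   | no h≢0  = inj₂ λ j<1+m → extend (ℕ.m≤n⇒m<n∨m≡n (ℕ.≤-pred j<1+m))
      where
      extend : ∀ {j} → j ℕ.< m ⊎ j ≡ m → h (suc j) ≢ 0ℚ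
      extend (inj₁ j<m)  = nz j<m
      extend (inj₂ refl) = h≢0

    terminates : ∃ λ d → NonzeroBelow d × h (suc d) ≡ 0ℚ
    terminates with search (suc n)
    ... | inj₁ found = found
    ... | inj₂ nz    = contradiction (NonzeroBelow⇒≤n (suc n) nz) (ℕ.<⇒≱ (ℕ.n<1+n n))

  abstract
    deg : ℕ
    deg = proj₁ terminates

    h≢0 : NonzeroBelow deg
    h≢0 = proj₁ (proj₂ terminates)

    w-deg : w (suc deg) ≈ᵛ 0ᵛ
    w-deg = ⟨v,v⟩≡0⇒v≡0 (w (suc deg)) (proj₂ (proj₂ terminates))

-- Splitting a real vector into eigenvectors

module RealVectors where

  open import Data.Fin.Properties using (suc-injective)
  open import Data.Rational.Base using () renaming (_+_ to _⊹_)
  open RationalProperties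
  open RationalVectors using (module Q)
  open RealProperties
  open Polynomials
  open ℝ-Solver using (solve; _:=_; _:+_; _:*_; _:-_; :-_; con)
  open R using (⟨_,_⟩; _*ᵛ_; _·ᵛ_; basis; 0ᵛ; _≈ᵛ_; ∑ᵛ; Eigenvector)

  *ᵛ-linear : ∀ {m} (M : Matrix ℝ m) → Linear (M *ᵛ_)
  *ᵛ-linear M = record { T-cong = R.*ᵛ-cong M ; T-+ = R.*ᵛ-+ M ; T-· = R.*ᵛ-· M }

  module _ {m} (M : Matrix ℝ m) where
    open Linear (*ᵛ-linear M)
    private T = M *ᵛ_

    ∏-linear : ∀ {d} (xs : Fin d → ℝ) c {u v z} → z ≋ (λ i → v i +ℝ c *ℝ u i) →
      Horner.∏ T z xs ≋ λ i → Horner.∏ T v xs i +ℝ c *ℝ Horner.∏ T u xs i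
    ∏-linear {zero}  xs c eq = eq
    ∏-linear {suc d} xs c {u} {v} {z} eq i = R.trans
      (R.+-cong (T-combination V c U ih i) (-ℝ‿cong (R.*-congˡ (ih i))))
      (solve 6 (λ tv c tu x v u → (tv :+ c :* tu) :- x :* (v :+ c :* u) := (tv :- x :* v) :+ c :* (tu :- x :* u))
        ≈-refl (T V i) c (T U i) (xs zero) (V i) (U i))
      where
      V = Horner.∏ T v (xs ∘ suc)
      U = Horner.∏ T u (xs ∘ suc)
      ih = ∏-linear (xs ∘ suc) c eq

    ∏-eigenvector : ∀ {d} (xs : Fin d → ℝ) x {u} → Eigenvector M x u → Horner.∏ T u xs ≋ ∏At x xs ·ᵛ u
    ∏-eigenvector {zero}  xs x {u} e i = R.sym (R.*-identityˡ (u i))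
    ∏-eigenvector {suc d} xs x {u} e i = R.trans
      (R.+-cong (R.trans (T-cong ih i) (R.trans (T-· p u i) (R.*-congˡ (e i)))) (-ℝ‿cong (R.*-congˡ (ih i))))
      (solve 4 (λ p x u y → p :* (x :* u) :- y :* (p :* u) := (x :* p :- y :* p) :* u) ≈-refl p x (u i) (xs zero))
      where
      p = ∏At x (xs ∘ suc)
      ih = ∏-eigenvector (xs ∘ suc) x e

  ∏At-#0 : ∀ {d} x (xs : Fin d → ℝ) → (∀ i → x +ℝ -ℝ xs i #0) → ∏At x xs #0
  ∏At-#0 {zero}  x xs h = inj₁ (Pos-ℚ 0<1)
  ∏At-#0 {suc d} x xs h = #0-cong
    (solve 3 (λ x y p → (x :- y) :* p := x :* p :- y :* p) ≈-refl x (xs zero) (∏At x (xs ∘ suc)))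
    (#0-* (h zero) (∏At-#0 x (xs ∘ suc) (h ∘ suc)))

  record EigenDecomposition {m} (M : Matrix ℝ m) {d} (xs : Fin d → ℝ) (v : Vector ℝ m) : Set where
    field
      part  : Fin d → Vector ℝ m
      eigen : ∀ j → Eigenvector M (xs j) (part j)
      total : v ≈ᵛ ∑ᵛ part

  -- Lagrange interpolation done recursively. The product of all factors but the first sends v to an
  -- eigenvector u for x₀; subtracting u divided by the product of the x₀ - xⱼ leaves a vector
  -- killed by the remaining factors. Apartness of the xⱼ provides that division.
  decompose : ∀ {m} (M : Matrix ℝ m) {d} (xs : Fin d → ℝ) v → Apart xs →
    Horner.∏ (M *ᵛ_) v xs ≋ 0ᵛ → EigenDecomposition M xs v
  decompose M {zero}  xs v apart killed = record { part = λ () ; eigen = λ () ; total = killed }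
  decompose M {suc d} xs v apart killed = record
    { part  = λ { zero → c ·ᵛ u ; (suc j) → part j }
    ; eigen = λ { zero → eigen-c·u ; (suc j) → eigen j }
    ; total = λ i → R.trans (solve 3 (λ v c u → v := c :* u :+ (v :- c :* u)) ≈-refl (v i) c (u i))
        (R.+-congˡ (total i))
    }
    where
    x₀ = xs zero
    ys = xs ∘ suc
    u = Horner.∏ (M *ᵛ_) v ys
    p = ∏At x₀ ys
    p#0 : p #0
    p#0 = ∏At-#0 x₀ ys λ i → apart λ ()
    c = proj₁ (inverse p p#0)
    p*c≈1 : p *ℝ c ≈ℝ 1ℝ
    p*c≈1 = proj₂ (inverse p p#0)
    u-eigen : Eigenvector M x₀ u
    u-eigen i = R.trans (solve 2 (λ t y → t := (t :- y) :+ y) ≈-refl ((M *ᵛ u) i) (x₀ *ℝ u i))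
      (R.trans (R.+-congʳ (killed i)) (R.+-identityˡ _))
    eigen-c·u : Eigenvector M x₀ (c ·ᵛ u)
    eigen-c·u i = R.trans (R.*ᵛ-· M c u i) (R.trans (R.*-congˡ (u-eigen i)) (R.x*yz≈y*xz c x₀ (u i)))
    v′ : Vector ℝ _
    v′ i = v i +ℝ -ℝ (c *ℝ u i)
    killed′ : Horner.∏ (M *ᵛ_) v′ ys ≋ 0ᵛ
    killed′ i = R.trans (∏-linear M ys (-ℝ c) (λ i → solve 3 (λ v c u → v :- c :* u := v :+ :- c :* u) ≈-refl (v i) c (u i)) i)
      (R.trans (R.+-congˡ (R.*-congˡ (∏-eigenvector M ys x₀ u-eigen i)))
      (R.trans (solve 3 (λ u c p → u :+ :- c :* (p :* u) := (con 1ℚ :- p :* c) :* u) ≈-refl (u i) c p)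
      (R.trans (R.*-congʳ (R.+-congˡ (-ℝ‿cong p*c≈1)))
        (solve 1 (λ u → (con 1ℚ :- con 1ℚ) :* u := con 0ℚ) ≈-refl (u i)))))
    open EigenDecomposition (decompose M ys v′ (λ i≢j → apart (i≢j ∘ suc-injective)) killed′)

  -- Rational vectors inside real ones

  cast : ∀ {m} → Vector ℚ m → Vector ℝ m
  cast v i = ℚ→ℝ (v i)

  seq-sum : ∀ {m} (f : Vector ℝ m) k → seq (R.sum f) k ≡ Q.sum (λ i → seq (f i) k)
  seq-sum {zero}  f k = ≡.refl
  seq-sum {suc m} f k = ≡.cong (seq (f zero) k ⊹_) (seq-sum (f ∘ suc) k)

  ⟨⟩-cast : ∀ {m} (u v : Vector ℚ m) → ⟨ cast u , cast v ⟩ ≈ℝ ℚ→ℝ Q.⟨ u , v ⟩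
  ⟨⟩-cast u v = pointwise (seq-sum λ i → ℚ→ℝ (u i) *ℝ ℚ→ℝ (v i))

  *ᵛ-cast : ∀ {m} (M : Matrix ℚ m) v → toℝ M *ᵛ cast v ≈ᵛ cast (M Q.*ᵛ v)
  *ᵛ-cast M v i = ⟨⟩-cast (M i) v

  cast-basis : ∀ {m} (a b : Fin m) → ℚ→ℝ (Q.basis a b) ≈ℝ basis a b
  cast-basis a b with a Fin.≟ b
  ... | yes _ = ≈-refl
  ... | no _ = ≈-refl

-- Krylov space of a vertex and the spectral decomposition of e_a

module SpectralDecomposition {n : ℕ} (H : Matrix ℚ n) (H-sym : ℚM.IsSymmetric H) where

  open import Data.Rational.Base using (_≤_; _<_) renaming (_+_ to _⊹_; _*_ to _·_)
  open RationalProperties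
  open RealProperties
  open Polynomials
  open RationalVectors
  open RealVectors
  open IntermediateValue using (Cut)
  open ℝ-Solver using (solve; _:=_; _:+_; _:*_; _:-_; :-_; con)

  open R using (⟨_,_⟩; _*ᵛ_; _·ᵛ_; _+ᵛ_; basis; 0ᵛ; _≈ᵛ_; Eigenvector)

  Hℝ : Matrix ℝ n
  Hℝ = toℝ H

  Hℝ-sym : R.IsSymmetric Hℝ
  Hℝ-sym i j = ℚ→ℝ-cong (H-sym i j)

  module Krylov (a : Fin n) where
    open Lanczos H H-sym a public
    open ThreeTerm α β public

    eₐ : Vector ℝ n
    eₐ = basis a

    W : ℕ → Vector ℝ n
    W k = cast (w k)

    W-1 : W 1 ≈ᵛ eₐ
    W-1 = cast-basis a

    H-W : ∀ k → Hℝ *ᵛ W (suc k) ≈ᵛ (W (suc (suc k)) +ᵛ ℚ→ℝ (α (suc k)) ·ᵛ W (suc k)) +ᵛ ℚ→ℝ (β (suc k)) ·ᵛ W k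
    H-W k i = R.trans (*ᵛ-cast H (w (suc k)) i) (R.trans (ℚ→ℝ-cong (H-w k i)) (pointwise λ _ → ≡.refl))

    -- The recurrence polynomials, evaluated at H and applied to e_a, return the Lanczos vectors. As
    -- the last of these is 0, the last polynomial annihilates e_a.
    S≈W : ∀ k → Sequence.S (Hℝ *ᵛ_) eₐ k ≋ W k
    S≈W zero          i = ≈-refl
    S≈W (suc zero)    i = R.sym (W-1 i)
    S≈W (suc (suc k)) i = R.trans
      (R.+-cong (R.+-cong (R.trans (R.*ᵛ-cong Hℝ (S≈W (suc k)) i) (H-W k i)) (-ℝ‿cong (R.*-congˡ (S≈W (suc k) i))))
        (-ℝ‿cong (R.*-congˡ (S≈W k i))))
      (solve 3 (λ x y z → ((x :+ y :+ z) :- y) :- z := x) ≈-refl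
        (W (suc (suc k)) i) (ℚ→ℝ (α (suc k)) *ℝ W (suc k) i) (ℚ→ℝ (β (suc k)) *ℝ W k i))

    W-deg : W (suc deg) ≈ᵛ 0ᵛ
    W-deg i = ℚ→ℝ-cong (w-deg i)

    -- Pairing with an eigenvector turns the vector recurrence into the scalar one.
    ⟨W,eigenvector⟩ : ∀ {s v} → Eigenvector Hℝ s v → ∀ k → ⟨ W k , v ⟩ ≈ℝ P s k *ℝ ⟨ eₐ , v ⟩
    ⟨W,eigenvector⟩ {s} {v} e zero       = R.trans (R.⟨⟩-0ˡ {v = W 0} {w = v} λ _ → ≈-refl) (R.sym (R.zeroˡ _))
    ⟨W,eigenvector⟩ {s} {v} e (suc zero) = R.trans (R.⟨⟩-cong {w = v} {w′ = v} W-1 λ _ → ≈-refl) (R.sym (R.*-identityˡ _))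
    ⟨W,eigenvector⟩ {s} {v} e (suc (suc k)) = step (⟨W,eigenvector⟩ e (suc k)) (⟨W,eigenvector⟩ e k)
     where
     E = ⟨ eₐ , v ⟩
     step : ⟨ W (suc k) , v ⟩ ≈ℝ P s (suc k) *ℝ E → ⟨ W k , v ⟩ ≈ℝ P s k *ℝ E →
       ⟨ W (suc (suc k)) , v ⟩ ≈ℝ P s (suc (suc k)) *ℝ E
     step ih ih′ = R.begin
      x
        R.≈⟨ solve 3 (λ x y z → x := ((x :+ y :+ z) :- y) :- z) ≈-refl x (A *ℝ ⟨ W (suc k) , v ⟩) (B *ℝ ⟨ W k , v ⟩) ⟩
      ((x +ℝ A *ℝ ⟨ W (suc k) , v ⟩ +ℝ B *ℝ ⟨ W k , v ⟩) +ℝ -ℝ (A *ℝ ⟨ W (suc k) , v ⟩)) +ℝ -ℝ (B *ℝ ⟨ W k , v ⟩)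
        R.≈⟨ R.+-cong (R.+-cong (R.sym expand) (-ℝ‿cong (R.*-congˡ ih))) (-ℝ‿cong (R.*-congˡ ih′)) ⟩
      (⟨ Hℝ *ᵛ W (suc k) , v ⟩ +ℝ -ℝ (A *ℝ (P s (suc k) *ℝ E))) +ℝ -ℝ (B *ℝ (P s k *ℝ E))
        R.≈⟨ R.+-congʳ (R.+-congʳ (R.trans (R.⟨⟩-adjoint Hℝ Hℝ-sym (W (suc k)) v)
               (R.trans (R.⟨⟩-cong {v = W (suc k)} {v′ = W (suc k)} (λ _ → ≈-refl) e)
               (R.trans (R.⟨⟩-·ʳ s (W (suc k)) v) (R.*-congˡ ih))))) ⟩
      (s *ℝ (P s (suc k) *ℝ E) +ℝ -ℝ (A *ℝ (P s (suc k) *ℝ E))) +ℝ -ℝ (B *ℝ (P s k *ℝ E))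
        R.≈⟨ solve 6 (λ s p e a b q → (s :* (p :* e) :- a :* (p :* e)) :- b :* (q :* e)
               := ((s :* p :- a :* p) :- b :* q) :* e) ≈-refl s (P s (suc k)) E A B (P s k) ⟩
      P s (suc (suc k)) *ℝ E R.∎
      where
      A = ℚ→ℝ (α (suc k))
      B = ℚ→ℝ (β (suc k))
      x = ⟨ W (suc (suc k)) , v ⟩
      expand : ⟨ Hℝ *ᵛ W (suc k) , v ⟩ ≈ℝ x +ℝ A *ℝ ⟨ W (suc k) , v ⟩ +ℝ B *ℝ ⟨ W k , v ⟩
      expand = R.trans (R.⟨⟩-cong {w = v} {w′ = v} (H-W k) λ _ → ≈-refl)
        (R.trans (R.⟨⟩-+ˡ (W (suc (suc k)) +ᵛ A ·ᵛ W (suc k)) (B ·ᵛ W k) v)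
        (R.+-cong (R.trans (R.⟨⟩-+ˡ (W (suc (suc k))) (A ·ᵛ W (suc k)) v) (R.+-congˡ (R.⟨⟩-·ˡ A (W (suc k)) v)))
          (R.⟨⟩-·ˡ B (W k) v)))

    Root : ℝ → Set
    Root x = P x (suc deg) ≈ℝ 0ℝ

    eigenvector⇒root : ∀ {s v} → Eigenvector Hℝ s v → P s (suc deg) *ℝ ⟨ eₐ , v ⟩ ≈ℝ 0ℝ
    eigenvector⇒root {s} {v} e = R.trans (R.sym (⟨W,eigenvector⟩ e (suc deg)))
      (R.⟨⟩-0ˡ {v = W (suc deg)} {w = v} W-deg)

    -- The Christoffel-Darboux kernel Σ P_m(x) w_m / h_m. At a root x it is the eigenvector in the
    -- Krylov space of e_a, scaled to have e_a-component 1, and it is obtained without any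
    -- projection.
    kernel : ℝ → ℕ → Vector ℝ n
    kernel x zero    i = 0ℝ
    kernel x (suc m) i = kernel x m i +ℝ (P x (suc m) *ℝ ℚ→ℝ (inv (h (suc m)))) *ℝ W (suc m) i

    -- The sum telescopes: β(m+1)/h(m+1) = 1/h(m), so the boundary term of one step cancels against
    -- the w(m)-part of the next. At m = `deg` and a root x both boundary terms vanish.
    christoffel-darboux : ∀ x m → m ℕ.≤ deg → Hℝ *ᵛ kernel x m ≈ᵛ
      λ i → x *ℝ kernel x m i +ℝ ℚ→ℝ (inv (h m)) *ℝ (P x m *ℝ W (suc m) i +ℝ -ℝ (P x (suc m) *ℝ W m i))
    christoffel-darboux x zero    _   i = R.trans (Linear.T-0 (*ᵛ-linear Hℝ) (λ _ → ≈-refl) i)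
      (solve 3 (λ x y z → con 0ℚ := x :* con 0ℚ :+ y :* (con 0ℚ :* z :- con 1ℚ :* con 0ℚ)) ≈-refl x (ℚ→ℝ (inv (h 0))) (W 1 i))
    christoffel-darboux x (suc m) m<d i = R.begin
      (Hℝ *ᵛ kernel x (suc m)) i
        R.≈⟨ Linear.T-combination (*ᵛ-linear Hℝ) (kernel x m) (q *ℝ ι₁) (W (suc m)) (λ _ → ≈-refl) i ⟩
      (Hℝ *ᵛ kernel x m) i +ℝ (q *ℝ ι₁) *ℝ (Hℝ *ᵛ W (suc m)) i
        R.≈⟨ R.+-cong (christoffel-darboux x m (ℕ.<⇒≤ m<d) i) (R.*-congˡ (R.trans (H-W m i)
               (R.+-congˡ (R.*-congʳ (pointwise {ℚ→ℝ (β (suc m))} {hh *ℝ ι₀} λ _ → ≡.refl))))) ⟩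
      (x *ℝ K +ℝ ι₀ *ℝ (p *ℝ w₁ +ℝ -ℝ (q *ℝ w₀))) +ℝ (q *ℝ ι₁) *ℝ (w₂ +ℝ A *ℝ w₁ +ℝ (hh *ℝ ι₀) *ℝ w₀)
        R.≈⟨ solve 11 (λ x k i₀ p w₁ q w₀ i₁ w₂ a hh →
               (x :* k :+ i₀ :* (p :* w₁ :- q :* w₀)) :+ (q :* i₁) :* (w₂ :+ a :* w₁ :+ (hh :* i₀) :* w₀)
               := (x :* (k :+ (q :* i₁) :* w₁) :+ i₁ :* (q :* w₂ :- ((x :* q :- a :* q) :- (hh :* i₀) :* p) :* w₁))
                  :+ (con 1ℚ :- hh :* i₁) :* (i₀ :* (p :* w₁ :- q :* w₀))) ≈-refl x K ι₀ p w₁ q w₀ ι₁ w₂ A hh ⟩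
      (x *ℝ (K +ℝ (q *ℝ ι₁) *ℝ w₁) +ℝ ι₁ *ℝ (q *ℝ w₂ +ℝ -ℝ (((x *ℝ q +ℝ -ℝ (A *ℝ q)) +ℝ -ℝ ((hh *ℝ ι₀) *ℝ p)) *ℝ w₁)))
        +ℝ (1ℝ +ℝ -ℝ (hh *ℝ ι₁)) *ℝ (ι₀ *ℝ (p *ℝ w₁ +ℝ -ℝ (q *ℝ w₀)))
        R.≈⟨ R.+-congˡ (R.trans (R.*-congʳ (R.+-congˡ (-ℝ‿cong (R.trans (pointwise λ _ → ≡.refl) (ℚ→ℝ-cong (*-inv (h≢0 m<d)))))))
               (solve 1 (λ z → (con 1ℚ :- con 1ℚ) :* z := con 0ℚ) ≈-refl (ι₀ *ℝ (p *ℝ w₁ +ℝ -ℝ (q *ℝ w₀))))) ⟩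
      (x *ℝ kernel x (suc m) i +ℝ ι₁ *ℝ (q *ℝ w₂ +ℝ -ℝ (((x *ℝ q +ℝ -ℝ (A *ℝ q)) +ℝ -ℝ ((hh *ℝ ι₀) *ℝ p)) *ℝ w₁))) +ℝ 0ℝ
        R.≈⟨ R.+-identityʳ _ ⟩
      x *ℝ kernel x (suc m) i +ℝ ι₁ *ℝ (q *ℝ w₂ +ℝ -ℝ (((x *ℝ q +ℝ -ℝ (A *ℝ q)) +ℝ -ℝ ((hh *ℝ ι₀) *ℝ p)) *ℝ w₁))
        R.≈⟨ R.+-congˡ (R.*-congˡ (R.+-congˡ (-ℝ‿cong (R.*-congʳ (R.+-congˡ (-ℝ‿cong (R.*-congʳ (pointwise λ _ → ≡.refl)))))))) ⟩
      x *ℝ kernel x (suc m) i +ℝ ι₁ *ℝ (q *ℝ w₂ +ℝ -ℝ (P x (suc (suc m)) *ℝ w₁)) R.∎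
      where
      K = kernel x m i
      p = P x m
      q = P x (suc m)
      ι₀ = ℚ→ℝ (inv (h m))
      ι₁ = ℚ→ℝ (inv (h (suc m)))
      hh = ℚ→ℝ (h (suc m))
      A = ℚ→ℝ (α (suc m))
      w₀ = W m i
      w₁ = W (suc m) i
      w₂ = W (suc (suc m)) i

    kernel-eigenvector : ∀ {x} → Root x → Eigenvector Hℝ x (kernel x deg)
    kernel-eigenvector {x} root i = R.trans (christoffel-darboux x deg ℕ.≤-refl i)
      (R.trans (R.+-congˡ (R.*-congˡ (R.+-cong (R.*-congˡ (W-deg i)) (-ℝ‿cong (R.*-congʳ root)))))
        (solve 4 (λ xk ι p w → xk :+ ι :* (p :* con 0ℚ :- con 0ℚ :* w) := xk) ≈-refl
          (x *ℝ kernel x deg i) (ℚ→ℝ (inv (h deg))) (P x deg) (W deg i)))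

    h-1 : h 1 ≡ 1ℚ
    h-1 = ≡.trans (Q.⟨⟩-basis (Q.basis a) a) (diagonal a)
      where
      diagonal : ∀ {m} (a : Fin m) → Q.basis a a ≡ 1ℚ
      diagonal a with a Fin.≟ a
      ... | yes _ = ≡.refl
      ... | no ¬p = contradiction ≡.refl ¬p

    0<deg : 0 ℕ.< deg
    0<deg = ℕ.n≢0⇒n>0 λ deg≡0 → contradiction (h-1-zero (≡.subst (λ d → ∀ i → w (suc d) i ≡ 0ℚ) deg≡0 w-deg)) λ ()
      where
      h-1-zero : (∀ i → w 1 i ≡ 0ℚ) → 1ℚ ≡ 0ℚ
      h-1-zero w≡0 = ≡.trans (≡.sym h-1) (Q.⟨⟩-0ˡ {v = w 1} {w = w 1} w≡0)

    -- The vector e_a is w(1), which is orthogonal to all later w; only the first summand, with P =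
    -- 1 and h = 1, contributes.
    ⟨kernel,eₐ⟩ : ∀ x → ⟨ kernel x deg , eₐ ⟩ ≈ℝ 1ℝ
    ⟨kernel,eₐ⟩ x = R.trans (R.⟨⟩-cong {v = kernel x deg} {v′ = kernel x deg} (λ _ → ≈-refl) (λ i → R.sym (W-1 i)))
      (up-to deg 0<deg ℕ.≤-refl)
      where
      term : ℕ → ℝ
      term m = P x (suc m) *ℝ ℚ→ℝ (inv (h (suc m)))
      extend : ∀ m → ⟨ kernel x (suc m) , W 1 ⟩ ≈ℝ ⟨ kernel x m , W 1 ⟩ +ℝ term m *ℝ ℚ→ℝ Q.⟨ w (suc m) , w 1 ⟩
      extend m = R.trans (R.⟨⟩-+ˡ (kernel x m) (term m ·ᵛ W (suc m)) (W 1)) (R.+-congˡ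
        (R.trans (R.⟨⟩-·ˡ (term m) (W (suc m)) (W 1)) (R.*-congˡ (⟨⟩-cast (w (suc m)) (w 1)))))
      up-to : ∀ m → 0 ℕ.< m → m ℕ.≤ deg → ⟨ kernel x m , W 1 ⟩ ≈ℝ 1ℝ
      up-to (suc zero) _ _ = R.trans (extend 0) (R.trans
        (R.+-cong (R.⟨⟩-0ˡ {v = kernel x 0} {w = W 1} (λ _ → ≈-refl))
          (R.*-cong (R.trans (R.*-identityˡ _) (ℚ→ℝ-cong (≡.trans (≡.cong inv h-1)
              (≡.trans (≡.sym (ℚ.*-identityˡ (inv 1ℚ))) (*-inv {1ℚ} λ ()))))) (ℚ→ℝ-cong h-1)))
        (solve 0 (con 0ℚ :+ con 1ℚ :* con 1ℚ := con 1ℚ) ≈-refl))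
      up-to (suc (suc m)) _ m<d = R.trans (extend (suc m)) (R.trans
        (R.+-cong (up-to (suc m) (s≤s z≤n) (ℕ.<⇒≤ m<d)) (R.*-congˡ (ℚ→ℝ-cong (≡.trans (Q.⟨⟩-comm (w (suc (suc m))) (w 1))
          (orthogonal deg h≢0 1 (suc (suc m)) (s≤s (s≤s z≤n)) (ℕ.m≤n⇒m≤1+n m<d))))))
        (solve 1 (λ t → con 1ℚ :+ t :* con 0ℚ := con 1ℚ) ≈-refl (term (suc m))))

    private
      0≤h : ∀ k → 0ℚ ≤ h k
      0≤h k = sum-nonNeg (λ i → w k i · w k i) (λ i → 0≤square (w k i))

      0<h : ∀ {k} → k ℕ.< deg → 0ℚ < h (suc k)
      0<h {k} k<d with ℚ.<-cmp 0ℚ (h (suc k))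
      ... | tri< 0<h _ _ = 0<h
      ... | tri≈ _ 0≡h _ = contradiction (≡.sym 0≡h) (h≢0 k<d)
      ... | tri> _ _ h<0 = contradiction (ℚ.≤-<-trans (0≤h (suc k)) h<0) (ℚ.<-irrefl ≡.refl)

      0≤inv : ∀ {q} → 0ℚ ≤ q → 0ℚ ≤ inv q
      0≤inv {q} 0≤q with ℚ.<-cmp 0ℚ q
      ... | tri< 0<q _ _    = ℚ.<⇒≤ (inv-pos 0<q)
      ... | tri≈ _ ≡.refl _ = ℚ.≤-reflexive (≡.sym inv-0)
      ... | tri> _ _ q<0    = contradiction (ℚ.≤-<-trans 0≤q q<0) (ℚ.<-irrefl ≡.refl)

      0≤β : ∀ k → 0ℚ ≤ β k
      0≤β zero    = ℚ.≤-refl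
      0≤β (suc k) = *-nonNeg (0≤h (suc k)) (0≤inv (0≤h k))

      0<β : ∀ k → suc (suc k) ℕ.≤ deg → 0ℚ < β (suc (suc k))
      0<β k k<d = *-pos (0<h k<d) (inv-pos (0<h (ℕ.<⇒≤ k<d)))

      module I = Interlacing α β 0≤β deg 0<β

    abstract
      private
        roots : I.Roots deg
        roots = I.all-roots deg ℕ.≤-refl

      λs : Fin deg → ℝ
      λs i = Cut.lower (I.Roots.root roots i)

      λs-apart : Apart λs
      λs-apart = I.Chain-apart I.top (I.Roots.root roots) I.bottom (I.Roots.chain roots)

      λs-root : ∀ i → Root (λs i)
      λs-root = I.Roots.is-root roots

      -- The last polynomial applied to e_a gives 0 and factors over its apart roots, which is the
      -- hypothesis of `decompose`.
      decomposition : EigenDecomposition Hℝ λs eₐ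
      decomposition = decompose Hℝ λs eₐ λs-apart λ i → R.trans
        (R.sym (P-factor (*ᵛ-linear Hℝ) eₐ λs λs-apart λs-root i))
        (R.trans (S≈W (suc deg) i) (W-deg i))

-- Symmetry of the support as symmetry of the roots

module EigenvalueSupport where

  open import Data.Bool.Base using (Bool; true; false; if_then_else_)
  open import Data.Rational.Base using (_≤_) renaming (_*_ to _·_; -_ to ⊖_)
  open import Relation.Unary using (_≐_)
  open RationalProperties
  open RealProperties
  open Polynomials
  open RationalVectors using (term≤sum)
  open RealVectors
  open SpectralDecomposition
  open R using (⟨_,_⟩; _*ᵛ_; _·ᵛ_; _+ᵛ_; _-ᵛ_; basis; 0ᵛ; _≈ᵛ_; ∑ᵛ; Eigenvector)
  open ℝ-Solver using (solve; _:=_; _:+_; _:*_; _:-_; :-_; con)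
  open EigenDecomposition

  RootSymmetric : ∀ {n} (H : Matrix ℚ n) → ℚM.IsSymmetric H → Fin n → Set
  RootSymmetric H H-sym a = ∀ {x} → Root x → Root (-ℝ x)
    where open Krylov H H-sym a

  -- Finiteness lets a double negation leave the quantifier. Finitely many comparisons of reals may
  -- therefore be taken as decided on the way to a negative statement.
  ¬¬-∀ : ∀ {n} {A : Fin n → Set} → (∀ i → ¬ ¬ A i) → ¬ ¬ (∀ i → A i)
  ¬¬-∀ {zero}  h k = k λ ()
  ¬¬-∀ {suc n} h k = h zero λ a₀ → ¬¬-∀ (h ∘ suc) λ as → k λ { zero → a₀ ; (suc i) → as i }

  ⟨v,v⟩≈0⇒v≈0 : ∀ {m} (v : Vector ℝ m) → ⟨ v , v ⟩ ≈ℝ 0ℝ → v ≈ᵛ 0ᵛ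
  ⟨v,v⟩≈0⇒v≈0 v eq i = tight λ vi#0 → contradiction eq (Pos⇒≉0 (enlarge (#0-square vi#0)))
    where
    enlarge : Pos (v i *ℝ v i) → Pos ⟨ v , v ⟩
    enlarge (mkPos δ 0<δ (N , h)) = mkPos δ 0<δ (N , λ k N≤k → ℚ.≤-trans (h k N≤k)
      (≡.subst (seq (v i) k · seq (v i) k ≤_) (≡.sym (seq-sum (λ j → v j *ℝ v j) k))
        (term≤sum (λ j → seq (v j) k · seq (v j) k) (λ j → 0≤square (seq (v j) k)) i)))

  module _ {n} (H : Matrix ℚ n) (H-sym : ℚM.IsSymmetric H) where

    private
      Hᵣ : Matrix ℝ n
      Hᵣ = toℝ H

    eigenvectors-orthogonal : ∀ {x y v w} → Eigenvector Hᵣ y v → Eigenvector Hᵣ x w → y +ℝ -ℝ x #0 → ⟨ v , w ⟩ ≈ℝ 0ℝ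
    eigenvectors-orthogonal {x} {y} {v} {w} ev ew y#x = cancel-factor y#x (R.begin
      (y +ℝ -ℝ x) *ℝ ⟨ v , w ⟩                  R.≈⟨ solve 3 (λ x y p → (y :- x) :* p := y :* p :- x :* p) ≈-refl x y ⟨ v , w ⟩ ⟩
      y *ℝ ⟨ v , w ⟩ +ℝ -ℝ (x *ℝ ⟨ v , w ⟩)     R.≈⟨ R.+-congʳ (R.trans (R.sym (R.⟨⟩-·ˡ y v w)) (R.trans
                                                      (R.⟨⟩-cong {w = w} {w′ = w} (λ i → R.sym (ev i)) (λ _ → ≈-refl))
                                                      (R.trans (R.⟨⟩-adjoint Hᵣ (Hℝ-sym H H-sym) v w)
                                                      (R.trans (R.⟨⟩-cong {v = v} {v′ = v} (λ _ → ≈-refl) ew) (R.⟨⟩-·ʳ x v w))))) ⟩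
      x *ℝ ⟨ v , w ⟩ +ℝ -ℝ (x *ℝ ⟨ v , w ⟩)     R.≈⟨ R.-‿inverseʳ _ ⟩
      0ℝ                                        R.∎)

    -- Deciding which eigenvalues of each basis vector equal x is possible under a double negation.
    Decided : ℝ → Set
    Decided x = ∀ j i → (λs′ j i +ℝ -ℝ x ≈ℝ 0ℝ) ⊎ (λs′ j i +ℝ -ℝ x #0)
      where
      λs′ : ∀ j → Fin (Krylov.deg H H-sym j) → ℝ
      λs′ j = Krylov.λs H H-sym j

    decided : ∀ x → ¬ ¬ Decided x
    decided x = ¬¬-∀ λ j → ¬¬-∀ λ i → ≈0-or-#0 (Krylov.λs H H-sym j i +ℝ -ℝ x)

    module Eigenprojection {x} (dec : Decided x) where

      select : ∀ {c} → (c ≈ℝ 0ℝ) ⊎ (c #0) → Vector ℝ n → Vector ℝ n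
      select (inj₁ _) v = v
      select (inj₂ _) v = 0ᵛ

      -- The projection of e_j to the x-eigenspace, assembled from the Krylov decomposition of e_j
      -- itself: parts with eigenvalue x are kept, the others are orthogonal to the eigenspace. Each
      -- vertex has its own decomposition, and H is never diagonalised as a whole.
      column : Fin n → Vector ℝ n
      column j = ∑ᵛ λ i → select (dec j i) (part (Krylov.decomposition H H-sym j) i)

      E : Matrix ℝ n
      E i j = column j i

      column-eigenvector : ∀ j → Eigenvector Hᵣ x (column j)
      column-eigenvector j k = R.trans (R.*ᵛ-∑ Hᵣ (λ i → select (dec j i) (part D i)) k)
        (R.trans (R.sum-cong-≋ λ i → selected (dec j i) (eigen D i) k)
          (R.sym (R.*-distribˡ-sum x (λ i → select (dec j i) (part D i) k))))
        where
        D = Krylov.decomposition H H-sym j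
        selected : ∀ {y v} (d : (y +ℝ -ℝ x ≈ℝ 0ℝ) ⊎ (y +ℝ -ℝ x #0)) → Eigenvector Hᵣ y v → Eigenvector Hᵣ x (select d v)
        selected {y} {v} (inj₁ y≈x) e i = R.trans (e i) (R.*-congʳ (R.trans
          (solve 2 (λ x y → y := (y :- x) :+ x) ≈-refl x y) (R.trans (R.+-congʳ y≈x) (R.+-identityˡ x))))
        selected {y} {v} (inj₂ _) e i = R.trans (Linear.T-0 (*ᵛ-linear Hᵣ) (λ _ → ≈-refl) i) (R.sym (R.zeroʳ x))

      ⟨column⟩ : ∀ j {w} → Eigenvector Hᵣ x w → ⟨ column j , w ⟩ ≈ℝ w j
      ⟨column⟩ j {w} ew = R.begin
        ⟨ column j , w ⟩
          R.≈⟨ R.⟨⟩-∑ˡ (λ i → select (dec j i) (part D i)) w ⟩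
        R.sum (λ i → ⟨ select (dec j i) (part D i) , w ⟩)
          R.≈⟨ R.sum-cong-≋ (λ i → selected (dec j i) (eigen D i)) ⟩
        R.sum (λ i → ⟨ part D i , w ⟩)
          R.≈⟨ R.⟨⟩-∑ˡ (part D) w ⟨
        ⟨ ∑ᵛ (part D) , w ⟩
          R.≈⟨ R.⟨⟩-cong {w = w} {w′ = w} (total D) (λ _ → ≈-refl) ⟨
        ⟨ basis j , w ⟩
          R.≈⟨ R.trans (R.⟨⟩-comm (basis j) w) (R.⟨⟩-basis w j) ⟩
        w j R.∎
        where
        D = Krylov.decomposition H H-sym j
        selected : ∀ {y v} (d : (y +ℝ -ℝ x ≈ℝ 0ℝ) ⊎ (y +ℝ -ℝ x #0)) → Eigenvector Hᵣ y v → ⟨ select d v , w ⟩ ≈ℝ ⟨ v , w ⟩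
        selected (inj₁ _)           ev = ≈-refl
        selected {y} {v} (inj₂ y#x) ev = R.trans (R.⟨⟩-0ˡ {v = 0ᵛ} {w = w} λ _ → ≈-refl)
          (R.sym (eigenvectors-orthogonal ev ew y#x))

      expand : ∀ v → E *ᵛ v ≈ᵛ ∑ᵛ λ j → v j ·ᵛ column j
      expand v i = R.sum-cong-≋ λ j → R.*-comm (column j i) (v j)

      isEigenprojection : IsEigenprojection Hᵣ x E
      isEigenprojection = record
        { range = λ v i → R.begin
            (Hᵣ *ᵛ (E *ᵛ v)) i
              R.≈⟨ R.*ᵛ-cong Hᵣ (expand v) i ⟩
            (Hᵣ *ᵛ ∑ᵛ (λ j → v j ·ᵛ column j)) i
              R.≈⟨ R.*ᵛ-∑ Hᵣ (λ j → v j ·ᵛ column j) i ⟩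
            R.sum (λ j → (Hᵣ *ᵛ (v j ·ᵛ column j)) i)
              R.≈⟨ R.sum-cong-≋ (λ j → R.trans (R.*ᵛ-· Hᵣ (v j) (column j) i) (R.trans
                     (R.*-congˡ (column-eigenvector j i)) (R.x*yz≈y*xz (v j) x (column j i)))) ⟩
            R.sum (λ j → x *ℝ (v j *ℝ column j i))
              R.≈⟨ R.*-distribˡ-sum x (λ j → v j *ℝ column j i) ⟨
            x *ℝ R.sum (λ j → v j *ℝ column j i)
              R.≈⟨ R.*-congˡ (expand v i) ⟨
            x *ℝ (E *ᵛ v) i R.∎
        ; orthogonal = λ v w ew → R.begin
            ⟨ v -ᵛ E *ᵛ v , w ⟩
              R.≈⟨ R.⟨⟩-cong {w = w} {w′ = w} (λ i → solve 2 (λ v e → v :- e := v :+ con (⊖ 1ℚ) :* e) ≈-refl (v i) ((E *ᵛ v) i)) (λ _ → ≈-refl) ⟩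
            ⟨ v +ᵛ ℚ→ℝ (⊖ 1ℚ) ·ᵛ (E *ᵛ v) , w ⟩
              R.≈⟨ R.trans (R.⟨⟩-+ˡ v (ℚ→ℝ (⊖ 1ℚ) ·ᵛ (E *ᵛ v)) w) (R.+-congˡ (R.⟨⟩-·ˡ (ℚ→ℝ (⊖ 1ℚ)) (E *ᵛ v) w)) ⟩
            ⟨ v , w ⟩ +ℝ ℚ→ℝ (⊖ 1ℚ) *ℝ ⟨ E *ᵛ v , w ⟩
              R.≈⟨ R.+-congˡ (R.*-congˡ (R.trans (R.⟨⟩-cong {w = w} {w′ = w} (expand v) (λ _ → ≈-refl))
                     (R.trans (R.⟨⟩-∑ˡ (λ j → v j ·ᵛ column j) w)
                       (R.sum-cong-≋ λ j → R.trans (R.⟨⟩-·ˡ (v j) (column j) w) (R.*-congˡ (⟨column⟩ j ew)))))) ⟩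
            ⟨ v , w ⟩ +ℝ ℚ→ℝ (⊖ 1ℚ) *ℝ ⟨ v , w ⟩
              R.≈⟨ solve 1 (λ p → p :+ con (⊖ 1ℚ) :* p := con 0ℚ) ≈-refl ⟨ v , w ⟩ ⟩
            0ℝ R.∎
        }

    ⟨projection⟩ : ∀ {x E} → IsEigenprojection Hᵣ x E → ∀ v {w} → Eigenvector Hᵣ x w → ⟨ v , w ⟩ ≈ℝ ⟨ E *ᵛ v , w ⟩
    ⟨projection⟩ {x} {E} isE v {w} ew = R.begin
      ⟨ v , w ⟩
        R.≈⟨ R.⟨⟩-cong {w = w} {w′ = w} (λ i → solve 2 (λ v e → v := (v :- e) :+ e) ≈-refl (v i) ((E *ᵛ v) i)) (λ _ → ≈-refl) ⟩
      ⟨ v -ᵛ E *ᵛ v +ᵛ E *ᵛ v , w ⟩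
        R.≈⟨ R.⟨⟩-+ˡ (v -ᵛ E *ᵛ v) (E *ᵛ v) w ⟩
      ⟨ v -ᵛ E *ᵛ v , w ⟩ +ℝ ⟨ E *ᵛ v , w ⟩
        R.≈⟨ R.trans (R.+-congʳ (IsEigenprojection.orthogonal isE v w ew)) (R.+-identityˡ _) ⟩
      ⟨ E *ᵛ v , w ⟩ R.∎

    module _ (a : Fin n) where
      open Krylov H H-sym a

      -- The kernel vector is an eigenvector with e_a-component 1, so neither it nor the projection
      -- of e_a can vanish. The projection exists only once eigenvalues have been compared with x,
      -- whence the double negation.
      root⇒support : ∀ {x} → Root x → ¬ ¬ Supp Hᵣ (basis a) x
      root⇒support {x} root k = decided x λ dec →
        let open Eigenprojection dec in
        k ( (v , ev , λ v≈0 → 1≉0 (R.trans (R.sym (⟨kernel,eₐ⟩ x)) (R.⟨⟩-0ˡ {v = v} {w = eₐ} v≈0)))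
          , E , isEigenprojection
          , λ Ee≈0 → 1≉0 (R.trans (R.sym (⟨kernel,eₐ⟩ x)) (R.trans (R.⟨⟩-comm v eₐ)
              (R.trans (⟨projection⟩ isEigenprojection eₐ ev) (R.⟨⟩-0ˡ {v = E *ᵛ eₐ} {w = v} Ee≈0)))))
        where
        v = kernel x deg
        ev : Eigenvector Hᵣ x v
        ev = kernel-eigenvector root
        1≉0 : ¬ (1ℝ ≈ℝ 0ℝ)
        1≉0 = Pos⇒≉0 (Pos-ℚ 0<1)

      -- Were P(s) apart from 0, the projection u of e_a would satisfy ⟨e_a, u⟩ = 0; but this number
      -- equals ⟨u, u⟩, so u would be 0.
      support⇒root : ∀ {s} → Supp Hᵣ (basis a) s → Root s
      support⇒root {s} (_ , E , isE , Ee≉0) = tight λ P#0 → Ee≉0 (⟨v,v⟩≈0⇒v≈0 u (R.trans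
        (R.sym (⟨projection⟩ isE eₐ eu)) (cancel-factor P#0 (eigenvector⇒root eu))))
        where
        u = E *ᵛ eₐ
        eu : Eigenvector Hᵣ s u
        eu = IsEigenprojection.range isE eₐ

      -- Being a root is an equality of reals, hence stable, so the doubly negated membership
      -- supplied by `root⇒support` is good enough.
      support-symmetric⇒root-symmetric : Supp Hᵣ (basis a) ≐ (-ˢ Supp Hᵣ (basis a)) → RootSymmetric H H-sym a
      support-symmetric⇒root-symmetric (⊆ , _) {x} root = ≈0-stable λ ¬root → root⇒support root λ x∈supp →
        let s , s∈supp , x≈-s = ⊆ x∈supp in
        ¬root (R.trans (P-cong (R.trans (-ℝ‿cong x≈-s) (solve 1 (λ s → :- (:- s) := s) ≈-refl s)) (suc deg))
          (support⇒root s∈supp))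

  module _ {n} (G : SimpleGraph n) where

    private A = adjacencyMatrix G

    adjacency-symmetric : ℚM.IsSymmetric A
    adjacency-symmetric u v with adj? G u v | adj? G v u
    ... | yes _ | yes _ = ≡.refl
    ... | no _  | no _  = ≡.refl
    ... | yes p | no ¬q = contradiction (symmetric G p) ¬q
    ... | no ¬p | yes q = contradiction (symmetric G q) ¬p

    module _ (bipartite : Bipartite G) where

      private
        side = proj₁ bipartite

        value : Bool → ℝ
        value b = if b then 1ℝ else -ℝ 1ℝ

        value-≢ : ∀ {b c} → b ≢ c → value c ≈ℝ -ℝ value b
        value-≢ {true}  {true}  b≢c = contradiction ≡.refl b≢c
        value-≢ {true}  {false} _   = ≈-refl
        value-≢ {false} {true}  _   = pointwise λ _ → ≡.refl
        value-≢ {false} {false} b≢c = contradiction ≡.refl b≢c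

        value-#0 : ∀ b → value b #0
        value-#0 true  = inj₁ (Pos-ℚ 0<1)
        value-#0 false = #0-neg (inj₁ (Pos-ℚ 0<1))

        σ : Fin n → ℝ
        σ i = value (side i)

        anticommutes : ∀ i j → toℝ A i j *ℝ σ j ≈ℝ -ℝ (σ i *ℝ toℝ A i j)
        anticommutes i j with adj? G i j
        ... | yes p = R.trans (R.*-congˡ (value-≢ (proj₂ bipartite p)))
                        (solve 1 (λ s → con 1ℚ :* :- s := :- (s :* con 1ℚ)) ≈-refl (σ i))
        ... | no _  = solve 2 (λ s t → con 0ℚ :* t := :- (s :* con 0ℚ)) ≈-refl (σ i) (σ j)

      -- Changing the sign on one colour class conjugates A into -A. It sends the kernel vector at x
      -- to an eigenvector for -x whose e_a-component is ±1, which makes -x a root.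
      bipartite⇒root-symmetric : ∀ a → RootSymmetric A adjacency-symmetric a
      bipartite⇒root-symmetric a {x} root = cancel-factor (value-#0 (side a)) (R.trans (R.*-comm _ _)
        (R.trans (R.*-congˡ (R.sym pairing)) (eigenvector⇒root ev′)))
        where
        open Krylov A adjacency-symmetric a
        v = kernel x deg
        v′ : Vector ℝ n
        v′ i = σ i *ℝ v i
        ev : Eigenvector (toℝ A) x v
        ev = kernel-eigenvector root
        ev′ : Eigenvector (toℝ A) (-ℝ x) v′
        ev′ i = R.begin
          R.sum (λ j → toℝ A i j *ℝ (σ j *ℝ v j))
            R.≈⟨ R.sum-cong-≋ (λ j → R.trans (R.sym (R.*-assoc _ _ _)) (R.trans (R.*-congʳ (anticommutes i j))
                   (solve 3 (λ s a v → :- (s :* a) :* v := :- s :* (a :* v)) ≈-refl (σ i) (toℝ A i j) (v j)))) ⟩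
          R.sum (λ j → -ℝ σ i *ℝ (toℝ A i j *ℝ v j))
            R.≈⟨ R.*-distribˡ-sum (-ℝ σ i) (λ j → toℝ A i j *ℝ v j) ⟨
          -ℝ σ i *ℝ (toℝ A *ᵛ v) i
            R.≈⟨ R.*-congˡ (ev i) ⟩
          -ℝ σ i *ℝ (x *ℝ v i)
            R.≈⟨ solve 3 (λ s x v → :- s :* (x :* v) := :- x :* (s :* v)) ≈-refl (σ i) x (v i) ⟩
          -ℝ x *ℝ v′ i R.∎
        pairing : ⟨ eₐ , v′ ⟩ ≈ℝ σ a
        pairing = R.trans (R.⟨⟩-comm eₐ v′) (R.trans (R.⟨⟩-basis v′ a)
          (R.trans (R.*-congˡ (R.trans (R.sym (R.⟨⟩-basis v a)) (⟨kernel,eₐ⟩ x))) (R.*-identityʳ _)))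

-- Complex numbers and limits of complex sequences

module ComplexProperties where

  open import Algebra.Bundles using (CommutativeRing)
  open import Algebra.Bundles.Raw using (RawRing)
  open import Data.Rational.Base
  open import Data.Rational.Properties
  open import Level using (0ℓ)
  open RationalProperties
  open RealProperties
  private
    module S = ℚ.+-*-Solver
    module R = ℝ-Solver
  open S using (_:=_; _:+_; _:*_; _:-_; :-_; con)

  ≈ℂ-refl : ∀ {z} → z ≈ℂ z
  ≈ℂ-refl = mk≈ ≈-refl ≈-refl

  ℂ-commutativeRing : CommutativeRing 0ℓ 0ℓ
  ℂ-commutativeRing = record
    { RawRing ℂ-rawRing
    ; isCommutativeRing = record
      { isRing = record
        { +-isAbelianGroup = record
          { isGroup = record
            { isMonoid = record
              { isSemigroup = record
                { isMagma = record
                  { isEquivalence = record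
                    { refl = ≈ℂ-refl
                    ; sym = λ { (mk≈ p q) → mk≈ (≈-sym p) (≈-sym q) }
                    ; trans = λ { (mk≈ p q) (mk≈ r s) → mk≈ (≈-trans p r) (≈-trans q s) } }
                  ; ∙-cong = λ { (mk≈ p q) (mk≈ r s) → mk≈ (+-cong p r) (+-cong q s) } }
                ; assoc = λ x y z → mk≈ (r.+-assoc (re x) (re y) (re z)) (r.+-assoc (im x) (im y) (im z)) }
              ; identity = (λ x → mk≈ (r.+-identityˡ (re x)) (r.+-identityˡ (im x)))
                         , (λ x → mk≈ (r.+-identityʳ (re x)) (r.+-identityʳ (im x))) }
            ; inverse = (λ x → mk≈ (r.-‿inverseˡ (re x)) (r.-‿inverseˡ (im x)))
                      , (λ x → mk≈ (r.-‿inverseʳ (re x)) (r.-‿inverseʳ (im x)))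
            ; ⁻¹-cong = λ { (mk≈ p q) → mk≈ (-ℝ‿cong p) (-ℝ‿cong q) } }
          ; comm = λ x y → mk≈ (r.+-comm (re x) (re y)) (r.+-comm (im x) (im y)) }
        ; *-cong = λ { (mk≈ p q) (mk≈ s t) → mk≈
            (+-cong (*-cong p s) (-ℝ‿cong (*-cong q t))) (+-cong (*-cong p t) (*-cong q s)) }
        ; *-assoc = λ { (a +i b) (c +i d) (e +i f) → mk≈
            (R.solve 6 (λ a b c d e f → (a R.:* c R.:- b R.:* d) R.:* e R.:- (a R.:* d R.:+ b R.:* c) R.:* f
               R.:= a R.:* (c R.:* e R.:- d R.:* f) R.:- b R.:* (c R.:* f R.:+ d R.:* e)) ≈-refl a b c d e f)
            (R.solve 6 (λ a b c d e f → (a R.:* c R.:- b R.:* d) R.:* f R.:+ (a R.:* d R.:+ b R.:* c) R.:* e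
               R.:= a R.:* (c R.:* f R.:+ d R.:* e) R.:+ b R.:* (c R.:* e R.:- d R.:* f)) ≈-refl a b c d e f) }
        ; *-identity =
            (λ { (a +i b) → mk≈
              (R.solve 2 (λ a b → R.con 1ℚ R.:* a R.:- R.con 0ℚ R.:* b R.:= a) ≈-refl a b)
              (R.solve 2 (λ a b → R.con 1ℚ R.:* b R.:+ R.con 0ℚ R.:* a R.:= b) ≈-refl a b) })
          , (λ { (a +i b) → mk≈
              (R.solve 2 (λ a b → a R.:* R.con 1ℚ R.:- b R.:* R.con 0ℚ R.:= a) ≈-refl a b)
              (R.solve 2 (λ a b → a R.:* R.con 0ℚ R.:+ b R.:* R.con 1ℚ R.:= b) ≈-refl a b) })
        ; distrib =
            (λ { (a +i b) (c +i d) (e +i f) → mk≈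
              (R.solve 6 (λ a b c d e f → a R.:* (c R.:+ e) R.:- b R.:* (d R.:+ f)
                 R.:= (a R.:* c R.:- b R.:* d) R.:+ (a R.:* e R.:- b R.:* f)) ≈-refl a b c d e f)
              (R.solve 6 (λ a b c d e f → a R.:* (d R.:+ f) R.:+ b R.:* (c R.:+ e)
                 R.:= (a R.:* d R.:+ b R.:* c) R.:+ (a R.:* f R.:+ b R.:* e)) ≈-refl a b c d e f) })
          , (λ { (a +i b) (c +i d) (e +i f) → mk≈
              (R.solve 6 (λ a b c d e f → (c R.:+ e) R.:* a R.:- (d R.:+ f) R.:* b
                 R.:= (c R.:* a R.:- d R.:* b) R.:+ (e R.:* a R.:- f R.:* b)) ≈-refl a b c d e f)
              (R.solve 6 (λ a b c d e f → (c R.:+ e) R.:* b R.:+ (d R.:+ f) R.:* a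
                 R.:= (c R.:* b R.:+ d R.:* a) R.:+ (e R.:* b R.:+ f R.:* a)) ≈-refl a b c d e f) }) }
      ; *-comm = λ { (a +i b) (c +i d) → mk≈
          (R.solve 4 (λ a b c d → a R.:* c R.:- b R.:* d R.:= c R.:* a R.:- d R.:* b) ≈-refl a b c d)
          (R.solve 4 (λ a b c d → a R.:* d R.:+ b R.:* c R.:= c R.:* b R.:+ d R.:* a) ≈-refl a b c d) } } }
    where module r = CommutativeRing ℝ-commutativeRing

  module C = LinearAlgebraProperties ℂ-commutativeRing

  infixl 6 _-ℂ_
  _-ℂ_ : ℂ → ℂ → ℂ
  z -ℂ w = z +ℂ (-ℂ w)

  -- The ℓ¹ norm of the n-th rational approximation. It is subadditive and submultiplicative, and it
  -- avoids square roots, so all estimates of series take place in ℚ.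
  ν : ℕ → ℂ → ℚ
  ν n z = ∣ seq (re z) n ∣ + ∣ seq (im z) n ∣

  0≤ν : ∀ n z → 0ℚ ≤ ν n z
  0≤ν n z = +-nonNeg (0≤∣p∣ (seq (re z) n)) (0≤∣p∣ (seq (im z) n))

  ∣re∣≤ν : ∀ n z → ∣ seq (re z) n ∣ ≤ ν n z
  ∣re∣≤ν n z = subst (_≤ ν n z) (+-identityʳ _) (+-monoʳ-≤ ∣ seq (re z) n ∣ (0≤∣p∣ (seq (im z) n)))

  ∣im∣≤ν : ∀ n z → ∣ seq (im z) n ∣ ≤ ν n z
  ∣im∣≤ν n z = subst (_≤ ν n z) (+-identityˡ _) (+-monoˡ-≤ ∣ seq (im z) n ∣ (0≤∣p∣ (seq (re z) n)))

  ν-+ : ∀ n z w → ν n (z +ℂ w) ≤ ν n z + ν n w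
  ν-+ n z w = ≤-trans (+-mono-≤ (∣p+q∣≤∣p∣+∣q∣ a c) (∣p+q∣≤∣p∣+∣q∣ b d))
    (≤-reflexive (S.solve 4 (λ a b c d → (a :+ c) :+ (b :+ d) := (a :+ b) :+ (c :+ d)) refl (∣ a ∣) (∣ b ∣) (∣ c ∣) (∣ d ∣)))
    where
    a = seq (re z) n
    b = seq (im z) n
    c = seq (re w) n
    d = seq (im w) n

  ν-* : ∀ n z w → ν n (z *ℂ w) ≤ ν n z * ν n w
  ν-* n z w = ≤-trans
    (+-mono-≤
      (≤-trans (∣p-q∣≤∣p∣+∣q∣ (a * c) (b * d)) (≤-reflexive (cong₂ _+_ (∣p*q∣≡∣p∣*∣q∣ a c) (∣p*q∣≡∣p∣*∣q∣ b d))))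
      (≤-trans (∣p+q∣≤∣p∣+∣q∣ (a * d) (b * c)) (≤-reflexive (cong₂ _+_ (∣p*q∣≡∣p∣*∣q∣ a d) (∣p*q∣≡∣p∣*∣q∣ b c)))))
    (≤-reflexive (S.solve 4 (λ a b c d → (a :* c :+ b :* d) :+ (a :* d :+ b :* c) := (a :+ b) :* (c :+ d)) refl
      (∣ a ∣) (∣ b ∣) (∣ c ∣) (∣ d ∣)))
    where
    a = seq (re z) n
    b = seq (im z) n
    c = seq (re w) n
    d = seq (im w) n

  ν-triangle : ∀ n x y z → ν n (x -ℂ z) ≤ ν n (x -ℂ y) + ν n (y -ℂ z)
  ν-triangle n x y z = ≤-trans
    (+-mono-≤ (∣-∣-triangle (seq (re x) n) (seq (re y) n) (seq (re z) n)) (∣-∣-triangle (seq (im x) n) (seq (im y) n) (seq (im z) n)))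
    (≤-reflexive (S.solve 4 (λ a b c d → (a :+ b) :+ (c :+ d) := (a :+ c) :+ (b :+ d)) refl
      (∣ seq (re x) n - seq (re y) n ∣) (∣ seq (re y) n - seq (re z) n ∣) (∣ seq (im x) n - seq (im y) n ∣) (∣ seq (im y) n - seq (im z) n ∣)))

  ν-comm : ∀ n x y → ν n (x -ℂ y) ≡ ν n (y -ℂ x)
  ν-comm n x y = cong₂ _+_ (∣-∣-comm (seq (re x) n) (seq (re y) n)) (∣-∣-comm (seq (im x) n) (seq (im y) n))

  ν-bounded : ∀ z → ∃ λ B → 0ℚ < B × Ev λ n → ν n z ≤ B
  ν-bounded z = let B , 0<B , hB = bounded (re z) ; C , 0<C , hC = bounded (im z) in
    B + C , +-pos 0<B 0<C , Ev-zip (λ n → +-mono-≤) hB hC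

  ≈ℂ⇒ν : ∀ {z w} → z ≈ℂ w → ∀ ε → 0ℚ < ε → Ev λ n → ν n (z -ℂ w) ≤ ε
  ≈ℂ⇒ν (mk≈ p q) ε 0<ε = Ev-zip (λ n a b → <⇒≤ (subst (_ <_) (halves ε) (+-mono-< a b)))
    (≈⇒null p _ (half-pos 0<ε)) (≈⇒null q _ (half-pos 0<ε))

  ν⇒≈ℂ : ∀ {z w} → (∀ ε → 0ℚ < ε → Ev λ n → ν n (z -ℂ w) ≤ ε) → z ≈ℂ w
  ν⇒≈ℂ {z} {w} h = mk≈
    (mk≈ λ ε 0<ε → Ev-map (λ n p → ≤-<-trans (≤-trans (∣re∣≤ν n (z -ℂ w)) p) (half< 0<ε)) (h _ (half-pos 0<ε)))
    (mk≈ λ ε 0<ε → Ev-map (λ n p → ≤-<-trans (≤-trans (∣im∣≤ν n (z -ℂ w)) p) (half< 0<ε)) (h _ (half-pos 0<ε)))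
    where
    half< : ∀ {ε} → 0ℚ < ε → ½ * ε < ε
    half< {ε} 0<ε = <-by (half-pos 0<ε) (S.solve 1 (λ e → e :- con ½ :* e := con ½ :* e) refl ε)

  infix 4 _⇝_
  -- Two layers of approximation: m runs along the sequence, and n, late enough depending on m,
  -- along the rational approximations. `⇝⇒⟶` and `⟶⇒⇝` relate it to the convergence used in the
  -- statement.
  record _⇝_ (u : ℕ → ℂ) (z : ℂ) : Set where
    constructor lim
    field
      approx : ∀ ε → 0ℚ < ε → Ev λ m → Ev λ n → ν n (u m -ℂ z) ≤ ε
  open _⇝_

  ⇝-unique : ∀ {u z w} → u ⇝ z → u ⇝ w → z ≈ℂ w
  ⇝-unique {u} {z} {w} (lim p) (lim q) = ν⇒≈ℂ λ ε 0<ε → Ev-const (λ m x → x) (Ev-zip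
    (λ m a b → Ev-zip (λ n c d → ≤-trans (ν-triangle n z (u m) w)
        (≤-trans (+-monoˡ-≤ _ (≤-reflexive (ν-comm n z (u m)))) (≤-trans (+-mono-≤ c d) (≤-reflexive (halves ε))))) a b)
    (p _ (half-pos 0<ε)) (q _ (half-pos 0<ε)))

  ⇝-cong : ∀ {u v z w} → (∀ m → u m ≈ℂ v m) → z ≈ℂ w → u ⇝ z → v ⇝ w
  ⇝-cong {u} {v} {z} {w} u≈v z≈w (lim p) = lim λ ε 0<ε → Ev-map
    (λ m a → Ev-zip (λ n c d → ≤-trans (ν-triangle n (v m) (u m) w) (≤-trans (+-mono-≤ c d) (≤-reflexive (halves ε))))
      (≈ℂ⇒ν (C.sym (u≈v m)) _ (half-pos 0<ε))
      (Ev-zip (λ n c d → ≤-trans (ν-triangle n (u m) z w) (≤-trans (+-mono-≤ c d) (≤-reflexive (halves (½ * ε)))))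
        a (≈ℂ⇒ν z≈w _ (half-pos (half-pos 0<ε)))))
    (p _ (half-pos (half-pos 0<ε)))

  ⇝-+ : ∀ {u v z w} → u ⇝ z → v ⇝ w → (λ m → u m +ℂ v m) ⇝ (z +ℂ w)
  ⇝-+ {u} {v} {z} {w} (lim p) (lim q) = lim λ ε 0<ε → Ev-zip
    (λ m a b → Ev-zip (λ n c d → ≤-trans (split n m) (≤-trans (+-mono-≤ c d) (≤-reflexive (halves ε)))) a b)
    (p _ (half-pos 0<ε)) (q _ (half-pos 0<ε))
    where
    rearrange : ∀ a b c d → (a + b) - (c + d) ≡ (a - c) + (b - d)
    rearrange = S.solve 4 (λ a b c d → (a :+ b) :- (c :+ d) := (a :- c) :+ (b :- d)) refl
    split : ∀ n m → ν n ((u m +ℂ v m) -ℂ (z +ℂ w)) ≤ ν n (u m -ℂ z) + ν n (v m -ℂ w)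
    split n m = subst (_≤ ν n (u m -ℂ z) + ν n (v m -ℂ w))
      (cong₂ (λ x y → ∣ x ∣ + ∣ y ∣)
        (sym (rearrange (seq (re (u m)) n) (seq (re (v m)) n) (seq (re z) n) (seq (re w) n)))
        (sym (rearrange (seq (im (u m)) n) (seq (im (v m)) n) (seq (im z) n) (seq (im w) n))))
      (ν-+ n (u m -ℂ z) (v m -ℂ w))

  ⇝-const : ∀ z → (λ _ → z) ⇝ z
  ⇝-const z = lim λ ε 0<ε → Ev-all λ m → ≈ℂ⇒ν (≈ℂ-refl {z}) ε 0<ε

  ⇝-0-*-bounded : ∀ {u v : ℕ → ℂ} → (∃ λ B → 0ℚ < B × Ev λ m → Ev λ n → ν n (u m) ≤ B) → v ⇝ ℝ→ℂ 0ℝ → (λ m → u m *ℂ v m) ⇝ ℝ→ℂ 0ℝ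
  ⇝-0-*-bounded {u} {v} (B , 0<B , hB) (lim q) = lim λ ε 0<ε → Ev-zip
    (λ m a b → Ev-zip (λ n c d → ≤-trans (≤-reflexive (minus-0 n (u m *ℂ v m)))
      (≤-trans (ν-* n (u m) (v m)) (≤-trans
        (RationalProperties.*-mono-≤ (0≤ν n (u m)) (0≤ν n (v m)) c (≤-trans (≤-reflexive (sym (minus-0 n (v m)))) d))
        (≤-reflexive (scale ε))))) a b)
    hB (q (ε * inv B) (*-pos 0<ε (inv-pos 0<B)))
    where
    minus-0 : ∀ n z → ν n (z -ℂ ℝ→ℂ 0ℝ) ≡ ν n z
    minus-0 n z = cong₂ (λ x y → ∣ x ∣ + ∣ y ∣) (+-identityʳ (seq (re z) n)) (+-identityʳ (seq (im z) n))
    scale : ∀ ε → B * (ε * inv B) ≡ ε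
    scale ε = trans (S.solve 3 (λ b e i → b :* (e :* i) := (b :* i) :* e) refl B ε (inv B))
      (trans (cong (_* ε) (*-inv (>⇒≢0 0<B))) (*-identityˡ ε))

  ⇝⇒difference : ∀ {u z} → u ⇝ z → (λ m → u m -ℂ z) ⇝ ℝ→ℂ 0ℝ
  ⇝⇒difference {u} {z} p = ⇝-cong (λ _ → ≈ℂ-refl) (C.-‿inverseʳ z) (⇝-+ p (⇝-const (-ℂ z)))

  ⇝-bounded : ∀ {u : ℕ → ℂ} {z} → u ⇝ z → ∃ λ B → 0ℚ < B × Ev λ m → Ev λ n → ν n (u m) ≤ B
  ⇝-bounded {u} {z} (lim p) = 1ℚ + B , +-pos 0<1 (proj₁ (proj₂ (ν-bounded z))) ,
    Ev-map (λ m a → Ev-zip (λ n c d → ≤-trans (bound m n) (+-mono-≤ c d)) a (proj₂ (proj₂ (ν-bounded z)))) (p 1ℚ 0<1)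
    where
    B = proj₁ (ν-bounded z)
    cancel : ∀ a b → (a - b) + b ≡ a
    cancel = S.solve 2 (λ a b → (a :- b) :+ b := a) refl
    bound : ∀ m n → ν n (u m) ≤ ν n (u m -ℂ z) + ν n z
    bound m n = subst (_≤ ν n (u m -ℂ z) + ν n z)
      (cong₂ (λ x y → ∣ x ∣ + ∣ y ∣) (cancel (seq (re (u m)) n) (seq (re z) n)) (cancel (seq (im (u m)) n) (seq (im z) n)))
      (ν-+ n (u m -ℂ z) z)

  ⇝-* : ∀ {u v z w} → u ⇝ z → v ⇝ w → (λ m → u m *ℂ v m) ⇝ (z *ℂ w)
  ⇝-* {u} {v} {z} {w} p q = ⇝-cong
    (λ m → C.trans (C.+-congʳ (C.+-cong (C.distribˡ (u m) (v m) (-ℂ w)) (C.trans (C.*-comm w (u m -ℂ z)) (C.distribʳ w (u m) (-ℂ z)))))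
        (shuffle (u m) (v m)))
    (C.trans (C.+-congʳ (C.+-identityʳ (ℝ→ℂ 0ℝ))) (C.+-identityˡ (z *ℂ w)))
    (⇝-+ (⇝-+ (⇝-0-*-bounded {u} {λ m → v m -ℂ w} (⇝-bounded p) (⇝⇒difference q))
              (⇝-0-*-bounded {λ _ → w} {λ m → u m -ℂ z} (⇝-bounded (⇝-const w)) (⇝⇒difference p)))
         (⇝-const (z *ℂ w)))
    where
    open import Algebra.Properties.Ring C.ring using (-‿distribˡ-*; -‿distribʳ-*)
    shuffle : ∀ a b → ((a *ℂ b +ℂ a *ℂ -ℂ w) +ℂ (a *ℂ w +ℂ -ℂ z *ℂ w)) +ℂ z *ℂ w ≈ℂ a *ℂ b
    shuffle a b = C.begin
      ((a *ℂ b +ℂ a *ℂ -ℂ w) +ℂ (a *ℂ w +ℂ -ℂ z *ℂ w)) +ℂ z *ℂ w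
        C.≈⟨ C.+-assoc _ _ _ ⟩
      (a *ℂ b +ℂ a *ℂ -ℂ w) +ℂ ((a *ℂ w +ℂ -ℂ z *ℂ w) +ℂ z *ℂ w)
        C.≈⟨ C.+-congˡ (C.trans (C.+-assoc _ _ _) (C.trans (C.+-congˡ (C.trans (C.+-congʳ (C.sym (-‿distribˡ-* z w)))
               (C.-‿inverseˡ (z *ℂ w)))) (C.+-identityʳ _))) ⟩
      (a *ℂ b +ℂ a *ℂ -ℂ w) +ℂ a *ℂ w
        C.≈⟨ C.trans (C.+-assoc _ _ _) (C.trans (C.+-congˡ (C.trans (C.+-congʳ (C.sym (-‿distribʳ-* a w)))
               (C.-‿inverseˡ (a *ℂ w)))) (C.+-identityʳ _)) ⟩
      a *ℂ b C.∎

  ⇝-sum : ∀ {k} {u : Fin k → ℕ → ℂ} {z} → (∀ j → u j ⇝ z j) → (λ m → C.sum λ j → u j m) ⇝ C.sum z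
  ⇝-sum {zero}  h = ⇝-const (ℝ→ℂ 0ℝ)
  ⇝-sum {suc k} h = ⇝-+ (h zero) (⇝-sum λ j → h (suc j))

-- Factorials, partial sums and convergent series

module ComplexSeries where

  import Data.Integer.Base as ℤ
  import Data.Integer.Properties as ℤ
  open import Data.Nat.Base using (_!)
  open import Data.Rational.Base
  open import Data.Rational.Properties
  open RationalProperties
  open RationalVectors using (module Q)
  open Q using (_^_)
  open RealProperties
  open ComplexProperties
  private
    module S = ℚ.+-*-Solver
  open S using (_:=_; _:+_; _:*_; _:-_; :-_; con)

  private
    1/n*n : ∀ n .{{_ : ℕ.NonZero n}} → (ℤ.1ℤ / n) * ι n ≡ 1ℚ
    1/n*n (suc m) = trans (cong (ℤ.1ℤ / suc m *_) (sym (ι-/1 (suc m)))) (toℚᵘ-injective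
      (ℚᵘ.≃-trans (toℚᵘ-homo-* (ℤ.1ℤ / suc m) (ℤ.+ suc m / 1))
      (ℚᵘ.≃-trans (ℚᵘ.*-cong (toℚᵘ-fromℚᵘ (mkℚᵘ ℤ.1ℤ m)) (toℚᵘ-fromℚᵘ (mkℚᵘ (ℤ.+ suc m) 0)))
        (*≡* (trans (ℤ.*-identityʳ _) (sym (trans (ℤ.*-identityˡ _)
          (trans (cong (λ z → ℤ.+ suc z) (ℕ.*-identityʳ m)) (sym (ℤ.*-identityˡ _))))))))))
      where
      open import Data.Rational.Unnormalised.Base as ℚᵘ using (mkℚᵘ; *≡*)
      import Data.Rational.Unnormalised.Properties as ℚᵘ

  abstract
    recip! : ℕ → ℚ
    recip! k = (ℤ.1ℤ / (k !)) {{k ℕ.!≢0}}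

    1/!≡recip! : ∀ k → 1/ k ! ≡ ℝ→ℂ (ℚ→ℝ (recip! k))
    1/!≡recip! k = refl

    recip!-0 : recip! 0 ≡ 1ℚ
    recip!-0 = refl

    recip!-suc : ∀ k → recip! (suc k) * ι (suc k) ≡ recip! k
    recip!-suc k = begin
      f′ * ι (suc k)                             ≡⟨ *-identityʳ _ ⟨
      f′ * ι (suc k) * 1ℚ                        ≡⟨ cong (f′ * ι (suc k) *_) (1/n*n (k !) {{k ℕ.!≢0}}) ⟨
      f′ * ι (suc k) * (f * ι (k !))             ≡⟨ S.solve 4 (λ g k f i → g :* k :* (f :* i) := g :* (k :* i) :* f) refl f′ (ι (suc k)) f (ι (k !)) ⟩
      f′ * (ι (suc k) * ι (k !)) * f             ≡⟨ cong (λ z → f′ * z * f) (sym (ι-* (suc k) (k !))) ⟩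
      f′ * ι (suc k !) * f                       ≡⟨ cong (_* f) (1/n*n (suc k !) {{suc k ℕ.!≢0}}) ⟩
      1ℚ * f                                     ≡⟨ *-identityˡ f ⟩
      f                                          ∎
      where
      open ≡-Reasoning
      f f′ : ℚ
      f = recip! k
      f′ = recip! (suc k)

    0<recip! : ∀ k → 0ℚ < recip! k
    0<recip! k = positive⁻¹ _ {{normalize-pos 1 (k !) {{k ℕ.!≢0}}}}

  0≤^ : ∀ {D} → 0ℚ ≤ D → ∀ k → 0ℚ ≤ D ^ k
  0≤^ 0≤D zero    = <⇒≤ 0<1
  0≤^ 0≤D (suc k) = *-nonNeg 0≤D (0≤^ 0≤D k)

  recip!-≤ : ∀ D → 0ℚ ≤ D → ∀ k → D + D ≤ ι (suc k) → D * recip! (suc k) ≤ ½ * recip! k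
  recip!-≤ D 0≤D k 2D≤ = subst (D * recip! (suc k) ≤_) (cong (½ *_) (recip!-suc k))
    (≤-by (*-nonNeg (<⇒≤ 0<½) (*-nonNeg (<⇒≤ (0<recip! (suc k))) (≤⇒0≤- 2D≤)))
      (S.solve 3 (λ d f i → con ½ :* (f :* i) :- d :* f := con ½ :* (f :* (i :- (d :+ d)))) refl D (recip! (suc k)) (ι (suc k))))

  -- Ratio test: once k + 1 ≥ 2D each term is at most half of its predecessor, and C is enlarged to
  -- absorb the finitely many terms before that.
  exp-terms-bound : ∀ D → 0ℚ ≤ D → ∃ λ C → 0ℚ ≤ C × (∀ k → D ^ k * recip! k ≤ C * ½^ k)
  exp-terms-bound D 0≤D = proj₁ (initial M) , proj₁ (proj₂ (initial M)) , all
    where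
    q : ℕ → ℚ
    q k = D ^ k * recip! k
    0≤q : ∀ k → 0ℚ ≤ q k
    0≤q k = *-nonNeg (0≤^ 0≤D k) (<⇒≤ (0<recip! k))
    M = proj₁ (archimedean (D + D))
    initial : ∀ K → ∃ λ C → 0ℚ ≤ C × (∀ k → k ℕ.≤ K → q k ≤ C * ½^ k)
    initial zero    = q 0 , 0≤q 0 , λ { zero _ → ≤-reflexive (sym (*-identityʳ (q 0))) }
    initial (suc K) = C + q (suc K) * i , +-nonNeg 0≤C 0≤qi , λ k k≤ → extend k (ℕ.m≤n⇒m<n∨m≡n k≤)
      where
      C = proj₁ (initial K)
      0≤C = proj₁ (proj₂ (initial K))
      i = inv (½^ (suc K))
      0≤qi : 0ℚ ≤ q (suc K) * i
      0≤qi = *-nonNeg (0≤q (suc K)) (<⇒≤ (inv-pos (0<½^ (suc K))))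
      extend : ∀ k → k ℕ.< suc K ⊎ k ≡ suc K → q k ≤ (C + q (suc K) * i) * ½^ k
      extend k (inj₁ k<) = ≤-trans (proj₂ (proj₂ (initial K)) k (ℕ.≤-pred k<))
        (*-monoʳ-≤′ (½^ k) {C} {C + q (suc K) * i} (<⇒≤ (0<½^ k)) (≤-by 0≤qi (S.solve 2 (λ c x → (c :+ x) :- c := x) refl C (q (suc K) * i))))
      extend _ (inj₂ refl) = begin
        q (suc K)                                ≡⟨ *-identityʳ (q (suc K)) ⟨
        q (suc K) * 1ℚ                           ≡⟨ cong (q (suc K) *_) (*-inv (>⇒≢0 (0<½^ (suc K)))) ⟨
        q (suc K) * (½^ (suc K) * i)             ≤⟨ ≤-by (*-nonNeg 0≤C (<⇒≤ (0<½^ (suc K))))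
          (S.solve 4 (λ c q i h → (c :+ q :* i) :* h :- q :* (h :* i) := c :* h) refl C (q (suc K)) i (½^ (suc K))) ⟩
        (C + q (suc K) * i) * ½^ (suc K)         ∎
        where open ≤-Reasoning
    C = proj₁ (initial M)
    later : ∀ j → q (j ℕ.+ M) ≤ C * ½^ (j ℕ.+ M)
    later zero    = proj₂ (proj₂ (initial M)) M ℕ.≤-refl
    later (suc j) = begin
      D * D ^ k * recip! (suc k)     ≡⟨ S.solve 3 (λ d p f → d :* p :* f := p :* (d :* f)) refl D (D ^ k) (recip! (suc k)) ⟩
      D ^ k * (D * recip! (suc k))   ≤⟨ *-monoˡ-≤′ (D ^ k) (0≤^ 0≤D k) (recip!-≤ D 0≤D k
                                          (≤-trans (proj₂ (archimedean (D + D))) (ι-mono (ℕ.m≤n⇒m≤1+n (ℕ.m≤n+m M j))))) ⟩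
      D ^ k * (½ * recip! k)         ≡⟨ S.solve 3 (λ p h f → p :* (h :* f) := h :* (p :* f)) refl (D ^ k) ½ (recip! k) ⟩
      ½ * q k                        ≤⟨ *-monoˡ-≤′ ½ (<⇒≤ 0<½) (later j) ⟩
      ½ * (C * ½^ k)                 ≡⟨ S.solve 2 (λ c x → con ½ :* (c :* x) := c :* (con ½ :* x)) refl C (½^ k) ⟩
      C * (½ * ½^ k)                 ∎
      where
      open ≤-Reasoning
      k = j ℕ.+ M
    all : ∀ k → q k ≤ C * ½^ k
    all k with ℕ.≤-total k M
    ... | inj₁ k≤M = proj₂ (proj₂ (initial M)) k k≤M
    ... | inj₂ M≤k = subst (λ z → q z ≤ C * ½^ z) (ℕ.m∸n+n≡m M≤k) (later (k ℕ.∸ M))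

  psum : (ℕ → ℂ) → ℕ → ℂ
  psum t zero    = ℝ→ℂ 0ℝ
  psum t (suc m) = psum t m +ℂ t m

  psum-cong : ∀ {s t} → (∀ k → s k ≈ℂ t k) → ∀ m → psum s m ≈ℂ psum t m
  psum-cong eq zero    = ≈ℂ-refl
  psum-cong eq (suc m) = C.+-cong (psum-cong eq m) (eq m)

  psum-head : ∀ t m → psum t (suc m) ≈ℂ t 0 +ℂ psum (t ∘ suc) m
  psum-head t zero    = C.+-comm (ℝ→ℂ 0ℝ) (t 0)
  psum-head t (suc m) = C.trans (C.+-congʳ (psum-head t m)) (C.+-assoc (t 0) (psum (t ∘ suc) m) (t (suc m)))

  sum≈psum : ∀ t m → C.sum {m} (λ k → t (toℕ k)) ≈ℂ psum t m
  sum≈psum t zero    = ≈ℂ-refl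
  sum≈psum t (suc m) = C.trans (C.+-congˡ (sum≈psum (t ∘ suc) m)) (C.sym (psum-head t m))

  psum-* : ∀ c t m → psum (λ k → c *ℂ t k) m ≈ℂ c *ℂ psum t m
  psum-* c t zero    = C.sym (C.zeroʳ c)
  psum-* c t (suc m) = C.trans (C.+-congʳ (psum-* c t m)) (C.sym (C.distribˡ c (psum t m) (t m)))

  -- The right side is the exact geometric sum of C·2⁻ᵏ over m ≤ k < j + m; the subtracted power is
  -- what makes the induction close.
  psum-tail : ∀ n t C m → (∀ k → m ℕ.≤ k → ν n (t k) ≤ C * ½^ k) →
    ∀ j → ν n (psum t (j ℕ.+ m) -ℂ psum t m) ≤ (C + C) * (½^ m - ½^ (j ℕ.+ m))
  psum-tail n t C m h zero = ≤-reflexive (trans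
    (cong₂ (λ x y → ∣ x ∣ + ∣ y ∣) (+-inverseʳ (seq (re (psum t m)) n)) (+-inverseʳ (seq (im (psum t m)) n)))
    (sym (trans (cong ((C + C) *_) (+-inverseʳ (½^ m))) (*-zeroʳ (C + C)))))
  psum-tail n t C m h (suc j) = begin
    ν n ((P +ℂ t k) -ℂ psum t m)                          ≡⟨ cong₂ (λ x y → ∣ x ∣ + ∣ y ∣)
          (swap (seq (re P) n) (seq (re (t k)) n) (seq (re (psum t m)) n)) (swap (seq (im P) n) (seq (im (t k)) n) (seq (im (psum t m)) n)) ⟩
    ν n ((P -ℂ psum t m) +ℂ t k)                          ≤⟨ ν-+ n (P -ℂ psum t m) (t k) ⟩
    ν n (P -ℂ psum t m) + ν n (t k)                       ≤⟨ +-mono-≤ (psum-tail n t C m h j) (h k (ℕ.m≤n+m m j)) ⟩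
    (C + C) * (½^ m - ½^ k) + C * ½^ k                    ≡⟨ S.solve 3 (λ c a b → (c :+ c) :* (a :- b) :+ c :* b := (c :+ c) :* (a :- con ½ :* b)) refl C (½^ m) (½^ k) ⟩
    (C + C) * (½^ m - ½ * ½^ k)                           ∎
    where
    open ≤-Reasoning
    k = j ℕ.+ m
    P = psum t k
    swap : ∀ a b c → (a + b) - c ≡ (a - c) + b
    swap = S.solve 3 (λ a b c → (a :+ b) :- c := (a :- c) :+ b) refl

  psum-tail′ : ∀ n t C → 0ℚ ≤ C → ∀ m → (∀ k → m ℕ.≤ k → ν n (t k) ≤ C * ½^ k) →
    ∀ m′ → m ℕ.≤ m′ → ν n (psum t m′ -ℂ psum t m) ≤ (C + C) * ½^ m
  psum-tail′ n t C 0≤C m h m′ m≤m′ = ≤-trans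
    (subst (λ z → ν n (psum t z -ℂ psum t m) ≤ (C + C) * (½^ m - ½^ z)) (ℕ.m∸n+n≡m m≤m′) (psum-tail n t C m h (m′ ℕ.∸ m)))
    (*-monoˡ-≤′ (C + C) (+-nonNeg 0≤C 0≤C)
      (≤-by (<⇒≤ (0<½^ m′)) (S.solve 2 (λ a b → a :- (a :- b) := b) refl (½^ m) (½^ m′))))

  -- The limit is the diagonal sequence: its n-th term is the n-th term of the n-th partial sum.
  module Limit (t : ℕ → ℂ) (C : ℚ) (0≤C : 0ℚ ≤ C) (N₀ : ℕ) (h : ∀ k n → N₀ ℕ.≤ n → ν n (t k) ≤ C * ½^ k) where

    tail : ∀ {n m m′} → N₀ ℕ.≤ n → m ℕ.≤ m′ → ν n (psum t m′ -ℂ psum t m) ≤ (C + C) * ½^ m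
    tail {n} {m} {m′} N₀≤n = psum-tail′ n t C 0≤C m (λ k _ → h k n N₀≤n) m′

    diagonal-cauchy : (f : ℂ → ℝ) → (∀ n z w → ∣ seq (f z) n - seq (f w) n ∣ ≤ ν n (z -ℂ w)) →
      IsCauchy (λ n → seq (f (psum t n)) n)
    diagonal-cauchy f f≤ν ε 0<ε = N , close
      where
      -- Both diagonal terms are compared with the fixed partial sum of index M: each tail costs
      -- ε/4, and the Cauchy modulus of that single real costs ε/2.
      ε′ = ½ * (½ * ε)
      M = proj₁ (½^-small (C + C) ε′ (half-pos (half-pos 0<ε)))
      cM = cauchy (f (psum t M)) (½ * ε) (half-pos 0<ε)
      N = (M ℕ.⊔ N₀) ℕ.⊔ proj₁ cM
      s : ℕ → ℕ → ℚ
      s m n = seq (f (psum t m)) n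
      near : ∀ n → N ℕ.≤ n → ∣ s n n - s M n ∣ ≤ ε′
      near n N≤n = ≤-trans (f≤ν n (psum t n) (psum t M)) (≤-trans
        (tail (ℕ.m⊔n≤o⇒n≤o M N₀ (ℕ.m⊔n≤o⇒m≤o (M ℕ.⊔ N₀) (proj₁ cM) N≤n)) (ℕ.m⊔n≤o⇒m≤o M N₀ (ℕ.m⊔n≤o⇒m≤o (M ℕ.⊔ N₀) (proj₁ cM) N≤n)))
        (<⇒≤ (proj₂ (½^-small (C + C) ε′ (half-pos (half-pos 0<ε))) M ℕ.≤-refl)))
      close : ∀ m n → N ℕ.≤ m → N ℕ.≤ n → ∣ s m m - s n n ∣ < ε
      close m n N≤m N≤n = begin-strict
        ∣ s m m - s n n ∣                                             ≤⟨ ∣-∣-triangle (s m m) (s M m) (s n n) ⟩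
        ∣ s m m - s M m ∣ + ∣ s M m - s n n ∣                         ≤⟨ +-monoʳ-≤ ∣ s m m - s M m ∣ (∣-∣-triangle (s M m) (s M n) (s n n)) ⟩
        ∣ s m m - s M m ∣ + (∣ s M m - s M n ∣ + ∣ s M n - s n n ∣)   <⟨ +-mono-≤-< (near m N≤m) (+-mono-<-≤
             (proj₂ cM m n (ℕ.m⊔n≤o⇒n≤o (M ℕ.⊔ N₀) (proj₁ cM) N≤m) (ℕ.m⊔n≤o⇒n≤o (M ℕ.⊔ N₀) (proj₁ cM) N≤n))
             (subst (_≤ ε′) (∣-∣-comm (s n n) (s M n)) (near n N≤n))) ⟩
        ε′ + (½ * ε + ε′)                                             ≡⟨ S.solve 1 (λ e → con ½ :* (con ½ :* e) :+ (con ½ :* e :+ con ½ :* (con ½ :* e)) := e) refl ε ⟩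
        ε                                                             ∎
        where open ≤-Reasoning

    total : ℂ
    total = mkℝ (λ n → seq (re (psum t n)) n) (diagonal-cauchy re λ n z w → ∣re∣≤ν n (z -ℂ w))
         +i mkℝ (λ n → seq (im (psum t n)) n) (diagonal-cauchy im λ n z w → ∣im∣≤ν n (z -ℂ w))

    converges : psum t ⇝ total
    converges = lim λ ε 0<ε → let M , small = ½^-small (C + C) ε 0<ε in
      M , λ m M≤m → m ℕ.⊔ N₀ , λ n m≤n → ≤-trans
        (≤-reflexive (ν-comm n (psum t m) (psum t n)))
        (≤-trans (tail (ℕ.m⊔n≤o⇒n≤o m N₀ m≤n) (ℕ.m⊔n≤o⇒m≤o m N₀ m≤n)) (<⇒≤ (small m M≤m)))

-- The complex exponential and its addition formula

module ComplexExponential where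

  open import Algebra.Solver.Ring.AlmostCommutativeRing using (fromCommutativeRing; _-Raw-AlmostCommutative⟶_)
  import Algebra.Solver.Ring
  open import Data.Maybe.Base using (Maybe; just; nothing)
  open import Data.Rational.Base
  open import Data.Rational.Properties
  open RationalProperties
  open RationalVectors using (module Q)
  open RealProperties
  open ComplexProperties
  open ComplexSeries
  private
    module S = ℚ.+-*-Solver
    module R = ℝ-Solver
  open S using (_:=_; _:+_; _:*_; _:-_; :-_; con)

  qℂ : ℚ → ℂ
  qℂ q = ℝ→ℂ (ℚ→ℝ q)

  ≗⇒≈ℂ : ∀ {z w} → (∀ n → seq (re z) n ≡ seq (re w) n) → (∀ n → seq (im z) n ≡ seq (im w) n) → z ≈ℂ w
  ≗⇒≈ℂ p q = mk≈ (pointwise p) (pointwise q)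

  qℂ-cong : ∀ {p q} → p ≡ q → qℂ p ≈ℂ qℂ q
  qℂ-cong refl = ≈ℂ-refl

  qℂ-morphism : +-*-rawRing -Raw-AlmostCommutative⟶ fromCommutativeRing ℂ-commutativeRing
  qℂ-morphism = record
    { ⟦_⟧ = qℂ
    ; +-homo = λ _ _ → ≗⇒≈ℂ (λ _ → refl) (λ _ → refl)
    ; *-homo = λ p q → ≗⇒≈ℂ
        (λ _ → S.solve 2 (λ p q → p :* q := p :* q :- con 0ℚ :* con 0ℚ) refl p q)
        (λ _ → S.solve 2 (λ p q → con 0ℚ := p :* con 0ℚ :+ con 0ℚ :* q) refl p q)
    ; -‿homo = λ _ → ≗⇒≈ℂ (λ _ → refl) (λ _ → refl)
    ; 0-homo = ≈ℂ-refl
    ; 1-homo = ≈ℂ-refl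
    }

  qℂ-weaklyDecidable : ∀ p q → Maybe (qℂ p ≈ℂ qℂ q)
  qℂ-weaklyDecidable p q with p ≟ q
  ... | yes p≡q = just (qℂ-cong p≡q)
  ... | no _    = nothing

  module ℂ-Solver = Algebra.Solver.Ring +-*-rawRing (fromCommutativeRing ℂ-commutativeRing)
    qℂ-morphism qℂ-weaklyDecidable
  private module K = ℂ-Solver

  ν-qℂ : ∀ n {q} → 0ℚ ≤ q → ν n (qℂ q) ≡ q
  ν-qℂ n {q} 0≤q = trans (+-identityʳ ∣ q ∣) (0≤p⇒∣p∣≡p 0≤q)

  ν-recip!-* : ∀ n k z {B} → 0ℚ ≤ B → ν n z ≤ B → ν n (qℂ (recip! k) *ℂ z) ≤ recip! k * B
  ν-recip!-* n k z {B} 0≤B h = ≤-trans (ν-* n (qℂ (recip! k)) z) (RationalProperties.*-mono-≤ (0≤ν n (qℂ (recip! k))) (0≤ν n z)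
    (≤-reflexive (ν-qℂ n {recip! k} (<⇒≤ (0<recip! k)))) h)

  -- Geometric growth of the coefficients is the only hypothesis, so the same convergence serves the
  -- powers of a complex number and the entries of the powers of a matrix.
  module ExpSeries (m : ℕ → ℂ) (D : ℚ) (0≤D : 0ℚ ≤ D) (N₀ : ℕ) (h : ∀ k n → N₀ ℕ.≤ n → ν n (m k) ≤ D Q.^ k) where

    private bound = exp-terms-bound D 0≤D

    open Limit (λ k → qℂ (recip! k) *ℂ m k) (proj₁ bound) (proj₁ (proj₂ bound)) N₀
      (λ k n N₀≤n → ≤-trans (ν-recip!-* n k (m k) (0≤^ 0≤D k) (h k n N₀≤n))
        (≤-trans (≤-reflexive (*-comm (recip! k) (D Q.^ k))) (proj₂ (proj₂ bound) k)))
      public using (total; converges)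

  ν-^ : ∀ n z {B} → ν n z ≤ B → ∀ k → ν n (z C.^ k) ≤ B Q.^ k
  ν-^ n z h zero    = ≤-reflexive (ν-qℂ n {1ℚ} (<⇒≤ 0<1))
  ν-^ n z h (suc k) = ≤-trans (ν-* n z (z C.^ k)) (RationalProperties.*-mono-≤ (0≤ν n z) (0≤ν n (z C.^ k)) h (ν-^ n z h k))

  term : ℂ → ℕ → ℂ
  term z k = qℂ (recip! k) *ℂ z C.^ k

  private
    module TermSeries (z : ℂ) where
      B : ℚ
      B = proj₁ (ν-bounded z)
      0<B : 0ℚ < B
      0<B = proj₁ (proj₂ (ν-bounded z))
      N : ℕ
      N = proj₁ (proj₂ (proj₂ (ν-bounded z)))
      bound : ∀ k n → N ℕ.≤ n → ν n (z C.^ k) ≤ B Q.^ k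
      bound k n N≤n = ν-^ n z {B} (proj₂ (proj₂ (proj₂ (ν-bounded z))) n N≤n) k
      open ExpSeries (λ k → z C.^ k) B (<⇒≤ 0<B) N bound public

  abstract
    cexp : ℂ → ℂ
    cexp z = TermSeries.total z

    cexp-limit : ∀ z → psum (term z) ⇝ cexp z
    cexp-limit z = TermSeries.converges z

  ^-congˡ : ∀ {z w} → z ≈ℂ w → ∀ k → z C.^ k ≈ℂ w C.^ k
  ^-congˡ eq zero    = ≈ℂ-refl
  ^-congˡ eq (suc k) = C.*-cong eq (^-congˡ eq k)

  cexp-cong : ∀ {z w} → z ≈ℂ w → cexp z ≈ℂ cexp w
  cexp-cong {z} {w} eq = ⇝-unique
    (⇝-cong (psum-cong λ k → C.*-congˡ (^-congˡ eq k)) ≈ℂ-refl (cexp-limit z)) (cexp-limit w)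

  cexp-0 : cexp (ℝ→ℂ 0ℝ) ≈ℂ ℝ→ℂ 1ℝ
  cexp-0 = ⇝-unique (cexp-limit (ℝ→ℂ 0ℝ)) (lim λ ε 0<ε → 1 , λ { (suc m) _ → ≈ℂ⇒ν (sums m) ε 0<ε })
    where
    sums : ∀ m → psum (term (ℝ→ℂ 0ℝ)) (suc m) ≈ℂ ℝ→ℂ 1ℝ
    sums zero    = C.trans (C.+-congˡ (C.*-congʳ (qℂ-cong recip!-0)))
      (K.solve 0 (K.con 0ℚ K.:+ K.con 1ℚ K.:* K.con 1ℚ K.:= K.con 1ℚ) ≈ℂ-refl)
    sums (suc m) = C.trans (C.+-cong (sums m)
      (K.solve 2 (λ f z → f K.:* (K.con 0ℚ K.:* z) K.:= K.con 0ℚ) ≈ℂ-refl (qℂ (recip! (suc m))) (ℝ→ℂ 0ℝ C.^ m))) (C.+-identityʳ _)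

  -- The addition formula, through the Cauchy product.

  ExpLike : ℚ → ℂ → (ℕ → ℂ) → Set
  ExpLike c z a = ∀ p → (qℂ c +ℂ qℂ (ι (suc p))) *ℂ a (suc p) ≈ℂ z *ℂ a p

  ExpLike-shift : ∀ {c z a} → ExpLike c z a → ExpLike (1ℚ + c) z (a ∘ suc)
  ExpLike-shift {c} {z} {a} h p = C.trans
    (C.*-congʳ (≗⇒≈ℂ (λ _ → S.solve 2 (λ c i → (con 1ℚ :+ c) :+ (con 1ℚ :+ i) := c :+ (con 1ℚ :+ (con 1ℚ :+ i))) refl c (ι p)) (λ _ → refl)))
    (h (suc p))

  term-ExpLike : ∀ z → ExpLike 0ℚ z (term z)
  term-ExpLike z p = C.trans
    (K.solve 4 (λ i f z w → (K.con 0ℚ K.:+ i) K.:* (f K.:* (z K.:* w)) K.:= z K.:* ((f K.:* i) K.:* w)) ≈ℂ-refl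
      (qℂ (ι (suc p))) (qℂ (recip! (suc p))) z (z C.^ p))
    (C.*-congˡ {z} (C.*-congʳ (C.trans (C.sym (_-Raw-AlmostCommutative⟶_.*-homo qℂ-morphism (recip! (suc p)) (ι (suc p))))
      (qℂ-cong (recip!-suc p)))))

  conv : (ℕ → ℂ) → (ℕ → ℂ) → ℕ → ℂ
  conv a b zero    = a 0 *ℂ b 0
  conv a b (suc l) = a 0 *ℂ b (suc l) +ℂ conv (a ∘ suc) b l

  -- Takes the place of the binomial theorem. The recurrence (p + 1)a(p+1) = z a(p) passes to the
  -- convolution with z + w; the offset c counts the terms already split off from a, and for c = 0
  -- the extra summand disappears.
  conv-ExpLike : ∀ {c z w a b} → ExpLike c z a → ExpLike 0ℚ w b → ∀ l →
    (qℂ c +ℂ qℂ (ι (suc l))) *ℂ conv a b (suc l) ≈ℂ qℂ c *ℂ (a 0 *ℂ b (suc l)) +ℂ (z +ℂ w) *ℂ conv a b l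
  conv-ExpLike {c} {z} {w} {a} {b} ha hb zero = C.begin
    (qℂ c +ℂ i) *ℂ (a 0 *ℂ b 1 +ℂ a 1 *ℂ b 0)
      C.≈⟨ K.solve 6 (λ c i a b a′ b′ → (c K.:+ i) K.:* (a K.:* b′ K.:+ a′ K.:* b)
             K.:= c K.:* (a K.:* b′) K.:+ (((c K.:+ i) K.:* a′) K.:* b K.:+ a K.:* ((K.con 0ℚ K.:+ i) K.:* b′))) ≈ℂ-refl
             (qℂ c) i (a 0) (b 0) (a 1) (b 1) ⟩
    qℂ c *ℂ (a 0 *ℂ b 1) +ℂ (((qℂ c +ℂ i) *ℂ a 1) *ℂ b 0 +ℂ a 0 *ℂ ((qℂ 0ℚ +ℂ i) *ℂ b 1))
      C.≈⟨ C.+-congˡ (C.+-cong (C.*-congʳ (ha 0)) (C.*-congˡ (hb 0))) ⟩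
    qℂ c *ℂ (a 0 *ℂ b 1) +ℂ ((z *ℂ a 0) *ℂ b 0 +ℂ a 0 *ℂ (w *ℂ b 0))
      C.≈⟨ C.+-congˡ (K.solve 4 (λ z w a b → (z K.:* a) K.:* b K.:+ a K.:* (w K.:* b) K.:= (z K.:+ w) K.:* (a K.:* b)) ≈ℂ-refl z w (a 0) (b 0)) ⟩
    qℂ c *ℂ (a 0 *ℂ b 1) +ℂ (z +ℂ w) *ℂ (a 0 *ℂ b 0) C.∎
    where i = qℂ (ι 1)
  conv-ExpLike {c} {z} {w} {a} {b} ha hb (suc l) = C.begin
    (qℂ c +ℂ qℂ (ι (suc (suc l)))) *ℂ (a 0 *ℂ b (suc (suc l)) +ℂ X)
      C.≈⟨ C.*-congʳ (C.+-congˡ ι-suc) ⟩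
    (qℂ c +ℂ (qℂ 1ℚ +ℂ i)) *ℂ (a 0 *ℂ b (suc (suc l)) +ℂ X)
      C.≈⟨ K.solve 5 (λ c i a b x → (c K.:+ (K.con 1ℚ K.:+ i)) K.:* (a K.:* b K.:+ x)
             K.:= c K.:* (a K.:* b) K.:+ (a K.:* ((K.con 0ℚ K.:+ (K.con 1ℚ K.:+ i)) K.:* b) K.:+ ((K.con 1ℚ K.:+ c) K.:+ i) K.:* x)) ≈ℂ-refl
             (qℂ c) i (a 0) (b (suc (suc l))) X ⟩
    qℂ c *ℂ (a 0 *ℂ b (suc (suc l))) +ℂ (a 0 *ℂ ((qℂ 0ℚ +ℂ (qℂ 1ℚ +ℂ i)) *ℂ b (suc (suc l))) +ℂ ((qℂ 1ℚ +ℂ qℂ c) +ℂ i) *ℂ X)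
      C.≈⟨ C.+-congˡ (C.+-cong
             (C.*-congˡ (C.trans (C.*-congʳ (C.+-congˡ (C.sym ι-suc))) (hb (suc l))))
             (C.trans (C.*-congʳ (C.+-congʳ (≗⇒≈ℂ (λ _ → refl) (λ _ → refl))))
               (conv-ExpLike (ExpLike-shift {c} {z} {a} ha) hb l))) ⟩
    qℂ c *ℂ (a 0 *ℂ b (suc (suc l))) +ℂ (a 0 *ℂ (w *ℂ b (suc l)) +ℂ (qℂ (1ℚ + c) *ℂ (a 1 *ℂ b (suc l)) +ℂ (z +ℂ w) *ℂ Y))
      C.≈⟨ C.+-congˡ (C.+-congˡ (C.+-congʳ (C.trans (C.sym (C.*-assoc _ _ _)) (C.*-congʳ
             (C.trans (C.*-congʳ (≗⇒≈ℂ (λ _ → S.solve 1 (λ c → con 1ℚ :+ c := c :+ (con 1ℚ :+ con 0ℚ)) refl c) (λ _ → refl))) (ha 0)))))) ⟩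
    qℂ c *ℂ (a 0 *ℂ b (suc (suc l))) +ℂ (a 0 *ℂ (w *ℂ b (suc l)) +ℂ ((z *ℂ a 0) *ℂ b (suc l) +ℂ (z +ℂ w) *ℂ Y))
      C.≈⟨ C.+-congˡ (K.solve 5 (λ z w a b y → a K.:* (w K.:* b) K.:+ ((z K.:* a) K.:* b K.:+ (z K.:+ w) K.:* y)
             K.:= (z K.:+ w) K.:* (a K.:* b K.:+ y)) ≈ℂ-refl z w (a 0) (b (suc l)) Y) ⟩
    qℂ c *ℂ (a 0 *ℂ b (suc (suc l))) +ℂ (z +ℂ w) *ℂ (a 0 *ℂ b (suc l) +ℂ Y) C.∎
    where
    i = qℂ (ι (suc l))
    X = conv (a ∘ suc) b (suc l)
    Y = conv (a ∘ suc) b l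
    ι-suc : qℂ (ι (suc (suc l))) ≈ℂ qℂ 1ℚ +ℂ i
    ι-suc = ≗⇒≈ℂ (λ _ → refl) (λ _ → refl)

  term-+ : ∀ z w l → term (z +ℂ w) l ≈ℂ conv (term z) (term w) l
  term-+ z w zero = C.trans (C.*-congʳ (qℂ-cong recip!-0)) (C.sym (C.trans
    (C.*-cong (C.*-congʳ (qℂ-cong recip!-0)) (C.*-congʳ (qℂ-cong recip!-0)))
    (K.solve 0 ((K.con 1ℚ K.:* K.con 1ℚ) K.:* (K.con 1ℚ K.:* K.con 1ℚ) K.:= K.con 1ℚ K.:* K.con 1ℚ) ≈ℂ-refl)))
  term-+ z w (suc l) = C.trans (C.sym (cancel (term (z +ℂ w) (suc l)))) (C.trans
    (C.*-congˡ {qℂ (inv i)} (C.trans (term-ExpLike (z +ℂ w) l)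
      (C.trans (C.*-congˡ {z +ℂ w} (term-+ z w l)) (C.sym (C.trans
        (conv-ExpLike (term-ExpLike z) (term-ExpLike w) l)
        (C.trans (C.+-congʳ (C.zeroˡ _)) (C.+-identityˡ _)))))))
    (cancel (conv (term z) (term w) (suc l))))
    where
    i = ι (suc l)
    cancel : ∀ x → qℂ (inv i) *ℂ ((qℂ 0ℚ +ℂ qℂ i) *ℂ x) ≈ℂ x
    cancel x = C.trans (C.sym (C.*-assoc _ _ x)) (C.trans (C.*-congʳ (C.trans (C.*-congˡ (C.+-identityˡ (qℂ i)))
      (C.trans (C.sym (_-Raw-AlmostCommutative⟶_.*-homo qℂ-morphism (inv i) i))
        (qℂ-cong (trans (*-comm (inv i) i) (*-inv (>⇒≢0 (0<ι l)))))))) (C.*-identityˡ x))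

  psum-conv : ∀ a b n → psum (conv a b) (suc n) ≈ℂ a 0 *ℂ psum b (suc n) +ℂ psum (conv (a ∘ suc) b) n
  psum-conv a b zero = K.solve 2 (λ a b → K.con 0ℚ K.:+ a K.:* b K.:= a K.:* (K.con 0ℚ K.:+ b) K.:+ K.con 0ℚ) ≈ℂ-refl (a 0) (b 0)
  psum-conv a b (suc n) = C.trans (C.+-congʳ (psum-conv a b n))
    (K.solve 5 (λ a B c b d → (a K.:* B K.:+ c) K.:+ (a K.:* b K.:+ d) K.:= a K.:* (B K.:+ b) K.:+ (c K.:+ d)) ≈ℂ-refl
      (a 0) (psum b (suc n)) (psum (conv (a ∘ suc) b) n) (b (suc n)) (conv (a ∘ suc) b n))

  -- The part of the product of the N-th partial sums that lies outside the triangle p + q < N.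
  corner : (ℕ → ℂ) → (ℕ → ℂ) → ℕ → ℕ → ℂ
  corner a b N zero    = ℝ→ℂ 0ℝ
  corner a b N (suc n) = a 0 *ℂ (psum b N -ℂ psum b (suc n)) +ℂ corner (a ∘ suc) b N n

  corner-spec : ∀ a b N n → psum a n *ℂ psum b N ≈ℂ psum (conv a b) n +ℂ corner a b N n
  corner-spec a b N zero    = C.trans (C.zeroˡ (psum b N)) (C.sym (C.+-identityˡ (ℝ→ℂ 0ℝ)))
  corner-spec a b N (suc n) = C.begin
    psum a (suc n) *ℂ B                                    C.≈⟨ C.*-congʳ (psum-head a n) ⟩
    (a 0 +ℂ psum a′ n) *ℂ B                                C.≈⟨ C.distribʳ B (a 0) (psum a′ n) ⟩
    a 0 *ℂ B +ℂ psum a′ n *ℂ B                             C.≈⟨ C.+-congˡ (corner-spec a′ b N n) ⟩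
    a 0 *ℂ B +ℂ (psum (conv a′ b) n +ℂ corner a′ b N n)    C.≈⟨ K.solve 5 (λ a B B′ c d → a K.:* B K.:+ (c K.:+ d)
         K.:= (a K.:* B′ K.:+ c) K.:+ (a K.:* (B K.:- B′) K.:+ d)) ≈ℂ-refl (a 0) B (psum b (suc n)) (psum (conv a′ b) n) (corner a′ b N n) ⟩
    (a 0 *ℂ psum b (suc n) +ℂ psum (conv a′ b) n) +ℂ corner a b N (suc n)
                                                           C.≈⟨ C.+-congʳ (psum-conv a b n) ⟨
    psum (conv a b) (suc n) +ℂ corner a b N (suc n)        C.∎
    where
    a′ = a ∘ suc
    B = psum b N

  -- Row i pairs a term of size 4⁻ⁱ with a tail of b of size 4⁻⁽ᴺ⁻ⁱ⁾, so every row costs the same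
  -- multiple of 4⁻ᴺ. In the induction a is the original sequence shifted by i.
  corner-bound : ∀ k C₀ → 0ℚ ≤ C₀ → ∀ b → (∀ p → ν k (b p) ≤ C₀ * ½^ p * ½^ p) →
    ∀ n i a N → i ℕ.+ n ≡ N → (∀ p → ν k (a p) ≤ C₀ * ½^ (i ℕ.+ p) * ½^ (i ℕ.+ p)) →
    ν k (corner a b N n) ≤ ι n * ((C₀ * C₀ + C₀ * C₀) * (½^ N * ½^ N))
  corner-bound k C₀ 0≤C b hb zero    i a N eq ha = ≤-reflexive (trans (ν-qℂ k {0ℚ} ≤-refl) (sym (*-zeroˡ ((C₀ * C₀ + C₀ * C₀) * (½^ N * ½^ N)))))
  corner-bound k C₀ 0≤C b hb (suc n) i a N eq ha = begin
    ν k (a 0 *ℂ (psum b N -ℂ psum b (suc n)) +ℂ corner a′ b N n)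
      ≤⟨ ν-+ k (a 0 *ℂ (psum b N -ℂ psum b (suc n))) (corner a′ b N n) ⟩
    ν k (a 0 *ℂ (psum b N -ℂ psum b (suc n))) + ν k (corner a′ b N n)
      ≤⟨ +-mono-≤ first (corner-bound k C₀ 0≤C b hb n (suc i) a′ N (trans (sym (ℕ.+-suc i n)) eq)
           λ p → subst (λ z → ν k (a (suc p)) ≤ C₀ * ½^ z * ½^ z) (ℕ.+-suc i p) (ha (suc p))) ⟩
    E + ι n * E
      ≡⟨ S.solve 2 (λ e i → e :+ i :* e := (con 1ℚ :+ i) :* e) refl E (ι n) ⟩
    ι (suc n) * E ∎
    where
    open ≤-Reasoning
    a′ = a ∘ suc
    E = (C₀ * C₀ + C₀ * C₀) * (½^ N * ½^ N)
    s = ½^ (suc n)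
    0≤s : 0ℚ ≤ s
    0≤s = <⇒≤ (0<½^ (suc n))
    b-tail : ν k (psum b N -ℂ psum b (suc n)) ≤ (C₀ * s + C₀ * s) * s
    b-tail = psum-tail′ k b (C₀ * s) (*-nonNeg 0≤C 0≤s) (suc n)
      (λ p n<p → ≤-trans (hb p) (*-monoʳ-≤′ (½^ p) (<⇒≤ (0<½^ p)) (*-monoˡ-≤′ C₀ 0≤C (½^-anti n<p))))
      N (subst (suc n ℕ.≤_) eq (ℕ.m≤n+m (suc n) i))
    a₀ : ν k (a 0) ≤ C₀ * ½^ i * ½^ i
    a₀ = subst (λ z → ν k (a 0) ≤ C₀ * ½^ z * ½^ z) (ℕ.+-identityʳ i) (ha 0)
    first : ν k (a 0 *ℂ (psum b N -ℂ psum b (suc n))) ≤ E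
    first = begin
      ν k (a 0 *ℂ (psum b N -ℂ psum b (suc n)))            ≤⟨ ν-* k (a 0) (psum b N -ℂ psum b (suc n)) ⟩
      ν k (a 0) * ν k (psum b N -ℂ psum b (suc n))         ≤⟨ RationalProperties.*-mono-≤ (0≤ν k (a 0)) (0≤ν k (psum b N -ℂ psum b (suc n))) a₀ b-tail ⟩
      C₀ * ½^ i * ½^ i * ((C₀ * s + C₀ * s) * s)           ≡⟨ S.solve 3 (λ c i s → c :* i :* i :* ((c :* s :+ c :* s) :* s)
                                                                := (c :* c :+ c :* c) :* ((i :* s) :* (i :* s))) refl C₀ (½^ i) s ⟩
      (C₀ * C₀ + C₀ * C₀) * ((½^ i * s) * (½^ i * s))      ≡⟨ cong (λ z → (C₀ * C₀ + C₀ * C₀) * (z * z))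
                                                                (trans (sym (½^-+ i (suc n))) (cong ½^ eq)) ⟩
      E                                                    ∎

  -- The rate is 4⁻ᵏ rather than 2⁻ᵏ to absorb the number of terms of the corner.
  term-bound : ∀ B → 0ℚ ≤ B → ∃ λ C₀ → 0ℚ ≤ C₀ × (∀ n z → ν n z ≤ B → ∀ p → ν n (term z p) ≤ C₀ * ½^ p * ½^ p)
  term-bound B 0≤B = let C₀ , 0≤C , h = exp-terms-bound (B + B) (+-nonNeg 0≤B 0≤B) in
    C₀ , 0≤C , λ n z νz≤B p → ≤-trans (ν-recip!-* n p (z C.^ p) (0≤^ 0≤B p) (ν-^ n z {B} νz≤B p)) (begin
      recip! p * B Q.^ p                          ≡⟨ cong (recip! p *_) (halve p) ⟩
      recip! p * ((B + B) Q.^ p * ½^ p)           ≡⟨ S.solve 3 (λ f d h → f :* (d :* h) := (d :* f) :* h) refl (recip! p) ((B + B) Q.^ p) (½^ p) ⟩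
      (B + B) Q.^ p * recip! p * ½^ p             ≤⟨ *-monoʳ-≤′ (½^ p) (<⇒≤ (0<½^ p)) (h p) ⟩
      C₀ * ½^ p * ½^ p                            ∎)
    where
    open ≤-Reasoning
    halve : ∀ p → B Q.^ p ≡ (B + B) Q.^ p * ½^ p
    halve zero    = refl
    halve (suc p) = trans (cong (B *_) (halve p))
      (S.solve 3 (λ b d h → b :* (d :* h) := ((b :+ b) :* d) :* (con ½ :* h)) refl B ((B + B) Q.^ p) (½^ p))

  cexp-+ : ∀ z w → cexp (z +ℂ w) ≈ℂ cexp z *ℂ cexp w
  cexp-+ z w = C.sym (⇝-unique (⇝-* (cexp-limit z) (cexp-limit w))
    (⇝-cong
      (λ n → C.sym (C.trans (corner-spec (term z) (term w) n n) (C.+-congʳ (psum-cong (λ l → C.sym (term-+ z w l)) n))))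
      (C.+-identityʳ _) (⇝-+ (cexp-limit (z +ℂ w)) corner⇝0)))
    where
    Bz = ν-bounded z
    Bw = ν-bounded w
    B = proj₁ Bz + proj₁ Bw
    0≤B : 0ℚ ≤ B
    0≤B = +-nonNeg (<⇒≤ (proj₁ (proj₂ Bz))) (<⇒≤ (proj₁ (proj₂ Bw)))
    tb = term-bound B 0≤B
    C₀ = proj₁ tb
    K₀ = C₀ * C₀ + C₀ * C₀
    small : Ev λ n → (ν n z ≤ B) × (ν n w ≤ B)
    small = Ev-zip (λ n p q →
        ≤-trans p (≤-by (<⇒≤ (proj₁ (proj₂ Bw))) (S.solve 2 (λ a b → (a :+ b) :- a := b) refl (proj₁ Bz) (proj₁ Bw))) ,
        ≤-trans q (≤-by (<⇒≤ (proj₁ (proj₂ Bz))) (S.solve 2 (λ a b → (a :+ b) :- b := a) refl (proj₁ Bz) (proj₁ Bw))))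
      (proj₂ (proj₂ Bz)) (proj₂ (proj₂ Bw))
    bound : ∀ N k → ν k z ≤ B → ν k w ≤ B → ν k (corner (term z) (term w) N N) ≤ K₀ * ½^ N
    bound N k hz hw = begin
      ν k (corner (term z) (term w) N N)     ≤⟨ corner-bound k C₀ 0≤C (term w) (proj₂ (proj₂ tb) k w hw) N 0 (term z) N refl (proj₂ (proj₂ tb) k z hz) ⟩
      ι N * (K₀ * (½^ N * ½^ N))             ≡⟨ S.solve 3 (λ i c h → i :* (c :* (h :* h)) := (c :* h) :* (i :* h)) refl (ι N) K₀ (½^ N) ⟩
      (K₀ * ½^ N) * (ι N * ½^ N)             ≤⟨ *-monoˡ-≤′ (K₀ * ½^ N) (*-nonNeg 0≤K (<⇒≤ (0<½^ N)))
                                                  (≤-trans (*-monoʳ-≤′ (½^ N) (<⇒≤ (0<½^ N)) (ι-mono (ℕ.n≤1+n N))) (ι*½^≤1 N)) ⟩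
      (K₀ * ½^ N) * 1ℚ                       ≡⟨ *-identityʳ _ ⟩
      K₀ * ½^ N                              ∎
      where
      open ≤-Reasoning
      0≤C : 0ℚ ≤ C₀
      0≤C = proj₁ (proj₂ tb)
      0≤K : 0ℚ ≤ K₀
      0≤K = +-nonNeg (*-nonNeg 0≤C 0≤C) (*-nonNeg 0≤C 0≤C)
    corner⇝0 : (λ n → corner (term z) (term w) n n) ⇝ ℝ→ℂ 0ℝ
    corner⇝0 = lim λ ε 0<ε → let M , h = ½^-small K₀ ε 0<ε in M , λ N M≤N →
      Ev-map (λ k p → ≤-trans (≤-reflexive (cong₂ (λ x y → ∣ x ∣ + ∣ y ∣)
          (+-identityʳ (seq (re (corner (term z) (term w) N N)) k)) (+-identityʳ (seq (im (corner (term z) (term w) N N)) k))))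
        (≤-trans (bound N k (proj₁ p) (proj₂ p)) (<⇒≤ (h N M≤N)))) small

-- The character e(x) = exp(-ix) and its discrete kernel

module UnitCircle where

  import Algebra.Definitions.RawSemiring as RawSemiringOps
  open import Data.Rational.Base
  open import Data.Rational.Properties
  open RationalProperties
  open RealProperties
  open ComplexProperties
  open ComplexSeries
  open ComplexExponential
  private
    module S = ℚ.+-*-Solver
    module R = ℝ-Solver
    module K = ℂ-Solver
  open S using (_:=_; _:+_; _:*_; _:-_; :-_; con)

  conj : ℂ → ℂ
  conj z = re z +i (-ℝ im z)

  conj-cong : ∀ {z w} → z ≈ℂ w → conj z ≈ℂ conj w
  conj-cong (mk≈ p q) = mk≈ p (-ℝ‿cong q)

  conj-* : ∀ z w → conj (z *ℂ w) ≈ℂ conj z *ℂ conj w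
  conj-* (a +i b) (c +i d) = mk≈
    (R.solve 4 (λ a b c d → a R.:* c R.:- b R.:* d R.:= a R.:* c R.:- R.:- b R.:* R.:- d) ≈-refl a b c d)
    (R.solve 4 (λ a b c d → R.:- (a R.:* d R.:+ b R.:* c) R.:= a R.:* R.:- d R.:+ R.:- b R.:* c) ≈-refl a b c d)

  conj-qℂ : ∀ q → conj (qℂ q) ≈ℂ qℂ q
  conj-qℂ q = ≗⇒≈ℂ (λ _ → refl) (λ _ → refl)

  conj-^ : ∀ z k → conj (z C.^ k) ≈ℂ conj z C.^ k
  conj-^ z zero    = conj-qℂ 1ℚ
  conj-^ z (suc k) = C.trans (conj-* z (z C.^ k)) (C.*-congˡ {conj z} (conj-^ z k))

  conj-psum : ∀ t m → conj (psum t m) ≈ℂ psum (conj ∘ t) m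
  conj-psum t zero    = conj-qℂ 0ℚ
  conj-psum t (suc m) = C.trans
    (≗⇒≈ℂ (λ _ → refl) λ n → neg-distrib-+ (seq (im (psum t m)) n) (seq (im (t m)) n)) (C.+-congʳ (conj-psum t m))

  ⇝-conj : ∀ {u z} → u ⇝ z → (conj ∘ u) ⇝ conj z
  ⇝-conj {u} {z} (lim p) = lim λ ε 0<ε → Ev-map (λ m → Ev-map λ n → ≤-trans (≤-reflexive (same m n))) (p ε 0<ε)
    where
    same : ∀ m n → ν n (conj (u m) -ℂ conj z) ≡ ν n (u m -ℂ z)
    same m n = cong (∣ seq (re (u m)) n - seq (re z) n ∣ +_) (trans
      (cong ∣_∣ (S.solve 2 (λ a b → (:- a) :- (:- b) := :- (a :- b)) refl (seq (im (u m)) n) (seq (im z) n)))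
      (∣-p∣≡∣p∣ (seq (im (u m)) n - seq (im z) n)))

  cexp-conj : ∀ z → cexp (conj z) ≈ℂ conj (cexp z)
  cexp-conj z = ⇝-unique (cexp-limit (conj z)) (⇝-cong (λ m → C.trans (conj-psum (term z) m) (psum-cong terms m)) ≈ℂ-refl
    (⇝-conj (cexp-limit z)))
    where
    terms : ∀ k → conj (term z k) ≈ℂ term (conj z) k
    terms k = C.trans (conj-* (qℂ (recip! k)) (z C.^ k)) (C.*-cong (conj-qℂ (recip! k)) (conj-^ z k))

  *-conj : ∀ z → z *ℂ conj z ≈ℂ ℝ→ℂ (normSq z)
  *-conj (a +i b) = mk≈
    (R.solve 2 (λ a b → a R.:* a R.:- b R.:* R.:- b R.:= a R.:* a R.:+ b R.:* b) ≈-refl a b)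
    (R.solve 2 (λ a b → a R.:* R.:- b R.:+ b R.:* a R.:= R.con 0ℚ) ≈-refl a b)

  -- e x is the exponential of − i x.
  e : ℝ → ℂ
  e x = cexp (0ℝ +i (-ℝ x))

  1ℂ : ℂ
  1ℂ = ℝ→ℂ 1ℝ

  e-cong : ∀ {x y} → x ≈ℝ y → e x ≈ℂ e y
  e-cong x≈y = cexp-cong (mk≈ ≈-refl (-ℝ‿cong x≈y))

  e-0 : e 0ℝ ≈ℂ 1ℂ
  e-0 = C.trans (cexp-cong (≗⇒≈ℂ (λ _ → refl) (λ _ → refl))) cexp-0

  e-+ : ∀ x y → e (x +ℝ y) ≈ℂ e x *ℂ e y
  e-+ x y = C.trans (cexp-cong (≗⇒≈ℂ (λ _ → refl) λ n → neg-distrib-+ (seq x n) (seq y n)))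
    (cexp-+ (0ℝ +i (-ℝ x)) (0ℝ +i (-ℝ y)))

  e-neg : ∀ x → e (-ℝ x) ≈ℂ conj (e x)
  e-neg x = cexp-conj (0ℝ +i (-ℝ x))

  e-*-neg : ∀ x → e x *ℂ e (-ℝ x) ≈ℂ 1ℂ
  e-*-neg x = C.trans (C.sym (e-+ x (-ℝ x))) (C.trans (e-cong (pointwise λ n → +-inverseʳ (seq x n))) e-0)

  -- |sin x − x| ≤ |x| / 2 for |x| ≤ 1, so the kernel of e is discrete.

  recip!-≤-½^ : ∀ k → recip! (suc k) ≤ (1ℚ + 1ℚ) * ½^ (suc k)
  recip!-≤-½^ zero    = ≤-reflexive recip!-1
    where
    recip!-1 : recip! 1 ≡ (1ℚ + 1ℚ) * ½^ 1
    recip!-1 = trans (sym (*-identityʳ (recip! 1))) (trans (recip!-suc 0) recip!-0)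
  recip!-≤-½^ (suc k) = ≤-trans (≤-reflexive (sym (*-identityˡ (recip! (suc (suc k))))))
    (≤-trans (recip!-≤ 1ℚ (<⇒≤ 0<1) (suc k) (ι-mono {2} {suc (suc k)} (s≤s (s≤s z≤n))))
    (≤-trans (*-monoˡ-≤′ ½ (<⇒≤ 0<½) (recip!-≤-½^ k)) (≤-reflexive
      (S.solve 1 (λ h → con ½ :* ((con 1ℚ :+ con 1ℚ) :* h) := (con 1ℚ :+ con 1ℚ) :* (con ½ :* h)) refl (½^ (suc k))))))

  private
    module _ (x : ℝ) where
      z : ℂ
      z = 0ℝ +i (-ℝ x)

      -- The terms of order 0 and 2 are real, so up to order 2 the imaginary part consists of the
      -- linear term alone.
      initial : ∀ n → seq (im (psum (term z) 3)) n ≡ - seq x n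
      initial n = trans (S.solve 4 (λ r₀ r₁ r₂ x →
          let y = :- x ; O = con 0ℚ ; I = con 1ℚ
              re₁ = O :* I :- y :* O ; im₁ = O :* O :+ y :* I
              re₂ = O :* re₁ :- y :* im₁ ; im₂ = O :* im₁ :+ y :* re₁
          in ((O :+ (r₀ :* O :+ O :* I)) :+ (r₁ :* im₁ :+ O :* re₁)) :+ (r₂ :* im₂ :+ O :* re₂) := r₁ :* y)
          refl (recip! 0) (recip! 1) (recip! 2) (seq x n))
        (trans (cong (_* - seq x n) (trans (sym (*-identityʳ (recip! 1))) (trans (recip!-suc 0) recip!-0)))
          (*-identityˡ (- seq x n)))

      term-small : ∀ n → ∣ seq x n ∣ ≤ 1ℚ → ∀ k → ν n (term z (suc k)) ≤ ((1ℚ + 1ℚ) * ∣ seq x n ∣) * ½^ (suc k)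
      term-small n h k = begin
        ν n (qℂ (recip! (suc k)) *ℂ z C.^ suc k)       ≤⟨ ν-recip!-* n (suc k) (z C.^ suc k) (0≤∣p∣ (seq x n)) (power k) ⟩
        recip! (suc k) * ∣ seq x n ∣                   ≤⟨ *-monoʳ-≤′ ∣ seq x n ∣ (0≤∣p∣ (seq x n)) (recip!-≤-½^ k) ⟩
        (1ℚ + 1ℚ) * ½^ (suc k) * ∣ seq x n ∣           ≡⟨ S.solve 2 (λ h a → (con 1ℚ :+ con 1ℚ) :* h :* a := ((con 1ℚ :+ con 1ℚ) :* a) :* h) refl (½^ (suc k)) (∣ seq x n ∣) ⟩
        ((1ℚ + 1ℚ) * ∣ seq x n ∣) * ½^ (suc k)         ∎
        where
        open ≤-Reasoning
        νz : ν n z ≡ ∣ seq x n ∣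
        νz = trans (+-identityˡ _) (∣-p∣≡∣p∣ (seq x n))
        power : ∀ k → ν n (z C.^ suc k) ≤ ∣ seq x n ∣
        power zero    = ≤-trans (ν-* n z 1ℂ) (≤-reflexive (trans (cong₂ _*_ νz (ν-qℂ n {1ℚ} (<⇒≤ 0<1))) (*-identityʳ _)))
        power (suc k) = ≤-trans (ν-* n z (z C.^ suc k)) (≤-trans
          (RationalProperties.*-mono-≤ (0≤ν n z) (0≤ν n (z C.^ suc k)) (≤-trans (≤-reflexive νz) h) (power k)) (≤-reflexive (*-identityˡ _)))

      -- From order 3 on the terms are at most 2|x|·2⁻ᵏ and add up to at most 4|x|·2⁻³ = |x|/2.
      -- Three is the first order for which this leaves half of the linear term.
      half-bound : ∀ n → ∣ seq x n ∣ ≤ 1ℚ → ∀ m → 3 ℕ.≤ m → ½ * ∣ seq x n ∣ ≤ ν n (psum (term z) m -ℂ 1ℂ)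
      half-bound n h m 3≤m = ≤-by (≤⇒0≤- (≤-trans (∣-∣-triangle (- seq x n) s 0ℚ) sum-bound)) rearrange
        where
        a = ∣ seq x n ∣
        s = seq (im (psum (term z) m)) n
        V = ν n (psum (term z) m -ℂ 1ℂ)
        rearrange : V - ½ * a ≡ (½ * a + V) - ∣ - seq x n - 0ℚ ∣
        rearrange = trans (S.solve 2 (λ v a → v :- con ½ :* a := (con ½ :* a :+ v) :- a) refl V a)
          (cong (λ y → (½ * a + V) - y) (sym (trans (cong ∣_∣ (+-identityʳ (- seq x n))) (∣-p∣≡∣p∣ (seq x n)))))
        tail-bound : ν n (psum (term z) m -ℂ psum (term z) 3) ≤ ½ * a
        tail-bound = ≤-trans (psum-tail′ n (term z) ((1ℚ + 1ℚ) * a) (*-nonNeg (<⇒≤ (+-pos 0<1 0<1)) (0≤∣p∣ (seq x n))) 3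
            (λ { (suc k) _ → term-small n h k }) m 3≤m)
          (≤-reflexive (S.solve 1 (λ a → ((con 1ℚ :+ con 1ℚ) :* a :+ (con 1ℚ :+ con 1ℚ) :* a) :* con (½^ 3) := con ½ :* a) refl a))
        sum-bound : ∣ - seq x n - s ∣ + ∣ s - 0ℚ ∣ ≤ ½ * a + V
        sum-bound = +-mono-≤
          (≤-trans (≤-reflexive (trans (∣-∣-comm (- seq x n) s) (cong (λ y → ∣ s - y ∣) (sym (initial n)))))
            (≤-trans (∣im∣≤ν n (psum (term z) m -ℂ psum (term z) 3)) tail-bound))
          (∣im∣≤ν n (psum (term z) m -ℂ 1ℂ))

  e-discrete : ∀ x → Ev (λ n → ∣ seq x n ∣ < 1ℚ) → e x ≈ℂ 1ℂ → x ≈ℝ 0ℝ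
  e-discrete x small ex≈1 = small⇒≈0 λ ε 0<ε →
    let M , p = _⇝_.approx (⇝-cong (λ _ → ≈ℂ-refl) ex≈1 (cexp-limit (z x))) (½ * (½ * ε)) (half-pos (half-pos 0<ε))
        m = 3 ℕ.⊔ M
    in Ev-zip (λ n lt νn → shrink 0<ε (≤-trans (half-bound x n (<⇒≤ lt) m (ℕ.m≤m⊔n 3 M)) νn)) small (p m (ℕ.m≤n⊔m 3 M))
    where
    shrink : ∀ {ε a} → 0ℚ < ε → ½ * a ≤ ½ * (½ * ε) → a < ε
    shrink {ε} {a} 0<ε h = ≤-<-trans (*-cancelˡ-≤-pos ½ h) (<-by (half-pos 0<ε) (S.solve 1 (λ e → e :- con ½ :* e := con ½ :* e) refl ε))

-- Convergence of the matrix exponential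

module MatrixExponential where

  import Algebra.Definitions.RawSemiring as RawSemiringOps
  open import Data.Rational.Base
  open import Data.Rational.Properties
  open RationalProperties
  open RationalVectors using (module Q)
  open RealProperties
  open ComplexProperties
  open ComplexSeries
  open ComplexExponential
  open UnitCircle
  private
    module S = ℚ.+-*-Solver
    module K = ℂ-Solver
  open S using (_:=_; _:+_; _:*_; _:-_; :-_; con)

  ⇝⇒⟶ : ∀ {u z} → u ⇝ z → u ⟶ℂ z
  ⇝⇒⟶ {u} {z} (lim p) = part re ∣re∣≤ν refl , part im ∣im∣≤ν refl
    where
    part : (f : ℂ → ℝ) → (∀ n w → ∣ seq (f w) n ∣ ≤ ν n w) →
      (∀ {n m} → seq (f (u m -ℂ z)) n ≡ seq (f (u m)) n - seq (f z) n) → (λ n → f (u n)) ⟶ℝ f z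
    part f f≤ν f-sub ε (mk< g 0<g N₀ h) with p (½ * g) (half-pos 0<g)
    ... | N , close = N , λ m N≤m →
        mk< (½ * g) (half-pos 0<g) (N₀ ℕ.⊔ proj₁ (close m N≤m)) (λ n q → below m n (h n (ℕ.m⊔n≤o⇒m≤o N₀ _ q))
          (≤-trans (f≤ν n (u m -ℂ z)) (proj₂ (close m N≤m) n (ℕ.m⊔n≤o⇒n≤o N₀ _ q)))) ,
        mk< (½ * g) (half-pos 0<g) (N₀ ℕ.⊔ proj₁ (close m N≤m)) (λ n q → above m n (h n (ℕ.m⊔n≤o⇒m≤o N₀ _ q))
          (≤-trans (f≤ν n (u m -ℂ z)) (proj₂ (close m N≤m) n (ℕ.m⊔n≤o⇒n≤o N₀ _ q))))
      where
      below : ∀ m n → 0ℚ + g ≤ seq ε n → ∣ seq (f (u m -ℂ z)) n ∣ ≤ ½ * g →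
        (seq (f z) n + - seq ε n) + ½ * g ≤ seq (f (u m)) n
      below m n g≤ε d≤ = ≤-by (+-nonNeg (≤⇒0≤- g≤ε) (≤⇒0≤- (≤-trans (-p≤∣p∣ _) d≤)))
        (trans (S.solve 4 (λ x e g y → y :- ((x :+ :- e) :+ con ½ :* g)
             := (e :- (con 0ℚ :+ g)) :+ (con ½ :* g :- :- (y :- x))) refl (seq (f z) n) (seq ε n) g (seq (f (u m)) n))
          (cong (λ d → (seq ε n - (0ℚ + g)) + (½ * g - - d)) (sym f-sub)))
      above : ∀ m n → 0ℚ + g ≤ seq ε n → ∣ seq (f (u m -ℂ z)) n ∣ ≤ ½ * g →
        seq (f (u m)) n + ½ * g ≤ seq (f z) n + seq ε n
      above m n g≤ε d≤ = ≤-by (+-nonNeg (≤⇒0≤- g≤ε) (≤⇒0≤- (≤-trans (p≤∣p∣ _) d≤)))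
        (trans (S.solve 4 (λ x e g y → (x :+ e) :- (y :+ con ½ :* g)
             := (e :- (con 0ℚ :+ g)) :+ (con ½ :* g :- (y :- x))) refl (seq (f z) n) (seq ε n) g (seq (f (u m)) n))
          (cong (λ d → (seq ε n - (0ℚ + g)) + (½ * g - d)) (sym f-sub)))

  ⟶⇒⇝ : ∀ {u z} → u ⟶ℂ z → u ⇝ z
  ⟶⇒⇝ {u} {z} (p , q) = lim λ ε 0<ε → Ev-zip
    (λ m a b → Ev-zip (λ n c d → subst (_ ≤_) (halves ε) (+-mono-≤ c d)) (near a) (near b))
    (p (ℚ→ℝ (½ * ε)) (mk< (½ * ε) (half-pos 0<ε) 0 λ _ _ → ≤-reflexive (+-identityˡ (½ * ε))))
    (q (ℚ→ℝ (½ * ε)) (mk< (½ * ε) (half-pos 0<ε) 0 λ _ _ → ≤-reflexive (+-identityˡ (½ * ε))))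
    where
    near : ∀ {x y δ} → ((x +ℝ (-ℝ ℚ→ℝ δ)) <ℝ y) × (y <ℝ (x +ℝ ℚ→ℝ δ)) → Ev λ n → ∣ seq y n - seq x n ∣ ≤ δ
    near {x} {y} {δ} (mk< g 0<g M h , mk< g′ 0<g′ M′ h′) = Ev-zip
      (λ n a b → ∣p∣≤
        (≤-by (+-nonNeg (≤⇒0≤- b) (<⇒≤ 0<g′))
          (S.solve 4 (λ x y d g → d :- (y :- x) := ((x :+ d) :- (y :+ g)) :+ g) refl (seq x n) (seq y n) δ g′))
        (≤-by (+-nonNeg (≤⇒0≤- a) (<⇒≤ 0<g))
          (S.solve 4 (λ x y d g → d :- :- (y :- x) := (y :- ((x :+ :- d) :+ g)) :+ g) refl (seq x n) (seq y n) δ g)))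
      (M , h) (M′ , h′)

  ν-sum : ∀ {m} n (f : Vector ℂ m) {c} → (∀ i → ν n (f i) ≤ c) → ν n (C.sum f) ≤ ι m * c
  ν-sum {zero}  n f {c} h = ≤-reflexive (sym (*-zeroˡ c))
  ν-sum {suc m} n f {c} h = ≤-trans (ν-+ n (f zero) (C.sum (f ∘ suc)))
    (≤-trans (+-mono-≤ (h zero) (ν-sum n (f ∘ suc) (h ∘ suc)))
      (≤-reflexive (S.solve 2 (λ c i → c :+ i :* c := (con 1ℚ :+ i) :* c) refl c (ι m))))

  Fin-bounded : ∀ {m} (f : Fin m → ℕ → ℚ) → (∀ i → ∃ λ B → 0ℚ < B × Ev λ n → f i n ≤ B) →
    ∃ λ B → 0ℚ < B × Ev λ n → ∀ i → f i n ≤ B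
  Fin-bounded {zero}  f h = 1ℚ , 0<1 , Ev-all λ n ()
  Fin-bounded {suc m} f h =
    let B , 0<B , p = h zero ; D , 0<D , q = Fin-bounded (f ∘ suc) (h ∘ suc) in
    B + D , +-pos 0<B 0<D , Ev-zip (λ n a b →
      λ { zero    → ≤-trans a (≤-by (<⇒≤ 0<D) (S.solve 2 (λ b d → (b :+ d) :- b := d) refl B D))
        ; (suc i) → ≤-trans (b i) (≤-by (<⇒≤ 0<B) (S.solve 2 (λ b d → (b :+ d) :- d := b) refl B D)) }) p q

  expPartialSum-entry : ∀ {m} (M : Matrix ℂ m) N i j →
    expPartialSum M N i j ≈ℂ psum (λ k → qℂ (recip! k) *ℂ (M C.^ᵐ k) i j) N
  expPartialSum-entry {m} M N i j = C.trans (entry {N} (λ k → 1/ toℕ k ! C.·ᵐ M C.^ᵐ toℕ k))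
    (C.trans (sum≈psum (λ k → 1/ k ! *ℂ (M C.^ᵐ k) i j) N)
      (psum-cong (λ k → C.*-congʳ (C.reflexive (1/!≡recip! k))) N))
    where
    open RawSemiringOps (C.matrix-rawSemiring m) using () renaming (sum to sumᵐ)
    entry : ∀ {N} (F : Vector (Matrix ℂ m) N) → sumᵐ F i j ≈ℂ C.sum (λ k → F k i j)
    entry {zero}  F = ≈ℂ-refl
    entry {suc N} F = C.+-congˡ (entry (F ∘ suc))

  module _ {m} (M : Matrix ℂ m) where
    private
      entry-bound : ∃ λ B → 0ℚ < B × Ev λ n → ∀ i j → ν n (M i j) ≤ B
      entry-bound = let B , 0<B , N , h = rows in B , 0<B , N , λ n N≤n i j → ≤-trans (proj₂ (proj₂ (row i n)) j) (h n N≤n i)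
        where
        row : ∀ i n → ∃ λ B → (0ℚ ≤ B) × (∀ j → ν n (M i j) ≤ B)
        row i n = Q.sum (λ j → ν n (M i j)) , sum-nonNeg _ (λ j → 0≤ν n (M i j)) , term≤sum (λ j → ν n (M i j)) (λ j → 0≤ν n (M i j))
          where open RationalVectors using (sum-nonNeg; term≤sum)
        rows : ∃ λ B → 0ℚ < B × Ev λ n → ∀ i → Q.sum (λ j → ν n (M i j)) ≤ B
        rows = Fin-bounded (λ i n → Q.sum (λ j → ν n (M i j))) λ i →
          let B , 0<B , h = Fin-bounded (λ j n → ν n (M i j)) (λ j → ν-bounded (M i j)) in
          ι m * B + 1ℚ , +-mono-≤-< (*-nonNeg (0≤ι m) (<⇒≤ 0<B)) 0<1 , Ev-map (λ n p → ≤-trans (sum-≤ (λ j → ν n (M i j)) p)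
            (≤-by (<⇒≤ 0<1) (S.solve 1 (λ x → (x :+ con 1ℚ) :- x := con 1ℚ) refl (ι m * B)))) h
          where
          sum-≤ : ∀ {m} (f : Vector ℚ m) {c} → (∀ i → f i ≤ c) → Q.sum f ≤ ι m * c
          sum-≤ {zero}  f {c} h = ≤-reflexive (sym (*-zeroˡ c))
          sum-≤ {suc m} f {c} h = ≤-trans (+-mono-≤ (h zero) (sum-≤ (f ∘ suc) (h ∘ suc)))
            (≤-reflexive (S.solve 2 (λ c i → c :+ i :* c := (con 1ℚ :+ i) :* c) refl c (ι m)))

      B = proj₁ entry-bound
      0<B = proj₁ (proj₂ entry-bound)
      N₀ = proj₁ (proj₂ (proj₂ entry-bound))

      -- A matrix product sums m products of entries, so entries bounded by B give k-th powers
      -- bounded by (mB)ᵏ.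
      D : ℚ
      D = ι m * B
      0≤D : 0ℚ ≤ D
      0≤D = *-nonNeg (0≤ι m) (<⇒≤ 0<B)

      ν-basis : ∀ n {m} (i j : Fin m) → ν n (C.basis i j) ≤ 1ℚ
      ν-basis n i j with i Fin.≟ j
      ... | yes _ = ≤-reflexive (ν-qℂ n {1ℚ} (<⇒≤ 0<1))
      ... | no _  = ≤-trans (≤-reflexive (ν-qℂ n {0ℚ} ≤-refl)) (<⇒≤ 0<1)

      power-bound : ∀ i j k n → N₀ ℕ.≤ n → ν n ((M C.^ᵐ k) i j) ≤ D Q.^ k
      power-bound i j zero    n N≤n = ν-basis n i j
      power-bound i j (suc k) n N≤n = ≤-trans
        (ν-sum n (λ l → M i l *ℂ (M C.^ᵐ k) l j) {B * D Q.^ k} λ l → ≤-trans (ν-* n (M i l) ((M C.^ᵐ k) l j))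
          (RationalProperties.*-mono-≤ (0≤ν n (M i l)) (0≤ν n ((M C.^ᵐ k) l j)) (proj₂ (proj₂ (proj₂ entry-bound)) n N≤n i l) (power-bound l j k n N≤n)))
        (≤-reflexive (sym (*-assoc (ι m) B (D Q.^ k))))

    -- `PST` demands a matrix as witness. Existence comes from convergence in every entry;
    -- afterwards only the column of the source vertex has to be identified, by uniqueness of
    -- limits.
    exponential : ∃ (IsExp M)
    exponential = (λ i j → ExpSeries.total (λ k → (M C.^ᵐ k) i j) D 0≤D N₀ (power-bound i j)) ,
      λ i j → ⇝⇒⟶ (⇝-cong (λ N → C.sym (expPartialSum-entry M N i j)) ≈ℂ-refl
        (ExpSeries.converges (λ k → (M C.^ᵐ k) i j) D 0≤D N₀ (power-bound i j)))

-- State transfer expressed by phases on eigenvectors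

module TransferOnEigenvectors where

  import Algebra.Properties.CommutativeSemiring.Exp as CommutativeSemiringExp
  open import Algebra.Bundles using (CommutativeRing)
  open RealProperties
  open Polynomials using (module R)
  open ComplexProperties
  open ComplexSeries
  open ComplexExponential
  open UnitCircle
  open MatrixExponential
  open R using (⟨_,_⟩; pow; basis; _≈ᵛ_; ∑ᵛ; _·ᵛ_)
  private
    module S = ℝ-Solver
    module K = ℂ-Solver

  ℝ→ℂ-cong : ∀ {x y} → x ≈ℝ y → ℝ→ℂ x ≈ℂ ℝ→ℂ y
  ℝ→ℂ-cong x≈y = mk≈ x≈y ≈-refl

  ℝ→ℂ-+ : ∀ x y → ℝ→ℂ (x +ℝ y) ≈ℂ ℝ→ℂ x +ℂ ℝ→ℂ y
  ℝ→ℂ-+ x y = mk≈ ≈-refl (pointwise λ _ → refl)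

  ℝ→ℂ-* : ∀ x y → ℝ→ℂ (x *ℝ y) ≈ℂ ℝ→ℂ x *ℂ ℝ→ℂ y
  ℝ→ℂ-* x y = mk≈
    (S.solve 2 (λ x y → x S.:* y S.:= x S.:* y S.:- S.con 0ℚ S.:* S.con 0ℚ) ≈-refl x y)
    (S.solve 2 (λ x y → S.con 0ℚ S.:= x S.:* S.con 0ℚ S.:+ S.con 0ℚ S.:* y) ≈-refl x y)

  ℝ→ℂ-sum : ∀ {m} (f : Vector ℝ m) → ℝ→ℂ (R.sum f) ≈ℂ C.sum (ℝ→ℂ ∘ f)
  ℝ→ℂ-sum {zero}  f = ≈ℂ-refl
  ℝ→ℂ-sum {suc m} f = C.trans (ℝ→ℂ-+ (f zero) (R.sum (f ∘ suc))) (C.+-congˡ (ℝ→ℂ-sum (f ∘ suc)))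

  ℝ→ℂ-^ : ∀ x k → ℝ→ℂ (x R.^ k) ≈ℂ ℝ→ℂ x C.^ k
  ℝ→ℂ-^ x zero    = ≈ℂ-refl
  ℝ→ℂ-^ x (suc k) = C.trans (ℝ→ℂ-* x (x R.^ k)) (C.*-congˡ {ℝ→ℂ x} (ℝ→ℂ-^ x k))

  ℝ→ℂ-basis : ∀ {m} (i j : Fin m) → ℝ→ℂ (basis i j) ≡ C.basis i j
  ℝ→ℂ-basis i j with i Fin.≟ j
  ... | yes _ = refl
  ... | no _  = refl

  -iτ : ℝ → ℂ
  -iτ τ = 0ℝ +i (-ℝ τ)

  -iτ≈ : ∀ τ → -ℂ (𝕚 *ℂ ℝ→ℂ τ) ≈ℂ -iτ τ
  -iτ≈ τ = mk≈
    (S.solve 1 (λ t → S.:- (S.con 0ℚ S.:* t S.:- S.con 1ℚ S.:* S.con 0ℚ) S.:= S.con 0ℚ) ≈-refl τ)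
    (S.solve 1 (λ t → S.:- (S.con 0ℚ S.:* S.con 0ℚ S.:+ S.con 1ℚ S.:* t) S.:= S.:- t) ≈-refl τ)

  -iτ-* : ∀ τ x → -iτ τ *ℂ ℝ→ℂ x ≈ℂ -iτ (τ *ℝ x)
  -iτ-* τ x = mk≈
    (S.solve 2 (λ t x → S.con 0ℚ S.:* x S.:- (S.:- t) S.:* S.con 0ℚ S.:= S.con 0ℚ) ≈-refl τ x)
    (S.solve 2 (λ t x → S.con 0ℚ S.:* S.con 0ℚ S.:+ (S.:- t) S.:* x S.:= S.:- (t S.:* x)) ≈-refl τ x)

  term-scale : ∀ τ x k → term (-iτ τ) k *ℂ ℝ→ℂ (x R.^ k) ≈ℂ term (-iτ (τ *ℝ x)) k
  term-scale τ x k = C.trans (C.*-assoc (qℂ (recip! k)) _ _) (C.*-congˡ (C.trans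
    (C.*-congˡ {(-iτ τ) C.^ k} (ℝ→ℂ-^ x k)) (C.trans (C.sym (^-distrib-* (-iτ τ) (ℝ→ℂ x) k)) (^-congˡ (-iτ-* τ x) k))))
    where open CommutativeSemiringExp (CommutativeRing.commutativeSemiring ℂ-commutativeRing) using (^-distrib-*)

  module _ {m} (K : Matrix ℝ m) (τ : ℝ) where

    private
      c : ℂ
      c = -ℂ (𝕚 *ℂ ℝ→ℂ τ)
      M : Matrix ℂ m
      M = c C.·ᵐ toℂ K

    scaled-power : ∀ k i j → (M C.^ᵐ k) i j ≈ℂ c C.^ k *ℂ ℝ→ℂ ((K R.^ᵐ k) i j)
    scaled-power zero    i j = C.trans (C.reflexive (sym (ℝ→ℂ-basis i j))) (C.sym (C.*-identityˡ _))
    scaled-power (suc k) i j = C.begin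
      C.sum (λ l → (c *ℂ ℝ→ℂ (K i l)) *ℂ (M C.^ᵐ k) l j)
        C.≈⟨ C.sum-cong-≋ (λ l → C.*-congˡ {c *ℂ ℝ→ℂ (K i l)} (scaled-power k l j)) ⟩
      C.sum (λ l → (c *ℂ ℝ→ℂ (K i l)) *ℂ (c C.^ k *ℂ ℝ→ℂ ((K R.^ᵐ k) l j)))
        C.≈⟨ C.sum-cong-≋ (λ l → C.trans (K.solve 4 (λ c x d y → (c K.:* x) K.:* (d K.:* y) K.:= (c K.:* d) K.:* (x K.:* y)) ≈ℂ-refl
               c (ℝ→ℂ (K i l)) (c C.^ k) (ℝ→ℂ ((K R.^ᵐ k) l j))) (C.*-congˡ (C.sym (ℝ→ℂ-* (K i l) ((K R.^ᵐ k) l j))))) ⟩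
      C.sum (λ l → (c *ℂ c C.^ k) *ℂ ℝ→ℂ (K i l *ℝ (K R.^ᵐ k) l j))
        C.≈⟨ C.*-distribˡ-sum (c *ℂ c C.^ k) (λ l → ℝ→ℂ (K i l *ℝ (K R.^ᵐ k) l j)) ⟨
      (c *ℂ c C.^ k) *ℂ C.sum (λ l → ℝ→ℂ (K i l *ℝ (K R.^ᵐ k) l j))
        C.≈⟨ C.*-congˡ {c *ℂ c C.^ k} (ℝ→ℂ-sum (λ l → K i l *ℝ (K R.^ᵐ k) l j)) ⟨
      c C.^ suc k *ℂ ℝ→ℂ ((K R.^ᵐ suc k) i j) C.∎

    column-sum : ∀ a i N → expPartialSum M N i a ≈ℂ psum (λ k → term (-iτ τ) k *ℂ ℝ→ℂ (pow K k (basis a) i)) N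
    column-sum a i N = C.trans (expPartialSum-entry M N i a) (psum-cong (λ k → C.trans
      (C.*-congˡ {qℂ (recip! k)} (C.trans (scaled-power k i a) (C.*-cong (^-congˡ (-iτ≈ τ) k)
        (ℝ→ℂ-cong (R.trans (R.sym (R.*ᵛ-basis (K R.^ᵐ k) a i)) (R.^ᵐ-*ᵛ K k (basis a) i))))))
      (C.sym (C.*-assoc (qℂ (recip! k)) (-iτ τ C.^ k) (ℝ→ℂ (pow K k (basis a) i))))) N)

    -- exp(−iτK) e_a = γ e_b, read entrywise off the exponential series.
    Transfer : Fin m → Fin m → ℂ → Set
    Transfer a b γ = ∀ i → psum (λ k → term (-iτ τ) k *ℂ ℝ→ℂ (pow K k (basis a) i)) ⇝ (γ *ℂ ℝ→ℂ (basis b i))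

    transfer : ∀ {a b γ} → (∃ λ X → IsExp M X × (X C.*ᵛ C.basis a) C.≈ᵛ (γ C.·ᵛ C.basis b)) → Transfer a b γ
    transfer {a} {b} {γ} (X , isExp , eq) i = ⇝-cong (column-sum a i)
      (C.trans (C.sym (C.*ᵛ-basis X a i)) (C.trans (eq i) (C.*-congˡ {γ} (C.reflexive (sym (ℝ→ℂ-basis b i))))))
      (⟶⇒⇝ (isExp i a))

    transfer⁻¹ : ∀ {a b γ} → Transfer a b γ → ∃ λ X → IsExp M X × (X C.*ᵛ C.basis a) C.≈ᵛ (γ C.·ᵛ C.basis b)
    transfer⁻¹ {a} {b} {γ} t = let X , isExp = exponential M in X , isExp , λ i →
      C.trans (C.*ᵛ-basis X a i) (C.trans
        (⇝-unique (⟶⇒⇝ (isExp i a)) (⇝-cong (λ N → C.sym (column-sum a i N)) ≈ℂ-refl (t i)))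
        (C.*-congˡ {γ} (C.reflexive (ℝ→ℂ-basis b i))))

    -- Geometric moments ⟨v, Kᵏe_a⟩ = xᵏ⟨v, e_a⟩ collapse the paired vector series to the scalar
    -- exponential at x. Stating the hypothesis by moments allows those of H to be reindexed for a
    -- power of H.
    transfer-pairing : ∀ {a b γ} → Transfer a b γ → ∀ v x → (∀ k → ⟨ v , pow K k (basis a) ⟩ ≈ℝ x R.^ k *ℝ ⟨ v , basis a ⟩) →
      e (τ *ℝ x) *ℂ ℝ→ℂ ⟨ v , basis a ⟩ ≈ℂ γ *ℂ ℝ→ℂ ⟨ v , basis b ⟩
    transfer-pairing {a} {b} {γ} t v x h = ⇝-unique
      (⇝-* (cexp-limit (-iτ (τ *ℝ x))) (⇝-const (ℝ→ℂ ⟨ v , basis a ⟩)))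
      (⇝-cong (λ N → C.sym (collect N)) (C.sym target)
        (⇝-sum λ i → ⇝-* (⇝-const (ℝ→ℂ (v i))) (t i)))
      where
      s : Fin m → ℕ → ℂ
      s i k = term (-iτ τ) k *ℂ ℝ→ℂ (pow K k (basis a) i)
      target : γ *ℂ ℝ→ℂ ⟨ v , basis b ⟩ ≈ℂ C.sum (λ i → ℝ→ℂ (v i) *ℂ (γ *ℂ ℝ→ℂ (basis b i)))
      target = C.trans (C.*-congˡ {γ} (ℝ→ℂ-sum (λ i → v i *ℝ basis b i))) (C.trans
        (C.*-distribˡ-sum γ (λ i → ℝ→ℂ (v i *ℝ basis b i)))
        (C.sum-cong-≋ λ i → C.trans (C.*-congˡ {γ} (ℝ→ℂ-* (v i) (basis b i)))
          (C.x*yz≈y*xz γ (ℝ→ℂ (v i)) (ℝ→ℂ (basis b i)))))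
      one-term : ∀ k → C.sum (λ i → ℝ→ℂ (v i) *ℂ s i k) ≈ℂ term (-iτ (τ *ℝ x)) k *ℂ ℝ→ℂ ⟨ v , basis a ⟩
      one-term k = C.begin
        C.sum (λ i → ℝ→ℂ (v i) *ℂ (T *ℂ ℝ→ℂ (pow K k (basis a) i)))
          C.≈⟨ C.sum-cong-≋ (λ i → C.trans (C.x*yz≈y*xz (ℝ→ℂ (v i)) T _) (C.*-congˡ {T} (C.sym (ℝ→ℂ-* (v i) (pow K k (basis a) i))))) ⟩
        C.sum (λ i → T *ℂ ℝ→ℂ (v i *ℝ pow K k (basis a) i))
          C.≈⟨ C.*-distribˡ-sum T (λ i → ℝ→ℂ (v i *ℝ pow K k (basis a) i)) ⟨
        T *ℂ C.sum (λ i → ℝ→ℂ (v i *ℝ pow K k (basis a) i))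
          C.≈⟨ C.*-congˡ {T} (C.trans (C.sym (ℝ→ℂ-sum (λ i → v i *ℝ pow K k (basis a) i))) (C.trans (ℝ→ℂ-cong (h k))
                 (ℝ→ℂ-* (x R.^ k) ⟨ v , basis a ⟩))) ⟩
        T *ℂ (ℝ→ℂ (x R.^ k) *ℂ ℝ→ℂ ⟨ v , basis a ⟩)
          C.≈⟨ C.trans (C.sym (C.*-assoc T _ _)) (C.*-congʳ (term-scale τ x k)) ⟩
        term (-iτ (τ *ℝ x)) k *ℂ ℝ→ℂ ⟨ v , basis a ⟩ C.∎
        where T = term (-iτ τ) k
      collect : ∀ N → psum (term (-iτ (τ *ℝ x))) N *ℂ ℝ→ℂ ⟨ v , basis a ⟩ ≈ℂ C.sum (λ i → ℝ→ℂ (v i) *ℂ psum (s i) N)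
      collect zero    = C.trans (C.zeroˡ _) (C.sym (C.sum-0 (λ i → ℝ→ℂ (v i) *ℂ ℝ→ℂ 0ℝ) λ i → C.zeroʳ (ℝ→ℂ (v i))))
      collect (suc N) = C.trans (C.distribʳ _ (psum (term (-iτ (τ *ℝ x))) N) (term (-iτ (τ *ℝ x)) N)) (C.trans
        (C.+-cong (collect N) (C.sym (one-term N)))
        (C.trans (C.sym (C.∑-distrib-+ (λ i → ℝ→ℂ (v i) *ℂ psum (s i) N) (λ i → ℝ→ℂ (v i) *ℂ s i N)))
          (C.sum-cong-≋ λ i → C.sym (C.distribˡ (ℝ→ℂ (v i)) (psum (s i) N) (s i N)))))

    spectral-limit : ∀ {d} (xs : Fin d → ℝ) (V : Fin d → Vector ℝ m) {a} →
      (∀ k → pow K k (basis a) ≈ᵛ ∑ᵛ (λ j → (xs j R.^ k) ·ᵛ V j)) →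
      ∀ i → psum (λ k → term (-iτ τ) k *ℂ ℝ→ℂ (pow K k (basis a) i)) ⇝ C.sum (λ j → e (τ *ℝ xs j) *ℂ ℝ→ℂ (V j i))
    spectral-limit xs V {a} h i = ⇝-cong (λ N → C.sym (collect N)) ≈ℂ-refl
      (⇝-sum λ j → ⇝-* (cexp-limit (-iτ (τ *ℝ xs j))) (⇝-const (ℝ→ℂ (V j i))))
      where
      one-term : ∀ k → term (-iτ τ) k *ℂ ℝ→ℂ (pow K k (basis a) i) ≈ℂ C.sum (λ j → term (-iτ (τ *ℝ xs j)) k *ℂ ℝ→ℂ (V j i))
      one-term k = C.trans (C.*-congˡ {T} (C.trans (ℝ→ℂ-cong (h k i)) (ℝ→ℂ-sum (λ j → xs j R.^ k *ℝ V j i))))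
        (C.trans (C.*-distribˡ-sum T (λ j → ℝ→ℂ (xs j R.^ k *ℝ V j i)))
        (C.sum-cong-≋ λ j → C.trans (C.*-congˡ {T} (ℝ→ℂ-* (xs j R.^ k) (V j i)))
          (C.trans (C.sym (C.*-assoc T (ℝ→ℂ (xs j R.^ k)) (ℝ→ℂ (V j i)))) (C.*-congʳ (term-scale τ (xs j) k)))))
        where T = term (-iτ τ) k
      collect : ∀ N → psum (λ k → term (-iτ τ) k *ℂ ℝ→ℂ (pow K k (basis a) i)) N ≈ℂ C.sum (λ j → psum (term (-iτ (τ *ℝ xs j))) N *ℂ ℝ→ℂ (V j i))
      collect zero    = C.sym (C.sum-0 (λ j → ℝ→ℂ 0ℝ *ℂ ℝ→ℂ (V j i)) λ j → C.zeroˡ (ℝ→ℂ (V j i)))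
      collect (suc N) = C.trans (C.+-cong (collect N) (one-term N))
        (C.trans (C.sym (C.∑-distrib-+ (λ j → psum (term (-iτ (τ *ℝ xs j))) N *ℂ ℝ→ℂ (V j i)) (λ j → term (-iτ (τ *ℝ xs j)) N *ℂ ℝ→ℂ (V j i))))
          (C.sum-cong-≋ λ j → C.sym (C.distribʳ (ℝ→ℂ (V j i)) (psum (term (-iτ (τ *ℝ xs j))) N) (term (-iτ (τ *ℝ xs j)) N))))

  -- When both matrices act diagonally on the same parts of e_a, exp(-iτK)e_a depends only on the
  -- phases of these parts; equal phases at the two times carry the transfer over with the same γ.
  transfer-between : ∀ {m} (K K′ : Matrix ℝ m) τ τ′ {d} (xs xs′ : Fin d → ℝ) (V : Fin d → Vector ℝ m) {a b γ} →
    (∀ k → pow K k (basis a) ≈ᵛ ∑ᵛ (λ j → (xs j R.^ k) ·ᵛ V j)) →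
    (∀ k → pow K′ k (basis a) ≈ᵛ ∑ᵛ (λ j → (xs′ j R.^ k) ·ᵛ V j)) →
    (∀ j → e (τ *ℝ xs j) ≈ℂ e (τ′ *ℝ xs′ j)) → Transfer K τ a b γ → Transfer K′ τ′ a b γ
  transfer-between K K′ τ τ′ xs xs′ V {a} h h′ same t i = ⇝-cong (λ _ → ≈ℂ-refl)
    (C.trans (C.sum-cong-≋ λ j → C.*-congʳ (C.sym (same j))) (⇝-unique (spectral-limit K τ xs V {a} h i) (t i)))
    (spectral-limit K′ τ′ xs′ V {a} h′ i)

-- Euclid's algorithm in discrete subgroups of the reals

module DiscreteLattices where

  open import Data.Integer.Base as ℤ using (ℤ; +_; -[1+_]; +0; +[1+_])
  import Data.Integer.Properties as ℤ
  open import Data.Rational.Base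
    using (mkℚ; ↥_; ↧_; _≤_; _<_; _/_; toℚᵘ) renaming (_+_ to _⊹_; _*_ to _·_; _-_ to _∸_; -_ to ⊖_)
  open import Data.Rational.Unnormalised.Base as ℚᵘ using (mkℚᵘ; *≡*)
  import Data.Rational.Unnormalised.Properties as ℚᵘ
  open RationalProperties
  open RealProperties
  open Polynomials using (module R; cancel-factor)
  private
    module S = ℚ.+-*-Solver
  open ℝ-Solver using (solve; _:=_; _:+_; _:*_; _:-_; :-_; con)

  module Z = LinearAlgebraProperties ℤ.+-*-commutativeRing

  abstract
    ℤ→ℚ : ℤ → ℚ
    ℤ→ℚ i = i / 1

    private
      toℚᵘ-ℤ→ℚ : ∀ i → toℚᵘ (ℤ→ℚ i) ℚᵘ.≃ mkℚᵘ i 0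
      toℚᵘ-ℤ→ℚ i = ℚ.toℚᵘ-fromℚᵘ (mkℚᵘ i 0)

    ℤ→ℚ-+ : ∀ i j → ℤ→ℚ (i ℤ.+ j) ≡ ℤ→ℚ i ⊹ ℤ→ℚ j
    ℤ→ℚ-+ i j = ℚ.toℚᵘ-injective (ℚᵘ.≃-trans (toℚᵘ-ℤ→ℚ (i ℤ.+ j)) (ℚᵘ.≃-trans
      (*≡* (cong (ℤ._* ℤ.+ 1) (≡.sym (cong₂ ℤ._+_ (ℤ.*-identityʳ i) (ℤ.*-identityʳ j)))))
      (ℚᵘ.≃-sym (ℚᵘ.≃-trans (ℚ.toℚᵘ-homo-+ (ℤ→ℚ i) (ℤ→ℚ j)) (ℚᵘ.+-cong (toℚᵘ-ℤ→ℚ i) (toℚᵘ-ℤ→ℚ j))))))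

    ℤ→ℚ-* : ∀ i j → ℤ→ℚ (i ℤ.* j) ≡ ℤ→ℚ i · ℤ→ℚ j
    ℤ→ℚ-* i j = ℚ.toℚᵘ-injective (ℚᵘ.≃-trans (toℚᵘ-ℤ→ℚ (i ℤ.* j))
      (ℚᵘ.≃-sym (ℚᵘ.≃-trans (ℚ.toℚᵘ-homo-* (ℤ→ℚ i) (ℤ→ℚ j)) (ℚᵘ.*-cong (toℚᵘ-ℤ→ℚ i) (toℚᵘ-ℤ→ℚ j)))))

    ℤ→ℚ-neg : ∀ i → ℤ→ℚ (ℤ.- i) ≡ ⊖ ℤ→ℚ i
    ℤ→ℚ-neg i = ℚ.toℚᵘ-injective (ℚᵘ.≃-trans (toℚᵘ-ℤ→ℚ (ℤ.- i))
      (ℚᵘ.≃-sym (ℚᵘ.≃-trans (ℚ.toℚᵘ-homo‿- (ℤ→ℚ i)) (ℚᵘ.-‿cong (toℚᵘ-ℤ→ℚ i)))))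

    ℤ→ℚ-ι : ∀ n → ℤ→ℚ (+ n) ≡ ι n
    ℤ→ℚ-ι = ι-/1

    ℤ→ℚ-injective : ∀ {i j} → ℤ→ℚ i ≡ ℤ→ℚ j → i ≡ j
    ℤ→ℚ-injective {i} {j} eq = ≡.trans (≡.sym (ℤ.*-identityʳ i)) (≡.trans
      (ℚᵘ.drop-*≡* (ℚᵘ.≃-trans (ℚᵘ.≃-sym (toℚᵘ-ℤ→ℚ i)) (ℚᵘ.≃-trans (ℚᵘ.≃-reflexive (cong toℚᵘ eq)) (toℚᵘ-ℤ→ℚ j))))
      (ℤ.*-identityʳ j))

    ↥-÷-↧ : ∀ q → q · ℤ→ℚ (↧ q) ≡ ℤ→ℚ (↥ q)
    ↥-÷-↧ q = ℚ.toℚᵘ-injective (ℚᵘ.≃-trans (ℚ.toℚᵘ-homo-* q (ℤ→ℚ (↧ q)))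
      (ℚᵘ.≃-trans (ℚᵘ.*-congˡ {toℚᵘ q} (toℚᵘ-ℤ→ℚ (↧ q))) (ℚᵘ.≃-trans (lemma q) (ℚᵘ.≃-sym (toℚᵘ-ℤ→ℚ (↥ q))))))
      where
      lemma : ∀ q → toℚᵘ q ℚᵘ.* mkℚᵘ (↧ q) 0 ℚᵘ.≃ mkℚᵘ (↥ q) 0
      lemma (mkℚ n d _) = *≡* (≡.trans (ℤ.*-identityʳ _) (cong (λ z → n ℤ.* + suc z) (≡.sym (ℕ.*-identityʳ d))))

  zℝ : ℤ → ℝ
  zℝ i = ℚ→ℝ (ℤ→ℚ i)

  zℝ-+ : ∀ i j → zℝ (i ℤ.+ j) ≈ℝ zℝ i +ℝ zℝ j
  zℝ-+ i j = pointwise λ _ → ℤ→ℚ-+ i j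

  zℝ-* : ∀ i j → zℝ (i ℤ.* j) ≈ℝ zℝ i *ℝ zℝ j
  zℝ-* i j = pointwise λ _ → ℤ→ℚ-* i j

  zℝ-neg : ∀ i → zℝ (ℤ.- i) ≈ℝ -ℝ zℝ i
  zℝ-neg i = pointwise λ _ → ℤ→ℚ-neg i

  zℝ-0 : zℝ +0 ≈ℝ 0ℝ
  zℝ-0 = ℚ→ℝ-cong (ℤ→ℚ-ι 0)

  zℝ-1 : zℝ (+ 1) ≈ℝ 1ℝ
  zℝ-1 = ℚ→ℝ-cong (ℤ→ℚ-ι 1)

  zℝ-injective : ∀ {i j} → zℝ i ≈ℝ zℝ j → i ≡ j
  zℝ-injective eq = ℤ→ℚ-injective (ℚ→ℝ-injective eq)

  zℝ-sum : ∀ {d} (f : Vector ℤ d) → zℝ (Z.sum f) ≈ℝ R.sum (zℝ ∘ f)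
  zℝ-sum {zero}  f = zℝ-0
  zℝ-sum {suc d} f = R.trans (zℝ-+ (f zero) (Z.sum (f ∘ suc))) (R.+-congˡ (zℝ-sum (f ∘ suc)))

  zℝ-≢ : ∀ {i j} → i ≢ j → zℝ i +ℝ -ℝ zℝ j #0
  zℝ-≢ {i} {j} i≢j = #0-cong (pointwise λ _ → refl) (#0-ℚ λ eq → i≢j (ℤ→ℚ-injective (≡.trans
    (S.solve 2 (λ a b → a S.:= (a S.:- b) S.:+ b) refl (ℤ→ℚ i) (ℤ→ℚ j)) (≡.trans (cong (_⊹ ℤ→ℚ j) eq) (ℚ.+-identityˡ _)))))

  -- A subgroup of ℝ whose elements can be decided to be 0 or at distance at least δ from 0 on a
  -- known side. The decision lets Euclid's algorithm branch on real numbers, and δ makes it stop.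
  record Discrete (P : ℝ → Set) : Set where
    field
      P-cong : ∀ {x y} → x ≈ℝ y → P x → P y
      P-0    : P 0ℝ
      P-sub  : ∀ {x y} → P x → P y → P (x +ℝ -ℝ y)
      δ      : ℚ
      0<δ    : 0ℚ < δ
      gap    : ∀ x → P x → x ≈ℝ 0ℝ ⊎ Ev (λ n → δ ≤ seq x n) ⊎ Ev (λ n → δ ≤ ⊖ seq x n)

    P-neg : ∀ {x} → P x → P (-ℝ x)
    P-neg {x} p = P-cong (solve 1 (λ x → con 0ℚ :- x := :- x) ≈-refl x) (P-sub P-0 p)

    P-+ : ∀ {x y} → P x → P y → P (x +ℝ y)
    P-+ {x} {y} p q = P-cong (solve 2 (λ x y → x :- :- y := x :+ y) ≈-refl x y) (P-sub p (P-neg q))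

    P-multiple : ∀ i {x} → P x → P (zℝ i *ℝ x)
    P-multiple (+ n) {x} p = P-cong (R.*-congʳ (ℚ→ℝ-cong (≡.sym (ℤ→ℚ-ι n)))) (natural n)
      where
      natural : ∀ n → P (ℚ→ℝ (ι n) *ℝ x)
      natural zero    = P-cong (solve 1 (λ x → con 0ℚ := con 0ℚ :* x) ≈-refl x) P-0
      natural (suc n) = P-cong (R.trans (solve 2 (λ x i → x :+ i :* x := (con 1ℚ :+ i) :* x) ≈-refl x (ℚ→ℝ (ι n)))
        (R.*-congʳ (pointwise λ _ → refl))) (P-+ p (natural n))
    P-multiple -[1+ n ] {x} p = P-cong
      (R.trans (solve 2 (λ i x → :- (i :* x) := (:- i) :* x) ≈-refl (zℝ +[1+ n ]) x) (R.*-congʳ (R.sym (zℝ-neg +[1+ n ]))))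
      (P-neg (P-multiple +[1+ n ] p))

    P-sum : ∀ {d} (f : Vector ℝ d) → (∀ i → P (f i)) → P (R.sum f)
    P-sum {zero}  f h = P-0
    P-sum {suc d} f h = P-+ (h zero) (P-sum (f ∘ suc) (h ∘ suc))

  module Euclid {P : ℝ → Set} (discrete : Discrete P) where
    open Discrete discrete

    record GCD (x y : ℝ) : Set where
      field
        g       : ℝ
        g∈P     : P g
        m n c d : ℤ
        x≈      : x ≈ℝ zℝ m *ℝ g
        y≈      : y ≈ℝ zℝ n *ℝ g
        g≈      : g ≈ℝ zℝ c *ℝ x +ℝ zℝ d *ℝ y

    GCD-swap : ∀ {x y} → GCD x y → GCD y x
    GCD-swap G = record { g = g ; g∈P = g∈P ; m = n ; n = m ; c = d ; d = c ; x≈ = y≈ ; y≈ = x≈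
                        ; g≈ = R.trans g≈ (R.+-comm _ _) }
      where open GCD G

    GCD-neg : ∀ {x y} → GCD (-ℝ x) y → GCD x y
    GCD-neg {x} {y} G = record { g = g ; g∈P = g∈P ; m = ℤ.- m ; n = n ; c = ℤ.- c ; d = d
      ; x≈ = R.trans (solve 1 (λ x → x := :- (:- x)) ≈-refl x) (R.trans (-ℝ‿cong x≈)
          (R.trans (solve 2 (λ m g → :- (m :* g) := (:- m) :* g) ≈-refl (zℝ m) g) (R.*-congʳ (R.sym (zℝ-neg m)))))
      ; y≈ = y≈
      ; g≈ = R.trans g≈ (R.+-congʳ (R.trans (solve 2 (λ c x → c :* :- x := (:- c) :* x) ≈-refl (zℝ c) x)
          (R.*-congʳ (R.sym (zℝ-neg c))))) }
      where open GCD G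

    GCD-add : ∀ {x y} → GCD (x +ℝ -ℝ y) y → GCD x y
    GCD-add {x} {y} G = record { g = g ; g∈P = g∈P ; m = m ℤ.+ n ; n = n ; c = c ; d = d ℤ.+ ℤ.- c
      ; x≈ = R.trans (solve 2 (λ x y → x := (x :- y) :+ y) ≈-refl x y) (R.trans (R.+-cong x≈ y≈)
          (R.trans (R.sym (R.distribʳ g (zℝ m) (zℝ n))) (R.*-congʳ (R.sym (zℝ-+ m n)))))
      ; y≈ = y≈
      ; g≈ = R.trans g≈ (R.trans (solve 4 (λ c d x y → c :* (x :- y) :+ d :* y := c :* x :+ (d :- c) :* y) ≈-refl (zℝ c) (zℝ d) x y)
          (R.+-congˡ (R.*-congʳ (R.sym (R.trans (zℝ-+ d (ℤ.- c)) (R.+-congˡ (zℝ-neg c))))))) }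
      where open GCD G

    GCD-0 : ∀ {x y} → P y → x ≈ℝ 0ℝ → GCD x y
    GCD-0 {x} {y} y∈P x≈0 = record { g = y ; g∈P = y∈P ; m = +0 ; n = + 1 ; c = +0 ; d = + 1
      ; x≈ = R.trans x≈0 (R.sym (R.trans (R.*-congʳ zℝ-0) (R.zeroˡ y)))
      ; y≈ = R.sym (R.trans (R.*-congʳ zℝ-1) (R.*-identityˡ y))
      ; g≈ = R.sym (R.trans (R.+-cong (R.*-congʳ zℝ-0) (R.*-congʳ zℝ-1))
          (solve 2 (λ x y → con 0ℚ :* x :+ con 1ℚ :* y := y) ≈-refl x y)) }

    Large : ℝ → Set
    Large x = Ev λ n → δ ≤ seq x n

    -- Subtractive Euclid. The fuel bounds (x + y)/δ, and replacing the larger number by the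
    -- difference lowers the sum by the smaller one, hence by at least δ.
    gcd-positive : ∀ fuel x y → P x → P y → Large x → Large y → Ev (λ n → seq x n ⊹ seq y n ≤ ι fuel · δ) → GCD x y
    gcd-positive zero x y x∈P y∈P Lx Ly bound = contradiction
      (Ev-const (λ _ lt → lt) (Ev-zip (λ n p q → ℚ.<-≤-trans p q)
        (Ev-zip (λ n p q → ℚ.<-≤-trans (+-pos 0<δ 0<δ) (ℚ.+-mono-≤ p q)) Lx Ly)
        (Ev-map (λ n p → ℚ.≤-trans p (ℚ.≤-reflexive (ℚ.*-zeroˡ δ))) bound)))
      (ℚ.<-irrefl refl)
    gcd-positive (suc fuel) x y x∈P y∈P Lx Ly bound = cases (gap (x +ℝ -ℝ y) (P-sub x∈P y∈P))
      where
      cases : (x +ℝ -ℝ y) ≈ℝ 0ℝ ⊎ Ev (λ n → δ ≤ seq x n ∸ seq y n) ⊎ Ev (λ n → δ ≤ ⊖ (seq x n ∸ seq y n)) → GCD x y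
      cases (inj₁ x≈y) = GCD-add (GCD-0 y∈P x≈y)
      cases (inj₂ (inj₁ L)) = GCD-add (gcd-positive fuel (x +ℝ -ℝ y) y (P-sub x∈P y∈P) y∈P L Ly
        (Ev-zip (λ n p q → ≤-by (+-nonNeg (≤⇒0≤- p) (≤⇒0≤- q))
          (S.solve 4 (λ x y i d → i S.:* d S.:- ((x S.:- y) S.:+ y)
             S.:= ((S.con 1ℚ S.:+ i) S.:* d S.:- (x S.:+ y)) S.:+ (y S.:- d)) refl (seq x n) (seq y n) (ι fuel) δ)) bound Ly))
      cases (inj₂ (inj₂ L)) = GCD-swap (GCD-add (gcd-positive fuel (y +ℝ -ℝ x) x (P-sub y∈P x∈P) x∈P
        (Ev-map (λ n → subst (δ ≤_) (S.solve 2 (λ x y → S.:- (x S.:- y) S.:= y S.:- x) refl (seq x n) (seq y n))) L) Lx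
        (Ev-zip (λ n p q → ≤-by (+-nonNeg (≤⇒0≤- p) (≤⇒0≤- q))
          (S.solve 4 (λ x y i d → i S.:* d S.:- ((y S.:- x) S.:+ x)
             S.:= ((S.con 1ℚ S.:+ i) S.:* d S.:- (x S.:+ y)) S.:+ (x S.:- d)) refl (seq x n) (seq y n) (ι fuel) δ)) bound Lx)))

    gcd-large : ∀ x y → P x → P y → Large x → Large y → GCD x y
    gcd-large x y x∈P y∈P Lx Ly = gcd-positive fuel x y x∈P y∈P Lx Ly (Ev-zip (λ n p q →
        ℚ.≤-trans (ℚ.+-mono-≤ (ℚ.≤-trans (p≤∣p∣ (seq x n)) p) (ℚ.≤-trans (p≤∣p∣ (seq y n)) q)) enough)
      (proj₂ (proj₂ (bounded x))) (proj₂ (proj₂ (bounded y))))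
      where
      B = proj₁ (bounded x) ⊹ proj₁ (bounded y)
      fuel = proj₁ (archimedean (B · inv δ))
      enough : B ≤ ι fuel · δ
      enough = ℚ.≤-trans (ℚ.≤-reflexive (≡.trans (≡.sym (ℚ.*-identityʳ B)) (≡.trans (cong (B ·_) (≡.sym (*-inv (>⇒≢0 0<δ))))
          (S.solve 3 (λ b d i → b S.:* (d S.:* i) S.:= (b S.:* i) S.:* d) refl B δ (inv δ)))))
        (*-monoʳ-≤′ δ {B · inv δ} {ι fuel} (ℚ.<⇒≤ 0<δ) (proj₂ (archimedean (B · inv δ))))

    gcd : ∀ x y → P x → P y → GCD x y
    gcd x y x∈P y∈P = cases (gap x x∈P) (gap y y∈P)
      where
      Gap : ℝ → Set
      Gap x = x ≈ℝ 0ℝ ⊎ Ev (λ n → δ ≤ seq x n) ⊎ Ev (λ n → δ ≤ ⊖ seq x n)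
      cases : Gap x → Gap y → GCD x y
      cases (inj₁ x≈0)       _                = GCD-0 y∈P x≈0
      cases _                (inj₁ y≈0)       = GCD-swap (GCD-0 x∈P y≈0)
      cases (inj₂ (inj₁ Lx)) (inj₂ (inj₁ Ly)) = gcd-large x y x∈P y∈P Lx Ly
      cases (inj₂ (inj₂ Lx)) (inj₂ (inj₁ Ly)) = GCD-neg (gcd-large (-ℝ x) y (P-neg x∈P) y∈P Lx Ly)
      cases (inj₂ (inj₁ Lx)) (inj₂ (inj₂ Ly)) = GCD-swap (GCD-neg (GCD-swap (gcd-large x (-ℝ y) x∈P (P-neg y∈P) Lx Ly)))
      cases (inj₂ (inj₂ Lx)) (inj₂ (inj₂ Ly)) =
        GCD-neg (GCD-swap (GCD-neg (GCD-swap (gcd-large (-ℝ x) (-ℝ y) (P-neg x∈P) (P-neg y∈P) Lx Ly))))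

    record Generator {d} (xs : Fin d → ℝ) : Set where
      field
        g        : ℝ
        g∈P      : P g
        multiple : Fin d → ℤ
        weight   : Fin d → ℤ
        xs≈      : ∀ i → xs i ≈ℝ zℝ (multiple i) *ℝ g
        g≈       : g ≈ℝ R.sum λ i → zℝ (weight i) *ℝ xs i

    generator : ∀ {d} (xs : Fin d → ℝ) → (∀ i → P (xs i)) → Generator xs
    generator {zero}  xs h = record { g = 0ℝ ; g∈P = P-0 ; multiple = λ () ; weight = λ () ; xs≈ = λ () ; g≈ = ≈-refl }
    generator {suc k} xs h = record
      { g = G.g ; g∈P = G.g∈P
      ; multiple = λ { zero → G.m ; (suc i) → I.multiple i ℤ.* G.n }
      ; weight = λ { zero → G.c ; (suc i) → G.d ℤ.* I.weight i }
      ; xs≈ = λ { zero → G.x≈ ; (suc i) → R.trans (I.xs≈ i) (R.trans (R.*-congˡ G.y≈)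
          (R.trans (R.sym (R.*-assoc (zℝ (I.multiple i)) (zℝ G.n) G.g)) (R.*-congʳ (R.sym (zℝ-* (I.multiple i) G.n))))) }
      ; g≈ = R.trans G.g≈ (R.+-congˡ (R.trans (R.*-congˡ I.g≈) (R.trans (R.*-distribˡ-sum (zℝ G.d) (λ i → zℝ (I.weight i) *ℝ xs (suc i)))
          (R.sum-cong-≋ λ i → R.trans (R.sym (R.*-assoc (zℝ G.d) (zℝ (I.weight i)) (xs (suc i)))) (R.*-congʳ (R.sym (zℝ-* G.d (I.weight i))))))))
      }
      where
      module I = Generator (generator (xs ∘ suc) (h ∘ suc))
      module G = GCD (gcd (xs zero) I.g (h zero) I.g∈P)

    record Basis {d} (xs : Fin d → ℝ) : Set where
      field
        g        : ℝ
        g#0      : g #0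
        g∈P      : P g
        multiple : Fin d → ℤ
        weight   : Fin d → ℤ
        xs≈      : ∀ i → xs i ≈ℝ zℝ (multiple i) *ℝ g
        bézout   : Z.⟨ weight , multiple ⟩ ≡ + 1

    -- Substituting the multiples into g = Σ weightᵢ xᵢ gives g = (Σ weightᵢ multipleᵢ)g. Cancelling
    -- g yields Bézout's identity, which is why the case g = 0 is set apart.
    basis-or-0 : ∀ {d} (xs : Fin d → ℝ) → (∀ i → P (xs i)) → (∀ i → xs i ≈ℝ 0ℝ) ⊎ Basis xs
    basis-or-0 xs h = cases (gap G.g G.g∈P)
      where
      module G = Generator (generator xs h)
      nonzero : G.g #0 → Basis xs
      nonzero g#0 = record { g = G.g ; g#0 = g#0 ; g∈P = G.g∈P ; multiple = G.multiple ; weight = G.weight ; xs≈ = G.xs≈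
        ; bézout = zℝ-injective (R.trans (R.trans
            (solve 1 (λ s → s := (s :- con 1ℚ) :+ con 1ℚ) ≈-refl (zℝ s)) (R.+-congʳ s-1≈0)) (R.trans (R.+-identityˡ 1ℝ) (R.sym zℝ-1))) }
        where
        s = Z.⟨ G.weight , G.multiple ⟩
        g≈sg : G.g ≈ℝ zℝ s *ℝ G.g
        g≈sg = R.trans G.g≈ (R.trans (R.sum-cong-≋ λ i → R.trans (R.*-congˡ (G.xs≈ i))
            (R.trans (R.sym (R.*-assoc (zℝ (G.weight i)) (zℝ (G.multiple i)) G.g)) (R.*-congʳ (R.sym (zℝ-* (G.weight i) (G.multiple i))))))
          (R.trans (R.sym (R.*-distribʳ-sum G.g (λ i → zℝ (G.weight i ℤ.* G.multiple i))))
            (R.*-congʳ (R.sym (zℝ-sum (λ i → G.weight i ℤ.* G.multiple i))))))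
        s-1≈0 : zℝ s +ℝ -ℝ 1ℝ ≈ℝ 0ℝ
        s-1≈0 = cancel-factor g#0 (R.trans (solve 2 (λ g s → g :* (s :- con 1ℚ) := s :* g :- g) ≈-refl G.g (zℝ s))
          (R.trans (R.+-congʳ (R.sym g≈sg)) (R.-‿inverseʳ G.g)))
      cases : G.g ≈ℝ 0ℝ ⊎ Ev (λ n → δ ≤ seq G.g n) ⊎ Ev (λ n → δ ≤ ⊖ seq G.g n) → (∀ i → xs i ≈ℝ 0ℝ) ⊎ Basis xs
      cases (inj₁ g≈0)      = inj₁ λ i → R.trans (G.xs≈ i) (R.trans (R.*-congˡ g≈0) (R.zeroʳ _))
      cases (inj₂ (inj₁ L)) = inj₂ (nonzero (inj₁ (mkPos δ 0<δ L)))
      cases (inj₂ (inj₂ L)) = inj₂ (nonzero (inj₂ (mkPos δ 0<δ L)))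

-- Parity of odd powers and coprime integers

module IntegerArithmetic where

  open import Data.Integer.Base as ℤ using (ℤ; +_; -[1+_]; +0; _+_; _*_; -_; _-_)
  import Data.Integer.DivMod as ℤ
  import Data.Integer.Properties as ℤ
  open import Data.Integer.Solver using (module +-*-Solver)
  open import Data.Nat.Divisibility using (_∤_; divides)
  open DiscreteLattices using (module Z)
  open Z using (_^_)
  open +-*-Solver using (solve; _:=_; _:+_; _:*_; _:-_; :-_; con)

  odd-form : ∀ r → 2 ∤ r → ∃ λ k → r ≡ suc (k ℕ.+ k)
  odd-form r 2∤r with parity r
    where
    parity : ∀ r → ∃ λ k → r ≡ k ℕ.+ k ⊎ r ≡ suc (k ℕ.+ k)
    parity zero = 0 , inj₁ refl
    parity (suc r) with parity r
    ... | k , inj₁ refl = k , inj₂ refl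
    ... | k , inj₂ refl = suc k , inj₁ (cong suc (sym (ℕ.+-suc k k)))
  ... | k , inj₂ eq = k , eq
  ... | k , inj₁ refl = contradiction (divides k (trans (cong (k ℕ.+_) (sym (ℕ.+-identityʳ k))) (ℕ.*-comm 2 k))) 2∤r

  Even Odd : ℤ → Set
  Even n = ∃ λ h → n ≡ h + h
  Odd n  = ∃ λ h → n ≡ + 1 + (h + h)

  even-or-odd : ∀ n → Even n ⊎ Odd n
  even-or-odd n = by-remainder (n ℤ.%ℕ 2) (ℤ.n%ℕd<d n 2) (ℤ.a≡a%ℕn+[a/ℕn]*n n 2)
    where
    q = n ℤ./ℕ 2
    by-remainder : ∀ r → r ℕ.< 2 → n ≡ + r + q * + 2 → Even n ⊎ Odd n
    by-remainder zero       _ eq = inj₁ (q , trans eq (solve 1 (λ q → con +0 :+ q :* con (+ 2) := q :+ q) refl q))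
    by-remainder (suc zero) _ eq = inj₂ (q , trans eq (solve 1 (λ q → con (+ 1) :+ q :* con (+ 2) := con (+ 1) :+ (q :+ q)) refl q))
    by-remainder (suc (suc _)) (s≤s (s≤s ())) _

  1-not-even : ¬ Even (+ 1)
  1-not-even (+ zero , ())
  1-not-even (+ suc n , eq) = contradiction (trans (cong suc (sym (ℕ.+-suc n n))) (sym (ℤ.+-injective eq))) λ ()
  1-not-even (-[1+ n ] , ())

  -- For n = 1 + 2h the square is 1 + 4(h² + h), so multiplying by n² changes nothing modulo 4.
  odd-power : ∀ {n} → Odd n → ∀ k → ∃ λ q → n ^ suc (k ℕ.+ k) ≡ n + + 4 * q
  odd-power {n} (h , refl) zero = +0 , solve 1 (λ n → n :* con (+ 1) := n :+ con (+ 4) :* con +0) refl n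
  odd-power {n} (h , refl) (suc k) = let q , eq = odd-power {n} (h , refl) k in
    q + (h * h + h) * n + + 4 * (h * h + h) * q ,
    trans (cong (λ e → n ^ suc e) (ℕ.+-suc (suc k) k)) (trans (cong (λ p → n * (n * p)) eq)
      (solve 2 (λ h q → let n = con (+ 1) :+ (h :+ h) ; u = h :* h :+ h in
         n :* (n :* (n :+ con (+ 4) :* q)) := n :+ con (+ 4) :* (q :+ u :* n :+ con (+ 4) :* u :* q)) refl h q))

  power-parity : ∀ n k → ∃ λ q → n ^ suc (k ℕ.+ k) ≡ n + + 2 * q
  power-parity n k with even-or-odd n
  ... | inj₂ odd = let q , eq = odd-power odd k in + 2 * q , trans eq (cong (λ z → n + z) (solve 1 (λ q → con (+ 4) :* q := con (+ 2) :* (con (+ 2) :* q)) refl q))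
  ... | inj₁ (h , refl) = h * p - h , solve 2 (λ h p → (h :+ h) :* p := (h :+ h) :+ con (+ 2) :* (h :* p :- h)) refl h p
    where p = (h + h) ^ (k ℕ.+ k)

  search : ∀ {d} {A B : Fin d → Set} → (∀ i → A i ⊎ B i) → (∀ i → A i) ⊎ ∃ B
  search {zero}  f = inj₁ λ ()
  search {suc d} f with f zero | search (f ∘ suc)
  ... | inj₂ b | _            = inj₂ (zero , b)
  ... | inj₁ _ | inj₂ (i , b) = inj₂ (suc i , b)
  ... | inj₁ a | inj₁ as      = inj₁ λ { zero → a ; (suc i) → as i }

  sum-even : ∀ {d} (f : Vector ℤ d) → (∀ i → Even (f i)) → Even (Z.sum f)
  sum-even {zero}  f h = +0 , refl
  sum-even {suc d} f h = let a , eq = h zero ; b , eq′ = sum-even (f ∘ suc) (h ∘ suc) in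
    a + b , trans (cong₂ _+_ eq eq′) (solve 2 (λ a b → (a :+ a) :+ (b :+ b) := (a :+ b) :+ (a :+ b)) refl a b)

  coprime⇒some-odd : ∀ {d} (c n : Vector ℤ d) → Z.⟨ c , n ⟩ ≡ + 1 → ∃ λ i → Odd (n i)
  coprime⇒some-odd c n bézout with search (even-or-odd ∘ n)
  ... | inj₂ odd  = odd
  ... | inj₁ even = contradiction (subst Even bézout (sum-even (λ i → c i * n i) λ i →
    let h , eq = even i in c i * h , trans (cong (c i *_) eq) (ℤ.*-distribˡ-+ (c i) h h))) 1-not-even

  record Ideal (Q : ℤ → Set) : Set where
    field
      +-closed : ∀ {a b} → Q a → Q b → Q (a + b)
      *-closed : ∀ c {a} → Q a → Q (c * a)

  -- Modulo Q + (n₀) the other nᵢ still generate 1; if 1 ≡ c n₀ modulo Q then 1 ≡ (c n₀)ʳ ≡ 0.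
  coprime-powers : ∀ {d} {Q : ℤ → Set} → Ideal Q → ∀ r (c n : Vector ℤ d) → (∀ i → Q (n i ^ r)) →
    Q (+ 1 - Z.⟨ c , n ⟩) → Q (+ 1)
  coprime-powers {zero}      I r c n h q = q
  coprime-powers {suc d} {Q} I r c n h q = finish (coprime-powers Q₁-ideal r (c ∘ suc) (n ∘ suc)
      (λ i → +0 , subst Q (solve 2 (λ p n → p := p :- con +0 :* n) refl (n (suc i) ^ r) n₀) (h (suc i)))
      (c zero , subst Q (solve 3 (λ c n s → con (+ 1) :- (c :* n :+ s) := (con (+ 1) :- s) :- c :* n) refl (c zero) n₀ Z.⟨ c ∘ suc , n ∘ suc ⟩) q))
    where
    open Ideal I
    n₀ = n zero
    Q₁ : ℤ → Set
    Q₁ z = ∃ λ c → Q (z - c * n₀)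
    Q₁-ideal : Ideal Q₁
    Q₁-ideal = record
      { +-closed = λ {a} {b} (c , p) (d , q) → c + d , subst Q
          (solve 5 (λ a b c d n → (a :- c :* n) :+ (b :- d :* n) := (a :+ b) :- (c :+ d) :* n) refl a b c d n₀) (+-closed p q)
      ; *-closed = λ e {a} (c , p) → e * c , subst Q
          (solve 4 (λ e a c n → e :* (a :- c :* n) := e :* a :- (e :* c) :* n) refl e a c n₀) (*-closed e p)
      }
    finish : Q₁ (+ 1) → Q (+ 1)
    finish (c , p) = subst Q (solve 1 (λ x → (con (+ 1) :- x) :+ x := con (+ 1)) refl (u ^ r)) (+-closed (1-u^ r) u^r)
      where
      u = c * n₀
      0∈Q : Q +0
      0∈Q = *-closed +0 p
      1-u^ : ∀ r → Q (+ 1 - u ^ r)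
      1-u^ zero    = 0∈Q
      1-u^ (suc r) = subst Q (solve 2 (λ u p → (con (+ 1) :- u) :+ u :* (con (+ 1) :- p) := con (+ 1) :- u :* p) refl u (u ^ r))
        (+-closed p (*-closed u (1-u^ r)))
      ^-* : ∀ r → (c * n₀) ^ r ≡ c ^ r * n₀ ^ r
      ^-* zero    = refl
      ^-* (suc r) = trans (cong (c * n₀ *_) (^-* r))
        (solve 4 (λ c n p q → c :* n :* (p :* q) := c :* p :* (n :* q)) refl c n₀ (c ^ r) (n₀ ^ r))
      u^r : Q (u ^ r)
      u^r = subst Q (sym (^-* r)) (*-closed (c ^ r) (h zero))

-- Projection, Vandermonde systems and symmetric functions of roots

module RationalSpans where

  open import Data.Fin.Properties using (suc-injective)
  open import Data.Integer.Base as ℤ using (ℤ; +_)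
  import Data.Integer.Properties as ℤ
  open import Data.Rational.Base using (↥_; ↧_) renaming (_+_ to _⊹_; _*_ to _·_; _-_ to _∸_; -_ to ⊖_)
  open import Data.Vec.Base as Vec using (Vec; []; _∷_)
  open RationalProperties
  open RationalVectors
  open RealProperties
  open Polynomials
  open DiscreteLattices using (ℤ→ℚ; ℤ→ℚ-*; ℤ→ℚ-ι; ↥-÷-↧)
  private
    module S = ℚ.+-*-Solver
  open ℝ-Solver using (solve; _:=_; _:+_; _:*_; _:-_; :-_; con)

  -- Orthogonal projection onto a rational span

  project : ∀ {d m} (v : Fin d → Vector ℚ m) (b : Vector ℚ m) →
    Σ[ q ∈ (Fin d → ℚ) ] (∀ j → Q.⟨ (λ i → b i ∸ Q.∑ᵛ (λ j → q j Q.·ᵛ v j) i) , v j ⟩ ≡ 0ℚ)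
  project {zero}  v b = (λ ()) , λ ()
  project {suc d} {m} v b = q , λ { zero → perp-v₀ ; (suc j) → ≡.trans (Q.⟨⟩-cong {w = vs j} {w′ = vs j} residual≡ (λ _ → refl)) (perp-vs j) }
    where
    vs = v ∘ suc
    v₀ = v zero
    p = proj₁ (project vs v₀)
    q′ = proj₁ (project vs b)
    V : (Fin d → ℚ) → Vector ℚ m
    V q = Q.∑ᵛ λ j → q j Q.·ᵛ vs j
    u y : Vector ℚ m
    u i = v₀ i ∸ V p i
    y i = b i ∸ V q′ i
    -- If v₀ already lies in the span of the other vectors, then u = 0 and the default of `inv`
    -- makes c = 0; the family may thus be dependent.
    c : ℚ
    c = Q.⟨ y , u ⟩ · inv Q.⟨ u , u ⟩
    q : Fin (suc d) → ℚ
    q zero    = c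
    q (suc j) = q′ j ∸ c · p j
    V-combination : ∀ i → V (λ j → q′ j ∸ c · p j) i ≡ V q′ i ⊹ (⊖ c) · V p i
    V-combination i = ≡.trans
      (Q.sum-cong-≋ λ j → S.solve 4 (λ q c p v → (q S.:- c S.:* p) S.:* v S.:= q S.:* v S.:+ (S.:- c) S.:* (p S.:* v)) refl (q′ j) c (p j) (vs j i))
      (≡.trans (Q.∑-distrib-+ (λ j → q′ j · vs j i) (λ j → (⊖ c) · (p j · vs j i)))
        (cong (V q′ i ⊹_) (≡.sym (Q.*-distribˡ-sum (⊖ c) (λ j → p j · vs j i)))))
    residual≡ : ∀ i → b i ∸ Q.∑ᵛ (λ j → q j Q.·ᵛ v j) i ≡ (y Q.+ᵛ (⊖ c) Q.·ᵛ u) i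
    residual≡ i = ≡.trans (cong (λ z → b i ∸ (c · v₀ i ⊹ z)) (V-combination i))
      (S.solve 5 (λ b c v₀ vq vp → b S.:- (c S.:* v₀ S.:+ (vq S.:+ (S.:- c) S.:* vp)) S.:= (b S.:- vq) S.:+ (S.:- c) S.:* (v₀ S.:- vp))
        refl (b i) c (v₀ i) (V q′ i) (V p i))
    expand : ∀ w → Q.⟨ y Q.+ᵛ (⊖ c) Q.·ᵛ u , w ⟩ ≡ Q.⟨ y , w ⟩ ⊹ (⊖ c) · Q.⟨ u , w ⟩
    expand w = ≡.trans (Q.⟨⟩-+ˡ y ((⊖ c) Q.·ᵛ u) w) (cong (Q.⟨ y , w ⟩ ⊹_) (Q.⟨⟩-·ˡ (⊖ c) u w))
    perp-vs : ∀ j → Q.⟨ y Q.+ᵛ (⊖ c) Q.·ᵛ u , vs j ⟩ ≡ 0ℚ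
    perp-vs j = ≡.trans (expand (vs j)) (≡.trans (cong₂ (λ a b → a ⊹ (⊖ c) · b) (proj₂ (project vs b) j) (proj₂ (project vs v₀) j))
      (S.solve 1 (λ c → S.con 0ℚ S.:+ (S.:- c) S.:* S.con 0ℚ S.:= S.con 0ℚ) refl c))
    z : Vector ℚ m
    z = y Q.+ᵛ (⊖ c) Q.·ᵛ u
    perp-u : Q.⟨ z , u ⟩ ≡ 0ℚ
    perp-u with Q.⟨ u , u ⟩ ℚ.≟ 0ℚ
    ... | yes u≡0 = Q.⟨⟩-0ʳ {v = z} {w = u} (⟨v,v⟩≡0⇒v≡0 u u≡0)
    ... | no u≢0  = ≡.trans (expand u) (≡.trans
      (S.solve 3 (λ a i n → a S.:+ (S.:- (a S.:* i)) S.:* n S.:= a S.:- a S.:* (n S.:* i)) refl Q.⟨ y , u ⟩ (inv Q.⟨ u , u ⟩) Q.⟨ u , u ⟩)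
      (≡.trans (cong (λ x → Q.⟨ y , u ⟩ ∸ Q.⟨ y , u ⟩ · x) (*-inv u≢0)) (S.solve 1 (λ a → a S.:- a S.:* S.con 1ℚ S.:= S.con 0ℚ) refl Q.⟨ y , u ⟩)))
    perp-V : ∀ p → Q.⟨ z , V p ⟩ ≡ 0ℚ
    perp-V p = ≡.trans (Q.⟨⟩-∑ʳ z (λ j → p j Q.·ᵛ vs j)) (Q.sum-0 (λ j → Q.⟨ z , p j Q.·ᵛ vs j ⟩)
      λ j → ≡.trans (Q.⟨⟩-·ʳ (p j) z (vs j)) (≡.trans (cong (p j ·_) (perp-vs j)) (ℚ.*-zeroʳ (p j))))
    perp-v₀ : Q.⟨ (λ i → b i ∸ Q.∑ᵛ (λ j → q j Q.·ᵛ v j) i) , v₀ ⟩ ≡ 0ℚ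
    perp-v₀ = ≡.trans (Q.⟨⟩-cong {w′ = u Q.+ᵛ V p} residual≡ (λ i → S.solve 2 (λ a b → a S.:= (a S.:- b) S.:+ b) refl (v₀ i) (V p i)))
      (≡.trans (Q.⟨⟩-+ʳ z u (V p)) (≡.trans (cong₂ _⊹_ perp-u (perp-V p)) refl))

  -- The combination of moment k + 1 minus t₀ times moment k eliminates ζ₀ and multiplies every
  -- other ζᵢ by tᵢ - t₀, which apartness later cancels.
  vandermonde : ∀ {d} (t ζ : Fin d → ℝ) → Apart t →
    (∀ k → k ℕ.< d → R.sum (λ i → t i R.^ k *ℝ ζ i) ≈ℝ 0ℝ) → ∀ i → ζ i ≈ℝ 0ℝ
  vandermonde {suc d} t ζ apart h = λ { zero → ζ₀≈0 ; (suc i) → rest i }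
    where
    t₀ = t zero
    ts = t ∘ suc
    ζs = ζ ∘ suc
    shifted : ∀ k → k ℕ.< d → R.sum (λ i → ts i R.^ k *ℝ ((ts i +ℝ -ℝ t₀) *ℝ ζs i)) ≈ℝ 0ℝ
    shifted k k<d = R.begin
      R.sum (λ i → ts i R.^ k *ℝ ((ts i +ℝ -ℝ t₀) *ℝ ζs i))
        R.≈⟨ R.+-identityˡ _ ⟨
      0ℝ +ℝ R.sum (λ i → ts i R.^ k *ℝ ((ts i +ℝ -ℝ t₀) *ℝ ζs i))
        R.≈⟨ R.+-cong (solve 3 (λ p t z → con 0ℚ := p :* ((t :- t) :* z)) ≈-refl (t₀ R.^ k) t₀ (ζ zero)) ≈-refl ⟩
      R.sum (λ i → t i R.^ k *ℝ ((t i +ℝ -ℝ t₀) *ℝ ζ i))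
        R.≈⟨ R.sum-cong-≋ (λ i → solve 4 (λ p t z t₀ → p :* ((t :- t₀) :* z) := (t :* p) :* z :+ (:- t₀) :* (p :* z)) ≈-refl (t i R.^ k) (t i) (ζ i) t₀) ⟩
      R.sum (λ i → t i R.^ suc k *ℝ ζ i +ℝ -ℝ t₀ *ℝ (t i R.^ k *ℝ ζ i))
        R.≈⟨ R.∑-distrib-+ (λ i → t i R.^ suc k *ℝ ζ i) (λ i → -ℝ t₀ *ℝ (t i R.^ k *ℝ ζ i)) ⟩
      R.sum (λ i → t i R.^ suc k *ℝ ζ i) +ℝ R.sum (λ i → -ℝ t₀ *ℝ (t i R.^ k *ℝ ζ i))
        R.≈⟨ R.+-cong (h (suc k) (s≤s k<d)) (R.trans (R.sym (R.*-distribˡ-sum (-ℝ t₀) (λ i → t i R.^ k *ℝ ζ i)))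
               (R.trans (R.*-congˡ (h k (ℕ.m<n⇒m<1+n k<d))) (R.zeroʳ (-ℝ t₀)))) ⟩
      0ℝ +ℝ 0ℝ
        R.≈⟨ R.+-identityˡ 0ℝ ⟩
      0ℝ R.∎
    rest : ∀ i → ζs i ≈ℝ 0ℝ
    rest i = cancel-factor (apart {suc i} {zero} λ ())
      (vandermonde ts (λ i → (ts i +ℝ -ℝ t₀) *ℝ ζs i) (λ i≢j → apart (i≢j ∘ suc-injective)) shifted i)
    ζ₀≈0 : ζ zero ≈ℝ 0ℝ
    ζ₀≈0 = R.trans (R.trans (R.sym (R.*-identityˡ (ζ zero))) (R.sym (R.+-identityʳ _)))
      (R.trans (R.+-congˡ (R.sym (R.sum-0 (λ i → 1ℝ *ℝ ζs i) λ i → R.trans (R.*-congˡ (rest i)) (R.zeroʳ 1ℝ))))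
        (h 0 (s≤s z≤n)))

  -- Injectivity of odd powers

  Pos-^ : ∀ {x} → Pos x → ∀ k → Pos (x R.^ k)
  Pos-^ p zero    = Pos-ℚ 0<1
  Pos-^ p (suc k) = Pos-* p (Pos-^ p k)

  ^-mono-Pos : ∀ {x y} → Pos y → Pos (x +ℝ -ℝ y) → ∀ k → Pos (x R.^ suc k +ℝ -ℝ (y R.^ suc k))
  ^-mono-Pos {x} {y} py d zero    = Pos-cong (solve 2 (λ x y → x :- y := x :* con 1ℚ :- y :* con 1ℚ) ≈-refl x y) d
  ^-mono-Pos {x} {y} py d (suc k) = Pos-cong
    (solve 4 (λ x y p q → x :* (p :- q) :+ (x :- y) :* q := x :* p :- y :* q) ≈-refl x y (x R.^ suc k) (y R.^ suc k))
    (Pos-+ (Pos-* px (^-mono-Pos py d k)) (Pos-* d (Pos-^ py (suc k))))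
    where
    px : Pos x
    px = Pos-cong (solve 2 (λ x y → (x :- y) :+ y := x) ≈-refl x y) (Pos-+ d py)

  ^-neg-odd : ∀ x k → (-ℝ x) R.^ suc (k ℕ.+ k) ≈ℝ -ℝ (x R.^ suc (k ℕ.+ k))
  ^-neg-odd x zero    = solve 1 (λ x → (:- x) :* con 1ℚ := :- (x :* con 1ℚ)) ≈-refl x
  ^-neg-odd x (suc k) = R.trans (R.reflexive (cong (λ e → (-ℝ x) R.^ suc e) (ℕ.+-suc (suc k) k)))
    (R.trans (R.*-congˡ (R.*-congˡ (^-neg-odd x k)))
    (R.trans (solve 2 (λ x p → (:- x) :* ((:- x) :* (:- p)) := :- (x :* (x :* p))) ≈-refl x (x R.^ suc (k ℕ.+ k)))
      (R.reflexive (cong (λ e → -ℝ (x R.^ suc e)) (≡.sym (ℕ.+-suc (suc k) k))))))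

  -- The sign of y is decided classically, which is harmless since the conclusion is negative.
  odd-power-injective : ∀ k {x y} → Pos (x +ℝ -ℝ y) → ¬ (x R.^ suc (k ℕ.+ k) ≈ℝ y R.^ suc (k ℕ.+ k))
  odd-power-injective k {x} {y} d eq = ≈0-or-#0 y λ
    { (inj₁ y≈0) → refute (positive (Pos-cong (R.trans (R.+-congˡ (-ℝ‿cong y≈0)) (solve 1 (λ x → x :- con 0ℚ := x) ≈-refl x)) d)
        (R.trans (R.*-congʳ y≈0) (R.zeroˡ _)))
    ; (inj₂ (inj₁ y>0)) → refute (^-mono-Pos y>0 d (k ℕ.+ k))
    ; (inj₂ (inj₂ y<0)) → ≈0-or-#0 x λ
      { (inj₁ x≈0) → refute (Pos-cong
          (R.trans (^-neg-odd y k) (R.trans (R.sym (R.+-identityˡ _)) (R.+-congʳ (R.sym (R.trans (R.*-congʳ x≈0) (R.zeroˡ _))))))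
          (Pos-^ y<0 (suc (k ℕ.+ k))))
      ; (inj₂ (inj₁ x>0)) → refute (Pos-+ (Pos-^ x>0 (suc (k ℕ.+ k))) (Pos-cong (^-neg-odd y k) (Pos-^ y<0 (suc (k ℕ.+ k)))))
      ; (inj₂ (inj₂ x<0)) → refute (Pos-cong
          (R.trans (R.+-cong (^-neg-odd y k) (-ℝ‿cong (^-neg-odd x k)))
            (solve 2 (λ p q → :- q :- :- p := p :- q) ≈-refl (x R.^ suc (k ℕ.+ k)) (y R.^ suc (k ℕ.+ k))))
          (^-mono-Pos x<0 (Pos-cong (solve 2 (λ x y → x :- y := :- y :- :- x) ≈-refl x y) d) (k ℕ.+ k))) } }
    where
    refute : ¬ Pos (x R.^ suc (k ℕ.+ k) +ℝ -ℝ (y R.^ suc (k ℕ.+ k)))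
    refute p = Pos⇒≉0 p (R.trans (R.+-congʳ eq) (R.-‿inverseʳ _))
    positive : Pos x → y R.^ suc (k ℕ.+ k) ≈ℝ 0ℝ → Pos (x R.^ suc (k ℕ.+ k) +ℝ -ℝ (y R.^ suc (k ℕ.+ k)))
    positive px y^≈0 = Pos-cong (R.trans (solve 1 (λ p → p := p :- con 0ℚ) ≈-refl _) (R.+-congˡ (-ℝ‿cong (R.sym y^≈0))))
      (Pos-^ px (suc (k ℕ.+ k)))

  -- The sum of the squares of the roots in terms of the coefficients

  coefficient₁ coefficient₂ : ∀ {d} → Vec ℝ d → ℝ
  coefficient₁ []       = 0ℝ
  coefficient₁ (c ∷ _)  = c
  coefficient₂ []       = 0ℝ
  coefficient₂ (_ ∷ cs) = coefficient₁ cs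

  -- Newton's identity p₂ = c₁² - 2c₂, by splitting off a root x: the quotient has coefficients x +
  -- c₁ and x(x + c₁) + c₂. In low degree the default coefficient 0 agrees with these because the
  -- remainder vanishes.
  sum-of-squares : ∀ {d} (cs : Vec ℝ d) (t : Fin d → ℝ) → Apart t → (∀ i → evalAt (t i) cs 1ℝ ≈ℝ 0ℝ) →
    R.sum (λ i → t i *ℝ t i) ≈ℝ coefficient₁ cs *ℝ coefficient₁ cs +ℝ -ℝ (coefficient₂ cs +ℝ coefficient₂ cs)
  sum-of-squares []       t apart roots = solve 0 (con 0ℚ := con 0ℚ :* con 0ℚ :- (con 0ℚ :+ con 0ℚ)) ≈-refl
  sum-of-squares (c ∷ cs) t apart roots = R.trans
    (R.+-congˡ (sum-of-squares q (t ∘ suc) (λ i≢j → apart (i≢j ∘ suc-injective))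
      (λ j → quotient-root (t (suc j)) x c cs (apart {suc j} {zero} λ ()) (roots zero) (roots (suc j)))))
    (R.trans (R.+-congˡ (R.+-cong (*-cong (first cs (roots zero)) (first cs (roots zero)))
        (-ℝ‿cong (+-cong (second cs (roots zero)) (second cs (roots zero))))))
      (solve 3 (λ x c d → x :* x :+ ((x :* con 1ℚ :+ c :* con 1ℚ) :* (x :* con 1ℚ :+ c :* con 1ℚ)
          :- ((x :* (x :* con 1ℚ :+ c :* con 1ℚ) :+ d :* con 1ℚ) :+ (x :* (x :* con 1ℚ :+ c :* con 1ℚ) :+ d :* con 1ℚ)))
        := c :* c :- (d :+ d)) ≈-refl x c (coefficient₁ cs)))
    where
    x = t zero
    b₁ = x *ℝ 1ℝ +ℝ c *ℝ 1ℝ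
    q = quotient x cs b₁
    first : ∀ {d} (cs : Vec ℝ d) → evalAt x cs b₁ ≈ℝ 0ℝ → coefficient₁ (quotient x cs b₁) ≈ℝ b₁
    first []       b₁≈0 = R.sym b₁≈0
    first (_ ∷ _)  _    = ≈-refl
    second : ∀ {d} (cs : Vec ℝ d) → evalAt x cs b₁ ≈ℝ 0ℝ → coefficient₂ (quotient x cs b₁) ≈ℝ x *ℝ b₁ +ℝ coefficient₁ cs *ℝ 1ℝ
    second []            b₁≈0 = R.sym (R.trans (R.+-congʳ (R.*-congˡ b₁≈0)) (solve 1 (λ x → x :* con 0ℚ :+ con 0ℚ :* con 1ℚ := con 0ℚ) ≈-refl x))
    second (c ∷ [])      b₂≈0 = R.sym b₂≈0
    second (c ∷ c′ ∷ cs) _    = ≈-refl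

  -- Exponents of the successive coefficients below the leading one.
  exponent : ∀ {d} → Fin d → ℕ
  exponent {suc d} zero    = d
  exponent {suc d} (suc j) = exponent j

  exponent-surjective : ∀ {d} k → k ℕ.< d → ∃ λ (j : Fin d) → exponent j ≡ k
  exponent-surjective {suc d} k k<1+d with ℕ.m≤n⇒m<n∨m≡n (ℕ.≤-pred k<1+d)
  ... | inj₂ refl = zero , refl
  ... | inj₁ k<d  = let j , eq = exponent-surjective k k<d in suc j , eq

  evalAt-tabulate : ∀ {d} x (c : Fin d → ℝ) b →
    evalAt x (Vec.tabulate c) b ≈ℝ b *ℝ x R.^ d +ℝ R.sum (λ j → c j *ℝ x R.^ exponent j)
  evalAt-tabulate {zero}  x c b = solve 1 (λ b → b := b :* con 1ℚ :+ con 0ℚ) ≈-refl b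
  evalAt-tabulate {suc d} x c b = R.trans (evalAt-tabulate x (c ∘ suc) (x *ℝ b +ℝ c zero *ℝ 1ℝ))
    (solve 5 (λ x b c p s → (x :* b :+ c :* con 1ℚ) :* p :+ s := b :* (x :* p) :+ (c :* p :+ s)) ≈-refl
      x b (c zero) (x R.^ d) (R.sum λ j → c (suc j) *ℝ x R.^ exponent j))

  common-denominator : ∀ {d} (A : Fin d → ℚ) → Σ[ N ∈ ℤ ] Σ[ k ∈ (Fin d → ℤ) ] (ℤ→ℚ N ≢ 0ℚ × (∀ i → A i · ℤ→ℚ N ≡ ℤ→ℚ (k i)))
  common-denominator {zero}  A = + 1 , (λ ()) , (λ eq → contradiction (≡.trans (≡.sym (ℤ→ℚ-ι 1)) eq) λ ()) , λ ()
  common-denominator {suc d} A = let N , k , N≢0 , h = common-denominator (A ∘ suc) in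
    N ℤ.* D , (λ { zero → ↥ A₀ ℤ.* N ; (suc i) → k i ℤ.* D }) ,
    (λ eq → D≢0 (*-zero-product N≢0 (≡.trans (≡.sym (ℤ→ℚ-* N D)) eq))) ,
    λ { zero → ≡.trans (cong (A₀ ·_) (ℤ→ℚ-* N D)) (≡.trans
          (S.solve 3 (λ a n d → a S.:* (n S.:* d) S.:= (a S.:* d) S.:* n) refl A₀ (ℤ→ℚ N) (ℤ→ℚ D))
          (≡.trans (cong (_· ℤ→ℚ N) (↥-÷-↧ A₀)) (≡.sym (ℤ→ℚ-* (↥ A₀) N))))
      ; (suc i) → ≡.trans (cong (A (suc i) ·_) (ℤ→ℚ-* N D)) (≡.trans (≡.sym (ℚ.*-assoc (A (suc i)) (ℤ→ℚ N) (ℤ→ℚ D)))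
          (≡.trans (cong (_· ℤ→ℚ D) (h i)) (≡.sym (ℤ→ℚ-* (k i) D)))) }
    where
    A₀ = A zero
    D = ↧ A₀
    D≢0 : ℤ→ℚ D ≢ 0ℚ
    D≢0 eq = >⇒≢0 (0<ι (ℕ.pred (ℤ.∣ D ∣))) (≡.trans (≡.sym (ℤ→ℚ-ι _)) eq)

-- Rational ratios of eigenvalues from commensurable odd powers

module RationalRatios {n : ℕ} (H : Matrix ℚ n) (H-sym : ℚM.IsSymmetric H) (a : Fin n) where

  open import Data.Integer.Base as ℤ using (ℤ)
  open SpectralDecomposition
  open EigenvalueSupport using (RootSymmetric)

  import Algebra.Properties.Semiring.Exp as SemiringExp
  open import Data.Integer.Base using (+_)
  open import Data.Rational.Base using () renaming (_+_ to _⊹_; _*_ to _·_; _-_ to _∸_; -_ to ⊖_)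
  open import Data.Vec.Base as Vec using (Vec)
  open RationalProperties
  open RationalVectors
  open RealProperties
  open Polynomials
  open RealVectors
  open DiscreteLattices using (ℤ→ℚ; ℤ→ℚ-*; ℤ→ℚ-ι; zℝ; zℝ-≢; module Z)
  open RationalSpans
  open Krylov H H-sym a
  open R using (⟨_,_⟩; pow; basis; _≈ᵛ_; ∑ᵛ; _·ᵛ_)
  private
    module S = ℚ.+-*-Solver
  open ℝ-Solver using (solve; _:=_; _:+_; _:*_; _:-_; :-_; con)
  open SemiringExp R.semiring using (^-congˡ; ^-assocʳ)
  open EigenDecomposition decomposition public

  private
    Hᵣ : Matrix ℝ n
    Hᵣ = toℝ H

  u : ℕ → Vector ℚ n
  u j = Q.pow H j (Q.basis a)

  pow-cast : ∀ j → pow Hᵣ j eₐ ≈ᵛ cast (u j)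
  pow-cast zero    i = R.sym (cast-basis a i)
  pow-cast (suc j) i = R.trans (R.*ᵛ-cong Hᵣ (pow-cast j) i) (*ᵛ-cast H (u j) i)

  pow-parts : ∀ j → pow Hᵣ j eₐ ≈ᵛ ∑ᵛ (λ i → (λs i R.^ j) ·ᵛ part i)
  pow-parts j i = R.trans (R.pow-cong Hᵣ j total i) (R.trans (pow-∑ j i) (R.sum-cong-≋ λ l → R.pow-eigenvector Hᵣ (eigen l) j i))
    where
    pow-∑ : ∀ j → pow Hᵣ j (∑ᵛ part) ≈ᵛ ∑ᵛ (λ i → pow Hᵣ j (part i))
    pow-∑ zero    i = ≈-refl
    pow-∑ (suc j) i = R.trans (R.*ᵛ-cong Hᵣ (pow-∑ j) i) (R.*ᵛ-∑ Hᵣ (λ l → pow Hᵣ j (part l)) i)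

  ⟨pow,kernel⟩ : ∀ {x} → Root x → ∀ j → ⟨ pow Hᵣ j eₐ , kernel x deg ⟩ ≈ℝ x R.^ j
  ⟨pow,kernel⟩ {x} root j = R.trans (R.⟨⟩-pow-eigenvector Hᵣ (Hℝ-sym H H-sym) (kernel-eigenvector root) j eₐ)
    (R.trans (R.*-congˡ (R.trans (R.⟨⟩-comm eₐ (kernel x deg)) (⟨kernel,eₐ⟩ x))) (R.*-identityʳ _))

  module _ (root-sym : RootSymmetric H H-sym a) (k : ℕ) where

    private
      r : ℕ
      r = suc (k ℕ.+ k)

    module _ (η : ℝ) (η#0 : η #0) (m : Fin deg → ℤ) (weight : Fin deg → ℤ) (bézout : Z.⟨ weight , m ⟩ ≡ + 1)
             (power : ∀ i → λs i R.^ r ≈ℝ zℝ (m i) *ℝ η) where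

      private
        t : Fin deg → ℝ
        t i = zℝ (m i) *ℝ η

        -- Since r is odd, x ↦ xʳ is injective on ℝ, so the integers mᵢ still tell the roots apart;
        -- Vandermonde in the tᵢ depends on it.
        m-injective : ∀ {i j} → i ≢ j → m i ≢ m j
        m-injective {i} {j} i≢j mi≡mj = refute (λs-apart i≢j)
          where
          same : λs i R.^ r ≈ℝ λs j R.^ r
          same = R.trans (power i) (R.trans (R.reflexive (cong (λ z → zℝ z *ℝ η) mi≡mj)) (R.sym (power j)))
          refute : ¬ (λs i +ℝ -ℝ λs j #0)
          refute (inj₁ p) = odd-power-injective k p same
          refute (inj₂ p) = odd-power-injective k
            (Pos-cong (solve 2 (λ x y → :- (x :- y) := y :- x) ≈-refl (λs i) (λs j)) p) (R.sym same)

        t-apart : Apart t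
        t-apart {i} {j} i≢j = #0-cong (solve 3 (λ a b η → (a :- b) :* η := a :* η :- b :* η) ≈-refl (zℝ (m i)) (zℝ (m j)) η)
          (#0-* (zℝ-≢ (m-injective i≢j)) η#0)

        power′ : ∀ i e → λs i R.^ (r ℕ.* e) ≈ℝ t i R.^ e
        power′ i e = R.trans (R.sym (^-assocʳ (λs i) r e)) (^-congˡ e (power i))

        generators : Fin deg → Vector ℚ n
        generators j = u (r ℕ.* exponent j)

      -- A rational vector orthogonal to all Hʳᵉ e_a (e < deg) is orthogonal to every part of e_a, by Vandermonde.
      in-span : ∀ s → Σ[ q ∈ (Fin deg → ℚ) ] (∀ i → u s i ≡ Q.∑ᵛ (λ j → q j Q.·ᵛ generators j) i)
      in-span s = q , λ i → ≡.trans
        (S.solve 2 (λ b c → b S.:= (b S.:- c) S.:+ c) refl (u s i) (V i))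
        (≡.trans (cong (_⊹ V i) (⟨v,v⟩≡0⇒v≡0 y ⟨y,y⟩≡0 i)) (ℚ.+-identityˡ (V i)))
        where
        q = proj₁ (project generators (u s))
        V y : Vector ℚ n
        V = Q.∑ᵛ (λ j → q j Q.·ᵛ generators j)
        y i = u s i ∸ V i
        ζ : Fin deg → ℝ
        ζ i = ⟨ cast y , part i ⟩
        ⟨y,u⟩ : ∀ j → ⟨ cast y , pow Hᵣ j eₐ ⟩ ≈ℝ R.sum (λ i → λs i R.^ j *ℝ ζ i)
        ⟨y,u⟩ j = R.trans (R.⟨⟩-cong {v = cast y} {v′ = cast y} (λ _ → ≈-refl) (pow-parts j))
          (R.trans (R.⟨⟩-∑ʳ (cast y) (λ i → (λs i R.^ j) ·ᵛ part i)) (R.sum-cong-≋ λ i → R.⟨⟩-·ʳ (λs i R.^ j) (cast y) (part i)))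
        ⟨y,u⟩ℚ : ∀ j → ⟨ cast y , pow Hᵣ j eₐ ⟩ ≈ℝ ℚ→ℝ Q.⟨ y , u j ⟩
        ⟨y,u⟩ℚ j = R.trans (R.⟨⟩-cong {v = cast y} {v′ = cast y} (λ _ → ≈-refl) (pow-cast j)) (⟨⟩-cast y (u j))
        ζ≈0 : ∀ i → ζ i ≈ℝ 0ℝ
        ζ≈0 = vandermonde t ζ t-apart λ e e<d → moment e (exponent-surjective e e<d)
          where
          moment : ∀ e → (∃ λ j → exponent {deg} j ≡ e) → R.sum (λ i → t i R.^ e *ℝ ζ i) ≈ℝ 0ℝ
          moment e (j , refl) = R.trans (R.sum-cong-≋ λ i → R.*-congʳ (R.sym (power′ i (exponent j))))
            (R.trans (R.sym (⟨y,u⟩ (r ℕ.* exponent j))) (R.trans (⟨y,u⟩ℚ (r ℕ.* exponent j))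
              (ℚ→ℝ-cong (proj₂ (project generators (u s)) j))))
        ⟨y,us⟩≡0 : Q.⟨ y , u s ⟩ ≡ 0ℚ
        ⟨y,us⟩≡0 = ℚ→ℝ-injective (R.trans (R.sym (⟨y,u⟩ℚ s)) (R.trans (⟨y,u⟩ s)
          (R.sum-0 (λ i → λs i R.^ s *ℝ ζ i) λ i → R.trans (R.*-congˡ (ζ≈0 i)) (R.zeroʳ _))))
        ⟨y,V⟩≡0 : Q.⟨ y , V ⟩ ≡ 0ℚ
        ⟨y,V⟩≡0 = ≡.trans (Q.⟨⟩-∑ʳ y (λ j → q j Q.·ᵛ generators j)) (Q.sum-0 (λ j → Q.⟨ y , q j Q.·ᵛ generators j ⟩)
          λ j → ≡.trans (Q.⟨⟩-·ʳ (q j) y (generators j)) (≡.trans (cong (q j ·_) (proj₂ (project generators (u s)) j)) (ℚ.*-zeroʳ (q j))))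
        ⟨y,y⟩≡0 : Q.⟨ y , y ⟩ ≡ 0ℚ
        ⟨y,y⟩≡0 = ≡.trans (Q.⟨⟩-cong {v = y} {v′ = y} {w′ = u s Q.+ᵛ (⊖ 1ℚ) Q.·ᵛ V} (λ _ → refl)
            (λ i → S.solve 2 (λ b c → b S.:- c S.:= b S.:+ S.con (⊖ 1ℚ) S.:* c) refl (u s i) (V i)))
          (≡.trans (Q.⟨⟩-+ʳ y (u s) ((⊖ 1ℚ) Q.·ᵛ V)) (≡.trans (cong₂ _⊹_ ⟨y,us⟩≡0
            (≡.trans (Q.⟨⟩-·ʳ (⊖ 1ℚ) y V) (cong ((⊖ 1ℚ) ·_) ⟨y,V⟩≡0))) refl))

      -- Pairing the linear relation between the vectors Hʲe_a with the kernel vector turns it into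
      -- a relation between powers of x. It is stated for every root, as it is evaluated at λ and at
      -- -λ.
      root-relation : ∀ s {x} → Root x → x R.^ s ≈ℝ R.sum (λ j → ℚ→ℝ (proj₁ (in-span s) j) *ℝ (x R.^ r) R.^ exponent j)
      root-relation s {x} root = R.begin
        x R.^ s
          R.≈⟨ ⟨pow,kernel⟩ root s ⟨
        ⟨ pow Hᵣ s eₐ , v ⟩
          R.≈⟨ R.⟨⟩-cong {w = v} {w′ = v} (λ i → R.trans (pow-cast s i) (spanned i)) (λ _ → ≈-refl) ⟩
        ⟨ ∑ᵛ (λ j → ℚ→ℝ (q j) ·ᵛ pow Hᵣ (r ℕ.* exponent j) eₐ) , v ⟩
          R.≈⟨ R.trans (R.⟨⟩-∑ˡ (λ j → ℚ→ℝ (q j) ·ᵛ pow Hᵣ (r ℕ.* exponent j) eₐ) v)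
                 (R.sum-cong-≋ λ j → R.trans (R.⟨⟩-·ˡ (ℚ→ℝ (q j)) (pow Hᵣ (r ℕ.* exponent j) eₐ) v)
                   (R.*-congˡ (R.trans (⟨pow,kernel⟩ root (r ℕ.* exponent j)) (R.sym (^-assocʳ x r (exponent j)))))) ⟩
        R.sum (λ j → ℚ→ℝ (q j) *ℝ (x R.^ r) R.^ exponent j) R.∎
        where
        v = kernel x deg
        q = proj₁ (in-span s)
        spanned : ∀ i → ℚ→ℝ (u s i) ≈ℝ R.sum (λ j → ℚ→ℝ (q j) *ℝ pow Hᵣ (r ℕ.* exponent j) eₐ i)
        spanned i = R.trans (ℚ→ℝ-cong (proj₂ (in-span s) i)) (R.trans
          (R.sym (pointwise (seq-sum λ j → ℚ→ℝ (q j) *ℝ ℚ→ℝ (generators j i))))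
          (R.sum-cong-≋ λ j → R.*-congˡ {ℚ→ℝ (q j)} (R.sym (pow-cast (r ℕ.* exponent j) i))))

      -- η² is rational: the tᵢ = mᵢ η are the roots of a monic rational polynomial, so Σ tᵢ² is rational.
      η²-rational : ∃ λ s → η *ℝ η ≈ℝ ℚ→ℝ s
      η²-rational = c · inv M₂ , (R.begin
        η *ℝ η                                    R.≈⟨ R.*-identityˡ (η *ℝ η) ⟨
        1ℝ *ℝ (η *ℝ η)                            R.≈⟨ R.*-congʳ (ℚ→ℝ-cong (≡.trans (ℚ.*-comm (inv M₂) M₂) (*-inv M₂≢0))) ⟨
        ℚ→ℝ (inv M₂ · M₂) *ℝ (η *ℝ η)             R.≈⟨ R.trans (R.*-congʳ (pointwise λ _ → refl)) (R.*-assoc (ℚ→ℝ (inv M₂)) (ℚ→ℝ M₂) (η *ℝ η)) ⟩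
        ℚ→ℝ (inv M₂) *ℝ (ℚ→ℝ M₂ *ℝ (η *ℝ η))      R.≈⟨ R.*-congˡ {ℚ→ℝ (inv M₂)} M₂η²≈c ⟩
        ℚ→ℝ (inv M₂) *ℝ ℚ→ℝ c                     R.≈⟨ pointwise (λ _ → ℚ.*-comm (inv M₂) c) ⟩
        ℚ→ℝ (c · inv M₂)                          R.∎)
        where
        mℚ : Fin deg → ℚ
        mℚ i = ℤ→ℚ (m i)
        M₂ : ℚ
        M₂ = Q.⟨ mℚ , mℚ ⟩
        -- Coprimality excludes that all mᵢ are 0, and a rational vector of norm 0 is 0.
        M₂≢0 : M₂ ≢ 0ℚ
        M₂≢0 eq = contradiction (≡.trans (≡.sym (ℤ→ℚ-ι 1)) (≡.trans (cong ℤ→ℚ (≡.sym bézout)) (≡.trans (ℤ→ℚ-sum (λ i → weight i ℤ.* m i))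
          (Q.sum-0 (λ i → ℤ→ℚ (weight i ℤ.* m i)) λ i → ≡.trans (ℤ→ℚ-* (weight i) (m i))
            (≡.trans (cong (ℤ→ℚ (weight i) ·_) (⟨v,v⟩≡0⇒v≡0 mℚ eq i)) (ℚ.*-zeroʳ (ℤ→ℚ (weight i)))))))) λ ()
          where
          open DiscreteLattices using (ℤ→ℚ-+)
          ℤ→ℚ-sum : ∀ {d} (f : Vector ℤ d) → ℤ→ℚ (Z.sum f) ≡ Q.sum (ℤ→ℚ ∘ f)
          ℤ→ℚ-sum {zero}  f = ℤ→ℚ-ι 0
          ℤ→ℚ-sum {suc d} f = ≡.trans (ℤ→ℚ-+ (f zero) (Z.sum (f ∘ suc))) (cong (ℤ→ℚ (f zero) ⊹_) (ℤ→ℚ-sum (f ∘ suc)))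
        -- Expressing λ^(r·deg) by the lower powers of λʳ gives a monic rational polynomial of
        -- degree `deg`; the tᵢ are `deg` apart roots of it, hence all of them.
        q = proj₁ (in-span (r ℕ.* deg))
        cs : Vec ℝ deg
        cs = Vec.tabulate λ j → ℚ→ℝ (⊖ q j)
        roots : ∀ i → evalAt (t i) cs 1ℝ ≈ℝ 0ℝ
        roots i = R.trans (evalAt-tabulate (t i) (λ j → ℚ→ℝ (⊖ q j)) 1ℝ) (R.begin
          1ℝ *ℝ t i R.^ deg +ℝ R.sum (λ j → ℚ→ℝ (⊖ q j) *ℝ t i R.^ exponent j)
            R.≈⟨ R.+-cong (R.trans (R.*-identityˡ _) (R.sym (power′ i deg)))
                   (R.trans (R.sum-cong-≋ λ j → R.trans (R.*-congʳ {t i R.^ exponent j} (pointwise {y = -ℝ 1ℝ *ℝ ℚ→ℝ (q j)} λ _ → S.solve 1 (λ q → S.:- q S.:= S.con (⊖ 1ℚ) S.:* q) refl (q j)))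
                       (R.trans (R.*-assoc (-ℝ 1ℝ) (ℚ→ℝ (q j)) (t i R.^ exponent j))
                         (R.*-congˡ (R.*-congˡ (R.sym (^-congˡ (exponent j) (power i)))))))
                     (R.sym (R.*-distribˡ-sum (-ℝ 1ℝ) (λ j → ℚ→ℝ (q j) *ℝ (λs i R.^ r) R.^ exponent j)))) ⟩
          λs i R.^ (r ℕ.* deg) +ℝ -ℝ 1ℝ *ℝ R.sum (λ j → ℚ→ℝ (q j) *ℝ (λs i R.^ r) R.^ exponent j)
            R.≈⟨ R.+-congˡ (R.*-congˡ (root-relation (r ℕ.* deg) (λs-root i))) ⟨
          λs i R.^ (r ℕ.* deg) +ℝ -ℝ 1ℝ *ℝ λs i R.^ (r ℕ.* deg)
            R.≈⟨ solve 1 (λ p → p :+ (:- con 1ℚ) :* p := con 0ℚ) ≈-refl (λs i R.^ (r ℕ.* deg)) ⟩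
          0ℝ R.∎)
        rational₁ : ∀ {d} (f : Fin d → ℚ) → ∃ λ x → coefficient₁ (Vec.tabulate (ℚ→ℝ ∘ f)) ≈ℝ ℚ→ℝ x
        rational₁ {zero}  f = 0ℚ , ≈-refl
        rational₁ {suc d} f = f zero , ≈-refl
        rational₂ : ∀ {d} (f : Fin d → ℚ) → ∃ λ x → coefficient₂ (Vec.tabulate (ℚ→ℝ ∘ f)) ≈ℝ ℚ→ℝ x
        rational₂ {zero}  f = 0ℚ , ≈-refl
        rational₂ {suc d} f = rational₁ (f ∘ suc)
        c₁ = proj₁ (rational₁ (⊖_ ∘ q))
        c₂ = proj₁ (rational₂ (⊖_ ∘ q))
        c = c₁ · c₁ ∸ (c₂ ⊹ c₂)
        M₂η²≈c : ℚ→ℝ M₂ *ℝ (η *ℝ η) ≈ℝ ℚ→ℝ c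
        M₂η²≈c = R.begin
          ℚ→ℝ M₂ *ℝ (η *ℝ η)                       R.≈⟨ R.*-congʳ (⟨⟩-cast mℚ mℚ) ⟨
          R.sum (λ i → zℝ (m i) *ℝ zℝ (m i)) *ℝ (η *ℝ η)
            R.≈⟨ R.trans (R.*-distribʳ-sum (η *ℝ η) (λ i → zℝ (m i) *ℝ zℝ (m i)))
                   (R.sum-cong-≋ λ i → solve 2 (λ m η → (m :* m) :* (η :* η) := (m :* η) :* (m :* η)) ≈-refl (zℝ (m i)) η) ⟩
          R.sum (λ i → t i *ℝ t i)                 R.≈⟨ sum-of-squares cs t t-apart roots ⟩
          coefficient₁ cs *ℝ coefficient₁ cs +ℝ -ℝ (coefficient₂ cs +ℝ coefficient₂ cs)
            R.≈⟨ R.+-cong (*-cong e₁ e₁) (-ℝ‿cong (+-cong e₂ e₂)) ⟩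
          ℚ→ℝ c₁ *ℝ ℚ→ℝ c₁ +ℝ -ℝ (ℚ→ℝ c₂ +ℝ ℚ→ℝ c₂) R.≈⟨ pointwise (λ _ → refl) ⟩
          ℚ→ℝ c                                    R.∎
          where
          e₁ = proj₂ (rational₁ (⊖_ ∘ q))
          e₂ = proj₂ (rational₂ (⊖_ ∘ q))

      -- λ and −λ are the values of one rational polynomial at t and −t, so λ is an odd rational polynomial in t = mη.
      ratio-rational : ∃ λ (A : Fin deg → ℚ) → ∀ i → λs i ≈ℝ ℚ→ℝ (A i) *ℝ η
      ratio-rational = A , λ i → R.begin
        λs i
          R.≈⟨ solve 1 (λ x → x := con ½ :* (x :* con 1ℚ :- (:- x) :* con 1ℚ)) ≈-refl (λs i) ⟩
        ℚ→ℝ ½ *ℝ (λs i R.^ 1 +ℝ -ℝ ((-ℝ λs i) R.^ 1))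
          R.≈⟨ R.*-congˡ (R.+-cong (at-root i) (-ℝ‿cong (at-minus-root i))) ⟩
        ℚ→ℝ ½ *ℝ (R.sum (λ j → ℚ→ℝ (q j) *ℝ (E i j +ℝ O i j *ℝ η)) +ℝ -ℝ R.sum (λ j → ℚ→ℝ (q j) *ℝ (E i j +ℝ -ℝ (O i j *ℝ η))))
          R.≈⟨ R.*-congˡ (R.trans (R.+-congˡ minus) (R.trans (R.sym (R.∑-distrib-+
                 (λ j → ℚ→ℝ (q j) *ℝ (E i j +ℝ O i j *ℝ η)) (λ j → -ℝ 1ℝ *ℝ (ℚ→ℝ (q j) *ℝ (E i j +ℝ -ℝ (O i j *ℝ η))))))
                 (R.trans (R.sum-cong-≋ λ j → solve 4 (λ q e o η → q :* (e :+ o :* η) :+ (:- con 1ℚ) :* (q :* (e :- o :* η))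
                      := (q :* o) :* ((con 1ℚ :+ con 1ℚ) :* η)) ≈-refl (ℚ→ℝ (q j)) (E i j) (O i j) η)
                   (R.sym (R.*-distribʳ-sum ((1ℝ +ℝ 1ℝ) *ℝ η) (λ j → ℚ→ℝ (q j) *ℝ O i j)))))) ⟩
        ℚ→ℝ ½ *ℝ (R.sum (λ j → ℚ→ℝ (q j) *ℝ O i j) *ℝ ((1ℝ +ℝ 1ℝ) *ℝ η))
          R.≈⟨ solve 2 (λ s η → con ½ :* (s :* ((con 1ℚ :+ con 1ℚ) :* η)) := s :* η) ≈-refl (R.sum (λ j → ℚ→ℝ (q j) *ℝ O i j)) η ⟩
        R.sum (λ j → ℚ→ℝ (q j) *ℝ O i j) *ℝ η
          R.≈⟨ R.*-congʳ (pointwise (seq-sum λ j → ℚ→ℝ (q j) *ℝ O i j)) ⟩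
        ℚ→ℝ (A i) *ℝ η R.∎
        where
        s = proj₁ η²-rational
        q = proj₁ (in-span 1)
        -- With η² = s rational, (μη)ᵉ lies in ℚ + ℚη; these are its two coordinates, an even and an
        -- odd function of μ.
        even odd : ℚ → ℕ → ℚ
        even μ zero    = 1ℚ
        even μ (suc e) = μ · s · odd μ e
        odd μ zero    = 0ℚ
        odd μ (suc e) = μ · even μ e
        E O : Fin deg → Fin deg → ℝ
        E i j = ℚ→ℝ (even (ℤ→ℚ (m i)) (exponent j))
        O i j = ℚ→ℝ (odd (ℤ→ℚ (m i)) (exponent j))
        A : Fin deg → ℚ
        A i = Q.sum λ j → q j · odd (ℤ→ℚ (m i)) (exponent j)
        t^ : ∀ μ e → (ℚ→ℝ μ *ℝ η) R.^ e ≈ℝ ℚ→ℝ (even μ e) +ℝ ℚ→ℝ (odd μ e) *ℝ η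
        t^ μ zero    = solve 1 (λ η → con 1ℚ := con 1ℚ :+ con 0ℚ :* η) ≈-refl η
        t^ μ (suc e) = R.begin
          (ℚ→ℝ μ *ℝ η) *ℝ (ℚ→ℝ μ *ℝ η) R.^ e
            R.≈⟨ R.*-congˡ (t^ μ e) ⟩
          (ℚ→ℝ μ *ℝ η) *ℝ (ℚ→ℝ (even μ e) +ℝ ℚ→ℝ (odd μ e) *ℝ η)
            R.≈⟨ solve 4 (λ μ η a b → (μ :* η) :* (a :+ b :* η) := μ :* (η :* η) :* b :+ (μ :* a) :* η) ≈-refl (ℚ→ℝ μ) η (ℚ→ℝ (even μ e)) (ℚ→ℝ (odd μ e)) ⟩
          ℚ→ℝ μ *ℝ (η *ℝ η) *ℝ ℚ→ℝ (odd μ e) +ℝ (ℚ→ℝ μ *ℝ ℚ→ℝ (even μ e)) *ℝ η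
            R.≈⟨ R.+-cong (R.trans (R.*-congʳ (R.*-congˡ (proj₂ η²-rational))) (pointwise λ _ → refl)) (R.*-congʳ (pointwise λ _ → refl)) ⟩
          ℚ→ℝ (even μ (suc e)) +ℝ ℚ→ℝ (odd μ (suc e)) *ℝ η R.∎
        parity : ∀ μ e → even (⊖ μ) e ≡ even μ e × odd (⊖ μ) e ≡ ⊖ odd μ e
        parity μ zero    = refl , refl
        parity μ (suc e) = let p , q = parity μ e in
          ≡.trans (cong (λ z → ⊖ μ · s · z) q) (S.solve 3 (λ m s z → (S.:- m) S.:* s S.:* (S.:- z) S.:= m S.:* s S.:* z) refl μ s (odd μ e)) ,
          ≡.trans (cong (λ z → ⊖ μ · z) p) (S.solve 2 (λ m z → (S.:- m) S.:* z S.:= S.:- (m S.:* z)) refl μ (even μ e))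
        at-root : ∀ i → λs i R.^ 1 ≈ℝ R.sum (λ j → ℚ→ℝ (q j) *ℝ (E i j +ℝ O i j *ℝ η))
        at-root i = R.trans (root-relation 1 (λs-root i)) (R.sum-cong-≋ λ j → R.*-congˡ {ℚ→ℝ (q j)}
          (R.trans (^-congˡ (exponent j) (power i)) (t^ (ℤ→ℚ (m i)) (exponent j))))
        at-minus-root : ∀ i → (-ℝ λs i) R.^ 1 ≈ℝ R.sum (λ j → ℚ→ℝ (q j) *ℝ (E i j +ℝ -ℝ (O i j *ℝ η)))
        at-minus-root i = R.trans (root-relation 1 (root-sym (λs-root i))) (R.sum-cong-≋ λ j → R.*-congˡ {ℚ→ℝ (q j)} (R.trans
          (^-congˡ (exponent j) (R.trans (^-neg-odd (λs i) k) (R.trans (-ℝ‿cong (power i))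
            (R.trans (solve 2 (λ m η → :- (m :* η) := (:- m) :* η) ≈-refl (zℝ (m i)) η) (R.*-congʳ (pointwise {y = ℚ→ℝ (⊖ ℤ→ℚ (m i))} λ _ → refl))))))
          (R.trans (t^ (⊖ ℤ→ℚ (m i)) (exponent j)) (R.+-cong (ℚ→ℝ-cong (proj₁ (parity (ℤ→ℚ (m i)) (exponent j))))
            (R.trans (R.*-congʳ (R.trans (ℚ→ℝ-cong (proj₂ (parity (ℤ→ℚ (m i)) (exponent j)))) (pointwise {y = -ℝ O i j} λ _ → refl)))
              (solve 2 (λ o η → (:- o) :* η := :- (o :* η)) ≈-refl (O i j) η))))))
        minus : ∀ {x} → -ℝ R.sum {deg} x ≈ℝ R.sum (λ j → -ℝ 1ℝ *ℝ x j)
        minus {x} = R.trans (solve 1 (λ s → :- s := (:- con 1ℚ) :* s) ≈-refl (R.sum x)) (R.*-distribˡ-sum (-ℝ 1ℝ) x)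

-- Transfer for a matrix and for its odd powers

module StateTransfer where

  import Algebra.Properties.Semiring.Exp as SemiringExp
  open import Data.Integer.Base as ℤ using (ℤ; +_; +0; -[1+_]; +[1+_])
  import Data.Integer.Properties as ℤ
  open import Data.Rational.Base using (_≤_; _<_; ∣_∣) renaming (_+_ to _⊹_; _*_ to _·_; _-_ to _∸_; -_ to ⊖_)
  open RationalProperties
  open RealProperties
  open Polynomials using (module R; cancel-factor)
  open ComplexProperties
  open UnitCircle
  open MatrixExponential
  open TransferOnEigenvectors
  open DiscreteLattices
  open IntegerArithmetic
  open RationalSpans
  open SpectralDecomposition
  open EigenvalueSupport using (RootSymmetric)
  open R using (⟨_,_⟩; pow; basis; _≈ᵛ_; ∑ᵛ; _·ᵛ_; _*ᵛ_)
  private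
    module S = ℚ.+-*-Solver
  open ℝ-Solver using (solve; _:=_; _:+_; _:*_; _:-_; :-_; con)
  open SemiringExp R.semiring using (^-congˡ; ^-assocʳ)

  Ker : ℝ → Set
  Ker x = e x ≈ℂ 1ℂ

  Ker-+ : ∀ {x y} → Ker x → Ker y → Ker (x +ℝ y)
  Ker-+ {x} {y} p q = C.trans (e-+ x y) (C.trans (C.*-cong p q) (C.*-identityˡ 1ℂ))

  Ker-neg : ∀ {x} → Ker x → Ker (-ℝ x)
  Ker-neg {x} p = C.trans (C.sym (C.*-identityˡ _)) (C.trans (C.*-congʳ (C.sym p)) (e-*-neg x))

  Ker-discrete : Discrete Ker
  Ker-discrete = record
    { P-cong = λ eq p → C.trans (e-cong (R.sym eq)) p
    ; P-0    = e-0
    ; P-sub  = λ p q → Ker-+ p (Ker-neg q)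
    ; δ      = ½ · (½ · 1ℚ)
    ; 0<δ    = half-pos (half-pos 0<1)
    ; gap    = λ x p → gap x p (small-or-large x 1ℚ 0<1)
    }
    where
    gap : ∀ x → Ker x → Ev (λ n → ∣ seq x n ∣ < 1ℚ) ⊎ Ev (λ n → ½ · (½ · 1ℚ) ≤ seq x n) ⊎ Ev (λ n → ½ · (½ · 1ℚ) ≤ ⊖ seq x n) →
      x ≈ℝ 0ℝ ⊎ Ev (λ n → ½ · (½ · 1ℚ) ≤ seq x n) ⊎ Ev (λ n → ½ · (½ · 1ℚ) ≤ ⊖ seq x n)
    gap x p (inj₁ small) = inj₁ (e-discrete x small p)
    gap x p (inj₂ large) = inj₂ large

  Multiples : ℝ → ℝ → Set
  Multiples ω x = ∃ λ k → x ≈ℝ zℝ k *ℝ ω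

  -- A lower bound δ of ω bounds every positive multiple of it. The gap is δ/2 because it is read
  -- off approximations of an x that only equals the multiple up to a null sequence.
  Multiples-discrete : ∀ {ω} → Pos ω → Discrete (Multiples ω)
  Multiples-discrete {ω} (mkPos δ 0<δ (N , above)) = record
    { P-cong = λ eq (k , p) → k , R.trans (R.sym eq) p
    ; P-0    = +0 , R.sym (R.trans (R.*-congʳ zℝ-0) (R.zeroˡ ω))
    ; P-sub  = λ (k , p) (l , q) → k ℤ.+ ℤ.- l , R.trans (R.+-cong p (-ℝ‿cong q))
        (R.trans (solve 3 (λ k l w → k :* w :- l :* w := (k :- l) :* w) ≈-refl (zℝ k) (zℝ l) ω)
          (R.*-congʳ (R.sym (R.trans (zℝ-+ k (ℤ.- l)) (R.+-congˡ (zℝ-neg l))))))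
    ; δ      = ½ · δ
    ; 0<δ    = half-pos 0<δ
    ; gap    = gap
    }
    where
    positive : ∀ n → Pos (zℝ +[1+ n ] *ℝ ω) × Ev (λ i → δ ≤ seq (zℝ +[1+ n ] *ℝ ω) i)
    positive n = Pos-* (Pos-cong (ℚ→ℝ-cong (≡.sym (ℤ→ℚ-ι (suc n)))) (Pos-ℚ (0<ι n))) (mkPos δ 0<δ (N , above)) ,
      N , λ i N≤i → ≡.subst (λ c → δ ≤ c · seq ω i) (≡.sym (ℤ→ℚ-ι (suc n)))
        (≤-by (+-nonNeg (≤⇒0≤- (above i N≤i)) (*-nonNeg (0≤ι n) (ℚ.≤-trans (ℚ.<⇒≤ 0<δ) (above i N≤i))))
          (S.solve 3 (λ i w d → (S.con 1ℚ S.:+ i) S.:* w S.:- d S.:= (w S.:- d) S.:+ i S.:* w) refl (ι n) (seq ω i) δ))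
    near : ∀ {x y} → x ≈ℝ y → Ev (λ i → δ ≤ seq y i) → Ev (λ i → ½ · δ ≤ seq x i)
    near {x} {y} eq h = Ev-zip (λ i p q → ≤-by (+-nonNeg (≤⇒0≤- p) (≤⇒0≤- (ℚ.≤-trans (-p≤∣p∣ _) (ℚ.<⇒≤ q))))
      (S.solve 3 (λ d x y → x S.:- S.con ½ S.:* d S.:= (y S.:- d) S.:+ (S.con ½ S.:* d S.:- S.:- (x S.:- y))) refl δ (seq x i) (seq y i)))
      h (≈⇒null eq (½ · δ) (half-pos 0<δ))
    gap : ∀ x → Multiples ω x → x ≈ℝ 0ℝ ⊎ Ev (λ i → ½ · δ ≤ seq x i) ⊎ Ev (λ i → ½ · δ ≤ ⊖ seq x i)
    gap x (+0 , eq)       = inj₁ (R.trans eq (R.trans (R.*-congʳ zℝ-0) (R.zeroˡ ω)))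
    gap x (+[1+ n ] , eq) = inj₂ (inj₁ (near eq (proj₂ (positive n))))
    gap x (-[1+ n ] , eq) = inj₂ (inj₂ (near {x = -ℝ x} (R.trans (-ℝ‿cong eq) (R.trans
      (-ℝ‿cong (R.*-congʳ (zℝ-neg +[1+ n ]))) (solve 2 (λ k w → :- (:- k :* w) := k :* w) ≈-refl (zℝ +[1+ n ]) ω))) (proj₂ (positive n))))

  open Discrete Ker-discrete using () renaming (P-cong to Ker-cong; P-multiple to Ker-multiple)

  double : ℝ → ℝ
  double x = x +ℝ x

  zℝ-2 : ∀ y → zℝ (+ 2) *ℝ y ≈ℝ double y
  zℝ-2 y = R.trans (R.*-congʳ (ℚ→ℝ-cong (ℤ→ℚ-ι 2))) (solve 1 (λ y → con (ι 2) :* y := y :+ y) ≈-refl y)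

  zℝ-4 : ∀ y → zℝ (+ 4) *ℝ y ≈ℝ double (double y)
  zℝ-4 y = R.trans (R.*-congʳ (ℚ→ℝ-cong (ℤ→ℚ-ι 4))) (solve 1 (λ y → con (ι 4) :* y := (y :+ y) :+ (y :+ y)) ≈-refl y)

  Ker-shift : ∀ {x y z} → x ≈ℝ y +ℝ z → Ker z → e x ≈ℂ e y
  Ker-shift {x} {y} {z} eq p = C.trans (e-cong eq) (C.trans (e-+ y z) (C.trans (C.*-congˡ {e y} p) (C.*-identityʳ (e y))))

  -- ζ = e y satisfies ζ⁴ = 1 and ζ^(2nᵢ) does not depend on i.  If all nᵢ are odd then nᵢʳ ≡ nᵢ (mod 4);
  -- otherwise odd and even nᵢ both occur, so ζ² = 1 and nᵢʳ ≡ nᵢ (mod 2) suffices.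
  module _ {d} (n weight : Fin d → ℤ) (bézout : Z.⟨ weight , n ⟩ ≡ + 1) (k : ℕ) (y : ℝ)
           (y∈ : Ker (double (double y))) (constant : ∀ i j → e (double (zℝ (n i) *ℝ y)) ≈ℂ e (double (zℝ (n j) *ℝ y))) where

    private
      shift : ∀ c q {m n′} → m ≡ n′ ℤ.+ c ℤ.* q → Ker (zℝ c *ℝ y) → e (zℝ m *ℝ y) ≈ℂ e (zℝ n′ *ℝ y)
      shift c q {m} {n′} refl p = Ker-shift (R.trans (R.*-congʳ (R.trans (zℝ-+ n′ (c ℤ.* q)) (R.+-congˡ (zℝ-* c q))))
        (solve 4 (λ n c q y → (n :+ c :* q) :* y := n :* y :+ q :* (c :* y)) ≈-refl (zℝ n′) (zℝ c) (zℝ q) y)) (Ker-multiple q p)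

      doubled : ∀ h → double (zℝ (h ℤ.+ h) *ℝ y) ≈ℝ zℝ h *ℝ double (double y)
      doubled h = R.trans (R.+-cong (R.*-congʳ (zℝ-+ h h)) (R.*-congʳ (zℝ-+ h h)))
        (solve 2 (λ h y → (h :+ h) :* y :+ (h :+ h) :* y := h :* ((y :+ y) :+ (y :+ y))) ≈-refl (zℝ h) y)

      -- By coprimality some nᵢ is odd, and there ζ^(2nᵢ) = ζ² since ζ⁴ = 1; an even nⱼ gives
      -- ζ^(2nⱼ) = 1, and the two values coincide.
      even⇒Ker-2y : ∀ j → Even (n j) → Ker (double y)
      even⇒Ker-2y j (h , nj≡) = C.trans (C.sym (Ker-shift odd-double (Ker-multiple h′ y∈))) (C.trans (constant i j) at-j)
        where
        i = proj₁ (coprime⇒some-odd weight n bézout)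
        h′ = proj₁ (proj₂ (coprime⇒some-odd weight n bézout))
        ni≡ = proj₂ (proj₂ (coprime⇒some-odd weight n bézout))
        at-j : Ker (double (zℝ (n j) *ℝ y))
        at-j = C.trans (C.reflexive (cong (λ z → e (double (zℝ z *ℝ y))) nj≡)) (C.trans (e-cong (doubled h)) (Ker-multiple h y∈))
        odd-double : double (zℝ (n i) *ℝ y) ≈ℝ double y +ℝ zℝ h′ *ℝ double (double y)
        odd-double = R.trans (R.reflexive (cong (λ z → double (zℝ z *ℝ y)) ni≡))
          (R.trans (R.+-cong one one) (R.trans (solve 2 (λ y z → (y :+ z) :+ (y :+ z) := (y :+ y) :+ (z :+ z)) ≈-refl y (zℝ (h′ ℤ.+ h′) *ℝ y))
            (R.+-congˡ (doubled h′))))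
          where
          one : zℝ (+ 1 ℤ.+ (h′ ℤ.+ h′)) *ℝ y ≈ℝ y +ℝ zℝ (h′ ℤ.+ h′) *ℝ y
          one = R.trans (R.*-congʳ (zℝ-+ (+ 1) (h′ ℤ.+ h′))) (R.trans (R.*-congʳ (R.+-congʳ zℝ-1))
            (solve 2 (λ y h → (con 1ℚ :+ h) :* y := y :+ h :* y) ≈-refl y (zℝ (h′ ℤ.+ h′))))

    odd-power-phase : ∀ i → e (zℝ (n i Z.^ suc (k ℕ.+ k)) *ℝ y) ≈ℂ e (zℝ (n i) *ℝ y)
    odd-power-phase i = cases (search λ j → swap (even-or-odd (n j)))
      where
      swap : ∀ {A B : Set} → A ⊎ B → B ⊎ A
      swap (inj₁ x) = inj₂ x
      swap (inj₂ y) = inj₁ y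
      cases : (∀ j → Odd (n j)) ⊎ ∃ (λ j → Even (n j)) → e (zℝ (n i Z.^ suc (k ℕ.+ k)) *ℝ y) ≈ℂ e (zℝ (n i) *ℝ y)
      cases (inj₁ odd)        = let q , eq = odd-power (odd i) k in shift (+ 4) q eq (Ker-cong (R.sym (zℝ-4 y)) y∈)
      cases (inj₂ (j , even)) = let q , eq = power-parity (n i) k in shift (+ 2) q eq (Ker-cong (R.sym (zℝ-2 y)) (even⇒Ker-2y j even))

  zℝ-^ : ∀ n k → zℝ (n Z.^ k) ≈ℝ zℝ n R.^ k
  zℝ-^ n zero    = zℝ-1
  zℝ-^ n (suc k) = R.trans (zℝ-* n (n Z.^ k)) (R.*-congˡ (zℝ-^ n k))

  ^-* : ∀ x y k → (x *ℝ y) R.^ k ≈ℝ x R.^ k *ℝ y R.^ k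
  ^-* x y zero    = R.sym (R.*-identityˡ 1ℝ)
  ^-* x y (suc k) = R.trans (R.*-congˡ (^-* x y k)) (solve 4 (λ x y p q → (x :* y) :* (p :* q) := (x :* p) :* (y :* q)) ≈-refl x y (x R.^ k) (y R.^ k))

  ^-+ : ∀ x j k → x R.^ (j ℕ.+ k) ≈ℝ x R.^ j *ℝ x R.^ k
  ^-+ x zero    k = R.sym (R.*-identityˡ _)
  ^-+ x (suc j) k = R.trans (R.*-congˡ (^-+ x j k)) (R.sym (R.*-assoc x (x R.^ j) (x R.^ k)))

  #0-^ : ∀ {x} → x #0 → ∀ k → x R.^ k #0
  #0-^ h zero    = inj₁ (Pos-ℚ 0<1)
  #0-^ h (suc k) = #0-* h (#0-^ h k)

  ^≈0⇒≈0 : ∀ {x} k → x R.^ k ≈ℝ 0ℝ → x ≈ℝ 0ℝ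
  ^≈0⇒≈0 k eq = tight λ x#0 → #0⇒≉0 (#0-^ x#0 k) eq

  module _ {n} (H : Matrix ℚ n) (H-sym : ℚM.IsSymmetric H) (a : Fin n) (root-sym : RootSymmetric H H-sym a) where
    open Krylov H H-sym a
    open RationalRatios H H-sym a

    private
      Hᵣ : Matrix ℝ n
      Hᵣ = toℝ H

    -- Exponent 1 covers `H` itself and exponent r covers `H ^ᵐ r`, so the analysis of phases is
    -- done once for both directions.
    ActsAsPower : ℕ → Matrix ℝ n → Set
    ActsAsPower ρ K = ∀ v → K *ᵛ v ≈ᵛ pow Hᵣ ρ v

    module Power {ρ K} (acts : ActsAsPower ρ K) where

      pow-K : ∀ j → pow K j eₐ ≈ᵛ pow Hᵣ (j ℕ.* ρ) eₐ
      pow-K zero    i = ≈-refl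
      pow-K (suc j) i = R.trans (acts (pow K j eₐ) i) (R.trans (R.pow-cong Hᵣ ρ (pow-K j) i) (pow-+ ρ (j ℕ.* ρ) i))
        where
        pow-+ : ∀ s t → pow Hᵣ s (pow Hᵣ t eₐ) ≈ᵛ pow Hᵣ (s ℕ.+ t) eₐ
        pow-+ zero    t i = ≈-refl
        pow-+ (suc s) t i = R.*ᵛ-cong Hᵣ (pow-+ s t) i

      ^-swap : ∀ x j → x R.^ (j ℕ.* ρ) ≈ℝ (x R.^ ρ) R.^ j
      ^-swap x j = R.trans (R.reflexive (cong (x R.^_) (ℕ.*-comm j ρ))) (R.sym (^-assocʳ x ρ j))

      K-parts : ∀ j → pow K j eₐ ≈ᵛ ∑ᵛ (λ i → ((λs i R.^ ρ) R.^ j) ·ᵛ part i)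
      K-parts j i = R.trans (pow-K j i) (R.trans (pow-parts (j ℕ.* ρ) i) (R.sum-cong-≋ λ l → R.*-congʳ (^-swap (λs l) j)))

      module _ {b τ γ} (γ-unit : normSq γ ≈ℝ 1ℝ) (t : Transfer K τ a b γ) where

        private
          s : ℝ → ℝ
          s x = ⟨ kernel x deg , basis b ⟩

        phase : ∀ {x} → Root x → e (τ *ℝ x R.^ ρ) ≈ℂ γ *ℂ ℝ→ℂ (s x)
        phase {x} root = C.trans (C.trans (C.sym (C.*-identityʳ _)) (C.*-congˡ {e (τ *ℝ x R.^ ρ)} (ℝ→ℂ-cong (R.sym (⟨kernel,eₐ⟩ x)))))
          (transfer-pairing K τ {a} {b} {γ} t (kernel x deg) (x R.^ ρ) λ j → R.trans (R.⟨⟩-comm (kernel x deg) (pow K j eₐ))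
            (R.trans (R.⟨⟩-cong {w = kernel x deg} {w′ = kernel x deg} (pow-K j) (λ _ → ≈-refl))
            (R.trans (⟨pow,kernel⟩ root (j ℕ.* ρ)) (R.trans (^-swap x j)
              (R.sym (R.trans (R.*-congˡ (⟨kernel,eₐ⟩ x)) (R.*-identityʳ _)))))))

        -- The e_b-component σ of the kernel vector is real. Multiplying e(θ) = γσ by its conjugate
        -- gives σ² = 1, because e(θ) and γ both have modulus 1; squaring the phase then removes the
        -- unknown sign.
        phase² : ∀ {x} → Root x → e (double (τ *ℝ x R.^ ρ)) ≈ℂ γ *ℂ γ
        phase² {x} root = C.begin
          e (double θ)                                  C.≈⟨ e-+ θ θ ⟩
          e θ *ℂ e θ                                    C.≈⟨ C.*-cong (phase root) (phase root) ⟩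
          (γ *ℂ σ) *ℂ (γ *ℂ σ)                          C.≈⟨ K′.solve 2 (λ g s → (g K′.:* s) K′.:* (g K′.:* s) K′.:= (g K′.:* g) K′.:* (s K′.:* s)) ≈ℂ-refl γ σ ⟩
          (γ *ℂ γ) *ℂ (σ *ℂ σ)                          C.≈⟨ C.*-congˡ {γ *ℂ γ} σ²≈1 ⟩
          (γ *ℂ γ) *ℂ 1ℂ                                C.≈⟨ C.*-identityʳ (γ *ℂ γ) ⟩
          γ *ℂ γ                                        C.∎
          where
          open ComplexExponential using (module ℂ-Solver)
          module K′ = ℂ-Solver
          θ = τ *ℝ x R.^ ρ
          σ = ℝ→ℂ (s x)
          σ²≈1 : σ *ℂ σ ≈ℂ 1ℂ
          σ²≈1 = C.begin
            σ *ℂ σ                              C.≈⟨ C.*-identityˡ (σ *ℂ σ) ⟨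
            1ℂ *ℂ (σ *ℂ σ)                      C.≈⟨ C.*-congʳ (C.trans (*-conj γ) (ℝ→ℂ-cong γ-unit)) ⟨
            (γ *ℂ conj γ) *ℂ (σ *ℂ σ)           C.≈⟨ K′.solve 3 (λ g h s → (g K′.:* h) K′.:* (s K′.:* s) K′.:= (g K′.:* s) K′.:* (h K′.:* s)) ≈ℂ-refl γ (conj γ) σ ⟩
            (γ *ℂ σ) *ℂ (conj γ *ℂ σ)           C.≈⟨ C.*-congˡ {γ *ℂ σ} (C.trans (conj-* γ σ) (C.*-congˡ {conj γ} (mk≈ ≈-refl (pointwise λ _ → refl)))) ⟨
            (γ *ℂ σ) *ℂ conj (γ *ℂ σ)           C.≈⟨ C.*-cong (phase root) (conj-cong (phase root)) ⟨
            e θ *ℂ conj (e θ)                   C.≈⟨ C.*-congˡ {e θ} (e-neg θ) ⟨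
            e θ *ℂ e (-ℝ θ)                     C.≈⟨ e-*-neg θ ⟩
            1ℂ                                  C.∎

        phase⁴ : (∃ λ l → ρ ≡ suc (l ℕ.+ l)) → ∀ {x} → Root x → Ker (double (double (τ *ℝ x R.^ ρ)))
        phase⁴ (l , refl) {x} root = C.trans (e-+ (double θ) (double θ)) (C.trans
          (C.*-congˡ {e (double θ)} (C.trans (phase² root) (C.trans (C.sym (phase² (root-sym root))) (e-cong (R.trans
            (R.+-cong negated negated) (solve 1 (λ t → :- t :+ :- t := :- (t :+ t)) ≈-refl θ))))))
          (e-*-neg (double θ)))
          where
          θ = τ *ℝ x R.^ ρ
          negated : τ *ℝ (-ℝ x) R.^ ρ ≈ℝ -ℝ θ
          negated = R.trans (R.*-congˡ (^-neg-odd x l)) (solve 2 (λ t p → t :* :- p := :- (t :* p)) ≈-refl τ (x R.^ ρ))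

    private
      module E = Euclid Ker-discrete

      quarter : ℝ → ℝ
      quarter g = ℚ→ℝ (½ · ½) *ℝ g

      four-quarters : ∀ g → double (double (quarter g)) ≈ℝ g
      four-quarters = solve 1 (λ g → (con (½ · ½) :* g :+ con (½ · ½) :* g) :+ (con (½ · ½) :* g :+ con (½ · ½) :* g) := g) ≈-refl

    record Quantised (τ : ℝ) (ρ : ℕ) : Set where
      field
        y        : ℝ
        y#0      : y #0
        y∈       : Ker (double (double y))
        multiple : Fin deg → ℤ
        weight   : Fin deg → ℤ
        bézout   : Z.⟨ weight , multiple ⟩ ≡ + 1
        values   : ∀ i → τ *ℝ λs i R.^ ρ ≈ℝ zℝ (multiple i) *ℝ y

    -- Euclid's algorithm runs on the numbers 4τλᵢ^ρ, which lie in the kernel of e. A quarter of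
    -- their generator is the unit y, so only 4y is known to be in the kernel.
    quantise : ∀ τ ρ → (∀ i → Ker (double (double (τ *ℝ λs i R.^ ρ)))) →
      (∀ i → τ *ℝ λs i R.^ ρ ≈ℝ 0ℝ) ⊎ Quantised τ ρ
    quantise τ ρ h = cases (E.basis-or-0 (λ i → double (double (τ *ℝ λs i R.^ ρ))) h)
      where
      unquarter : ∀ x → x ≈ℝ quarter (double (double x))
      unquarter = solve 1 (λ x → x := con (½ · ½) :* ((x :+ x) :+ (x :+ x))) ≈-refl
      cases : (∀ i → double (double (τ *ℝ λs i R.^ ρ)) ≈ℝ 0ℝ) ⊎ E.Basis (λ i → double (double (τ *ℝ λs i R.^ ρ))) →
        (∀ i → τ *ℝ λs i R.^ ρ ≈ℝ 0ℝ) ⊎ Quantised τ ρ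
      cases (inj₁ zeros) = inj₁ λ i → R.trans (unquarter (τ *ℝ λs i R.^ ρ)) (R.trans (R.*-congˡ (zeros i)) (R.zeroʳ _))
      cases (inj₂ B) = inj₂ (record
        { y = quarter g
        ; y#0 = #0-* (#0-ℚ λ ()) g#0
        ; y∈ = Ker-cong (R.sym (four-quarters g)) g∈P
        ; multiple = multiple ; weight = weight ; bézout = bézout
        ; values = λ i → R.trans (unquarter (τ *ℝ λs i R.^ ρ)) (R.trans (R.*-congˡ (xs≈ i)) (R.x*yz≈y*xz (ℚ→ℝ (½ · ½)) (zℝ (multiple i)) g))
        })
        where open E.Basis B

    private
      one-power : ∀ x → x R.^ 1 ≈ℝ x
      one-power = R.*-identityʳ

      module _ {τ} (0<τ : 0ℝ <ℝ τ) where
        τ>0 : Pos τ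
        τ>0 = Pos-cong (solve 1 (λ t → t :- con 0ℚ := t) ≈-refl τ) (<⇒Pos 0<τ)

        τ⁻¹ : ℝ
        τ⁻¹ = proj₁ (inverse τ (inj₁ τ>0))

        τ*τ⁻¹ : τ *ℝ τ⁻¹ ≈ℝ 1ℝ
        τ*τ⁻¹ = proj₂ (inverse τ (inj₁ τ>0))

        divide : ∀ {x m y} → τ *ℝ x ≈ℝ m *ℝ y → x ≈ℝ m *ℝ (τ⁻¹ *ℝ y)
        divide {x} {m} {y} eq = R.begin
          x                     R.≈⟨ R.*-identityˡ x ⟨
          1ℝ *ℝ x               R.≈⟨ R.*-congʳ τ*τ⁻¹ ⟨
          (τ *ℝ τ⁻¹) *ℝ x       R.≈⟨ solve 3 (λ t i x → (t :* i) :* x := i :* (t :* x)) ≈-refl τ τ⁻¹ x ⟩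
          τ⁻¹ *ℝ (τ *ℝ x)       R.≈⟨ R.*-congˡ eq ⟩
          τ⁻¹ *ℝ (m *ℝ y)       R.≈⟨ R.x*yz≈y*xz τ⁻¹ m y ⟩
          m *ℝ (τ⁻¹ *ℝ y)       R.∎

        quotient-#0 : ∀ {y} → y #0 → τ⁻¹ *ℝ y #0
        quotient-#0 = #0-* (#0-cancelˡ {τ} (#0-cong (R.sym τ*τ⁻¹) (inj₁ (Pos-ℚ 0<1))))

    module _ (k : ℕ) {b : Fin n} where

      private
        r : ℕ
        r = suc (k ℕ.+ k)

        Hʳ-acts : ActsAsPower r (toℝ H ℝM.^ᵐ r)
        Hʳ-acts = R.^ᵐ-*ᵛ Hᵣ r

        module Base   = Power {1} {Hᵣ} (λ v i → ≈-refl)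
        module Powers = Power {r} {toℝ H ℝM.^ᵐ r} Hʳ-acts

        odd-1 : ∃ λ l → 1 ≡ suc (l ℕ.+ l)
        odd-1 = 0 , refl

        odd-r : ∃ λ l → r ≡ suc (l ℕ.+ l)
        odd-r = k , refl

        square : ℝ → ℝ
        square θ = θ R.^ k *ℝ θ R.^ k

        split-power : ∀ θ → θ R.^ r ≈ℝ θ *ℝ square θ
        split-power θ = R.*-congˡ (^-+ θ k k)

        power-of-multiple : ∀ {x} m θ → x ≈ℝ zℝ m *ℝ θ → x R.^ r ≈ℝ zℝ (m Z.^ r) *ℝ (θ *ℝ square θ)
        power-of-multiple {x} m θ eq = R.trans (^-congˡ r eq) (R.trans (^-* (zℝ m) θ r)
          (R.*-cong (R.sym (zℝ-^ m r)) (split-power θ)))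

        -- When all eigenvalues vanish every phase is 1 at every time, so the new time is arbitrary;
        -- it is taken to be 1.
        same-if-0 : (∀ i → λs i ≈ℝ 0ℝ) → ∀ τ τ′ ρ ρ′ → 0 ℕ.< ρ → 0 ℕ.< ρ′ → ∀ i → e (τ *ℝ λs i R.^ ρ) ≈ℂ e (τ′ *ℝ λs i R.^ ρ′)
        same-if-0 λs≈0 τ τ′ (suc ρ) (suc ρ′) _ _ i = e-cong (R.trans (vanish τ ρ) (R.sym (vanish τ′ ρ′)))
          where
          vanish : ∀ τ ρ → τ *ℝ λs i R.^ suc ρ ≈ℝ 0ℝ
          vanish τ ρ = R.trans (R.*-congˡ (R.trans (R.*-congʳ (λs≈0 i)) (R.zeroˡ _))) (R.zeroʳ τ)

        0<1ℝ : 0ℝ <ℝ 1ℝ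
        0<1ℝ = Pos⇒< (Pos-cong (pointwise λ _ → refl) (Pos-ℚ 0<1))

        Pos⇒0< : ∀ {x} → Pos x → 0ℝ <ℝ x
        Pos⇒0< {x} p = Pos⇒< (Pos-cong (solve 1 (λ x → x := x :- con 0ℚ) ≈-refl x) p)

        conclude : ∀ {K₁ K₂ ρ₁ ρ₂ τ₁ τ₂ γ} → ActsAsPower ρ₁ K₁ → ActsAsPower ρ₂ K₂ → 0ℝ <ℝ τ₂ → normSq γ ≈ℝ 1ℝ →
          (∀ i → e (τ₁ *ℝ λs i R.^ ρ₁) ≈ℂ e (τ₂ *ℝ λs i R.^ ρ₂)) → Transfer K₁ τ₁ a b γ → PST K₂ a b
        conclude {K₁} {K₂} {ρ₁} {ρ₂} {τ₁} {τ₂} {γ} acts₁ acts₂ 0<τ₂ unit same t = τ₂ , 0<τ₂ , γ , unit ,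
          transfer⁻¹ K₂ τ₂ {a} {b} {γ} (transfer-between K₁ K₂ τ₁ τ₂ (λ i → λs i R.^ ρ₁) (λ i → λs i R.^ ρ₂) part {a} {b} {γ}
            (Power.K-parts {ρ₁} {K₁} acts₁) (Power.K-parts {ρ₂} {K₂} acts₂) same t)

      PST⇒power-PST : PST (toℝ H) a b → PST (toℝ H ℝM.^ᵐ suc (k ℕ.+ k)) a b
      PST⇒power-PST (τ , 0<τ , γ , unit , X) = cases (quantise τ 1 λ i → Base.phase⁴ {b} {τ} {γ} unit t odd-1 (λs-root i))
        where
        t : Transfer Hᵣ τ a b γ
        t = transfer Hᵣ τ {a} {b} {γ} X
        cases : (∀ i → τ *ℝ λs i R.^ 1 ≈ℝ 0ℝ) ⊎ Quantised τ 1 → PST (toℝ H ℝM.^ᵐ r) a b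
        cases (inj₁ zeros) = conclude {Hᵣ} {toℝ H ℝM.^ᵐ r} {1} {r} {τ} {1ℝ} {γ} (λ v i → ≈-refl) Hʳ-acts 0<1ℝ unit
          (same-if-0 (λ i → ^≈0⇒≈0 1 (cancel-factor (inj₁ (τ>0 0<τ)) (zeros i))) τ 1ℝ 1 r (ℕ.s≤s ℕ.z≤n) (ℕ.s≤s ℕ.z≤n)) t
        cases (inj₂ Qn) = conclude {Hᵣ} {toℝ H ℝM.^ᵐ r} {1} {r} {τ} {τ′} {γ} (λ v i → ≈-refl) Hʳ-acts
          (Pos⇒0< (Pos-* (τ>0 0<τ) ψ>0)) unit same t
          where
          open Quantised Qn renaming (multiple to m)
          -- Here λᵢ = mᵢθ and φ = θ^(r-1) is a square apart from 0, so τ′ = τ/φ is positive and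
          -- τ′λᵢʳ = mᵢʳτθ = mᵢʳy.
          θ = τ⁻¹ 0<τ *ℝ y
          φ = square θ
          φ>0 : Pos φ
          φ>0 = #0-square (#0-^ (quotient-#0 0<τ y#0) k)
          ψ = proj₁ (inverse φ (inj₁ φ>0))
          φψ≈1 : φ *ℝ ψ ≈ℝ 1ℝ
          φψ≈1 = proj₂ (inverse φ (inj₁ φ>0))
          ψ>0 : Pos ψ
          ψ>0 = Pos-cancelˡ φ>0 (Pos-cong (R.sym φψ≈1) (Pos-ℚ 0<1))
          τ′ = τ *ℝ ψ
          λs≈ : ∀ i → λs i ≈ℝ zℝ (m i) *ℝ θ
          λs≈ i = R.trans (R.sym (one-power (λs i))) (divide 0<τ (values i))
          values′ : ∀ i → τ′ *ℝ λs i R.^ r ≈ℝ zℝ (m i Z.^ r) *ℝ y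
          values′ i = R.begin
            τ′ *ℝ λs i R.^ r                                        R.≈⟨ R.*-congˡ (power-of-multiple (m i) θ (λs≈ i)) ⟩
            (τ *ℝ ψ) *ℝ (zℝ (m i Z.^ r) *ℝ (θ *ℝ φ))                R.≈⟨ solve 6 (λ t p m i y f → (t :* p) :* (m :* ((i :* y) :* f))
                                                                         := m :* (((t :* i) :* (f :* p)) :* y)) ≈-refl τ ψ (zℝ (m i Z.^ r)) (τ⁻¹ 0<τ) y φ ⟩
            zℝ (m i Z.^ r) *ℝ (((τ *ℝ τ⁻¹ 0<τ) *ℝ (φ *ℝ ψ)) *ℝ y)   R.≈⟨ R.*-congˡ (R.*-congʳ (R.*-cong (τ*τ⁻¹ 0<τ) φψ≈1)) ⟩
            zℝ (m i Z.^ r) *ℝ ((1ℝ *ℝ 1ℝ) *ℝ y)                     R.≈⟨ R.*-congˡ (solve 1 (λ y → (con 1ℚ :* con 1ℚ) :* y := y) ≈-refl y) ⟩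
            zℝ (m i Z.^ r) *ℝ y                                     R.∎
          constant : ∀ i j → e (double (zℝ (m i) *ℝ y)) ≈ℂ e (double (zℝ (m j) *ℝ y))
          constant i j = C.trans (at i) (C.sym (at j))
            where
            at : ∀ i → e (double (zℝ (m i) *ℝ y)) ≈ℂ γ *ℂ γ
            at i = C.trans (e-cong (R.+-cong (R.sym (values i)) (R.sym (values i)))) (Base.phase² {b} {τ} {γ} unit t (λs-root i))
          same : ∀ i → e (τ *ℝ λs i R.^ 1) ≈ℂ e (τ′ *ℝ λs i R.^ r)
          same i = C.trans (e-cong (values i)) (C.trans (C.sym (odd-power-phase m weight bézout k y y∈ constant i)) (e-cong (R.sym (values′ i))))

      power-PST⇒PST : PST (toℝ H ℝM.^ᵐ suc (k ℕ.+ k)) a b → PST (toℝ H) a b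
      power-PST⇒PST (τ , 0<τ , γ , unit , X) = cases (quantise τ r λ i → Powers.phase⁴ {b} {τ} {γ} unit t odd-r (λs-root i))
        where
        t : Transfer (toℝ H ℝM.^ᵐ r) τ a b γ
        t = transfer (toℝ H ℝM.^ᵐ r) τ {a} {b} {γ} X
        all-0 : (∀ i → λs i ≈ℝ 0ℝ) → PST Hᵣ a b
        all-0 λs≈0 = conclude {toℝ H ℝM.^ᵐ r} {Hᵣ} {r} {1} {τ} {1ℝ} {γ} Hʳ-acts (λ v i → ≈-refl) 0<1ℝ unit
          (same-if-0 λs≈0 τ 1ℝ r 1 (ℕ.s≤s ℕ.z≤n) (ℕ.s≤s ℕ.z≤n)) t

        from-multiples : ∀ θ → θ #0 → (n weight : Fin deg → ℤ) → Z.⟨ weight , n ⟩ ≡ + 1 → (∀ i → λs i ≈ℝ zℝ (n i) *ℝ θ) → PST Hᵣ a b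
        from-multiples θ θ#0 n weight bézout λs≈ = conclude {toℝ H ℝM.^ᵐ r} {Hᵣ} {r} {1} {τ} {τ′} {γ} Hʳ-acts (λ v i → ≈-refl)
          (Pos⇒0< (Pos-* (τ>0 0<τ) (#0-square (#0-^ θ#0 k)))) unit same t
          where
          φ = square θ
          -- With φ = θ^(r-1) and y = τθʳ both phases become multiples of the same unit: τλᵢʳ = nᵢʳy
          -- and τ′λᵢ = nᵢy.
          τ′ = τ *ℝ φ
          y = τ *ℝ (θ *ℝ φ)
          D = double (double y)
          values : ∀ i → τ *ℝ λs i R.^ r ≈ℝ zℝ (n i Z.^ r) *ℝ y
          values i = R.trans (R.*-congˡ (power-of-multiple (n i) θ (λs≈ i))) (R.x*yz≈y*xz τ (zℝ (n i Z.^ r)) (θ *ℝ φ))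
          values′ : ∀ i → τ′ *ℝ λs i R.^ 1 ≈ℝ zℝ (n i) *ℝ y
          values′ i = R.trans (R.*-congˡ (R.trans (one-power (λs i)) (λs≈ i)))
            (solve 4 (λ t f n h → (t :* f) :* (n :* h) := n :* (t :* (h :* f))) ≈-refl τ φ (zℝ (n i)) θ)
          scaled : ∀ m → zℝ m *ℝ D ≈ℝ double (double (zℝ m *ℝ y))
          scaled m = solve 2 (λ m y → m :* ((y :+ y) :+ (y :+ y)) := (m :* y :+ m :* y) :+ (m :* y :+ m :* y)) ≈-refl (zℝ m) y
          Q : ℤ → Set
          Q m = Ker (zℝ m *ℝ D)
          Q-ideal : Ideal Q
          Q-ideal = record
            { +-closed = λ {m} {m′} p q → Ker-cong (R.trans (R.sym (R.distribʳ D (zℝ m) (zℝ m′))) (R.*-congʳ (R.sym (zℝ-+ m m′)))) (Ker-+ p q)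
            ; *-closed = λ c {m} p → Ker-cong (R.trans (R.sym (R.*-assoc (zℝ c) (zℝ m) D)) (R.*-congʳ (R.sym (zℝ-* c m)))) (Ker-multiple c p)
            }
          -- The hypothesis places only nᵢʳ·4y in the kernel. The integers m with m·4y in the kernel
          -- form an ideal, and as the nᵢ are coprime, an ideal containing all nᵢʳ contains 1.
          y∈ : Ker D
          y∈ = Ker-cong (R.trans (R.*-congʳ zℝ-1) (R.*-identityˡ D)) (coprime-powers Q-ideal r weight n
            (λ i → Ker-cong (R.sym (R.trans (scaled (n i Z.^ r)) (R.+-cong (R.+-cong (R.sym (values i)) (R.sym (values i))) (R.+-cong (R.sym (values i)) (R.sym (values i))))))
              (Powers.phase⁴ {b} {τ} {γ} unit t odd-r (λs-root i)))
            (subst Q (≡.sym (≡.trans (cong (λ z → + 1 ℤ.+ ℤ.- z) bézout) refl)) (Ker-cong (R.sym (R.trans (R.*-congʳ zℝ-0) (R.zeroˡ D))) e-0)))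
          -- The hypothesis fixes ζ^(2nᵢʳ); since nᵢʳ ≡ nᵢ (mod 2) and ζ⁴ = 1, this is also ζ^(2nᵢ).
          constant : ∀ i j → e (double (zℝ (n i) *ℝ y)) ≈ℂ e (double (zℝ (n j) *ℝ y))
          constant i j = C.trans (at i) (C.sym (at j))
            where
            at : ∀ i → e (double (zℝ (n i) *ℝ y)) ≈ℂ γ *ℂ γ
            at i = C.trans (C.sym (Ker-shift expand (Ker-multiple q y∈)))
              (C.trans (e-cong (R.+-cong (R.sym (values i)) (R.sym (values i)))) (Powers.phase² {b} {τ} {γ} unit t (λs-root i)))
              where
              q = proj₁ (power-parity (n i) k)
              expand : double (zℝ (n i Z.^ r) *ℝ y) ≈ℝ double (zℝ (n i) *ℝ y) +ℝ zℝ q *ℝ D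
              expand = R.trans (R.+-cong one one) (solve 3 (λ n q y → (n :* y :+ q :* (y :+ y)) :+ (n :* y :+ q :* (y :+ y))
                  := (n :* y :+ n :* y) :+ q :* ((y :+ y) :+ (y :+ y))) ≈-refl (zℝ (n i)) (zℝ q) y)
                where
                one : zℝ (n i Z.^ r) *ℝ y ≈ℝ zℝ (n i) *ℝ y +ℝ zℝ q *ℝ double y
                one = R.trans (R.*-congʳ (R.trans (R.reflexive (cong zℝ (proj₂ (power-parity (n i) k)))) (R.trans (zℝ-+ (n i) (+ 2 ℤ.* q))
                  (R.+-congˡ (zℝ-* (+ 2) q))))) (R.trans (solve 4 (λ n c q y → (n :+ c :* q) :* y := n :* y :+ q :* (c :* y)) ≈-refl (zℝ (n i)) (zℝ (+ 2)) (zℝ q) y)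
                  (R.+-congˡ (R.*-congˡ (zℝ-2 y))))
          same : ∀ i → e (τ *ℝ λs i R.^ r) ≈ℂ e (τ′ *ℝ λs i R.^ 1)
          same i = C.trans (e-cong (values i)) (C.trans (odd-power-phase n weight bézout k y y∈ constant i) (e-cong (R.sym (values′ i))))

        -- The multiples of ω found by clearing denominators may share a factor. A second run of
        -- Euclid's algorithm, inside ℤω, replaces them by coprime ones.
        from-lattice : ∀ ω → Pos ω → (∀ i → Multiples ω (λs i)) → PST Hᵣ a b
        from-lattice ω ω>0 h = split (E′.basis-or-0 λs h)
          where
          module E′ = Euclid (Multiples-discrete ω>0)
          split : (∀ i → λs i ≈ℝ 0ℝ) ⊎ E′.Basis λs → PST Hᵣ a b
          split (inj₁ zeros) = all-0 zeros
          split (inj₂ B)     = from-multiples g g#0 multiple weight bézout xs≈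
            where open E′.Basis B

        cases : (∀ i → τ *ℝ λs i R.^ r ≈ℝ 0ℝ) ⊎ Quantised τ r → PST Hᵣ a b
        cases (inj₁ zeros) = all-0 λ i → ^≈0⇒≈0 r (cancel-factor (inj₁ (τ>0 0<τ)) (zeros i))
        cases (inj₂ Qn)    = signs ω#0
          where
          open Quantised Qn renaming (multiple to m)
          η = τ⁻¹ 0<τ *ℝ y
          ratio = ratio-rational root-sym k η (quotient-#0 0<τ y#0) m weight bézout (λ i → divide 0<τ (values i))
          A = proj₁ ratio
          denominator = common-denominator A
          N = proj₁ denominator
          c = proj₁ (proj₂ denominator)
          N≢0 : ℤ→ℚ N ≢ 0ℚ
          N≢0 = proj₁ (proj₂ (proj₂ denominator))
          A≡ : ∀ i → A i ≡ ℤ→ℚ (c i) · inv (ℤ→ℚ N)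
          A≡ i = ≡-*-inv N≢0 (proj₂ (proj₂ (proj₂ denominator)) i)
          -- Dividing η by a common denominator N of the rational ratios λᵢ/η makes all λᵢ integer
          -- multiples of ω.
          ω = ℚ→ℝ (inv (ℤ→ℚ N)) *ℝ η
          ω#0 : ω #0
          ω#0 = #0-* (#0-ℚ λ eq → contradiction (≡.trans (≡.sym (*-inv N≢0)) (≡.trans (cong (ℤ→ℚ N ·_) eq) (ℚ.*-zeroʳ (ℤ→ℚ N)))) λ ())
            (quotient-#0 0<τ y#0)
          λs≈ : ∀ i → λs i ≈ℝ zℝ (c i) *ℝ ω
          λs≈ i = R.trans (proj₂ ratio i) (R.trans (R.*-congʳ (R.trans (ℚ→ℝ-cong (A≡ i)) (pointwise {y = zℝ (c i) *ℝ ℚ→ℝ (inv (ℤ→ℚ N))} λ _ → refl)))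
            (R.*-assoc (zℝ (c i)) (ℚ→ℝ (inv (ℤ→ℚ N))) η))
          signs : ω #0 → PST Hᵣ a b
          signs (inj₁ ω>0) = from-lattice ω ω>0 λ i → c i , λs≈ i
          signs (inj₂ ω<0) = from-lattice (-ℝ ω) ω<0 λ i → ℤ.- c i , R.trans (λs≈ i) (R.trans
            (solve 2 (λ c w → c :* w := :- c :* :- w) ≈-refl (zℝ (c i)) ω) (R.*-congʳ (R.sym (zℝ-neg (c i)))))

-- The equivalence for symmetric supports and for bipartite graphs

open import Data.Nat.Base using (_+_; _<_)
open import Data.Nat.Divisibility using (_∤_)
open import Function.Bundles using (_⇔_; mk⇔)
open import Relation.Unary using (_≐_)
open IntegerArithmetic using (odd-form)
open StateTransfer using (PST⇒power-PST; power-PST⇒PST)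
open EigenvalueSupport

root-symmetric⇒PST⇔ : ∀ {n} (H : Matrix ℚ n) (H-sym : ℚM.IsSymmetric H) (a : Fin n) → RootSymmetric H H-sym a →
  ∀ b r → 2 ∤ r → PST (toℝ H ℝM.^ᵐ r) a b ⇔ PST (toℝ H) a b
root-symmetric⇒PST⇔ H H-sym a root-sym b r 2∤r = by-exponent r (odd-form r 2∤r)
  where
  by-exponent : ∀ r → (∃ λ k → r ≡ suc (k + k)) → PST (toℝ H ℝM.^ᵐ r) a b ⇔ PST (toℝ H) a b
  by-exponent _ (k , refl) = mk⇔ (power-PST⇒PST H H-sym a root-sym k {b}) (PST⇒power-PST H H-sym a root-sym k {b})

theorem1p4 : (∀ (n : ℕ) (H : Matrix ℚ n) → ℚM.IsSymmetric H → (a : Fin n) →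
    Supp (toℝ H) (ℝM.basis a) ≐ (-ˢ Supp (toℝ H) (ℝM.basis a)) →
    (b : Fin n) → b ≢ a → (r : ℕ) → 0 < r → 2 ∤ r →
    PST (toℝ H ℝM.^ᵐ r) a b ⇔ PST (toℝ H) a b)
    ×
    (∀ (n : ℕ) (G : SimpleGraph n) → Bipartite G → (a b : Fin n) → a ≢ b →
    (r : ℕ) → 0 < r → 2 ∤ r →
    PST (toℝ (adjacencyMatrix G) ℝM.^ᵐ r) a b ⇔ PST (toℝ (adjacencyMatrix G)) a b)
theorem1p4 =
  (λ n H H-sym a supp-sym b _ r _ → root-symmetric⇒PST⇔ H H-sym a (support-symmetric⇒root-symmetric H H-sym a supp-sym) b r) ,
  (λ n G bipartite a b _ r _ → root-symmetric⇒PST⇔ (adjacencyMatrix G) (adjacency-symmetric G) a (bipartite⇒root-symmetric G bipartite a) b r)
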